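{- For every $\varepsilon > 0$ there exists an integer $n_0(\varepsilon)$ such that every strongly well-connected $d$-regular digraph on $n\geq n_0(\varepsilon)$ vertices with $d\geq (1/3+\varepsilon)n$ has a Hamilton cycle.
   Context: A digraph is a finite directed graph without loops, in which for each ordered pair of distinct vertices $(a,b)$ there is at most one edge $ab$ from $a$ to $b$ (so edges in both directions between two vertices are allowed). It is $d$-regular if every vertex has exactly $d$ outneighbours and exactly $d$ inneighbours. A digraph $G$ on at least four vertices is strongly well-connected if for every partition $(A,B)$ of $V(G)$ with $|A|,|B|\geq 2$ there exist two edges $ab$ and $cd$ of $G$ with no common vertex such that $a,d\in A$ and $b,c\in B$. A Hamilton cycle is a directed cycle through all vertices. -}

module Defs where

open import Data.Nat using (ℕ; zero; suc; _≤_)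
open import Data.Fin using (Fin; toℕ)
open import Data.Bool using (Bool; true; false; not)
open import Data.List using (List; filter; length)
open import Data.List.Base using (allFin)
open import Data.Product using (Σ; _×_; _,_; ∃-syntax)
open import Relation.Binary.PropositionalEquality using (_≡_; _≢_)
open import Relation.Nullary using (¬_)
open import Data.Bool.Properties using (T?)
open import Data.Bool using (T)
open import Data.Nat.DivMod using (_%_)
open import Data.Fin using (fromℕ<)
open import Data.Nat.DivMod using (m%n<n)
open import Function.Bundles using (_↔_; Inverse)
open import Data.Empty using (⊥)

record Digraph (n : ℕ) : Set where
  field
    E      : Fin n → Fin n → Bool
    noLoop : ∀ v → E v v ≡ false
open Digraph public

count : ∀ {n} → (Fin n → Bool) → ℕ
count {n} P = length (filter (λ v → T? (P v)) (allFin n))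

outdeg : ∀ {n} → Digraph n → Fin n → ℕ
outdeg G v = count (λ w → E G v w)

indeg : ∀ {n} → Digraph n → Fin n → ℕ
indeg G v = count (λ w → E G w v)

Regular : ∀ {n} → ℕ → Digraph n → Set
Regular d G = ∀ v → outdeg G v ≡ d × indeg G v ≡ d

-- Partition (A,B) of V(G) encoded by A : Fin n → Bool (B = complement).
StronglyWellConnected : ∀ {n} → Digraph n → Set
StronglyWellConnected {n} G =
  4 ≤ n ×
  ((A : Fin n → Bool) → 2 ≤ count A → 2 ≤ count (λ v → not (A v)) →
    ∃[ a ] ∃[ b ] ∃[ c ] ∃[ d ]
      (A a ≡ true × A d ≡ true × A b ≡ false × A c ≡ false ×
       a ≢ d × b ≢ c × E G a b ≡ true × E G c d ≡ true))

next : ∀ {m} → Fin (suc m) → Fin (suc m)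
next {m} i = fromℕ< (m%n<n (suc (toℕ i)) (suc m))

HamiltonCycle : ∀ {n} → Digraph n → Set
HamiltonCycle {zero} G = ⊥
HamiltonCycle {suc m} G =
  Σ (Fin (suc m) ↔ Fin (suc m)) λ σ →
    ∀ i → E G (Inverse.to σ i) (Inverse.to σ (next i)) ≡ true

{-# OPTIONS --safe #-}

-- Let H be the bipartite double cover of G, with an out-copy and an in-copy of every vertex.
-- Count the walks of length 7 in H from the in-copy of s to the out-copy of t.
--
-- If every pair (s , t) has a positive proportion of all possible walks, then H is robustly
-- connected and absorption works.  Let u u′ a a′ p w be the interior of such a walk.  A cycle that
-- runs through the edges u → u′, p → w, a → a′ in this order can be rerouted as
-- u → s … t → w … a → u′ … p → a′, which swallows any path from s to t.  Multiplicative weights give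
-- linearly many disjoint gadgets of this kind such that every pair is served by many of them, and
-- short paths join them to one cycle.  By Hall's theorem the remaining vertices still span a
-- k-regular digraph with k linear; distributing them evenly over many classes and matching
-- consecutive classes covers them with fewer paths than there are gadgets for each pair.
--
-- Otherwise, since d > n/3, the neighbourhoods around a bad pair give sets X of out-copies and Y
-- of in-copies such that few edges of H join (X , Y) to its complement.  Both parts ("rooms") have
-- density above 1/2, so the first case applies to each of them.  A few crossing edges that form a
-- linear forest (they exist by regularity and, in degenerate cases, by strong well-connectedness)
-- are contracted so that the rooms become balanced and are linked by paths from one to the other
-- ("doors").  Pair the doors arbitrarily, take a Hamilton cycle of the second room and cut it at
-- the doors; the resulting paths are contracted in turn, and a Hamilton cycle of the first room
-- then expands to one of G.  Below, V₁₁ = X ∩ Y and V₂₂ is the set of vertices outside X ∪ Y.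

module Submission where

open import Defs

-- Why length 7: absorption exchanges edges alternately along a walk of the double cover. With one
-- removed edge (length 3) a single edge u → u′ would have to serve both s and t. With two (length
-- 5) the exchange always splits off the closed part u′ ... a. With three there is an order on the
-- cycle for which the result stays a single cycle, and the walk reaches three steps from either
-- end. Three steps also suit d > n/3: the robust neighbourhoods met on the way have size about d,
-- and three sets of that size cannot be nearly disjoint.
--
-- The argument is deterministic. Random choices are replaced by averages: gadgets come from a
-- potential function, the even classes from a greedy second-moment bound.
--
-- Errors are natural numbers on a few scales: h is about n/e, the surplus of d over n/3; τ is about
-- h/5, a degree that is certainly available inside a room; ζ is about τ/Q and measures sparse cuts
-- and exceptional sets. Q is fixed after the robustness constant of the rooms, because contracted
-- paths and crossing edges disturb the regularity of a room on the scale ζ.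

module Hamiltonicity where

  open import Data.Nat hiding (_≟_)
  open import Data.Nat.Properties hiding (_≟_)
  open import Data.Nat.DivMod using (m<n⇒m%n≡m; n%n≡0; m≡m%n+[m/n]*n; m%n<n; m/n*n≤m)
  open import Data.Bool using (Bool; true; false; not; _∧_; _∨_; T; if_then_else_)
  open import Data.Bool.Properties using (T?; T-≡) renaming (_≟_ to _≟ᵇ_)
  open import Data.Fin using (Fin; zero; suc; toℕ; fromℕ; fromℕ<; inject₁; splitAt; _↑ˡ_; _↑ʳ_)
  open import Data.Fin.Properties using (_≟_; any?; toℕ-injective; toℕ-fromℕ; toℕ-fromℕ<; toℕ-inject₁; toℕ<n; splitAt⁻¹-↑ˡ; splitAt⁻¹-↑ʳ; splitAt-↑ˡ; splitAt-↑ʳ)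
  open import Data.Fin.Subset.Properties using (anySubset?)
  open import Data.Maybe using (Maybe; just; nothing)
  open import Data.List using (List; []; _∷_; _++_; map; length; filter; allFin; concatMap; lookup; zip)
  open import Data.List.Properties using (length-tabulate; length-map; map-tabulate; map-++; length-++)
  open import Data.List.Membership.Propositional using (_∈_)
  open import Data.List.Membership.Propositional.Properties using (∈-allFin; ∈-lookup; ∈-filter⁻; ∈-++⁻; ∈-++⁺ˡ; ∈-++⁺ʳ; ∈-map⁺; ∈-map⁻)
  open import Data.List.Relation.Unary.Any using (here; there)
  open import Data.Product using (_×_; _,_; ∃; Σ; proj₁; proj₂)
  open import Data.Sum using (_⊎_; inj₁; inj₂; [_,_]′)
  open import Data.Empty using (⊥; ⊥-elim)
  open import Data.Vec using (Vec; []; _∷_; toList)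
  import Data.Vec as Vec
  open import Data.Vec.Properties using (lookup∘tabulate)
  open import Function using (_∘_; id)
  open import Function.Bundles using (Equivalence; mk↔ₛ′)
  open import Relation.Nullary using (yes; no; ¬_; Dec; does; _×-dec_)
  open import Relation.Nullary.Decidable using (¬?; decidable-stable)
  open import Relation.Binary.PropositionalEquality

  -- Linear arithmetic by certificates

  infixl 6 _⊕_
  infixl 7 _⊗_

  data Ex : Set where
    # con : ℕ → Ex
    _⊕_ _⊗_ : Ex → Ex → Ex

  nth : List ℕ → ℕ → ℕ
  nth [] _ = 0
  nth (x ∷ _) zero = x
  nth (_ ∷ xs) (suc i) = nth xs i

  ⟦_⟧ : Ex → List ℕ → ℕ
  ⟦ # i ⟧ ρ = nth ρ i
  ⟦ con c ⟧ ρ = c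
  ⟦ a ⊕ b ⟧ ρ = ⟦ a ⟧ ρ + ⟦ b ⟧ ρ
  ⟦ a ⊗ b ⟧ ρ = ⟦ a ⟧ ρ * ⟦ b ⟧ ρ

  Mono Poly : Set
  Mono = List ℕ
  Poly = List (ℕ × Mono)

  module _ (ρ : List ℕ) where
    ⟦_⟧m : Mono → ℕ
    ⟦ [] ⟧m = 1
    ⟦ i ∷ m ⟧m = nth ρ i * ⟦ m ⟧m

    ⟦_⟧p : Poly → ℕ
    ⟦ [] ⟧p = 0
    ⟦ (c , m) ∷ p ⟧p = c * ⟦ m ⟧m + ⟦ p ⟧p

  -- Monomials are kept sorted, so that commuted products become equal lists.
  insV : ℕ → Mono → Mono
  insV i [] = i ∷ []
  insV i (j ∷ m) = if i ≤ᵇ j then i ∷ j ∷ m else j ∷ insV i m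

  mulM : Mono → Mono → Mono
  mulM [] m' = m'
  mulM (i ∷ m) m' = insV i (mulM m m')

  eqM : Mono → Mono → Bool
  eqM [] [] = true
  eqM (i ∷ m) (j ∷ m') = if i ≡ᵇ j then eqM m m' else false
  eqM _ _ = false

  insP : ℕ → Mono → Poly → Poly
  insP c m [] = (c , m) ∷ []
  insP c m ((c' , m') ∷ p) = if eqM m m' then (c + c' , m') ∷ p else (c' , m') ∷ insP c m p

  addP : Poly → Poly → Poly
  addP [] q = q
  addP ((c , m) ∷ p) q = insP c m (addP p q)

  scaleP : ℕ → Mono → Poly → Poly
  scaleP c m [] = []
  scaleP c m ((c' , m') ∷ p) = insP (c * c') (mulM m m') (scaleP c m p)

  mulP : Poly → Poly → Poly
  mulP [] q = []
  mulP ((c , m) ∷ p) q = addP (scaleP c m q) (mulP p q)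

  norm : Ex → Poly
  norm (# i) = (1 , i ∷ []) ∷ []
  norm (con c) = (c , []) ∷ []
  norm (a ⊕ b) = addP (norm a) (norm b)
  norm (a ⊗ b) = mulP (norm a) (norm b)

  subP : ℕ → Mono → Poly → Maybe Poly
  subP zero m p = just p
  subP (suc c) m [] = nothing
  subP (suc c) m ((c' , m') ∷ p) with eqM m m'
  ... | true = if suc c ≤ᵇ c' then just ((c' ∸ suc c , m') ∷ p) else nothing
  ... | false with subP (suc c) m p
  ...   | just p' = just ((c' , m') ∷ p')
  ...   | nothing = nothing

  -- A coefficientwise test is sound because the variables are natural numbers, so every monomial is
  -- nonnegative.
  leqP : Poly → Poly → Bool
  leqP [] q = true
  leqP ((c , m) ∷ p) q with subP c m q
  ... | just q' = leqP p q'
  ... | nothing = false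

  module _ (ρ : List ℕ) where
    private
      M = ⟦_⟧m ρ
      P = ⟦_⟧p ρ

    open ≡-Reasoning

    swap* : ∀ a b c → a * (b * c) ≡ b * (a * c)
    swap* a b c = trans (sym (*-assoc a b c)) (trans (cong (_* c) (*-comm a b)) (*-assoc b a c))

    swap+ : ∀ a b c → a + (b + c) ≡ b + (a + c)
    swap+ a b c = trans (sym (+-assoc a b c)) (trans (cong (_+ c) (+-comm a b)) (+-assoc b a c))

    insV-sound : ∀ i m → M (insV i m) ≡ nth ρ i * M m
    insV-sound i [] = refl
    insV-sound i (j ∷ m) with i ≤ᵇ j
    ... | true = refl
    ... | false = trans (cong (nth ρ j *_) (insV-sound i m)) (swap* (nth ρ j) (nth ρ i) (M m))

    mulM-sound : ∀ m m' → M (mulM m m') ≡ M m * M m'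
    mulM-sound [] m' = sym (*-identityˡ _)
    mulM-sound (i ∷ m) m' = trans (insV-sound i (mulM m m'))
      (trans (cong (nth ρ i *_) (mulM-sound m m')) (sym (*-assoc (nth ρ i) (M m) (M m'))))

    eqM-sound : ∀ m m' → eqM m m' ≡ true → m ≡ m'
    eqM-sound [] [] _ = refl
    eqM-sound (i ∷ m) (j ∷ m') e with i ≡ᵇ j in eq
    ... | true = cong₂ _∷_ (≡ᵇ⇒≡ i j (subst (λ b → T b) (sym eq) _)) (eqM-sound m m' e)
    eqM-sound (i ∷ m) (j ∷ m') () | false

    insP-sound : ∀ c m p → P (insP c m p) ≡ c * M m + P p
    insP-sound c m [] = refl
    insP-sound c m ((c' , m') ∷ p) with eqM m m' in eq
    ... | false = trans (cong (c' * M m' +_) (insP-sound c m p)) (swap+ (c' * M m') (c * M m) (P p))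
    ... | true with eqM-sound m m' eq
    ...   | refl = trans (cong (_+ P p) (*-distribʳ-+ (M m) c c')) (+-assoc (c * M m) (c' * M m) (P p))

    addP-sound : ∀ p q → P (addP p q) ≡ P p + P q
    addP-sound [] q = refl
    addP-sound ((c , m) ∷ p) q = trans (insP-sound c m (addP p q))
      (trans (cong (c * M m +_) (addP-sound p q)) (sym (+-assoc (c * M m) (P p) (P q))))

    scaleP-sound : ∀ c m p → P (scaleP c m p) ≡ c * M m * P p
    scaleP-sound c m [] = sym (*-zeroʳ (c * M m))
    scaleP-sound c m ((c' , m') ∷ p) = begin
      P (insP (c * c') (mulM m m') (scaleP c m p)) ≡⟨ insP-sound (c * c') (mulM m m') (scaleP c m p) ⟩
      c * c' * M (mulM m m') + P (scaleP c m p)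
        ≡⟨ cong₂ (λ x y → c * c' * x + y) (mulM-sound m m') (scaleP-sound c m p) ⟩
      c * c' * (M m * M m') + c * M m * P p ≡⟨ cong (_+ c * M m * P p) ([m*n]*[o*p]≡[m*o]*[n*p] c c' (M m) (M m')) ⟩
      c * M m * (c' * M m') + c * M m * P p ≡⟨ *-distribˡ-+ (c * M m) (c' * M m') (P p) ⟨
      c * M m * (c' * M m' + P p) ∎

    mulP-sound : ∀ p q → P (mulP p q) ≡ P p * P q
    mulP-sound [] q = refl
    mulP-sound ((c , m) ∷ p) q = trans (addP-sound (scaleP c m q) (mulP p q))
      (trans (cong₂ _+_ (scaleP-sound c m q) (mulP-sound p q)) (sym (*-distribʳ-+ (P q) (c * M m) (P p))))

    norm-sound : ∀ e → P (norm e) ≡ ⟦ e ⟧ ρ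
    norm-sound (# i) = trans (+-identityʳ _) (trans (+-identityʳ _) (*-identityʳ _))
    norm-sound (con c) = trans (+-identityʳ _) (*-identityʳ c)
    norm-sound (a ⊕ b) = trans (addP-sound (norm a) (norm b)) (cong₂ _+_ (norm-sound a) (norm-sound b))
    norm-sound (a ⊗ b) = trans (mulP-sound (norm a) (norm b)) (cong₂ _*_ (norm-sound a) (norm-sound b))

    subP-sound : ∀ c m p {q} → subP c m p ≡ just q → P p ≡ c * M m + P q
    subP-sound zero m p refl = refl
    subP-sound (suc c) m [] ()
    subP-sound (suc c) m ((c' , m') ∷ p) e with eqM m m' in eq
    subP-sound (suc c) m ((c' , m') ∷ p) e | true with suc c ≤ᵇ c' in le | eqM-sound m m' eq
    subP-sound (suc c) m ((c' , m') ∷ p) refl | true | true | refl =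
      trans (cong (λ x → x * M m + P p) (sym (m+[n∸m]≡n {suc c} {c'} (≤ᵇ⇒≤ (suc c) c' (subst T (sym le) _)))))
        (trans (cong (_+ P p) (*-distribʳ-+ (M m) (suc c) (c' ∸ suc c))) (+-assoc (suc c * M m) _ (P p)))
    subP-sound (suc c) m ((c' , m') ∷ p) e | false with subP (suc c) m p in r
    subP-sound (suc c) m ((c' , m') ∷ p) refl | false | just p' =
      trans (cong (c' * M m' +_) (subP-sound (suc c) m p r)) (swap+ (c' * M m') (suc c * M m) (P p'))
    subP-sound (suc c) m ((c' , m') ∷ p) () | false | nothing

    leqP-sound : ∀ p q → leqP p q ≡ true → P p ≤ P q
    leqP-sound [] q e = z≤n
    leqP-sound ((c , m) ∷ p) q e with subP c m q in r
    ... | just q' = ≤-trans (+-monoʳ-≤ (c * M m) (leqP-sound p q' e)) (≤-reflexive (sym (subP-sound c m q r)))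
    leqP-sound ((c , m) ∷ p) q () | nothing

  infix 5 _≼_by_
  infixl 6 _⊞_
  infixr 7 _⊠_

  -- The two sides are stored as syntax: sums and polynomial multiples of hypotheses stay reified,
  -- and one computed comparison of coefficients closes a goal.
  record Comb (ρ : List ℕ) : Set where
    constructor _≼_by_
    field
      lo hi : Ex
      pf : ⟦ lo ⟧ ρ ≤ ⟦ hi ⟧ ρ

  _⊞_ : ∀ {ρ} → Comb ρ → Comb ρ → Comb ρ
  (a ≼ b by p) ⊞ (c ≼ d by q) = (a ⊕ c) ≼ (b ⊕ d) by +-mono-≤ p q

  _⊠_ : ∀ {ρ} → Ex → Comb ρ → Comb ρ
  _⊠_ {ρ} m (a ≼ b by p) = (m ⊗ a) ≼ (m ⊗ b) by *-monoʳ-≤ (⟦ m ⟧ ρ) p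

  -- Farkas certificate: (1+k)·(u − t) dominates, coefficient by coefficient, a nonnegative
  -- combination of the differences hi − lo of the hypotheses.
  abstract
    lin : ∀ ρ t u k (c : Comb ρ) →
          leqP (norm ((con (suc k) ⊗ t) ⊕ Comb.hi c)) (norm ((con (suc k) ⊗ u) ⊕ Comb.lo c)) ≡ true → ⟦ t ⟧ ρ ≤ ⟦ u ⟧ ρ
    lin ρ t u k (a ≼ b by p) e = *-cancelˡ-≤ (suc k) (+-cancelʳ-≤ (⟦ b ⟧ ρ) _ _ (begin
        suc k * ⟦ t ⟧ ρ + ⟦ b ⟧ ρ ≡⟨ norm-sound ρ ((con (suc k) ⊗ t) ⊕ b) ⟨
        ⟦ norm ((con (suc k) ⊗ t) ⊕ b) ⟧p' ≤⟨ leqP-sound ρ (norm ((con (suc k) ⊗ t) ⊕ b)) (norm ((con (suc k) ⊗ u) ⊕ a)) e ⟩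
        ⟦ norm ((con (suc k) ⊗ u) ⊕ a) ⟧p' ≡⟨ norm-sound ρ ((con (suc k) ⊗ u) ⊕ a) ⟩
        suc k * ⟦ u ⟧ ρ + ⟦ a ⟧ ρ ≤⟨ +-monoʳ-≤ (suc k * ⟦ u ⟧ ρ) p ⟩
        suc k * ⟦ u ⟧ ρ + ⟦ b ⟧ ρ ∎))
      where
      open ≤-Reasoning
      ⟦_⟧p' : Poly → ℕ
      ⟦_⟧p' = ⟦_⟧p ρ

  triv : ∀ {ρ} → Comb ρ
  triv = con 0 ≼ con 0 by z≤n

  -- Finite sums

  infixr 1 _∙_
  private variable
    𝔸 𝔹 : Set

  _∙_ : {x y z : 𝔸} → x ≡ y → y ≡ z → x ≡ z
  _∙_ = trans

  𝟙 : Bool → ℕ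
  𝟙 true = 1
  𝟙 false = 0

  𝟙≤1 : ∀ b → 𝟙 b ≤ 1
  𝟙≤1 true = ≤-refl
  𝟙≤1 false = z≤n

  𝟙-not : ∀ b → 𝟙 b + 𝟙 (not b) ≡ 1
  𝟙-not true = refl
  𝟙-not false = refl

  𝟙-∧ : ∀ a b → 𝟙 (a ∧ b) ≡ 𝟙 a * 𝟙 b
  𝟙-∧ true b = sym (+-identityʳ _)
  𝟙-∧ false b = refl

  𝟙-true : ∀ {b} → 1 ≤ 𝟙 b → b ≡ true
  𝟙-true {true} _ = refl

  ∑ : List 𝔸 → (𝔸 → ℕ) → ℕ
  ∑ [] f = 0
  ∑ (x ∷ xs) f = f x + ∑ xs f

  infixr 9 ∑
  syntax ∑ xs (λ x → e) = ∑[ x ∈ xs ] e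

  ∑-cong : ∀ (xs : List 𝔸) {f g : 𝔸 → ℕ} → (∀ x → f x ≡ g x) → ∑ xs f ≡ ∑ xs g
  ∑-cong [] p = refl
  ∑-cong (x ∷ xs) p = cong₂ _+_ (p x) (∑-cong xs p)

  ∑-mono : ∀ (xs : List 𝔸) {f g : 𝔸 → ℕ} → (∀ x → f x ≤ g x) → ∑ xs f ≤ ∑ xs g
  ∑-mono [] p = z≤n
  ∑-mono (x ∷ xs) p = +-mono-≤ (p x) (∑-mono xs p)

  ∑-mono∈ : ∀ (xs : List 𝔸) {f g : 𝔸 → ℕ} → (∀ {x} → x ∈ xs → f x ≤ g x) → ∑ xs f ≤ ∑ xs g
  ∑-mono∈ [] p = z≤n
  ∑-mono∈ (x ∷ xs) p = +-mono-≤ (p (here refl)) (∑-mono∈ xs (p ∘ there))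

  +-interchange : ∀ a b c d → (a + b) + (c + d) ≡ (a + c) + (b + d)
  +-interchange a b c d = +-assoc a b (c + d) ∙ cong (a +_) (sym (+-assoc b c d) ∙ cong (_+ d) (+-comm b c) ∙ +-assoc c b d) ∙ sym (+-assoc a c (b + d))

  ∑-+ : ∀ (xs : List 𝔸) (f g : 𝔸 → ℕ) → ∑ xs (λ x → f x + g x) ≡ ∑ xs f + ∑ xs g
  ∑-+ [] f g = refl
  ∑-+ (x ∷ xs) f g = cong (f x + g x +_) (∑-+ xs f g) ∙ +-interchange (f x) (g x) (∑ xs f) (∑ xs g)

  ∑-*ˡ : ∀ (xs : List 𝔸) c (f : 𝔸 → ℕ) → ∑ xs (λ x → c * f x) ≡ c * ∑ xs f
  ∑-*ˡ [] c f = sym (*-zeroʳ c)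
  ∑-*ˡ (x ∷ xs) c f = cong (c * f x +_) (∑-*ˡ xs c f) ∙ sym (*-distribˡ-+ c (f x) (∑ xs f))

  ∑-*ʳ : ∀ (xs : List 𝔸) c (f : 𝔸 → ℕ) → ∑ xs (λ x → f x * c) ≡ ∑ xs f * c
  ∑-*ʳ [] c f = refl
  ∑-*ʳ (x ∷ xs) c f = cong (f x * c +_) (∑-*ʳ xs c f) ∙ sym (*-distribʳ-+ c (f x) (∑ xs f))

  ∑-const : ∀ (xs : List 𝔸) c → ∑ xs (λ _ → c) ≡ length xs * c
  ∑-const [] c = refl
  ∑-const (x ∷ xs) c = cong (c +_) (∑-const xs c)

  ∑-zero : ∀ (xs : List 𝔸) → ∑ xs (λ _ → 0) ≡ 0
  ∑-zero xs = ∑-const xs 0 ∙ *-zeroʳ (length xs)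

  ∑-bound : ∀ (xs : List 𝔸) {f : 𝔸 → ℕ} c → (∀ x → f x ≤ c) → ∑ xs f ≤ length xs * c
  ∑-bound xs c p = ≤-trans (∑-mono xs p) (≤-reflexive (∑-const xs c))

  ∑-swap : ∀ (xs : List 𝔸) (ys : List 𝔹) (f : 𝔸 → 𝔹 → ℕ) →
           ∑ xs (λ x → ∑ ys (f x)) ≡ ∑ ys (λ y → ∑ xs (λ x → f x y))
  ∑-swap [] ys f = sym (∑-zero ys)
  ∑-swap (x ∷ xs) ys f = cong (∑ ys (f x) +_) (∑-swap xs ys f) ∙ sym (∑-+ ys (f x) (λ y → ∑ xs (λ x → f x y)))

  ∑-++ : ∀ (xs ys : List 𝔸) (f : 𝔸 → ℕ) → ∑ (xs ++ ys) f ≡ ∑ xs f + ∑ ys f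
  ∑-++ [] ys f = refl
  ∑-++ (x ∷ xs) ys f = cong (f x +_) (∑-++ xs ys f) ∙ sym (+-assoc (f x) _ _)

  ∑-map : ∀ (g : 𝔸 → 𝔹) (xs : List 𝔸) (f : 𝔹 → ℕ) → ∑ (map g xs) f ≡ ∑ xs (f ∘ g)
  ∑-map g [] f = refl
  ∑-map g (x ∷ xs) f = cong (f (g x) +_) (∑-map g xs f)

  ∑-concatMap : ∀ (g : 𝔸 → List 𝔹) (xs : List 𝔸) (f : 𝔹 → ℕ) → ∑ (concatMap g xs) f ≡ ∑ xs (λ x → ∑ (g x) f)
  ∑-concatMap g [] f = refl
  ∑-concatMap g (x ∷ xs) f = ∑-++ (g x) _ f ∙ cong (∑ (g x) f +_) (∑-concatMap g xs f)

  ∑-∈ : ∀ {xs : List 𝔸} (f : 𝔸 → ℕ) {x} → x ∈ xs → f x ≤ ∑ xs f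
  ∑-∈ f (here refl) = m≤m+n _ _
  ∑-∈ {xs = y ∷ xs} f (there p) = ≤-trans (∑-∈ f p) (m≤n+m _ (f y))

  ∑-filter : ∀ (P : 𝔸 → Bool) (xs : List 𝔸) (f : 𝔸 → ℕ) →
             ∑ (filter (λ x → T? (P x)) xs) f ≡ ∑ xs (λ x → 𝟙 (P x) * f x)
  ∑-filter P [] f = refl
  ∑-filter P (x ∷ xs) f with P x
  ... | true = cong₂ _+_ (sym (+-identityʳ (f x))) (∑-filter P xs f)
  ... | false = ∑-filter P xs f

  length-∑ : ∀ (xs : List 𝔸) → length xs ≡ ∑ xs (λ _ → 1)
  length-∑ [] = refl
  length-∑ (x ∷ xs) = cong suc (length-∑ xs)

  ∑-<⇒∃ : ∀ (xs : List 𝔸) {f g : 𝔸 → ℕ} → ∑ xs f < ∑ xs g → ∃ λ x → x ∈ xs × f x < g x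
  ∑-<⇒∃ [] ()
  ∑-<⇒∃ (x ∷ xs) {f} {g} lt with f x <? g x
  ... | yes p = x , here refl , p
  ... | no ¬p with ∑-<⇒∃ xs (+-cancelˡ-< (g x) _ _ (<-≤-trans (s≤s (+-monoˡ-≤ (∑ xs f) (≮⇒≥ ¬p))) lt))
  ...   | y , y∈ , q = y , there y∈ , q

  -- The source of the choices of a class, of a gadget and of a busy vertex below. Nonemptiness is
  -- required because the inequality is not strict.
  ∑-average : ∀ (xs : List 𝔸) {f g : 𝔸 → ℕ} → 1 ≤ length xs → ∑ xs f ≤ ∑ xs g → ∃ λ x → x ∈ xs × f x ≤ g x
  ∑-average (x ∷ xs) {f} {g} _ le with f x ≤? g x
  ... | yes p = x , here refl , p
  ... | no ¬p with ∑-<⇒∃ xs {f} {g} (+-cancelˡ-< (f x) _ _ (≤-<-trans le (+-monoˡ-< (∑ xs g) (≰⇒> ¬p))))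
  ...   | y , y∈ , q = y , there y∈ , <⇒≤ q

  ∑-*∑ : ∀ (xs : List 𝔸) (ys : List 𝔹) (f : 𝔸 → ℕ) (g : 𝔹 → ℕ) →
         ∑ xs f * ∑ ys g ≡ ∑ xs (λ x → ∑ ys (λ y → f x * g y))
  ∑-*∑ xs ys f g = sym (∑-*ʳ xs (∑ ys g) f) ∙ ∑-cong xs (λ x → sym (∑-*ˡ ys (f x) g))

  module _ {n : ℕ} where

    infix 7 _==_
    _==_ : Fin n → Fin n → Bool
    x == y = does (x ≟ y)

    ==-refl : ∀ x → (x == x) ≡ true
    ==-refl x with x ≟ x
    ... | yes _ = refl
    ... | no x≢x = ⊥-elim (x≢x refl)

    ==⇒≡ : ∀ {x y} → (x == y) ≡ true → x ≡ y
    ==⇒≡ {x} {y} e with x ≟ y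
    ... | yes p = p

    ≢⇒== : ∀ {x y} → ¬ (x ≡ y) → (x == y) ≡ false
    ≢⇒== {x} {y} x≢y with x ≟ y
    ... | yes p = ⊥-elim (x≢y p)
    ... | no _ = refl

    card : (Fin n → Bool) → ℕ
    card A = ∑[ v ∈ allFin n ] 𝟙 (A v)

    -- Multiplicities replace permutations and distinctness: disjointness is a bound by 1, exact
    -- covering is the value 1, and both can be added up.
    occ : Fin n → List (Fin n) → ℕ
    occ x xs = ∑[ z ∈ xs ] 𝟙 (z == x)

    occ-++ : ∀ x xs ys → occ x (xs ++ ys) ≡ occ x xs + occ x ys
    occ-++ x xs ys = ∑-++ xs ys _

    occ-here : ∀ x xs → occ x (x ∷ xs) ≡ suc (occ x xs)
    occ-here x xs rewrite ==-refl x = refl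

    ∈⇒occ : ∀ {x xs} → x ∈ xs → 1 ≤ occ x xs
    ∈⇒occ {x} {xs} p = ≤-trans (≤-reflexive (cong 𝟙 (sym (==-refl x)))) (∑-∈ _ p)

    occ⇒∈ : ∀ {x} xs → 1 ≤ occ x xs → x ∈ xs
    occ⇒∈ [] ()
    occ⇒∈ {x} (y ∷ xs) h with y ≟ x
    ... | yes p = here (sym p)
    ... | no _ = there (occ⇒∈ xs h)

  ∑-allFin-suc : ∀ {n} (f : Fin (suc n) → ℕ) → ∑ (allFin (suc n)) f ≡ f zero + ∑ (allFin n) (f ∘ suc)
  ∑-allFin-suc {n} f = cong (f zero +_) (cong (λ l → ∑ l f) (sym (map-tabulate id suc)) ∙ ∑-map suc (allFin n) f)

  ∑-δ : ∀ {n} (x : Fin n) (f : Fin n → ℕ) → ∑[ v ∈ allFin n ] (𝟙 (x == v) * f v) ≡ f x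
  ∑-δ {suc n} zero f = ∑-allFin-suc (λ v → 𝟙 (zero == v) * f v)
    ∙ cong₂ _+_ (+-identityʳ (f zero)) (∑-zero (allFin n)) ∙ +-identityʳ (f zero)
  ∑-δ {suc n} (suc x) f = ∑-allFin-suc (λ v → 𝟙 (suc x == v) * f v)
    ∙ ∑-cong (allFin n) (λ v → cong (λ b → 𝟙 b * f (suc v)) (lemma x v)) ∙ ∑-δ x (f ∘ suc)
    where
    lemma : ∀ {m} (x v : Fin m) → (suc x == suc v) ≡ (x == v)
    lemma x v with x ≟ v
    ... | yes _ = refl
    ... | no _ = refl

  ==-sym : ∀ {n} (x y : Fin n) → (x == y) ≡ (y == x)
  ==-sym x y with x ≟ y | y ≟ x
  ... | yes _ | yes _ = refl
  ... | no _ | no _ = refl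
  ... | yes p | no q = ⊥-elim (q (sym p))
  ... | no p | yes q = ⊥-elim (p (sym q))

  ∑-δ′ : ∀ {n} (x : Fin n) (f : Fin n → ℕ) → ∑[ v ∈ allFin n ] (𝟙 (v == x) * f v) ≡ f x
  ∑-δ′ {n} x f = ∑-cong (allFin n) (λ v → cong (λ b → 𝟙 b * f v) (==-sym v x)) ∙ ∑-δ x f

  occ-allFin : ∀ {n} (x : Fin n) → occ x (allFin n) ≡ 1
  occ-allFin {n} x = ∑-cong (allFin n) (λ v → sym (*-identityʳ _)) ∙ ∑-δ′ x (λ _ → 1)

  card-single : ∀ {n} (x : Fin n) → card (λ v → v == x) ≡ 1
  card-single = occ-allFin

  ∑-occ : ∀ {n} (xs : List (Fin n)) (f : Fin n → ℕ) → ∑ xs f ≡ ∑[ v ∈ allFin n ] (occ v xs * f v)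
  ∑-occ {n} [] f = sym (∑-zero (allFin n))
  ∑-occ {n} (x ∷ xs) f = cong₂ _+_ (sym (∑-δ x f)) (∑-occ xs f) ∙ sym (∑-+ (allFin n) _ _)
    ∙ ∑-cong (allFin n) (λ v → sym (*-distribʳ-+ (f v) (𝟙 (x == v)) (occ v xs)))

  length-occ : ∀ {n} (xs : List (Fin n)) → length xs ≡ ∑[ v ∈ allFin n ] occ v xs
  length-occ {n} xs = length-∑ xs ∙ ∑-occ xs (λ _ → 1) ∙ ∑-cong (allFin n) (λ v → *-identityʳ _)

  card-pos : ∀ {n} (A : Fin n → Bool) → 1 ≤ card A → ∃ λ v → A v ≡ true
  card-pos {n} A h with ∑-<⇒∃ (allFin n) {λ _ → 0} {𝟙 ∘ A} (≤-<-trans (≤-reflexive (∑-zero (allFin n))) h)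
  ... | v , _ , p = v , 𝟙-true p

  ∑-allFin-∈ : ∀ {n} (f : Fin n → ℕ) (x : Fin n) → f x ≤ ∑ (allFin n) f
  ∑-allFin-∈ f x = ∑-∈ f (∈-allFin x)

  card-∈ : ∀ {n} (A : Fin n → Bool) v → A v ≡ true → 1 ≤ card A
  card-∈ A v p = ≤-trans (≤-reflexive (cong 𝟙 (sym p))) (∑-allFin-∈ (𝟙 ∘ A) v)

  card-not : ∀ {n} (A : Fin n → Bool) → card A + card (not ∘ A) ≡ n
  card-not {n} A = sym (∑-+ (allFin n) _ _) ∙ ∑-cong (allFin n) (λ v → 𝟙-not (A v)) ∙ ∑-const (allFin n) 1
    ∙ *-identityʳ _ ∙ length-tabulate id

  -- Hall's theorem

  _⊆ᵇ_ : ∀ {n} → (Fin n → Bool) → (Fin n → Bool) → Set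
  A ⊆ᵇ B = ∀ x → A x ≡ true → B x ≡ true

  ⊆ᵇ-𝟙 : ∀ {a b} → (a ≡ true → b ≡ true) → 𝟙 a ≤ 𝟙 b
  ⊆ᵇ-𝟙 {false} h = z≤n
  ⊆ᵇ-𝟙 {true} {b} h rewrite h refl = ≤-refl

  ∧-proj₁ : ∀ {a b} → a ∧ b ≡ true → a ≡ true
  ∧-proj₁ {true} _ = refl

  ∧-proj₂ : ∀ {a b} → a ∧ b ≡ true → b ≡ true
  ∧-proj₂ {true} e = e

  ∧-intro : ∀ {a b} → a ≡ true → b ≡ true → a ∧ b ≡ true
  ∧-intro refl refl = refl

  not-true : ∀ {a} → not a ≡ true → a ≡ false
  not-true {false} _ = refl

  ∨-split : ∀ a b → 𝟙 (a ∨ b) ≤ 𝟙 a + 𝟙 b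
  ∨-split true b = s≤s z≤n
  ∨-split false b = ≤-refl

  module Matching {n m : ℕ} (M : Fin n → Fin m → Bool) where

    nb : (Fin n → Bool) → Fin m → Bool
    nb S y = 1 ≤ᵇ ∑[ x ∈ allFin n ] (𝟙 (S x) * 𝟙 (M x y))

    nb-intro : ∀ {S x y} → S x ≡ true → M x y ≡ true → nb S y ≡ true
    nb-intro {S} {x} {y} p q with ∑[ x ∈ allFin n ] (𝟙 (S x) * 𝟙 (M x y)) | ∑-allFin-∈ (λ x → 𝟙 (S x) * 𝟙 (M x y)) x
    ... | zero | h rewrite p | q with h
    ...   | ()
    nb-intro {S} {x} {y} p q | suc _ | h = refl

    nb-elim : ∀ {S y} → nb S y ≡ true → ∃ λ x → S x ≡ true × M x y ≡ true
    nb-elim {S} {y} e with ∑-<⇒∃ (allFin n) {λ _ → 0} {λ x → 𝟙 (S x) * 𝟙 (M x y)}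
         (≤-<-trans (≤-reflexive (∑-zero (allFin n))) (≤ᵇ⇒≤ 1 _ (subst (λ b → T b) (sym e) _)))
    ... | x , _ , h with S x in p | M x y in q
    ...   | true | true = x , p , q

    HallCondition : (Fin n → Bool) → (Fin m → Bool) → Set
    HallCondition X Y = ∀ S → S ⊆ᵇ X → card S ≤ card (λ y → Y y ∧ nb S y)

    record Saturating (X : Fin n → Bool) (Y : Fin m → Bool) : Set where
      field
        es : List (Fin n × Fin m)
        es⊆M : ∀ {x y} → (x , y) ∈ es → M x y ≡ true
        sources : ∀ x → occ x (map proj₁ es) ≡ 𝟙 (X x)
        targets : ∀ y → occ y (map proj₂ es) ≤ 𝟙 (Y y)
    open Saturating

    add-pair : ∀ {X Y} x y → X x ≡ true → Y y ≡ true → M x y ≡ true →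
               Saturating (λ z → X z ∧ not (z == x)) (λ z → Y z ∧ not (z == y)) → Saturating X Y
    add-pair {X} {Y} x y px py pm s = record
      { es = (x , y) ∷ es s
      ; es⊆M = λ { (here refl) → pm ; (there i) → es⊆M s i }
      ; sources = λ z → cong (𝟙 (x == z) +_) (sources s z) ∙ h x z X px
      ; targets = λ z → ≤-trans (+-monoʳ-≤ (𝟙 (y == z)) (targets s z)) (≤-reflexive (h y z Y py)) }
      where
      h : ∀ {k} (x z : Fin k) (X : Fin k → Bool) → X x ≡ true → 𝟙 (x == z) + 𝟙 (X z ∧ not (z == x)) ≡ 𝟙 (X z)
      h x z X px rewrite ==-sym x z with z ≟ x
      ... | yes refl rewrite px = refl
      ... | no _ with X z
      ...   | true = refl
      ...   | false = refl

    join : ∀ {X₁ X₂ X Y₁ Y₂ Y} → (∀ x → 𝟙 (X₁ x) + 𝟙 (X₂ x) ≡ 𝟙 (X x)) → (∀ y → 𝟙 (Y₁ y) + 𝟙 (Y₂ y) ≤ 𝟙 (Y y)) →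
           Saturating X₁ Y₁ → Saturating X₂ Y₂ → Saturating X Y
    join hX hY s t = record
      { es = es s ++ es t
      ; es⊆M = λ i → f (∈-++⁻ (es s) i)
      ; sources = λ x → cong (occ x) (map-++ proj₁ (es s) (es t)) ∙ occ-++ x (map proj₁ (es s)) _ ∙ cong₂ _+_ (sources s x) (sources t x) ∙ hX x
      ; targets = λ y → ≤-trans (≤-reflexive (cong (occ y) (map-++ proj₂ (es s) (es t)) ∙ occ-++ y (map proj₂ (es s)) _))
                        (≤-trans (+-mono-≤ (targets s y) (targets t y)) (hY y)) }
      where
      f : ∀ {x y} → (x , y) ∈ es s ⊎ (x , y) ∈ es t → M x y ≡ true
      f (inj₁ i) = es⊆M s i
      f (inj₂ i) = es⊆M t i

    card-mono : ∀ {k} {A B : Fin k → Bool} → A ⊆ᵇ B → card A ≤ card B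
    card-mono {k} h = ∑-mono (allFin k) λ x → ⊆ᵇ-𝟙 (h x)

    nb-mono : ∀ {S T} → S ⊆ᵇ T → nb S ⊆ᵇ nb T
    nb-mono {S} {T} h y e with nb-elim {S} e
    ... | x , p , q = nb-intro {T} (h x p) q

    card-remove : ∀ {k} (A : Fin k → Bool) x → card A ≤ suc (card (λ z → A z ∧ not (z == x)))
    card-remove {k} A x = ≤-trans (∑-mono (allFin k) λ z → h z) (≤-reflexive (∑-+ (allFin k) _ _ ∙ cong (_+ card (λ z → A z ∧ not (z == x))) (card-single x)))
      where
      h : ∀ z → 𝟙 (A z) ≤ 𝟙 (z == x) + 𝟙 (A z ∧ not (z == x))
      h z with z == x
      ... | true = ≤-trans (𝟙≤1 (A z)) (s≤s z≤n)
      ... | false with A z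
      ...   | true = ≤-refl
      ...   | false = z≤n

    card-remove< : ∀ {k} (A : Fin k → Bool) x → A x ≡ true → card (λ z → A z ∧ not (z == x)) < card A
    card-remove< {k} A x p = ≤-trans (≤-reflexive (cong (_+ card (λ z → A z ∧ not (z == x))) (sym (card-single x)) ∙ sym (∑-+ (allFin k) _ _)))
        (∑-mono (allFin k) h)
      where
      h : ∀ z → 𝟙 (z == x) + 𝟙 (A z ∧ not (z == x)) ≤ 𝟙 (A z)
      h z with z ≟ x
      ... | yes refl rewrite p = ≤-refl
      ... | no _ with A z
      ...   | true = ≤-refl
      ...   | false = ≤-refl

    -- Halmos–Vaughan: either some proper nonempty set is tight and the problem splits along it,
    -- or any edge at x can be used.
    hall : ∀ k X Y → card X ≤ k → HallCondition X Y → Saturating X Y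
    hall k X Y hk hc with 1 ≤? card X
    ... | no card<1 = record { es = [] ; es⊆M = λ () ; sources = λ x → sym (n≤0⇒n≡0 (≤-trans (∑-allFin-∈ (𝟙 ∘ X) x) (≤-pred (≰⇒> card<1)))) ; targets = λ _ → z≤n }
    hall zero X Y hk hc | yes 1≤ = ⊥-elim (1+n≰n (≤-trans 1≤ hk))
    hall (suc k) X Y hk hc | yes 1≤ with card-pos X 1≤
    -- The search is confined to subsets of `X′`, which lacks `x`: a tight set found there is
    -- proper, so both halves of the split are smaller. Inclusion is tested as emptiness of a
    -- difference.
    ... | x , px = split (anySubset? λ S → (1 ≤? card (Vec.lookup S)) ×-dec ((card (λ z → Vec.lookup S z ∧ not (X′ z)) ≤? 0)
                             ×-dec (card (λ y → Y y ∧ nb (Vec.lookup S) y) ≤? card (Vec.lookup S))))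
      where
      X′ : Fin n → Bool
      X′ z = X z ∧ not (z == x)
      X′<X : card X′ < card X
      X′<X = card-remove< X x px
      single : Fin n → Bool
      single z = z == x
      split : Dec (∃ λ S → 1 ≤ card (Vec.lookup S) × card (λ z → Vec.lookup S z ∧ not (X′ z)) ≤ 0
                    × card (λ y → Y y ∧ nb (Vec.lookup S) y) ≤ card (Vec.lookup S)) → Saturating X Y
      split (yes (S , ne , sub , tight)) = join {S′} {X₂} {X} {Y₁} {Y₂} hX hY
          (hall k S′ Y₁ (≤-trans (card-mono S⊆X′) (≤-pred (≤-trans X′<X hk))) hc₁)
          (hall k X₂ Y₂ (≤-pred (≤-trans X₂<X hk)) hc₂)
        where
        S′ X₂ : Fin n → Bool
        S′ = Vec.lookup S
        X₂ z = X z ∧ not (S′ z)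
        Y₁ Y₂ : Fin m → Bool
        Y₁ y = Y y ∧ nb S′ y
        Y₂ y = Y y ∧ not (nb S′ y)
        S⊆X′ : S′ ⊆ᵇ X′
        S⊆X′ z p with X′ z | ≤-trans (∑-allFin-∈ (λ z → 𝟙 (S′ z ∧ not (X′ z))) z) sub
        ... | true | _ = refl
        ... | false | h rewrite p with h
        ...   | ()
        S⊆X : S′ ⊆ᵇ X
        S⊆X z p = ∧-proj₁ (S⊆X′ z p)
        hX : ∀ z → 𝟙 (S′ z) + 𝟙 (X₂ z) ≡ 𝟙 (X z)
        hX z with S′ z in eq
        ... | true rewrite S⊆X z eq = refl
        ... | false with X z
        ...   | true = refl
        ...   | false = refl
        hY : ∀ y → 𝟙 (Y₁ y) + 𝟙 (Y₂ y) ≤ 𝟙 (Y y)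
        hY y with Y y | nb S′ y
        ... | false | _ = ≤-refl
        ... | true | true = ≤-refl
        ... | true | false = ≤-refl
        X₂<X : card X₂ < card X
        X₂<X = ≤-trans (+-monoˡ-≤ (card X₂) ne) (≤-reflexive (sym (∑-+ (allFin n) _ _) ∙ ∑-cong (allFin n) hX))
        hc₁ : HallCondition S′ Y₁
        hc₁ T T⊆ = ≤-trans (hc T (λ z p → S⊆X z (T⊆ z p))) (card-mono λ y e → ∧-intro (∧-intro (∧-proj₁ e) (nb-mono {T} {S′} T⊆ y (∧-proj₂ {Y y} e))) (∧-proj₂ {Y y} e))
        hc₂ : HallCondition X₂ Y₂
        -- Apply Hall's condition to the union of `T` with the tight set, then cancel the neighbours
        -- of the tight set, of which there are at most `card S′`.
        hc₂ T T⊆ = +-cancelʳ-≤ (card S′) _ _ (begin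
          card T + card S′ ≡⟨ ∑-+ (allFin n) _ _ ⟨
          ∑[ z ∈ allFin n ] (𝟙 (T z) + 𝟙 (S′ z)) ≤⟨ ∑-mono (allFin n) disj ⟩
          card TS ≤⟨ hc TS TS⊆ ⟩
          card (λ y → Y y ∧ nb TS y) ≤⟨ ∑-mono (allFin m) nbs ⟩
          ∑[ y ∈ allFin m ] (𝟙 (Y₂ y ∧ nb T y) + 𝟙 (Y₁ y)) ≡⟨ ∑-+ (allFin m) _ _ ⟩
          card (λ y → Y₂ y ∧ nb T y) + card Y₁ ≤⟨ +-monoʳ-≤ _ tight ⟩
          card (λ y → Y₂ y ∧ nb T y) + card S′ ∎)
          where
          open ≤-Reasoning
          TS : Fin n → Bool
          TS z = T z ∨ S′ z
          disj : ∀ z → 𝟙 (T z) + 𝟙 (S′ z) ≤ 𝟙 (TS z)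
          disj z with T z in eq
          ... | false = ≤-refl
          ... | true rewrite not-true (∧-proj₂ {X z} (T⊆ z eq)) = ≤-refl
          TS⊆ : TS ⊆ᵇ X
          TS⊆ z e with T z in eq
          ... | true = ∧-proj₁ (T⊆ z eq)
          ... | false = S⊆X z e
          nbs : ∀ y → 𝟙 (Y y ∧ nb TS y) ≤ 𝟙 (Y₂ y ∧ nb T y) + 𝟙 (Y₁ y)
          nbs y with Y y | nb S′ y in e₁ | nb T y in e₂ | nb TS y in e₃
          ... | false | _ | _ | _ = z≤n
          ... | true | true | _ | true = ≤-refl
          ... | true | true | _ | false = z≤n
          ... | true | false | true | b = 𝟙≤1 b
          ... | true | false | false | false = z≤n
          ... | true | false | false | true with nb-elim {TS} {y} e₃
          ...   | z , p , q with T z in t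
          ...     | true = ⊥-elim (t≢f (sym (nb-intro {T} t q) ∙ e₂))
            where
            t≢f : true ≡ false → ⊥
            t≢f ()
          ...     | false = ⊥-elim (t≢f (sym (nb-intro {S′} p q) ∙ e₁))
            where
            t≢f : true ≡ false → ⊥
            t≢f ()
      split (no loose) with card-pos (λ y → Y y ∧ nb single y)
               (≤-trans (≤-reflexive (sym (card-single x))) (hc single λ z e → subst (λ v → X v ≡ true) (sym (==⇒≡ e)) px))
      ... | y , py with nb-elim {single} {y} (∧-proj₂ {Y y} py)
      ...   | x′ , e , q with ==⇒≡ {x = x′} {x} e
      ...     | refl = add-pair x y px (∧-proj₁ py) q (hall k X′ Y′ (≤-pred (≤-trans X′<X hk)) hc′)
        where
        Y′ : Fin m → Bool
        Y′ z = Y z ∧ not (z == y)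
        hc′ : HallCondition X′ Y′
        hc′ T T⊆ with 1 ≤? card T
        ... | no t<1 = ≤-trans (≤-pred (≰⇒> t<1)) z≤n
        -- As no nonempty subset of `X′` is tight, `T` has a neighbour to spare, which pays for the
        -- loss of `y`.
        ... | yes 1≤t = ≤-pred (begin
            suc (card T) ≤⟨ ≰⇒> (λ le → loose (Vec.tabulate T , ≤-trans 1≤t (≤-reflexive (∑-cong (allFin n) λ z → cong 𝟙 (sym (lt z))))
                  , ≤-trans (∑-mono (allFin n) sub) (≤-reflexive (∑-zero (allFin n)))
                  , ≤-trans (card-mono λ z e → ∧-intro (∧-proj₁ e) (nb-mono {Vec.lookup (Vec.tabulate T)} {T} (λ v p → sym (lt v) ∙ p) z (∧-proj₂ {Y z} e)))
                      (≤-trans le (≤-reflexive (∑-cong (allFin n) λ z → cong 𝟙 (sym (lt z))))))) ⟩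
            card (λ z → Y z ∧ nb T z) ≤⟨ card-remove _ y ⟩
            suc (card (λ z → (Y z ∧ nb T z) ∧ not (z == y))) ≤⟨ s≤s (card-mono λ z e → ∧-intro (∧-intro (∧-proj₁ (∧-proj₁ e)) (∧-proj₂ {Y z ∧ nb T z} e)) (∧-proj₂ {Y z} (∧-proj₁ e))) ⟩
            suc (card (λ z → Y′ z ∧ nb T z)) ∎)
          where
          open ≤-Reasoning
          lt : ∀ z → Vec.lookup (Vec.tabulate T) z ≡ T z
          lt z = lookup∘tabulate T z
          sub : ∀ z → 𝟙 (Vec.lookup (Vec.tabulate T) z ∧ not (X′ z)) ≤ 0
          sub z rewrite lt z with T z in eq
          ... | false = z≤n
          ... | true rewrite T⊆ z eq = z≤n

  -- Paths and linear forests

  private variable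
    𝑅 𝑅′ : 𝔸 → 𝔸 → Set

  data Walk {𝔸 : Set} (R : 𝔸 → 𝔸 → Set) : 𝔸 → 𝔸 → List 𝔸 → Set where
    [_] : ∀ x → Walk R x x (x ∷ [])
    _∷⟨_⟩_ : ∀ x {y z l} → R x y → Walk R y z l → Walk R x z (x ∷ l)

  infixr 5 _∷⟨_⟩_ _⟨_⟩++_

  _⟨_⟩++_ : ∀ {x y z w l l′} → Walk 𝑅 x y l → 𝑅 y z → Walk 𝑅 z w l′ → Walk 𝑅 x w (l ++ l′)
  [ x ] ⟨ r ⟩++ q = x ∷⟨ r ⟩ q
  (x ∷⟨ s ⟩ p) ⟨ r ⟩++ q = x ∷⟨ s ⟩ (p ⟨ r ⟩++ q)

  walk-map : (∀ {x y} → 𝑅 x y → 𝑅′ x y) → ∀ {x y l} → Walk 𝑅 x y l → Walk 𝑅′ x y l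
  walk-map f [ x ] = [ x ]
  walk-map f (x ∷⟨ r ⟩ p) = x ∷⟨ f r ⟩ walk-map f p

  walk-rank : (ρ : 𝔸 → ℕ) → (∀ {x y} → 𝑅 x y → ρ x < ρ y) → ∀ {x y l} → Walk 𝑅 x y l → ρ x ≤ ρ y
  walk-rank ρ h [ x ] = ≤-refl
  walk-rank ρ h (x ∷⟨ r ⟩ p) = ≤-trans (<⇒≤ (h r)) (walk-rank ρ h p)

  record Path {𝔸 : Set} (R : 𝔸 → 𝔸 → Set) : Set where
    constructor path
    field
      {hd tl} : 𝔸
      {vs} : List 𝔸
      walk : Walk R hd tl vs
  open Path public

  -- Removal of one element is described by its effect on every sum, so the order of what remains
  -- never has to be tracked.
  pick : ∀ {xs : List 𝔸} {x} → x ∈ xs → ∃ λ rest → ∀ f → ∑ xs f ≡ f x + ∑ rest f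
  pick {xs = _ ∷ xs} (here refl) = xs , λ f → refl
  pick {xs = y ∷ xs} {x} (there i) with pick i
  ... | rest , h = y ∷ rest , λ f → cong (f y +_) (h f) ∙ swap+ [] (f y) (f x) (∑ rest f)

  ∑-pos : ∀ (xs : List 𝔸) (f : 𝔸 → ℕ) → 1 ≤ ∑ xs f → ∃ λ x → x ∈ xs × 1 ≤ f x
  ∑-pos xs f h = ∑-<⇒∃ xs {λ _ → 0} {f} (≤-<-trans (≤-reflexive (∑-zero xs)) h)

  module _ {n : ℕ} where

    heads tails inside : {R : Fin n → Fin n → Set} → Fin n → List (Path R) → ℕ
    heads v ps = ∑[ p ∈ ps ] 𝟙 (hd p == v)
    tails v ps = ∑[ p ∈ ps ] 𝟙 (tl p == v)
    inside v ps = ∑[ p ∈ ps ] occ v (vs p)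

    -- A ledger for every vertex: it heads a path unless it is the target of a chosen edge, and it
    -- ends a path unless it is a source.
    record Linked (R : Fin n → Fin n → Set) (ws : List (Fin n)) (es : List (Fin n × Fin n)) : Set where
      field
        paths : List (Path R)
        covers : ∀ v → inside v paths ≡ occ v ws
        heads+targets : ∀ v → heads v paths + occ v (map proj₂ es) ≡ occ v ws
        tails+sources : ∀ v → tails v paths + occ v (map proj₁ es) ≡ occ v ws
    open Linked

    -- The rank function rules out that the edges close up to a cycle.
    link : ∀ (R : Fin n → Fin n → Set) ws es (ρ : Fin n → ℕ) →
           (∀ {x y} → R x y → ρ x < ρ y) → (∀ {x y} → (x , y) ∈ es → R x y) →
           (∀ v → occ v (map proj₁ es) ≤ occ v ws) → (∀ v → occ v (map proj₂ es) ≤ occ v ws) → Linked R ws es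
    link R ws [] ρ rk es⊆R src tgt = record
      { paths = map (λ w → path [ w ]) ws
      ; covers = λ v → ∑-map _ ws _ ∙ ∑-cong ws (λ w → +-identityʳ _)
      ; heads+targets = λ v → +-identityʳ _ ∙ ∑-map _ ws _
      ; tails+sources = λ v → +-identityʳ _ ∙ ∑-map _ ws _ }
    link R ws ((v , z) ∷ es) ρ rk es⊆R src tgt = go
      where
      IH : Linked R ws es
      IH = link R ws es ρ rk (es⊆R ∘ there) (λ w → ≤-trans (m≤n+m _ _) (src w)) (λ w → ≤-trans (m≤n+m _ _) (tgt w))
      arith : ∀ {a b c} x → 𝟙 (x == x) + b ≤ c → a + b ≡ c → 1 ≤ a
      arith {a} {b} x h e rewrite ==-refl x = +-cancelʳ-≤ b 1 a (≤-trans h (≤-reflexive (sym e)))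
      rk-vz : ρ v < ρ z
      rk-vz = rk (es⊆R (here refl))
      go : Linked R ws ((v , z) ∷ es)
      -- The new edge takes up one of the `occ v ws` sources allowed at `v`, so some path of the
      -- smaller forest still ends at `v`.
      go with ∑-pos (paths IH) (λ p → 𝟙 (tl p == v)) (arith v (src v) (tails+sources IH v))
      ... | P , P∈ , eP with ==⇒≡ {x = tl P} {v} (𝟙-true eP) | pick P∈
      ... | refl | rest , hrest with hd P ≟ z
      ... | yes refl = ⊥-elim (<⇒≱ rk-vz (walk-rank ρ rk (walk P)))
      ... | no hP≢z with ∑-pos rest (λ p → 𝟙 (hd p == z))
                  (≤-trans (arith z (tgt z) (heads+targets IH z)) (≤-reflexive (hrest _ ∙ cong (λ b → 𝟙 b + heads z rest) (≢⇒== hP≢z))))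
      ... | Q , Q∈ , eQ with ==⇒≡ {x = hd Q} {z} (𝟙-true eQ) | pick Q∈
      ... | refl | rest′ , hrest′ = record
        { paths = path (walk P ⟨ es⊆R (here refl) ⟩++ walk Q) ∷ rest′
        ; covers = λ w → cong (_+ inside w rest′) (occ-++ w (vs P) (vs Q)) ∙ +-assoc (occ w (vs P)) _ _
            ∙ cong (occ w (vs P) +_) (sym (hrest′ _)) ∙ sym (hrest _) ∙ covers IH w
        ; heads+targets = λ w → rot (𝟙 (hd P == w)) (heads w rest′) (𝟙 (hd Q == w)) (occ w (map proj₂ es))
            ∙ cong (λ k → 𝟙 (hd P == w) + k + occ w (map proj₂ es)) (sym (hrest′ _))
            ∙ cong (_+ occ w (map proj₂ es)) (sym (hrest _)) ∙ heads+targets IH w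
        ; tails+sources = λ w → rot′ (𝟙 (tl P == w)) (tails w rest′) (𝟙 (tl Q == w)) (occ w (map proj₁ es))
            ∙ cong (λ k → 𝟙 (tl P == w) + k + occ w (map proj₁ es)) (sym (hrest′ _))
            ∙ cong (_+ occ w (map proj₁ es)) (sym (hrest _)) ∙ tails+sources IH w }
        where
        rot : ∀ a b c d → (a + b) + (c + d) ≡ a + (c + b) + d
        rot a b c d = sym (+-assoc (a + b) c d) ∙ cong (_+ d) (+-assoc a b c ∙ cong (a +_) (+-comm b c))
        rot′ : ∀ a b c d → (c + b) + (a + d) ≡ a + (c + b) + d
        rot′ a b c d = sym (+-assoc (c + b) a d) ∙ cong (_+ d) (+-comm (c + b) a)

    ∑-𝟙== : ∀ (v : Fin n) → ∑[ x ∈ allFin n ] 𝟙 (v == x) ≡ 1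
    ∑-𝟙== v = ∑-cong (allFin n) (λ x → cong 𝟙 (==-sym v x)) ∙ card-single v

    length-heads : ∀ {R : Fin n → Fin n → Set} (ps : List (Path R)) → ∑[ v ∈ allFin n ] heads v ps ≡ length ps
    length-heads ps = ∑-swap (allFin n) ps _ ∙ ∑-cong ps (λ p → ∑-𝟙== (hd p)) ∙ sym (length-∑ ps)

    -- Sum the ledger over all vertices: every edge saves one path.
    linked-length : ∀ {R ws es} (L : Linked R ws es) → length (paths L) + length es ≡ length ws
    linked-length {R} {ws} {es} L = cong₂ _+_ (sym (length-heads (paths L))) (sym (length-map proj₂ es) ∙ length-occ (map proj₂ es))
      ∙ sym (∑-+ (allFin n) _ _) ∙ ∑-cong (allFin n) (heads+targets L) ∙ sym (length-occ ws)

  -- Path covers of regular digraphs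

  -- Allows variances to be computed in ℕ: the cross term stands on the left instead of being
  -- subtracted.
  ∣-∣-square : ∀ x y → ∣ x - y ∣ * ∣ x - y ∣ + 2 * (x * y) ≡ x * x + y * y
  ∣-∣-square x y with ≤-total x y
  ... | inj₁ x≤y rewrite m≤n⇒∣m-n∣≡n∸m x≤y = h x y (y ∸ x) (m+[n∸m]≡n x≤y)
    where
    h0 : ∀ x d → d * d + 2 * (x * (x + d)) ≡ x * x + (x + d) * (x + d)
    h0 x d =
        ≤-antisym
        (lin ρ (# 1 ⊗ # 1 ⊕ con 2 ⊗ (# 0 ⊗ (# 0 ⊕ # 1))) (# 0 ⊗ # 0 ⊕ (# 0 ⊕ # 1) ⊗ (# 0 ⊕ # 1)) 0
        (triv) refl)
        (lin ρ (# 0 ⊗ # 0 ⊕ (# 0 ⊕ # 1) ⊗ (# 0 ⊕ # 1)) (# 1 ⊗ # 1 ⊕ con 2 ⊗ (# 0 ⊗ (# 0 ⊕ # 1))) 0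
        (triv) refl)
      where
      ρ = x ∷ d ∷ []
    h : ∀ x y d → x + d ≡ y → d * d + 2 * (x * y) ≡ x * x + y * y
    h x y d refl = h0 x d
  ... | inj₂ y≤x rewrite m≤n⇒∣n-m∣≡n∸m y≤x = h x y (x ∸ y) (m+[n∸m]≡n y≤x)
    where
    h0 : ∀ y d → d * d + 2 * ((y + d) * y) ≡ (y + d) * (y + d) + y * y
    h0 y d =
        ≤-antisym
        (lin ρ (# 1 ⊗ # 1 ⊕ con 2 ⊗ ((# 0 ⊕ # 1) ⊗ # 0)) ((# 0 ⊕ # 1) ⊗ (# 0 ⊕ # 1) ⊕ # 0 ⊗ # 0) 0
        (triv) refl)
        (lin ρ ((# 0 ⊕ # 1) ⊗ (# 0 ⊕ # 1) ⊕ # 0 ⊗ # 0) (# 1 ⊗ # 1 ⊕ con 2 ⊗ ((# 0 ⊕ # 1) ⊗ # 0)) 0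
        (triv) refl)
      where
      ρ = y ∷ d ∷ []
    h : ∀ x y d → y + d ≡ x → d * d + 2 * (x * y) ≡ x * x + y * y
    h x y d refl = h0 y d

  -- Classes that meet many given sets evenly

  module Classes (K : ℕ) {I : Set} (is : List I) where

    private
      Js = allFin K

    ∑Js-const : ∀ x → ∑[ j ∈ Js ] x ≡ K * x
    ∑Js-const x = ∑-const Js x ∙ cong (_* x) (length-tabulate {n = K} id)

    hits : ∀ {n} → (I → Fin n → Bool) → (Fin n → Fin K) → I → Fin K → ℕ
    hits {n} A f i j = ∑[ v ∈ allFin n ] (𝟙 (A i v) * 𝟙 (f v == j))

    hits-total : ∀ {n} (A : I → Fin n → Bool) f i → ∑[ j ∈ Js ] hits A f i j ≡ card (A i)
    hits-total {n} A f i = ∑-swap Js (allFin n) _ ∙ ∑-cong (allFin n) λ v → ∑-*ˡ Js (𝟙 (A i v)) _ ∙ cong (𝟙 (A i v) *_) (∑-𝟙== (f v)) ∙ *-identityʳ _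

    square-add : ∀ a b → (a + b) * (a + b) ≡ b * b + (a * a + 2 * (a * b))
    square-add a b =
        ≤-antisym
        (lin ρ ((# 0 ⊕ # 1) ⊗ (# 0 ⊕ # 1)) (# 1 ⊗ # 1 ⊕ (# 0 ⊗ # 0 ⊕ con 2 ⊗ (# 0 ⊗ # 1))) 0
        (triv) refl)
        (lin ρ (# 1 ⊗ # 1 ⊕ (# 0 ⊗ # 0 ⊕ con 2 ⊗ (# 0 ⊗ # 1))) ((# 0 ⊕ # 1) ⊗ (# 0 ⊕ # 1)) 0
        (triv) refl)
      where
      ρ = a ∷ b ∷ []

    step-arith : ∀ K S T L R a → L ≤ R → K * S ≤ T → L + K * (a + 2 * S) ≤ R + (a + 2 * T + K * a)
    step-arith K S T L R a H1 H2 =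
        lin ρ (# 3 ⊕ # 0 ⊗ (# 5 ⊕ con 2 ⊗ # 1)) (# 4 ⊕ (# 5 ⊕ con 2 ⊗ # 2 ⊕ # 0 ⊗ # 5)) 0
        ((# 3 ≼ # 4 by H1)
          ⊞ con 2 ⊠ (# 0 ⊗ # 1 ≼ # 2 by H2)) refl
      where
      ρ = K ∷ S ∷ T ∷ L ∷ R ∷ a ∷ []

    reorg : ∀ C K a → a * a ≡ a → (a + C) * (a + C) + K * (a + C) ≡ C * C + K * C + (a + 2 * (a * C) + K * a)
    reorg C K a H =
        ≤-antisym
        (lin ρ ((# 2 ⊕ # 0) ⊗ (# 2 ⊕ # 0) ⊕ # 1 ⊗ (# 2 ⊕ # 0)) (# 0 ⊗ # 0 ⊕ # 1 ⊗ # 0 ⊕ (# 2 ⊕ con 2 ⊗ (# 2 ⊗ # 0) ⊕ # 1 ⊗ # 2)) 0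
        ((# 2 ⊗ # 2 ≼ # 2 by ≤-reflexive H)) refl)
        (lin ρ (# 0 ⊗ # 0 ⊕ # 1 ⊗ # 0 ⊕ (# 2 ⊕ con 2 ⊗ (# 2 ⊗ # 0) ⊕ # 1 ⊗ # 2)) ((# 2 ⊕ # 0) ⊗ (# 2 ⊕ # 0) ⊕ # 1 ⊗ (# 2 ⊕ # 0)) 0
        ((# 2 ≼ # 2 ⊗ # 2 by ≤-reflexive (sym H))) refl)
      where
      ρ = C ∷ K ∷ a ∷ []

    𝟙-sq : ∀ b → 𝟙 b * 𝟙 b ≡ 𝟙 b
    𝟙-sq true = refl
    𝟙-sq false = refl

    -- Each element in turn joins the class that meets the sets containing it least.
    partition : 1 ≤ K → ∀ n (A : I → Fin n → Bool) → ∃ λ (f : Fin n → Fin K) →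
      ∑[ i ∈ is ] (K * (∑[ j ∈ Js ] (hits A f i j * hits A f i j))) ≤ ∑[ i ∈ is ] (card (A i) * card (A i) + K * card (A i))
    partition 1≤K zero A = (λ ()) , ≤-trans (≤-reflexive (∑-cong is (λ i → cong (K *_) (∑-zero Js) ∙ *-zeroʳ K) ∙ ∑-zero is)) z≤n
    partition 1≤K (suc n) A with partition 1≤K n (λ i v → A i (suc v))
    ... | f , IH = f′ , bound
      where
      A′ : I → Fin n → Bool
      A′ i v = A i (suc v)
      a C : I → ℕ
      a i = 𝟙 (A i zero)
      C i = card (A′ i)
      c : I → Fin K → ℕ
      c = hits A′ f
      load : Fin K → ℕ
      load j = ∑[ i ∈ is ] (a i * c i j)
      total : ∑ Js load ≡ ∑[ i ∈ is ] (a i * C i)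
      total = ∑-swap Js is _ ∙ ∑-cong is λ i → ∑-*ˡ Js (a i) _ ∙ cong (a i *_) (hits-total A′ f i)
      -- The loads of the `K` classes add up to the right-hand side, so some class carries at most
      -- its `K`-th part.
      best : ∃ λ j → j ∈ Js × K * load j ≤ ∑[ i ∈ is ] (a i * C i)
      best = ∑-average Js (≤-trans 1≤K (≤-reflexive (sym (length-tabulate id))))
        (≤-reflexive (∑-*ˡ Js K load ∙ cong (K *_) total ∙ sym (∑Js-const (∑[ i ∈ is ] (a i * C i)))))
      j₀ = proj₁ best
      f′ : Fin (suc n) → Fin K
      f′ zero = j₀
      f′ (suc v) = f v
      hits-suc : ∀ i j → hits A f′ i j ≡ a i * 𝟙 (j₀ == j) + c i j
      hits-suc i j = ∑-allFin-suc {n} (λ v → 𝟙 (A i v) * 𝟙 (f′ v == j))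
      card-suc : ∀ i → card (A i) ≡ a i + C i
      card-suc i = ∑-allFin-suc {n} (λ v → 𝟙 (A i v))
      squares : ∀ i → ∑[ j ∈ Js ] (hits A f′ i j * hits A f′ i j) ≡ ∑[ j ∈ Js ] (c i j * c i j) + (a i + 2 * (a i * c i j₀))
      squares i = ∑-cong Js (λ j → cong₂ _*_ (hits-suc i j) (hits-suc i j) ∙ square-add (a i * 𝟙 (j₀ == j)) (c i j) ∙ cong (c i j * c i j +_) (fix (A i zero) (j₀ == j) (c i j)))
        ∙ ∑-+ Js _ _ ∙ cong (∑[ j ∈ Js ] (c i j * c i j) +_) (∑-δ j₀ (λ j → a i + 2 * (a i * c i j)))
        where
        fix : ∀ a b c → 𝟙 a * 𝟙 b * (𝟙 a * 𝟙 b) + 2 * (𝟙 a * 𝟙 b * c) ≡ 𝟙 b * (𝟙 a + 2 * (𝟙 a * c))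
        fix false true c = refl
        fix false false c = refl
        fix true false c = refl
        fix true true c = cong suc (sym (+-identityʳ _))
      lhs : ∑[ i ∈ is ] (K * (∑[ j ∈ Js ] (hits A f′ i j * hits A f′ i j))) ≡ ∑[ i ∈ is ] (K * (∑[ j ∈ Js ] (c i j * c i j))) + K * (∑ is a + 2 * load j₀)
      lhs = ∑-cong is (λ i → cong (K *_) (squares i) ∙ *-distribˡ-+ K _ _) ∙ ∑-+ is _ _ ∙ cong (∑[ i ∈ is ] (K * (∑[ j ∈ Js ] (c i j * c i j))) +_)
        (∑-*ˡ is K _ ∙ cong (K *_) (∑-+ is a (λ i → 2 * (a i * c i j₀)) ∙ cong (∑ is a +_) (∑-*ˡ is 2 _)))
      rhs : ∑[ i ∈ is ] (card (A i) * card (A i) + K * card (A i)) ≡ ∑[ i ∈ is ] (C i * C i + K * C i) + ((∑ is a + 2 * ∑[ i ∈ is ] (a i * C i)) + K * ∑ is a)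
      rhs = ∑-cong is (λ i → cong (λ s → s * s + K * s) (card-suc i) ∙ reorg (C i) K (a i) (𝟙-sq (A i zero)))
        ∙ ∑-+ is (λ i → C i * C i + K * C i) (λ i → a i + 2 * (a i * C i) + K * a i) ∙ cong (∑[ i ∈ is ] (C i * C i + K * C i) +_)
           (∑-+ is (λ i → a i + 2 * (a i * C i)) (λ i → K * a i) ∙ cong₂ _+_ (∑-+ is a (λ i → 2 * (a i * C i)) ∙ cong (∑ is a +_) (∑-*ˡ is 2 _)) (∑-*ˡ is K a))
      bound : ∑[ i ∈ is ] (K * (∑[ j ∈ Js ] (hits A f′ i j * hits A f′ i j))) ≤ ∑[ i ∈ is ] (card (A i) * card (A i) + K * card (A i))
      bound = ≤-trans (≤-reflexive lhs) (≤-trans (step-arith K (load j₀) (∑[ i ∈ is ] (a i * C i)) _ _ (∑ is a) IH (proj₂ (proj₂ best))) (≤-reflexive (sym rhs)))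

    -- The hypothesis is what a uniformly random assignment satisfies in expectation: the squares of
    -- the parts of a set of size s sum to at most s²/K + s.
    module Deviation {n} (A : I → Fin n → Bool) (f : Fin n → Fin K)
      (bal : ∑[ i ∈ is ] (K * (∑[ j ∈ Js ] (hits A f i j * hits A f i j))) ≤ ∑[ i ∈ is ] (card (A i) * card (A i) + K * card (A i))) where

      dev : I → Fin K → ℕ
      dev i j = ∣ K * hits A f i j - card (A i) ∣

      var-arith : ∀ C K q d → d + 2 * (K * C * C) ≡ K * K * q + K * (C * C) → d + K * (C * C) ≡ K * (K * q)
      var-arith C K q d H =
          ≤-antisym
          (lin ρ (# 3 ⊕ # 1 ⊗ (# 0 ⊗ # 0)) (# 1 ⊗ (# 1 ⊗ # 2)) 0
          ((# 3 ⊕ con 2 ⊗ (# 1 ⊗ # 0 ⊗ # 0) ≼ # 1 ⊗ # 1 ⊗ # 2 ⊕ # 1 ⊗ (# 0 ⊗ # 0) by ≤-reflexive H)) refl)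
          (lin ρ (# 1 ⊗ (# 1 ⊗ # 2)) (# 3 ⊕ # 1 ⊗ (# 0 ⊗ # 0)) 0
          ((# 1 ⊗ # 1 ⊗ # 2 ⊕ # 1 ⊗ (# 0 ⊗ # 0) ≼ # 3 ⊕ con 2 ⊗ (# 1 ⊗ # 0 ⊗ # 0) by ≤-reflexive (sym H))) refl)
        where
        ρ = C ∷ K ∷ q ∷ d ∷ []

      dev-arith : ∀ s K d t q → d + K * s ≡ K * q → q ≤ s + K * t → d ≤ K * K * t
      dev-arith s K d t q H1 H2 =
          lin ρ (# 2) (# 1 ⊗ # 1 ⊗ # 3) 0
          ((# 2 ⊕ # 1 ⊗ # 0 ≼ # 1 ⊗ # 4 by ≤-reflexive H1)
            ⊞ (# 1 ⊗ # 4 ≼ # 1 ⊗ (# 0 ⊕ # 1 ⊗ # 3) by *-monoʳ-≤ (K) (H2))) refl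
        where
        ρ = s ∷ K ∷ d ∷ t ∷ q ∷ []

      -- Second moment minus square of the mean, scaled by K² and with the negative term moved to
      -- the left.
      variance : ∀ i → ∑[ j ∈ Js ] (dev i j * dev i j) + K * (card (A i) * card (A i)) ≡ K * (K * (∑[ j ∈ Js ] (hits A f i j * hits A f i j)))
      variance i = var-arith (card (A i)) K (∑[ j ∈ Js ] (hits A f i j * hits A f i j)) (∑[ j ∈ Js ] (dev i j * dev i j)) (begin-equality
        ∑[ j ∈ Js ] (dev i j * dev i j) + 2 * (K * C * C)
          ≡⟨ cong (λ x → ∑[ j ∈ Js ] (dev i j * dev i j) + x) (cong (2 *_) (cong (_* C) (cong (K *_) (sym (hits-total A f i)) ∙ sym (∑-*ˡ Js K _)) ∙ sym (∑-*ʳ Js C _)) ∙ sym (∑-*ˡ Js 2 _)) ∙ sym (∑-+ Js _ _) ⟩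
        ∑[ j ∈ Js ] (dev i j * dev i j + 2 * (K * hits A f i j * C)) ≡⟨ ∑-cong Js (λ j → ∣-∣-square (K * hits A f i j) C) ⟩
        ∑[ j ∈ Js ] (K * hits A f i j * (K * hits A f i j) + C * C) ≡⟨ ∑-+ Js _ _ ∙ cong₂ _+_ (∑-cong Js (λ j → [m*n]*[o*p]≡[m*o]*[n*p] K _ K _) ∙ ∑-*ˡ Js (K * K) _) (∑Js-const (C * C)) ⟩
        K * K * (∑[ j ∈ Js ] (hits A f i j * hits A f i j)) + K * (C * C) ∎)
        where
        open ≤-Reasoning
        C = card (A i)

      -- `τ` may depend on the partition, because for each set the square at one class is bounded by
      -- the sum over all classes.
      total-variance : ∀ (τ : I → Fin K) → ∑[ i ∈ is ] (dev i (τ i) * dev i (τ i)) ≤ K * K * ∑[ i ∈ is ] card (A i)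
      total-variance τ = ≤-trans (∑-mono is λ i → ∑-allFin-∈ (λ j → dev i j * dev i j) (τ i))
        (dev-arith (∑[ i ∈ is ] (card (A i) * card (A i))) K _ (∑[ i ∈ is ] card (A i)) (∑[ i ∈ is ] (K * (∑[ j ∈ Js ] (hits A f i j * hits A f i j))))
          (cong (∑[ i ∈ is ] (∑[ j ∈ Js ] (dev i j * dev i j)) +_) (sym (∑-*ˡ is K _)) ∙ sym (∑-+ is _ _) ∙ ∑-cong is variance ∙ ∑-*ˡ is K _)
          (≤-trans bal (≤-reflexive (∑-+ is _ _ ∙ cong (∑[ i ∈ is ] (card (A i) * card (A i)) +_) (∑-*ˡ is K _)))))

      -- 2 z N d ≤ z² d² + N², summed over the sets.
      total-deviation : ∀ (τ : I → Fin K) z N → 2 * (N * (z * ∑[ i ∈ is ] dev i (τ i))) ≤ z * z * (K * K * ∑[ i ∈ is ] card (A i)) + length is * (N * N)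
      total-deviation τ z N = begin
        2 * (N * (z * ∑[ i ∈ is ] dev i (τ i))) ≡⟨ cong (2 *_) (cong (N *_) (sym (∑-*ˡ is z _)) ∙ sym (∑-*ˡ is N _)) ∙ sym (∑-*ˡ is 2 _) ⟩
        ∑[ i ∈ is ] (2 * (N * (z * dev i (τ i)))) ≤⟨ ∑-mono is (λ i → ≤-trans (m≤n+m _ (∣ N - z * dev i (τ i) ∣ * ∣ N - z * dev i (τ i) ∣)) (≤-reflexive (∣-∣-square N (z * dev i (τ i))))) ⟩
        ∑[ i ∈ is ] (N * N + z * dev i (τ i) * (z * dev i (τ i))) ≡⟨ ∑-+ is _ _ ∙ cong₂ _+_ (∑-const is (N * N)) (∑-cong is (λ i → [m*n]*[o*p]≡[m*o]*[n*p] z _ z _) ∙ ∑-*ˡ is (z * z) _) ⟩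
        length is * (N * N) + z * z * (∑[ i ∈ is ] (dev i (τ i) * dev i (τ i))) ≤⟨ +-monoʳ-≤ (length is * (N * N)) (*-monoʳ-≤ (z * z) (total-variance τ)) ⟩
        length is * (N * N) + z * z * (K * K * ∑[ i ∈ is ] card (A i)) ≡⟨ +-comm (length is * (N * N)) _ ⟩
        z * z * (K * K * ∑[ i ∈ is ] card (A i)) + length is * (N * N) ∎
        where open ≤-Reasoning

  ∑-allFin-+ : ∀ m n (f : Fin (m + n) → ℕ) → ∑ (allFin (m + n)) f ≡ ∑[ i ∈ allFin m ] f (i ↑ˡ n) + ∑[ j ∈ allFin n ] f (m ↑ʳ j)
  ∑-allFin-+ zero n f = refl
  ∑-allFin-+ (suc m) n f = ∑-allFin-suc f ∙ cong (f zero +_) (∑-allFin-+ m n (f ∘ suc)) ∙ sym (+-assoc (f zero) _ _)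
    ∙ cong (_+ ∑[ j ∈ allFin n ] f (suc m ↑ʳ j)) (sym (∑-allFin-suc (λ i → f (i ↑ˡ n))))

  module Deficient {n : ℕ} (M : Fin n → Fin n → Bool) (q : ℕ) where

    open Matching M

    reals : List (Fin n × Fin (n + q)) → List (Fin n × Fin n)
    reals [] = []
    reals ((x , y) ∷ es) with splitAt n y
    ... | inj₁ y′ = (x , y′) ∷ reals es
    ... | inj₂ _ = reals es

    reals-∈ : ∀ es {x y} → (x , y) ∈ reals es → (x , y ↑ˡ q) ∈ es
    reals-∈ ((x , y) ∷ es) i with splitAt n y in eq
    reals-∈ ((x , y) ∷ es) (here refl) | inj₁ y′ = here (cong (x ,_) (splitAt⁻¹-↑ˡ eq))
    reals-∈ ((x , y) ∷ es) (there i) | inj₁ y′ = there (reals-∈ es i)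
    reals-∈ ((x , y) ∷ es) i | inj₂ _ = there (reals-∈ es i)

    reals-sources : ∀ es x → occ x (map proj₁ (reals es)) ≤ occ x (map proj₁ es)
    reals-sources [] x = z≤n
    reals-sources ((x′ , y) ∷ es) x with splitAt n y
    ... | inj₁ _ = +-monoʳ-≤ (𝟙 (x′ == x)) (reals-sources es x)
    ... | inj₂ _ = ≤-trans (reals-sources es x) (m≤n+m _ _)

    reals-targets : ∀ es y → occ y (map proj₂ (reals es)) ≤ occ (y ↑ˡ q) (map proj₂ es)
    reals-targets [] y = z≤n
    reals-targets ((x , y′) ∷ es) y with splitAt n y′ in eq
    ... | inj₂ _ = ≤-trans (reals-targets es y) (m≤n+m _ _)
    ... | inj₁ z = +-mono-≤ (⊆ᵇ-𝟙 λ e → subst (λ w → (w == (y ↑ˡ q)) ≡ true) (splitAt⁻¹-↑ˡ eq) (subst (λ w → ((z ↑ˡ q) == (w ↑ˡ q)) ≡ true) (==⇒≡ {x = z} {y} e) (==-refl (z ↑ˡ q)))) (reals-targets es y)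

    reals-length : ∀ es → length es ≤ length (reals es) + ∑[ j ∈ allFin q ] occ (n ↑ʳ j) (map proj₂ es)
    reals-length [] = z≤n
    reals-length ((x , y) ∷ es) with splitAt n y in eq
    ... | inj₁ _ = s≤s (≤-trans (reals-length es) (+-monoʳ-≤ (length (reals es)) (∑-mono (allFin q) λ j → m≤n+m _ _)))
    ... | inj₂ j = ≤-trans (s≤s (reals-length es)) (≤-trans (≤-reflexive (sym (+-suc (length (reals es)) _))) (+-monoʳ-≤ (length (reals es))
        (≤-trans (+-monoˡ-≤ _ hit) (≤-reflexive (sym (∑-+ (allFin q) (λ j → 𝟙 (y == (n ↑ʳ j))) (λ j → occ (n ↑ʳ j) (map proj₂ es))))))))
      where
      hit : 1 ≤ ∑[ j ∈ allFin q ] 𝟙 (y == (n ↑ʳ j))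
      hit = ≤-trans (≤-reflexive (cong 𝟙 (sym (subst (λ w → (y == w) ≡ true) (sym (splitAt⁻¹-↑ʳ eq)) (==-refl y))))) (∑-allFin-∈ (λ j → 𝟙 (y == (n ↑ʳ j))) j)

    record Large (X Y : Fin n → Bool) : Set where
      field
        es : List (Fin n × Fin n)
        es⊆M : ∀ {x y} → (x , y) ∈ es → M x y ≡ true
        sources : ∀ x → occ x (map proj₁ es) ≤ 𝟙 (X x)
        targets : ∀ y → occ y (map proj₂ es) ≤ 𝟙 (Y y)
        large : card X ≤ length es + q

    -- q extra targets joined to everything absorb the deficiency.
    deficient-hall : ∀ X Y → (∀ S → S ⊆ᵇ X → card S ≤ card (λ y → Y y ∧ nb S y) + q) → Large X Y
    deficient-hall X Y hc = record
      { es = reals es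
      ; es⊆M = λ {x} {y} i → sym (cong [ M x , (λ _ → true) ]′ (splitAt-↑ˡ n y q)) ∙ es⊆M (reals-∈ es i)
      ; sources = λ x → ≤-trans (reals-sources es x) (≤-reflexive (sources x))
      ; targets = λ y → ≤-trans (reals-targets es y) (≤-trans (targets (y ↑ˡ q)) (≤-reflexive (cong (𝟙 ∘ [ Y , (λ _ → true) ]′) (splitAt-↑ˡ n y q))))
      ; large = ≤-trans (≤-reflexive (sym (∑-cong (allFin n) sources) ∙ sym (length-occ (map proj₁ es)) ∙ length-map proj₁ es))
          (≤-trans (reals-length es) (+-monoʳ-≤ (length (reals es)) (≤-trans (∑-bound (allFin q) 1 λ j → ≤-trans (targets (n ↑ʳ j)) (𝟙≤1 (Y′ (n ↑ʳ j)))) (≤-reflexive (*-identityʳ _ ∙ length-tabulate {n = q} id))))) }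
      where
      M′ : Fin n → Fin (n + q) → Bool
      M′ x y = [ M x , (λ _ → true) ]′ (splitAt n y)
      Y′ : Fin (n + q) → Bool
      Y′ y = [ Y , (λ _ → true) ]′ (splitAt n y)
      module M′ = Matching M′
      hc′ : M′.HallCondition X Y′
      hc′ S S⊆ with 1 ≤? card S
      ... | no s<1 = ≤-trans (≤-pred (≰⇒> s<1)) z≤n
      ... | yes 1≤s with card-pos S 1≤s
      ...   | x , px = ≤-trans (hc S S⊆) (≤-trans (+-mono-≤ (∑-mono (allFin n) λ y → ⊆ᵇ-𝟙 (left y))
                (≤-trans (≤-reflexive (sym (*-identityʳ q) ∙ cong (_* 1) (sym (length-tabulate {n = q} id)) ∙ sym (∑-const (allFin q) 1))) (∑-mono (allFin q) λ j → ≤-reflexive (cong 𝟙 (sym (right j))))))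
                (≤-reflexive (sym (∑-allFin-+ n q (λ y → 𝟙 (Y′ y ∧ M′.nb S y))))))
        where
        left : ∀ y → Y y ∧ nb S y ≡ true → Y′ (y ↑ˡ q) ∧ M′.nb S (y ↑ˡ q) ≡ true
        left y e with nb-elim {S} {y} (∧-proj₂ {Y y} e)
        ... | z , pz , qz = ∧-intro (cong [ Y , (λ _ → true) ]′ (splitAt-↑ˡ n y q) ∙ ∧-proj₁ e)
                (M′.nb-intro {S} pz (cong [ M z , (λ _ → true) ]′ (splitAt-↑ˡ n y q) ∙ qz))
        right : ∀ j → Y′ (n ↑ʳ j) ∧ M′.nb S (n ↑ʳ j) ≡ true
        right j = ∧-intro (cong [ Y , (λ _ → true) ]′ (splitAt-↑ʳ n q j)) (M′.nb-intro {S} px (cong [ M x , (λ _ → true) ]′ (splitAt-↑ʳ n q j)))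
      open M′.Saturating (M′.hall (card X) X Y′ ≤-refl hc′)

  adjacent : ∀ {K} → Fin K → Fin K → Bool
  adjacent i j = toℕ j ≡ᵇ suc (toℕ i)

  ≡ᵇ-== : ∀ {K} (i j : Fin K) → (toℕ i ≡ᵇ toℕ j) ≡ (i == j)
  ≡ᵇ-== i j with toℕ i ≡ᵇ toℕ j in eq
  ... | true = sym (subst (λ w → (i == w) ≡ true) (toℕ-injective (≡ᵇ⇒≡ _ _ (subst T (sym eq) _))) (==-refl i))
  ... | false = sym (≢⇒== {x = i} {j} λ { refl → subst T eq (≡⇒≡ᵇ (toℕ i) _ refl) })

  adjacent-next : ∀ {K′} (i : Fin (suc K′)) → i ≡ fromℕ K′ ⊎ (∃ λ i′ → ∀ j → adjacent i j ≡ (j == i′))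
  adjacent-next {K′} i with suc (toℕ i) <? suc K′
  ... | yes p = inj₂ (fromℕ< p , λ j → cong (toℕ j ≡ᵇ_) (sym (toℕ-fromℕ< p)) ∙ ≡ᵇ-== j (fromℕ< p))
  ... | no ¬p = inj₁ (toℕ-injective (≤-antisym (≤-pred (toℕ<n i)) (≤-pred (≮⇒≥ ¬p)) ∙ sym (toℕ-fromℕ K′)))

  adjacent-prev : ∀ {K′} (j : Fin (suc K′)) → (∀ i → adjacent i j ≡ false) ⊎ (∃ λ j′ → ∀ i → adjacent i j ≡ (i == j′))
  adjacent-prev zero = inj₁ λ i → refl
  adjacent-prev {suc K′} (suc j) = inj₂ (inject₁ j , λ i → h (toℕ j) (toℕ i) ∙ cong (toℕ i ≡ᵇ_) (sym (toℕ-inject₁ j)) ∙ ≡ᵇ-== i (inject₁ j))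
    where
    h : ∀ a b → (a ≡ᵇ b) ≡ (b ≡ᵇ a)
    h zero zero = refl
    h zero (suc b) = refl
    h (suc a) zero = refl
    h (suc a) (suc b) = h a b

  -- The sets to be met evenly: out-neighbourhoods, in-neighbourhoods and the whole vertex set. The
  -- last is repeated n times, so that its single deviation is bounded n times more sharply.
  data Tag (n : ℕ) : Set where
    outs ins whole : Fin n → Tag n

  pc-cancel : ∀ N z K X Y C → 2 * (N * (z * (X + Y))) ≤ z * z * (K * K * C) + (N + (N + N)) * (N * N) → C ≤ N * N + (N * N + N * N) → 3 * (z * z * (K * K)) ≤ N → 2 * N * (z * (X + Y)) ≤ 2 * N * (2 * N * N)
  pc-cancel N z K X Y C H1 H2 H3 =
      lin ρ (con 2 ⊗ # 0 ⊗ (# 1 ⊗ (# 3 ⊕ # 4))) (con 2 ⊗ # 0 ⊗ (con 2 ⊗ # 0 ⊗ # 0)) 0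
      ((con 2 ⊗ (# 0 ⊗ (# 1 ⊗ (# 3 ⊕ # 4))) ≼ # 1 ⊗ # 1 ⊗ (# 2 ⊗ # 2 ⊗ # 5) ⊕ (# 0 ⊕ (# 0 ⊕ # 0)) ⊗ (# 0 ⊗ # 0) by H1)
        ⊞ (# 1 ⊗ # 1 ⊗ # 2 ⊗ # 2 ⊗ # 5 ≼ # 1 ⊗ # 1 ⊗ # 2 ⊗ # 2 ⊗ (# 0 ⊗ # 0 ⊕ (# 0 ⊗ # 0 ⊕ # 0 ⊗ # 0)) by *-monoʳ-≤ (z * z * K * K) (H2))
        ⊞ (# 0 ⊗ # 0 ⊗ (con 3 ⊗ (# 1 ⊗ # 1 ⊗ (# 2 ⊗ # 2))) ≼ # 0 ⊗ # 0 ⊗ # 0 by *-monoʳ-≤ (N * N) (H3))) refl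
    where
    ρ = N ∷ z ∷ K ∷ X ∷ Y ∷ C ∷ []

  pc-dev : ∀ N z X dl → z * (X + N * dl) ≤ 2 * N * N → N * (z * dl) ≤ N * (2 * N)
  pc-dev N z X dl H =
      lin ρ (# 0 ⊗ (# 1 ⊗ # 3)) (# 0 ⊗ (con 2 ⊗ # 0)) 0
      ((# 1 ⊗ (# 2 ⊕ # 0 ⊗ # 3) ≼ con 2 ⊗ # 0 ⊗ # 0 by H)) refl
    where
    ρ = N ∷ z ∷ X ∷ dl ∷ []

  pc-last : ∀ N K m la dl w → K * la ≤ w + dl → w ≤ N → dl ≤ 2 * N → 6 * N ≤ K * m → K * (2 * la) ≤ K * m
  pc-last N K m la dl w H1 H2 H3 H4 =
      lin ρ (# 1 ⊗ (con 2 ⊗ # 3)) (# 1 ⊗ # 2) 0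
      (con 2 ⊠ (# 1 ⊗ # 3 ≼ # 5 ⊕ # 4 by H1)
        ⊞ con 2 ⊠ (# 5 ≼ # 0 by H2)
        ⊞ con 2 ⊠ (# 4 ≼ con 2 ⊗ # 0 by H3)
        ⊞ (con 6 ⊗ # 0 ≼ # 1 ⊗ # 2 by H4)) refl
    where
    ρ = N ∷ K ∷ m ∷ la ∷ dl ∷ w ∷ []

  pc-X : ∀ N z k m X Y → z * (X + Y) ≤ 2 * N * N → 4 * N * N ≤ z * (k * m) → z * (2 * X) ≤ z * (k * m)
  pc-X N z k m X Y H1 H2 =
      lin ρ (# 1 ⊗ (con 2 ⊗ # 4)) (# 1 ⊗ (# 2 ⊗ # 3)) 0
      (con 2 ⊠ (# 1 ⊗ (# 4 ⊕ # 5) ≼ con 2 ⊗ # 0 ⊗ # 0 by H1)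
        ⊞ (con 4 ⊗ # 0 ⊗ # 0 ≼ # 1 ⊗ (# 2 ⊗ # 3) by H2)) refl
    where
    ρ = N ∷ z ∷ k ∷ m ∷ X ∷ Y ∷ []

  pc-final : ∀ k S B m la X → k * S ≤ k * B + k * la + X → 2 * la ≤ m → 2 * X ≤ k * m → k * S ≤ k * (B + m)
  pc-final k S B m la X H1 H2 H3 =
      lin ρ (# 0 ⊗ # 1) (# 0 ⊗ (# 2 ⊕ # 3)) 1
      (con 2 ⊠ (# 0 ⊗ # 1 ≼ # 0 ⊗ # 2 ⊕ # 0 ⊗ # 4 ⊕ # 5 by H1)
        ⊞ (con 2 ⊗ # 5 ≼ # 0 ⊗ # 3 by H3)
        ⊞ (# 0 ⊗ (con 2 ⊗ # 4) ≼ # 0 ⊗ # 3 by *-monoʳ-≤ (k) (H2))) refl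
    where
    ρ = k ∷ S ∷ B ∷ m ∷ la ∷ X ∷ []

  pc-sum : ∀ k K S d la Xo B Xi → k * S ≤ K * d + k * la + Xo → K * d ≤ k * B + Xi → k * S ≤ k * B + k * la + (Xo + Xi)
  pc-sum k K S d la Xo B Xi H1 H2 =
      lin ρ (# 0 ⊗ # 2) (# 0 ⊗ # 6 ⊕ # 0 ⊗ # 4 ⊕ (# 5 ⊕ # 7)) 0
      ((# 0 ⊗ # 2 ≼ # 1 ⊗ # 3 ⊕ # 0 ⊗ # 4 ⊕ # 5 by H1)
        ⊞ (# 1 ⊗ # 3 ≼ # 0 ⊗ # 6 ⊕ # 7 by H2)) refl
    where
    ρ = k ∷ K ∷ S ∷ d ∷ la ∷ Xo ∷ B ∷ Xi ∷ []

  dist-lo : ∀ a b → b ≤ a + ∣ a - b ∣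
  dist-lo a b = m≤n+∣n-m∣ b a

  dist-hi : ∀ a b → a ≤ b + ∣ a - b ∣
  dist-hi a b = m≤n+∣m-n∣ a b

  -- `k` is the degree of the factor, `m` the number of paths allowed, `K′` + 1 the number of
  -- classes and 1/z the accuracy. The numerical hypotheses say that one class is small against m,
  -- that the deviations are small against k m, and that n is large enough for this accuracy.
  module PathCover {n : ℕ} (W : Fin n → Bool) (R : Fin n → Fin n → Bool) (k m z K′ : ℕ)
    (R⊆ : ∀ x y → R x y ≡ true → W x ≡ true × W y ≡ true)
    (out-k : ∀ x → ∑[ y ∈ allFin n ] 𝟙 (R x y) ≡ k * 𝟙 (W x))
    (in-k : ∀ y → ∑[ x ∈ allFin n ] 𝟙 (R x y) ≤ k)
    (1≤n : 1 ≤ n) (6n≤Km : 6 * n ≤ suc K′ * m) (4n²≤zkm : 4 * n * n ≤ z * (k * m)) (zK≤n : 3 * (z * z * (suc K′ * suc K′)) ≤ n) where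

    private
      N = n
      K = suc K′
      U = allFin n

    is : List (Tag n)
    is = map outs U ++ (map ins U ++ map whole U)

    A : Tag n → Fin n → Bool
    A (outs v) w = R v w
    A (ins w) v = R v w
    A (whole _) v = W v

    ∑is : ∀ (f : Tag n → ℕ) → ∑ is f ≡ ∑[ v ∈ U ] f (outs v) + (∑[ v ∈ U ] f (ins v) + ∑[ v ∈ U ] f (whole v))
    ∑is f = ∑-++ (map outs U) _ f ∙ cong₂ _+_ (∑-map outs U f) (∑-++ (map ins U) _ f ∙ cong₂ _+_ (∑-map ins U f) (∑-map whole U f))

    open Classes K is

    private
      P = partition (s≤s z≤n) n A
    f : Fin n → Fin K
    f = proj₁ P
    open Deviation A f (proj₂ P)

    last : Fin K
    last = fromℕ K′

    target-class : Fin K → Fin K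
    target-class i with adjacent-next i
    -- A default: the last class has no successor, and its vertices are charged to `Lst`.
    ... | inj₁ _ = i
    ... | inj₂ (i′ , _) = i′

    source-class : Fin K → Fin K
    source-class i with adjacent-prev i
    ... | inj₁ _ = i
    ... | inj₂ (i′ , _) = i′

    τ : Tag n → Fin K
    τ (outs v) = target-class (f v)
    τ (ins v) = source-class (f v)
    τ (whole v) = last

    δ : Tag n → ℕ
    δ i = dev i (τ i)

    M : Fin n → Fin n → Bool
    M x y = R x y ∧ adjacent (f x) (f y)

    Lst Xo Xi dl : ℕ
    Lst = ∑[ v ∈ U ] (𝟙 (W v) * 𝟙 (f v == last))
    Xo = ∑[ v ∈ U ] δ (outs v)
    Xi = ∑[ v ∈ U ] δ (ins v)
    dl = ∣ K * Lst - card W ∣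

    card≤n : ∀ (B : Fin n → Bool) → card B ≤ n
    card≤n B = ≤-trans (∑-bound U 1 (𝟙≤1 ∘ B)) (≤-reflexive (*-identityʳ _ ∙ length-tabulate {n = n} id))

    ∑U≤ : ∀ (g : Fin n → ℕ) b → (∀ v → g v ≤ b) → ∑ U g ≤ n * b
    ∑U≤ g b h = ≤-trans (∑-bound U b h) (≤-reflexive (cong (_* b) (length-tabulate {n = n} id)))

    -- In the bound 2 z N δ ≤ z² δ² + N², summed over all 3N tags, the squares contribute at most N³
    -- by the choice of `z` and the constant terms 3N³; then 2N is cancelled.
    deviation : z * ((Xo + Xi) + N * dl) ≤ 2 * N * N
    deviation = *-cancelˡ-≤ (2 * N) {{>-nonZero (≤-trans 1≤n (m≤m+n n _))}} (pc-cancel N z K (Xo + Xi) (N * dl) (∑[ i ∈ is ] card (A i))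
      (≤-trans (≤-reflexive (cong (λ x → 2 * (N * (z * x))) (sym (∑is δ ∙ sym (+-assoc Xo Xi _) ∙ cong ((Xo + Xi) +_) (∑-const U dl ∙ cong (_* dl) (length-tabulate {n = n} id))))))
        (≤-trans (total-deviation τ z N) (≤-reflexive (cong (λ x → z * z * (K * K * ∑[ i ∈ is ] card (A i)) + x * (N * N)) len))))
      (≤-trans (≤-reflexive (∑is (λ i → card (A i)))) (+-mono-≤ (∑U≤ _ n (λ v → card≤n (R v))) (+-mono-≤ (∑U≤ _ n (λ v → card≤n (λ x → R x v))) (∑U≤ _ n (λ v → card≤n W)))))
      zK≤n)
      where
      lm : ∀ (g : Fin n → Tag n) → length (map g U) ≡ n
      lm g = length-map g U ∙ length-tabulate {n = n} id
      len : length is ≡ N + (N + N)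
      len = length-++ (map outs U) ∙ cong₂ _+_ (lm outs) (length-++ (map ins U) ∙ cong₂ _+_ (lm ins) (lm whole))

    1≤zkm : 1 ≤ z * (k * m)
    1≤zkm = ≤-trans (*-mono-≤ (*-mono-≤ (s≤s (z≤n {3})) 1≤n) 1≤n) 4n²≤zkm

    pos-factor : ∀ {a b} → 1 ≤ a * b → NonZero a
    pos-factor {suc a} _ = _

    pos-factorʳ : ∀ {a b} → 1 ≤ a * b → 1 ≤ b
    pos-factorʳ {a} {zero} h rewrite *-zeroʳ a = h
    pos-factorʳ {a} {suc b} _ = s≤s z≤n

    instance
      z≢0 : NonZero z
      z≢0 = pos-factor 1≤zkm
      k≢0 : NonZero k
      k≢0 = pos-factor (pos-factorʳ {z} 1≤zkm)

    2last≤m : 2 * Lst ≤ m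
    2last≤m = *-cancelˡ-≤ K (pc-last N K m Lst dl (card W) (dist-hi (K * Lst) (card W)) (card≤n W)
      (≤-trans (m≤n*m dl z) (*-cancelˡ-≤ N {{>-nonZero 1≤n}} (pc-dev N z (Xo + Xi) dl deviation))) 6n≤Km)

    2X≤km : 2 * (Xo + Xi) ≤ k * m
    2X≤km = *-cancelˡ-≤ z (pc-X N z k m (Xo + Xi) (N * dl) deviation 4n²≤zkm)

    out-M : ∀ v → k * 𝟙 (W v) ≤ K * ∑[ w ∈ U ] 𝟙 (M v w) + k * (𝟙 (W v) * 𝟙 (f v == last)) + δ (outs v)
    out-M v with adjacent-next (f v)
    ... | inj₁ e rewrite e | ==-refl last | *-identityʳ (𝟙 (W v)) = ≤-trans (m≤n+m _ (K * ∑[ w ∈ U ] 𝟙 (R v w ∧ adjacent last (f w)))) (m≤m+n _ _)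
    ... | inj₂ (i′ , e) = ≤-trans (≤-reflexive (sym (out-k v))) (≤-trans (dist-lo (K * hits A f (outs v) i′) (card (A (outs v))))
          (+-monoˡ-≤ (dev (outs v) i′) (≤-trans (≤-reflexive (cong (K *_) (∑-cong U λ w → sym (𝟙-∧ (R v w) _ ∙ cong (λ b → 𝟙 (R v w) * 𝟙 b) (e (f w)))))) (m≤m+n _ _))))

    in-M : ∀ w → K * ∑[ v ∈ U ] 𝟙 (M v w) ≤ k + δ (ins w)
    in-M w with adjacent-prev (f w)
    ... | inj₁ e = ≤-trans (≤-reflexive (cong (K *_) (∑-cong U (λ v → 𝟙-∧ (R v w) _ ∙ cong (λ b → 𝟙 (R v w) * 𝟙 b) (e (f v)) ∙ *-zeroʳ (𝟙 (R v w))) ∙ ∑-zero U) ∙ *-zeroʳ K)) z≤n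
    ... | inj₂ (j′ , e) = ≤-trans (≤-reflexive (cong (K *_) (∑-cong U λ v → 𝟙-∧ (R v w) _ ∙ cong (λ b → 𝟙 (R v w) * 𝟙 b) (e (f v)))))
          (≤-trans (dist-hi (K * hits A f (ins w) j′) (card (A (ins w)))) (+-monoˡ-≤ (dev (ins w) j′) (in-k w)))

    open Matching M using (nb; nb-intro)
    open Deficient M m

    -- Edges of `M` leaving `S` are counted from both sides. At most m/2 of the deficiency is due to
    -- the last class and at most m/2 to uneven neighbourhoods.
    hall-cond : ∀ S → S ⊆ᵇ W → card S ≤ card (λ y → W y ∧ nb S y) + m
    hall-cond S S⊆W = *-cancelˡ-≤ k (pc-final k (card S) (card B) m Lst (Xo + Xi)
        (pc-sum k K (card S) d Lst Xo (card B) Xi lower upper) 2last≤m 2X≤km)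
      where
      B : Fin n → Bool
      B y = W y ∧ nb S y
      d : ℕ
      d = ∑[ v ∈ U ] ∑[ w ∈ U ] (𝟙 (S v) * 𝟙 (M v w))
      lower-pt : ∀ s w a b c → (s ≡ true → w ≡ true) → k * 𝟙 w ≤ K * a + b + c → k * 𝟙 s ≤ K * (𝟙 s * a) + b + c
      lower-pt false w a b c h g = ≤-trans (≤-reflexive (*-zeroʳ k)) z≤n
      lower-pt true w a b c h g rewrite h refl | +-identityʳ a = g
      lower : k * card S ≤ K * d + k * Lst + Xo
      lower = begin
        k * card S ≡⟨ ∑-*ˡ U k _ ⟨
        ∑[ v ∈ U ] (k * 𝟙 (S v)) ≤⟨ ∑-mono U (λ v → lower-pt (S v) (W v) (∑[ w ∈ U ] 𝟙 (M v w)) (k * (𝟙 (W v) * 𝟙 (f v == last))) (δ (outs v)) (S⊆W v) (out-M v)) ⟩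
        ∑[ v ∈ U ] (K * (𝟙 (S v) * ∑[ w ∈ U ] 𝟙 (M v w)) + k * (𝟙 (W v) * 𝟙 (f v == last)) + δ (outs v))
          ≡⟨ ∑-+ U _ (λ v → δ (outs v)) ∙ cong (_+ Xo) (∑-+ U (λ v → K * (𝟙 (S v) * ∑[ w ∈ U ] 𝟙 (M v w))) (λ v → k * (𝟙 (W v) * 𝟙 (f v == last)))
              ∙ cong₂ _+_ (∑-*ˡ U K _ ∙ cong (K *_) (∑-cong U λ v → sym (∑-*ˡ U (𝟙 (S v)) _))) (∑-*ˡ U k _)) ⟩
        K * d + k * Lst + Xo ∎
        where open ≤-Reasoning
      upper-pt : ∀ s mm b → (s ≡ true → mm ≡ true → b ≡ true) → 𝟙 s * 𝟙 mm ≤ 𝟙 b * 𝟙 mm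
      upper-pt false mm b h = z≤n
      upper-pt true false b h = z≤n
      upper-pt true true b h rewrite h refl refl = ≤-refl
      upper : K * d ≤ k * card B + Xi
      upper = begin
        K * d ≤⟨ *-monoʳ-≤ K (∑-mono U λ v → ∑-mono U λ w → upper-pt (S v) (M v w) (B w) λ p q → ∧-intro (proj₂ (R⊆ v w (∧-proj₁ q))) (nb-intro {S} p q)) ⟩
        K * ∑[ v ∈ U ] ∑[ w ∈ U ] (𝟙 (B w) * 𝟙 (M v w)) ≡⟨ cong (K *_) (∑-swap U U _ ∙ ∑-cong U (λ w → ∑-*ˡ U (𝟙 (B w)) _)) ∙ sym (∑-*ˡ U K _) ⟩
        ∑[ w ∈ U ] (K * (𝟙 (B w) * ∑[ v ∈ U ] 𝟙 (M v w))) ≤⟨ ∑-mono U (λ w → pt (B w) (∑[ v ∈ U ] 𝟙 (M v w)) (δ (ins w)) (in-M w)) ⟩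
        ∑[ w ∈ U ] (k * 𝟙 (B w) + δ (ins w)) ≡⟨ ∑-+ U _ _ ∙ cong (_+ Xi) (∑-*ˡ U k _) ⟩
        k * card B + Xi ∎
        where
        open ≤-Reasoning
        pt : ∀ b a c → K * a ≤ k + c → K * (𝟙 b * a) ≤ k * 𝟙 b + c
        pt false a c h = ≤-trans (≤-reflexive (*-zeroʳ K)) z≤n
        pt true a c h rewrite +-identityʳ a | *-identityʳ k = h

    private
      L = deficient-hall W W hall-cond
    open Large L

    ws : List (Fin n)
    ws = filter (λ v → T? (W v)) U

    occ-ws : ∀ v → occ v ws ≡ 𝟙 (W v)
    occ-ws v = ∑-filter W U _ ∙ ∑-cong U (λ x → *-comm (𝟙 (W x)) _) ∙ ∑-δ′ v (𝟙 ∘ W)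

    Link : Fin n → Fin n → Set
    Link x y = R x y ≡ true × toℕ (f x) < toℕ (f y)

    -- Matched edges lead to the next class, so the class number is a rank that excludes closed
    -- walks.
    linked : Linked Link ws es
    linked = link Link ws es (toℕ ∘ f) proj₂
      (λ {x} {y} i → ∧-proj₁ (es⊆M i) , ≤-reflexive (sym (≡ᵇ⇒≡ _ _ (subst T (sym (∧-proj₂ {R x y} (es⊆M i))) _))))
      (λ v → ≤-trans (sources v) (≤-reflexive (sym (occ-ws v)))) (λ v → ≤-trans (targets v) (≤-reflexive (sym (occ-ws v))))

    path-cover : ∃ λ (ps : List (Path (λ x y → R x y ≡ true))) → length ps ≤ m × (∀ v → inside v ps ≡ 𝟙 (W v))
    path-cover = map weaken paths , ≤-trans (≤-reflexive (length-map weaken paths)) short ,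
        λ v → ∑-map weaken paths _ ∙ covers v ∙ occ-ws v
      where
      open Linked linked
      weaken : Path Link → Path (λ x y → R x y ≡ true)
      weaken p = path (walk-map proj₁ (walk p))
      short : length paths ≤ m
      short = +-cancelʳ-≤ (length es) _ _ (≤-trans (≤-reflexive (linked-length linked ∙ length-∑ ws ∙ ∑-filter W U _ ∙ ∑-cong U λ v → *-identityʳ _))
        (≤-trans large (≤-reflexive (+-comm (length es) m))))

  -- Absorption

  module Graph {N : ℕ} (E : Fin N → Fin N → Bool) where

    V : Set
    V = Fin N

    U : List V
    U = allFin N

    ∣U∣ : length U ≡ N
    ∣U∣ = length-tabulate id

    size : (V → Bool) → ℕ
    size A = ∑[ v ∈ U ] 𝟙 (A v)

    edges : (V → Bool) → (V → Bool) → ℕ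
    edges A B = ∑[ x ∈ U ] ∑[ y ∈ U ] (𝟙 (A x) * (𝟙 (B y) * 𝟙 (E x y)))

    -- Edges of the double cover between the part with out-copies in `A` and in-copies in `B` and
    -- the complementary part.
    cut : (V → Bool) → (V → Bool) → ℕ
    cut A B = edges A (not ∘ B) + edges (not ∘ A) B

    ∑U-bound : ∀ {f : V → ℕ} c → (∀ x → f x ≤ c) → ∑ U f ≤ N * c
    ∑U-bound c p = ≤-trans (∑-bound U c p) (≤-reflexive (cong (_* c) ∣U∣))

    ∑U-const : ∀ c → ∑[ x ∈ U ] c ≡ N * c
    ∑U-const c = ∑-const U c ∙ cong (_* c) ∣U∣

    -- k y x counts walks of a fixed odd length in the bipartite double cover, from the
    -- in-copy of y to the out-copy of x.
    comp : (V → V → ℕ) → V → V → ℕ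
    comp k y x = ∑[ a ∈ U ] ∑[ b ∈ U ] (k y a * (𝟙 (E a b) * k b x))

    walks₁ walks₃ walks₇ : V → V → ℕ
    walks₁ y x = 𝟙 (E x y)
    walks₃ = comp walks₁
    walks₇ = comp walks₃

    comp-bound : ∀ k M → (∀ y x → k y x ≤ M) → ∀ y x → comp k y x ≤ N * (N * (M * M))
    comp-bound k M h y x = ∑U-bound _ λ a → ∑U-bound _ λ b →
      *-mono-≤ (h y a) (≤-trans (*-mono-≤ (𝟙≤1 (E a b)) (h b x)) (≤-reflexive (*-identityˡ M)))

    -- Walks from an in-copy inside the part (A, B) to an out-copy outside it; each of them has to
    -- cross the cut.
    leak : (V → V → ℕ) → (V → Bool) → (V → Bool) → ℕ
    leak k A B = ∑[ y ∈ U ] ∑[ x ∈ U ] (𝟙 (B y) * (𝟙 (not (A x)) * k y x))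

    -- A leaking composite walk leaks in its first half (a outside A), leaks in its second half (b
    -- in B), or crosses the cut by its middle edge a → b. The factors left over are bounded by `M`.
    leak-step : ∀ by ax aa bb ee p q M → p ≤ M → q ≤ M →
      𝟙 by * (𝟙 (not ax) * (p * (𝟙 ee * q))) ≤
      𝟙 by * (𝟙 (not aa) * p) * M + 𝟙 bb * (𝟙 (not ax) * q) * M + M * M * (𝟙 aa * (𝟙 (not bb) * 𝟙 ee))
    leak-step false ax aa bb ee p q M h h′ = z≤n
    leak-step true true aa bb ee p q M h h′ = z≤n
    leak-step true false aa bb false p q M h h′ rewrite *-zeroʳ p = z≤n
    leak-step true false false bb true p q M h h′
      rewrite +-identityʳ (p * (q + 0)) | +-identityʳ (p * (q + 0)) | +-identityʳ q | +-identityʳ p | +-identityʳ p =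
      ≤-trans (*-monoʳ-≤ p h′) (≤-trans (m≤m+n (p * M) _) (m≤m+n _ _))
    leak-step true false true true true p q M h h′
      rewrite +-identityʳ (p * (q + 0)) | +-identityʳ (p * (q + 0)) | +-identityʳ q | +-identityʳ q =
      ≤-trans (≤-trans (*-monoˡ-≤ q h) (≤-reflexive (*-comm M q))) (m≤m+n (q * M) _)
    leak-step true false true false true p q M h h′
      rewrite +-identityʳ (p * (q + 0)) | +-identityʳ (p * (q + 0)) | +-identityʳ q | *-identityʳ (M * M) = *-mono-≤ h h′

    ∑∑ : (V → V → ℕ) → ℕ
    ∑∑ f = ∑[ x ∈ U ] ∑[ y ∈ U ] f x y

    ∑∑-mono : ∀ {f g : V → V → ℕ} → (∀ x y → f x y ≤ g x y) → ∑∑ f ≤ ∑∑ g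
    ∑∑-mono h = ∑-mono U λ x → ∑-mono U λ y → h x y

    ∑∑-cong : ∀ {f g : V → V → ℕ} → (∀ x y → f x y ≡ g x y) → ∑∑ f ≡ ∑∑ g
    ∑∑-cong h = ∑-cong U λ x → ∑-cong U λ y → h x y

    ∑∑-+ : ∀ (f g : V → V → ℕ) → ∑∑ (λ x y → f x y + g x y) ≡ ∑∑ f + ∑∑ g
    ∑∑-+ f g = ∑-cong U (λ x → ∑-+ U (f x) (g x)) ∙ ∑-+ U _ _

    ∑∑-*ˡ : ∀ c (f : V → V → ℕ) → ∑∑ (λ x y → c * f x y) ≡ c * ∑∑ f
    ∑∑-*ˡ c f = ∑-cong U (λ x → ∑-*ˡ U c (f x)) ∙ ∑-*ˡ U c _

    ∑∑-*ʳ : ∀ c (f : V → V → ℕ) → ∑∑ (λ x y → f x y * c) ≡ ∑∑ f * c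
    ∑∑-*ʳ c f = ∑-cong U (λ x → ∑-*ʳ U c (f x)) ∙ ∑-*ʳ U c _

    ∑∑-const : ∀ c → ∑∑ (λ _ _ → c) ≡ N * (N * c)
    ∑∑-const c = ∑-cong U (λ _ → ∑U-const c) ∙ ∑U-const _

    ∑∑-left : ∀ (f : V → ℕ) → ∑∑ (λ x _ → f x) ≡ N * ∑ U f
    ∑∑-left f = ∑-cong U (λ x → ∑U-const (f x)) ∙ ∑-*ˡ U N f

    ∑∑-right : ∀ (f : V → ℕ) → ∑∑ (λ _ y → f y) ≡ N * ∑ U f
    ∑∑-right f = ∑U-const _

    ∑∑∑∑-outer : ∀ (f : V → V → ℕ) → ∑∑ (λ y x → ∑∑ λ a b → f y a) ≡ N * (N * ∑∑ f)
    ∑∑∑∑-outer f = ∑-cong U (λ y → ∑-cong U (λ x → ∑∑-left (f y)) ∙ ∑U-const _ ∙ cong (N *_) refl)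
      ∙ ∑-*ˡ U N _ ∙ cong (N *_) (∑-*ˡ U N _)

    ∑∑∑∑-inner : ∀ (f : V → V → ℕ) → ∑∑ (λ y x → ∑∑ λ a b → f b x) ≡ N * (N * ∑∑ f)
    ∑∑∑∑-inner f = ∑U-const _ ∙ cong (N *_) (∑-cong U (λ x → ∑U-const _) ∙ ∑-*ˡ U N _ ∙ cong (N *_) (∑-swap U U (λ x b → f b x)))

    leak-comp : ∀ k A B M ℓ κ → (∀ y x → k y x ≤ M) → leak k A B ≤ ℓ → edges A (not ∘ B) ≤ κ →
                leak (comp k) A B ≤ N * (N * (ℓ * M)) + N * (N * (ℓ * M)) + N * (N * (M * M * κ))
    leak-comp k A B M ℓ κ hM hℓ hκ = begin
      leak (comp k) A B
        ≡⟨ ∑∑-cong (λ y x → cong (𝟙 (B y) *_) (sym (∑∑-*ˡ (𝟙 (not (A x))) _)) ∙ sym (∑∑-*ˡ (𝟙 (B y)) _)) ⟩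
      ∑∑ (λ y x → ∑∑ λ a b → 𝟙 (B y) * (𝟙 (not (A x)) * (k y a * (𝟙 (E a b) * k b x))))
        ≤⟨ ∑∑-mono (λ y x → ∑∑-mono λ a b → leak-step (B y) (A x) (A a) (B b) (E a b) (k y a) (k b x) M (hM y a) (hM b x)) ⟩
      ∑∑ (λ y x → ∑∑ λ a b → F y a * M + F b x * M + M * M * (𝟙 (A a) * (𝟙 (not (B b)) * 𝟙 (E a b))))
        ≡⟨ ∑∑-cong (λ y x → ∑∑-+ _ _ ∙ cong₂ _+_ (∑∑-+ _ _) (∑∑-*ˡ (M * M) _)) ∙ ∑∑-+ _ _ ∙ cong₂ _+_ (∑∑-+ _ _) (∑∑-const _) ⟩
      ∑∑ (λ y x → ∑∑ λ a b → F y a * M) + ∑∑ (λ y x → ∑∑ λ a b → F b x * M) + N * (N * (M * M * edges A (not ∘ B)))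
        ≡⟨ cong (_+ N * (N * (M * M * edges A (not ∘ B)))) (cong₂ _+_ (∑∑∑∑-outer (λ y x → F y x * M) ∙ cong (λ z → N * (N * z)) (∑∑-*ʳ M F))
             (∑∑∑∑-inner (λ y x → F y x * M) ∙ cong (λ z → N * (N * z)) (∑∑-*ʳ M F))) ⟩
      N * (N * (leak k A B * M)) + N * (N * (leak k A B * M)) + N * (N * (M * M * edges A (not ∘ B)))
        ≤⟨ +-mono-≤ (+-mono-≤ h h) (*-monoʳ-≤ N (*-monoʳ-≤ N (*-monoʳ-≤ (M * M) hκ))) ⟩
      N * (N * (ℓ * M)) + N * (N * (ℓ * M)) + N * (N * (M * M * κ)) ∎
      where
      open ≤-Reasoning
      F : V → V → ℕ
      F y x = 𝟙 (B y) * (𝟙 (not (A x)) * k y x)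
      h = *-monoʳ-≤ N (*-monoʳ-≤ N (*-monoˡ-≤ M hℓ))

    edges-swap : ∀ A B → ∑∑ (λ y x → 𝟙 (B y) * (𝟙 (A x) * 𝟙 (E x y))) ≡ edges A B
    edges-swap A B = ∑-swap U U _ ∙ ∑∑-cong (λ x y → swap* [] (𝟙 (B y)) (𝟙 (A x)) (𝟙 (E x y)))

    -- Every pair of `B` and the complement of `A` has N⁶/c walks, all of them leaking. The factor 7
    -- counts the position of the crossing edge in the walk; the other six vertices are free.
    cut-expansion : ∀ c A B → 1 ≤ N → (∀ s t → N * N * N * N * N * N ≤ c * walks₇ s t) →
                    size B * size (not ∘ A) ≤ 7 * c * cut A B
    cut-expansion c A B 1≤N W = *-cancelˡ-≤ (N * N * N * N * N * N) {{>-nonZero pos}} (begin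
      N⁶ * (size B * size (not ∘ A)) ≡⟨ cong (N⁶ *_) (∑-*∑ U U _ _) ∙ sym (∑∑-*ˡ N⁶ _) ⟩
      ∑∑ (λ y x → N⁶ * (𝟙 (B y) * 𝟙 (not (A x)))) ≤⟨ ∑∑-mono (λ y x → ≤-trans (≤-reflexive (*-comm N⁶ _)) (*-monoʳ-≤ (𝟙 (B y) * 𝟙 (not (A x))) (W y x))) ⟩
      ∑∑ (λ y x → 𝟙 (B y) * 𝟙 (not (A x)) * (c * walks₇ y x)) ≡⟨ ∑∑-cong (λ y x → *-assoc (𝟙 (B y)) (𝟙 (not (A x))) _ ∙ cong (𝟙 (B y) *_) (swap* [] (𝟙 (not (A x))) c _) ∙ swap* [] (𝟙 (B y)) c _) ∙ ∑∑-*ˡ c _ ⟩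
      c * leak walks₇ A B ≤⟨ *-monoʳ-≤ c h₇ ⟩
      c * (N * (N * (3N²κ * (N * (N * 1)))) + N * (N * (3N²κ * (N * (N * 1)))) + N * (N * (N * (N * 1) * (N * (N * 1)) * κ)))
        ≤⟨ lin (N ∷ c ∷ κ ∷ []) (# 1 ⊗ (X ⊕ X ⊕ # 0 ⊗ (# 0 ⊗ (# 0 ⊗ (# 0 ⊗ con 1) ⊗ (# 0 ⊗ (# 0 ⊗ con 1)) ⊗ # 2))))
             (# 0 ⊗ # 0 ⊗ # 0 ⊗ # 0 ⊗ # 0 ⊗ # 0 ⊗ (con 7 ⊗ # 1 ⊗ # 2)) 0 triv refl ⟩
      N⁶ * (7 * c * κ) ∎)
      where
      open ≤-Reasoning
      κ = cut A B
      N⁶ = N * N * N * N * N * N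
      3N²κ = N * (N * (κ * 1)) + N * (N * (κ * 1)) + N * (N * (1 * 1 * κ))
      3X = # 0 ⊗ (# 0 ⊗ (# 2 ⊗ con 1)) ⊕ # 0 ⊗ (# 0 ⊗ (# 2 ⊗ con 1)) ⊕ # 0 ⊗ (# 0 ⊗ (con 1 ⊗ con 1 ⊗ # 2))
      X = # 0 ⊗ (# 0 ⊗ (3X ⊗ (# 0 ⊗ (# 0 ⊗ con 1))))
      pos : 0 < N⁶
      pos = *-mono-≤ (*-mono-≤ (*-mono-≤ (*-mono-≤ (*-mono-≤ 1≤N 1≤N) 1≤N) 1≤N) 1≤N) 1≤N
      e≤κ : edges A (not ∘ B) ≤ κ
      e≤κ = m≤m+n _ _
      h₁ : leak walks₁ A B ≤ κ
      h₁ = ≤-trans (≤-reflexive (edges-swap (not ∘ A) B)) (m≤n+m _ _)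
      h₃ : leak walks₃ A B ≤ 3N²κ
      h₃ = leak-comp walks₁ A B 1 κ κ (λ y x → 𝟙≤1 (E x y)) h₁ e≤κ
      h₇ = leak-comp walks₃ A B (N * (N * 1)) 3N²κ κ (comp-bound walks₁ 1 (λ y x → 𝟙≤1 (E x y))) h₃ e≤κ

  -- Near-regularity turns a one-sided bound into a bound on the whole cut: `S` sends about D·S
  -- edges, nearly all into the smaller set `U`, which can receive only about D·U, so few edges
  -- enter it from elsewhere.
  cut-arith : ∀ D S U Dl k eS eSU eSnU enSU eU → D * S ≤ eS + Dl → eU ≤ D * U + Dl → eS ≡ eSU + eSnU → eU ≡ eSU + enSU → eSnU ≤ k → suc U ≤ S → eSnU + enSU ≤ 2 * Dl + 2 * k
  cut-arith D S U Dl k eS eSU eSnU enSU eU H1 H2 H3 H4 H5 H6 =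
      lin ρ (# 7 ⊕ # 8) (con 2 ⊗ # 3 ⊕ con 2 ⊗ # 4) 0
      ((# 0 ⊗ # 1 ≼ # 5 ⊕ # 3 by H1)
        ⊞ (# 9 ≼ # 0 ⊗ # 2 ⊕ # 3 by H2)
        ⊞ (# 5 ≼ # 6 ⊕ # 7 by ≤-reflexive H3)
        ⊞ (# 6 ⊕ # 8 ≼ # 9 by ≤-reflexive (sym H4))
        ⊞ con 2 ⊠ (# 7 ≼ # 4 by H5)
        ⊞ (# 0 ⊗ (con 1 ⊕ # 2) ≼ # 0 ⊗ # 1 by *-monoʳ-≤ (D) (H6))) refl
    where
    ρ = D ∷ S ∷ U ∷ Dl ∷ k ∷ eS ∷ eSU ∷ eSnU ∷ enSU ∷ eU ∷ []

  big-arith : ∀ N m S nU c X → N ≤ 2 * S → m ≤ nU → nU * S ≤ 7 * c * X → m * N ≤ 14 * c * X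
  big-arith N m S nU c X H2 H3 H4 =
      lin ρ (# 1 ⊗ # 0) (con 14 ⊗ # 4 ⊗ # 5) 0
      (con 2 ⊠ (# 3 ⊗ # 2 ≼ con 7 ⊗ # 4 ⊗ # 5 by H4)
        ⊞ con 2 ⊠ (# 2 ⊗ # 1 ≼ # 2 ⊗ # 3 by *-monoʳ-≤ (S) (H3))
        ⊞ (# 1 ⊗ # 0 ≼ # 1 ⊗ (con 2 ⊗ # 2) by *-monoʳ-≤ (m) (H2))) refl
    where
    ρ = N ∷ m ∷ S ∷ nU ∷ c ∷ X ∷ []

  big-arith2 : ∀ N m S nS nU c X → N ≤ 2 * nS → m ≤ S → nU * S ≤ 7 * c * X → nS ≤ nU → m * N ≤ 14 * c * X
  big-arith2 N m S nS nU c X H2 H3 H4 H5 =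
      lin ρ (# 1 ⊗ # 0) (con 14 ⊗ # 5 ⊗ # 6) 0
      (con 2 ⊠ (# 4 ⊗ # 2 ≼ con 7 ⊗ # 5 ⊗ # 6 by H4)
        ⊞ con 2 ⊠ (# 2 ⊗ # 3 ≼ # 2 ⊗ # 4 by *-monoʳ-≤ (S) (H5))
        ⊞ con 2 ⊠ (# 3 ⊗ # 1 ≼ # 3 ⊗ # 2 by *-monoʳ-≤ (nS) (H3))
        ⊞ (# 1 ⊗ # 0 ≼ # 1 ⊗ (con 2 ⊗ # 3) by *-monoʳ-≤ (m) (H2))) refl
    where
    ρ = N ∷ m ∷ S ∷ nS ∷ nU ∷ c ∷ X ∷ []

  half : ∀ N S nS → S + nS ≡ N → 2 * S < N → N ≤ 2 * nS
  half N S nS H1 H2 =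
      lin ρ (# 0) (con 2 ⊗ # 2) 0
      (con 2 ⊠ (# 0 ≼ # 1 ⊕ # 2 by ≤-reflexive (sym H1))
        ⊞ (con 1 ⊕ con 2 ⊗ # 1 ≼ # 0 by H2)) refl
    where
    ρ = N ∷ S ∷ nS ∷ []

  compl-lt : ∀ N S nS U nU → S + nS ≡ N → U + nU ≡ N → U < S → nS ≤ nU
  compl-lt N S nS U nU H1 H2 H3 =
      lin ρ (# 2) (# 4) 0
      ((# 1 ⊕ # 2 ≼ # 0 by ≤-reflexive H1)
        ⊞ (# 0 ≼ # 3 ⊕ # 4 by ≤-reflexive (sym H2))
        ⊞ (con 1 ⊕ # 3 ≼ # 1 by H3)) refl
    where
    ρ = N ∷ S ∷ nS ∷ U ∷ nU ∷ []

  deg-arith : ∀ N c b k deg m dW dR Dl → N ≤ c * deg → deg ≤ m + dW + dR → dW ≤ b → dR ≤ k → 28 * c * c * Dl + 28 * c * c * (b + k) * N + c * (b + k) * N < N * N → m * N ≤ 14 * c * (2 * Dl + 2 * ((b + k) * N)) → ⊥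
  deg-arith N c b k deg m dW dR Dl H1 H2 H3 H4 H5 H6 =
      1+n≰n (lin ρ (con 1) (con 0) 0
      ((con 1 ⊕ (con 28 ⊗ # 1 ⊗ # 1 ⊗ # 8 ⊕ con 28 ⊗ # 1 ⊗ # 1 ⊗ (# 2 ⊕ # 3) ⊗ # 0 ⊕ # 1 ⊗ (# 2 ⊕ # 3) ⊗ # 0) ≼ # 0 ⊗ # 0 by H5)
        ⊞ (# 0 ⊗ # 0 ≼ # 0 ⊗ (# 1 ⊗ # 4) by *-monoʳ-≤ (N) (H1))
        ⊞ (# 1 ⊗ # 0 ⊗ # 4 ≼ # 1 ⊗ # 0 ⊗ (# 5 ⊕ # 6 ⊕ # 7) by *-monoʳ-≤ (c * N) (H2))
        ⊞ (# 1 ⊗ # 0 ⊗ # 6 ≼ # 1 ⊗ # 0 ⊗ # 2 by *-monoʳ-≤ (c * N) (H3))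
        ⊞ (# 1 ⊗ # 0 ⊗ # 7 ≼ # 1 ⊗ # 0 ⊗ # 3 by *-monoʳ-≤ (c * N) (H4))
        ⊞ (# 1 ⊗ (# 5 ⊗ # 0) ≼ # 1 ⊗ (con 14 ⊗ # 1 ⊗ (con 2 ⊗ # 8 ⊕ con 2 ⊗ ((# 2 ⊕ # 3) ⊗ # 0))) by *-monoʳ-≤ (c) (H6))) refl)
    where
    ρ = N ∷ c ∷ b ∷ k ∷ deg ∷ m ∷ dW ∷ dR ∷ Dl ∷ []

  slack-mono : ∀ c N Dl b k m → 28 * c * c * Dl + 28 * c * c * (b + m) * N + c * (b + m) * N < N * N → k ≤ m → 28 * c * c * Dl + 28 * c * c * (b + k) * N + c * (b + k) * N < N * N
  slack-mono c N Dl b k m H1 H2 =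
      lin ρ (con 1 ⊕ (con 28 ⊗ # 0 ⊗ # 0 ⊗ # 2 ⊕ con 28 ⊗ # 0 ⊗ # 0 ⊗ (# 3 ⊕ # 4) ⊗ # 1 ⊕ # 0 ⊗ (# 3 ⊕ # 4) ⊗ # 1)) (# 1 ⊗ # 1) 0
      ((con 1 ⊕ (con 28 ⊗ # 0 ⊗ # 0 ⊗ # 2 ⊕ con 28 ⊗ # 0 ⊗ # 0 ⊗ (# 3 ⊕ # 5) ⊗ # 1 ⊕ # 0 ⊗ (# 3 ⊕ # 5) ⊗ # 1) ≼ # 1 ⊗ # 1 by H1)
        ⊞ con 28 ⊠ (# 0 ⊗ # 0 ⊗ # 1 ⊗ # 4 ≼ # 0 ⊗ # 0 ⊗ # 1 ⊗ # 5 by *-monoʳ-≤ (c * c * N) (H2))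
        ⊞ (# 0 ⊗ # 1 ⊗ # 4 ≼ # 0 ⊗ # 1 ⊗ # 5 by *-monoʳ-≤ (c * N) (H2))) refl
    where
    ρ = c ∷ N ∷ Dl ∷ b ∷ k ∷ m ∷ []

  mem : ∀ {n} → List (Fin n × Fin n) → Fin n → Fin n → Bool
  mem es x y = 1 ≤ᵇ ∑[ e ∈ es ] (𝟙 (proj₁ e == x) * 𝟙 (proj₂ e == y))

  -- As long as `x` is a source at most once, the Boolean relation forgets no multiplicity, so its
  -- degrees can be read off the list.
  𝟙-mem : ∀ {n} (es : List (Fin n × Fin n)) x y → occ x (map proj₁ es) ≤ 1 →
          𝟙 (mem es x y) ≡ ∑[ e ∈ es ] (𝟙 (proj₁ e == x) * 𝟙 (proj₂ e == y))
  𝟙-mem es x y h with ∑[ e ∈ es ] (𝟙 (proj₁ e == x) * 𝟙 (proj₂ e == y)) | bound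
    where
    bound : ∑[ e ∈ es ] (𝟙 (proj₁ e == x) * 𝟙 (proj₂ e == y)) ≤ 1
    bound = ≤-trans (∑-mono es λ e → ≤-trans (*-monoʳ-≤ (𝟙 (proj₁ e == x)) (𝟙≤1 (proj₂ e == y))) (≤-reflexive (*-identityʳ _)))
            (≤-trans (≤-reflexive (sym (∑-map proj₁ es _))) h)
  ... | zero | _ = refl
  ... | suc zero | _ = refl
  ... | suc (suc _) | s≤s ()

  mem-∈ : ∀ {n} (es : List (Fin n × Fin n)) {x y} → mem es x y ≡ true → (x , y) ∈ es
  mem-∈ es {x} {y} e with ∑-<⇒∃ es {λ _ → 0} (≤-<-trans (≤-reflexive (∑-zero es)) (≤ᵇ⇒≤ 1 _ (subst T (sym e) _)))
  ... | (x′ , y′) , i , h with x′ ≟ x | y′ ≟ y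
  ... | yes refl | yes refl = i
  ... | yes refl | no _ with h
  ...   | ()
  mem-∈ es e | (x′ , y′) , i , () | no _ | _

  𝟙<𝟙 : ∀ a b → 𝟙 a < 𝟙 b → b ≡ true × a ≡ false
  𝟙<𝟙 false true _ = refl , refl
  𝟙<𝟙 true true (s≤s ())

  true≢false : true ≡ false → ⊥
  true≢false ()

  -- Supplies the minimum degree for the matching step: being least, μ lies below every degree that
  -- beats the bound `X`, so a degree condition reduces to refuting one inequality.
  least-multiple : ∀ X N → 1 ≤ N → ∃ λ μ → X < μ * N × (∀ d → X < d * N → μ ≤ d)
  least-multiple X N 1≤N = suc (X / N) ,
      ≤-trans (s≤s (≤-reflexive (m≡m%n+[m/n]*n X N))) (+-monoˡ-≤ (X / N * N) (m%n<n X N)) ,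
      λ d h → *-cancelʳ-< N (X / N) d (≤-<-trans (m/n*n≤m X N) h)
    where
    instance _ = >-nonZero 1≤N

  self-cut-arith : ∀ D S Dl eS eSU eSnU enSU eU → D * S ≤ eS + Dl → eU ≤ D * S + Dl → eS ≡ eSU + eSnU → eU ≡ eSU + enSU → eSnU + enSU ≤ 2 * Dl + 2 * eSnU
  self-cut-arith D S Dl eS eSU eSnU enSU eU H1 H2 H3 H4 =
      lin ρ (# 5 ⊕ # 6) (con 2 ⊗ # 2 ⊕ con 2 ⊗ # 5) 0
      ((# 0 ⊗ # 1 ≼ # 3 ⊕ # 2 by H1)
        ⊞ (# 7 ≼ # 0 ⊗ # 1 ⊕ # 2 by H2)
        ⊞ (# 3 ≼ # 4 ⊕ # 5 by ≤-reflexive H3)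
        ⊞ (# 4 ⊕ # 6 ≼ # 7 by ≤-reflexive (sym H4))) refl
    where
    ρ = D ∷ S ∷ Dl ∷ eS ∷ eSU ∷ eSnU ∷ enSU ∷ eU ∷ []

  growth-arith : ∀ N c b g Dl A nA e → N ≤ c * A + c * b → 2 * (c * b) ≤ N → N ≤ c * nA → A * nA ≤ 7 * c * (2 * Dl + 2 * e) → e ≤ N * (g + b) → 56 * (c * c * c) * (N * b + Dl) ≤ N * N → N * N ≤ N * (56 * (c * c * c) * g)
  growth-arith N c b g Dl A nA e H1 H2 H3 H4 H5 H6 =
      lin ρ (# 0 ⊗ # 0) (# 0 ⊗ (con 56 ⊗ (# 1 ⊗ # 1 ⊗ # 1) ⊗ # 3)) 0
      ((con 56 ⊗ (# 1 ⊗ # 1 ⊗ # 1) ⊗ (# 0 ⊗ # 2 ⊕ # 4) ≼ # 0 ⊗ # 0 by H6)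
        ⊞ con 4 ⊠ (# 0 ⊗ # 0 ≼ # 0 ⊗ (# 1 ⊗ # 5 ⊕ # 1 ⊗ # 2) by *-monoʳ-≤ (N) (H1))
        ⊞ con 2 ⊠ (# 0 ⊗ (con 2 ⊗ (# 1 ⊗ # 2)) ≼ # 0 ⊗ # 0 by *-monoʳ-≤ (N) (H2))
        ⊞ con 4 ⊠ (# 1 ⊗ # 5 ⊗ # 0 ≼ # 1 ⊗ # 5 ⊗ (# 1 ⊗ # 6) by *-monoʳ-≤ (c * A) (H3))
        ⊞ con 4 ⊠ (# 1 ⊗ # 1 ⊗ (# 5 ⊗ # 6) ≼ # 1 ⊗ # 1 ⊗ (con 7 ⊗ # 1 ⊗ (con 2 ⊗ # 4 ⊕ con 2 ⊗ # 7)) by *-monoʳ-≤ (c * c) (H4))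
        ⊞ con 56 ⊠ (# 1 ⊗ # 1 ⊗ # 1 ⊗ # 7 ≼ # 1 ⊗ # 1 ⊗ # 1 ⊗ (# 0 ⊗ (# 3 ⊕ # 2)) by *-monoʳ-≤ (c * c * c) (H5))) refl
    where
    ρ = N ∷ c ∷ b ∷ g ∷ Dl ∷ A ∷ nA ∷ e ∷ []

  iterate-arith : ∀ N G i A B g → i * N ≤ G * A → N ≤ G * g → B ≡ A + g → suc i * N ≤ G * B
  iterate-arith N G i A B g H1 H2 H3 =
      lin ρ ((con 1 ⊕ # 2) ⊗ # 0) (# 1 ⊗ # 4) 0
      ((# 2 ⊗ # 0 ≼ # 1 ⊗ # 3 by H1)
        ⊞ (# 0 ≼ # 1 ⊗ # 5 by H2)
        ⊞ (# 1 ⊗ (# 3 ⊕ # 5) ≼ # 1 ⊗ # 4 by *-monoʳ-≤ (G) (≤-reflexive (sym H3)))) refl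
    where
    ρ = N ∷ G ∷ i ∷ A ∷ B ∷ g ∷ []

  overflow : ∀ N G A → suc G * N ≤ G * A → A ≤ N → 1 ≤ N → ⊥
  overflow N G A H1 H2 H3 =
      1+n≰n (lin ρ (con 1) (con 0) 0
      (((con 1 ⊕ # 1) ⊗ # 0 ≼ # 1 ⊗ # 2 by H1)
        ⊞ (con 1 ≼ # 0 by H3)
        ⊞ (# 1 ⊗ # 2 ≼ # 1 ⊗ # 0 by *-monoʳ-≤ (G) (H2))) refl)
    where
    ρ = N ∷ G ∷ A ∷ []

  deg-split-arith : ∀ N c d b A → N ≤ c * d → d ≤ A + b → N ≤ c * A + c * b
  deg-split-arith N c d b A H1 H2 =
      lin ρ (# 0) (# 1 ⊗ # 4 ⊕ # 1 ⊗ # 3) 0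
      ((# 0 ≼ # 1 ⊗ # 2 by H1)
        ⊞ (# 1 ⊗ # 2 ≼ # 1 ⊗ (# 4 ⊕ # 3) by *-monoʳ-≤ (c) (H2))) refl
    where
    ρ = N ∷ c ∷ d ∷ b ∷ A ∷ []

  good-arith : ∀ N N6 c b w g B → N6 ≤ c * w → w ≤ g + B → N * B ≤ N6 * (6 * (b + 6)) → 12 * c * (b + 6) ≤ N → N * N6 ≤ N * (2 * c * g)
  good-arith N N6 c b w g B H1 H2 H3 H4 =
      lin ρ (# 0 ⊗ # 1) (# 0 ⊗ (con 2 ⊗ # 2 ⊗ # 5)) 0
      (con 2 ⊠ (# 0 ⊗ # 1 ≼ # 0 ⊗ (# 2 ⊗ # 4) by *-monoʳ-≤ (N) (H1))
        ⊞ con 2 ⊠ (# 0 ⊗ # 2 ⊗ # 4 ≼ # 0 ⊗ # 2 ⊗ (# 5 ⊕ # 6) by *-monoʳ-≤ (N * c) (H2))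
        ⊞ con 2 ⊠ (# 2 ⊗ (# 0 ⊗ # 6) ≼ # 2 ⊗ (# 1 ⊗ (con 6 ⊗ (# 3 ⊕ con 6))) by *-monoʳ-≤ (c) (H3))
        ⊞ (# 1 ⊗ (con 12 ⊗ # 2 ⊗ (# 3 ⊕ con 6)) ≼ # 1 ⊗ # 0 by *-monoʳ-≤ (N6) (H4))) refl
    where
    ρ = N ∷ N6 ∷ c ∷ b ∷ w ∷ g ∷ B ∷ []

  decay-arith : ∀ q r P P2 A a b X → P2 + A ≡ 2 * P → P ≤ q * A → suc r ≡ 2 * q → a * P ≤ b * X → q * a * P2 ≤ r * b * X
  decay-arith q r P P2 A a b X H1 H2 H3 H4 =
      lin ρ (# 0 ⊗ # 5 ⊗ # 3) (# 1 ⊗ # 6 ⊗ # 7) 0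
      ((# 5 ⊗ # 0 ⊗ (# 3 ⊕ # 4) ≼ # 5 ⊗ # 0 ⊗ (con 2 ⊗ # 2) by *-monoʳ-≤ (a * q) (≤-reflexive H1))
        ⊞ (# 5 ⊗ # 2 ≼ # 5 ⊗ (# 0 ⊗ # 4) by *-monoʳ-≤ (a) (H2))
        ⊞ (# 5 ⊗ # 2 ⊗ (con 2 ⊗ # 0) ≼ # 5 ⊗ # 2 ⊗ (con 1 ⊕ # 1) by *-monoʳ-≤ (a * P) (≤-reflexive (sym H3)))
        ⊞ (# 1 ⊗ (# 5 ⊗ # 2) ≼ # 1 ⊗ (# 6 ⊗ # 7) by *-monoʳ-≤ (r) (H4))) refl
    where
    ρ = q ∷ r ∷ P ∷ P2 ∷ A ∷ a ∷ b ∷ X ∷ []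

  ^-distribʳ-* : ∀ a b m → (a * b) ^ m ≡ a ^ m * b ^ m
  ^-distribʳ-* a b zero = refl
  ^-distribʳ-* a b (suc m) = cong (a * b *_) (^-distribʳ-* a b m) ∙ [m*n]*[o*p]≡[m*o]*[n*p] a b (a ^ m) (b ^ m)

  -- (1 + x)ᵐ ≥ xᵐ + m xᵐ⁻¹, multiplied through by x.
  bernoulli : ∀ x m → x * x ^ m + m * x ^ m ≤ x * suc x ^ m
  bernoulli x zero = ≤-reflexive (+-identityʳ _)
  bernoulli x (suc m) = bern-step x m (x ^ m) (suc x ^ m) (bernoulli x m)
    where
    bern-step : ∀ x m P Q → x * P + m * P ≤ x * Q → x * (x * P) + suc m * (x * P) ≤ x * (suc x * Q)
    bern-step x m P Q H =
        lin ρ (# 0 ⊗ (# 0 ⊗ # 2) ⊕ (con 1 ⊕ # 1) ⊗ (# 0 ⊗ # 2)) (# 0 ⊗ ((con 1 ⊕ # 0) ⊗ # 3)) 0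
        (((con 1 ⊕ # 0) ⊗ (# 0 ⊗ # 2 ⊕ # 1 ⊗ # 2) ≼ (con 1 ⊕ # 0) ⊗ (# 0 ⊗ # 3) by *-monoʳ-≤ (suc x) (H))) refl
      where
      ρ = x ∷ m ∷ P ∷ Q ∷ []

  2x^x≤ : ∀ x → 1 ≤ x → 2 * x ^ x ≤ suc x ^ x
  2x^x≤ x 1≤x = *-cancelˡ-≤ x {{>-nonZero 1≤x}} (≤-trans (≤-reflexive (swap* [] x 2 (x ^ x) ∙ cong (x * x ^ x +_) (+-identityʳ _))) (bernoulli x x))

  -- (1 + 1/x) to the power x is at least 2; this is raised to the power M.
  power-gap : ∀ x M → 1 ≤ x → 2 ^ M * x ^ (x * M) ≤ suc x ^ (x * M)
  power-gap x M 1≤x = begin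
    2 ^ M * x ^ (x * M) ≡⟨ cong (2 ^ M *_) (sym (^-*-assoc x x M)) ∙ sym (^-distribʳ-* 2 (x ^ x) M) ⟩
    (2 * x ^ x) ^ M ≤⟨ ^-monoˡ-≤ M (2x^x≤ x 1≤x) ⟩
    (suc x ^ x) ^ M ≡⟨ ^-*-assoc (suc x) x M ⟩
    suc x ^ (x * M) ∎
    where
    open ≤-Reasoning

  -- A Hamilton cycle in the form in which it is built: a walk, a closing edge and multiplicities.
  -- It becomes a permutation only at the very end.
  record Cyclic {N : ℕ} (E : Fin N → Fin N → Bool) : Set where
    field
      {start end} : Fin N
      {vertices} : List (Fin N)
      route : Walk (λ x y → E x y ≡ true) start end vertices
      closes : E end start ≡ true
      once : ∀ v → occ v vertices ≡ 1

  beta-lt : ∀ b N T L → suc (T * 6) + (3 * T + 1) * L ≤ b → b ≤ N → T * 6 < N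
  beta-lt b N T L H1 H2 =
      lin ρ (con 1 ⊕ # 2 ⊗ con 6) (# 1) 0
      ((con 1 ⊕ # 2 ⊗ con 6 ⊕ (con 3 ⊗ # 2 ⊕ con 1) ⊗ # 3 ≼ # 0 by H1)
        ⊞ (# 0 ≼ # 1 by H2)) refl
    where
    ρ = b ∷ N ∷ T ∷ L ∷ []

  beta-le : ∀ c b N → 2 * (c * b) ≤ N → b ≤ c * b → b ≤ N
  beta-le c b N H1 H2 =
      lin ρ (# 1) (# 2) 1
      ((con 2 ⊗ (# 0 ⊗ # 1) ≼ # 2 by H1)
        ⊞ con 2 ⊠ (# 1 ≼ # 0 ⊗ # 1 by H2)) refl
    where
    ρ = c ∷ b ∷ N ∷ []

  -- Absorbing gadgets and chains of gadgets

  module RobustDigraph {N : ℕ} (E : Fin N → Fin N → Bool) where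

    open Graph E public

    tuples : ∀ k → List (Vec V k)
    tuples zero = [] ∷ []
    tuples (suc k) = concatMap (λ x → map (x ∷_) (tuples k)) U

    ∑-tuples : ∀ k (f : Vec V (suc k) → ℕ) → ∑ (tuples (suc k)) f ≡ ∑[ x ∈ U ] ∑[ xs ∈ tuples k ] f (x ∷ xs)
    ∑-tuples k f = ∑-concatMap _ U f ∙ ∑-cong U λ x → ∑-map (x ∷_) (tuples k) f

    length-tuples : ∀ k → length (tuples k) ≡ N ^ k
    length-tuples zero = refl
    length-tuples (suc k) = length-∑ (tuples (suc k)) ∙ ∑-tuples k _ ∙ ∑U-const _ ∙ cong (N *_) (sym (length-∑ (tuples k)) ∙ length-tuples k)

    -- Every accepted entry joins the forbidden set, so one test covers both avoidance of `F` and
    -- distinctness.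
    fresh : ∀ {k} → (V → Bool) → Vec V k → Bool
    fresh F [] = true
    fresh F (x ∷ xs) = not (F x) ∧ fresh (λ v → F v ∨ (x == v)) xs

    fresh-occ : ∀ {k} F (xs : Vec V k) → fresh F xs ≡ true → ∀ v → occ v (toList xs) + 𝟙 (F v) ≤ 1
    fresh-occ F [] e v = 𝟙≤1 (F v)
    fresh-occ F (x ∷ xs) e v with fresh-occ (λ v → F v ∨ (x == v)) xs (∧-proj₂ {not (F x)} e) v
    ... | h with x ≟ v
    ...   | yes refl rewrite not-true (∧-proj₁ {not (F x)} e) = ≤-trans (≤-reflexive (+-identityʳ _ ∙ +-comm 1 _)) h
    ...   | no _ with F v
    ...     | true = h
    ...     | false = h

    -- Union bound: each of the k entries has at most b + k forbidden values. The factor N on the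
    -- left avoids a division.
    stale : ∀ k F b → size F ≤ b → N * ∑[ xs ∈ tuples k ] 𝟙 (not (fresh F xs)) ≤ N ^ k * (k * (b + k))
    stale zero F b h = ≤-trans (≤-reflexive (*-zeroʳ N)) z≤n
    stale (suc k) F b h = ≤-trans (*-monoʳ-≤ N (≤-trans (≤-reflexive (∑-tuples k (λ xs → 𝟙 (not (fresh F xs))))) (≤-trans (∑-mono U step)
        (≤-reflexive (∑-+ U (λ x → 𝟙 (F x) * N ^ k) (λ x → ∑[ xs ∈ tuples k ] 𝟙 (not (fresh (λ v → F v ∨ (x == v)) xs))) ∙ cong (_+ ∑[ x ∈ U ] rest x) (∑-*ʳ U (N ^ k) _))))))
        (≤-trans (≤-reflexive (*-distribˡ-+ N _ _)) (≤-trans (+-mono-≤ (*-monoʳ-≤ N (*-monoˡ-≤ (N ^ k) h)) (≤-trans (≤-reflexive (sym (∑-*ˡ U N rest)))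
          (∑U-bound _ λ x → stale k (λ v → F v ∨ (x == v)) (suc b) (size-insert x)))) (fin N (N ^ k) b k)))
      where
      rest : V → ℕ
      rest x = ∑[ xs ∈ tuples k ] 𝟙 (not (fresh (λ v → F v ∨ (x == v)) xs))
      step : ∀ x → ∑[ xs ∈ tuples k ] 𝟙 (not (fresh F (x ∷ xs))) ≤ 𝟙 (F x) * N ^ k + rest x
      step x with F x
      ... | false = ≤-refl
      ... | true = ≤-trans (≤-reflexive (sym (length-∑ (tuples k)) ∙ length-tuples k ∙ sym (+-identityʳ _))) (m≤m+n _ _)
      size-insert : ∀ x → size (λ v → F v ∨ (x == v)) ≤ suc b
      size-insert x = ≤-trans (∑-mono U λ v → ∨-split (F v) (x == v)) (≤-trans (≤-reflexive (∑-+ U _ _)) (≤-trans (+-mono-≤ h (≤-reflexive (∑-𝟙== x))) (≤-reflexive (+-comm b 1))))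
      fin : ∀ N P b k → N * (b * P) + N * (P * (k * (suc b + k))) ≤ N * P * (suc k * (b + suc k))
      fin N P b k =
          lin ρ (# 0 ⊗ (# 2 ⊗ # 1) ⊕ # 0 ⊗ (# 1 ⊗ (# 3 ⊗ (con 1 ⊕ # 2 ⊕ # 3)))) (# 0 ⊗ # 1 ⊗ ((con 1 ⊕ # 3) ⊗ (# 2 ⊕ (con 1 ⊕ # 3)))) 0
          (triv) refl
        where
        ρ = N ∷ P ∷ b ∷ k ∷ []

    -- The entries u u′ a a′ p w are the interior of a walk s u u′ a a′ p w t in the double cover.
    core : Vec V 6 → Bool
    core (a ∷ a′ ∷ u ∷ u′ ∷ p ∷ w ∷ []) = E u u′ ∧ (E a u′ ∧ (E a a′ ∧ (E p a′ ∧ E p w)))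

    absorbs : Vec V 6 → V → V → Bool
    absorbs (a ∷ a′ ∷ u ∷ u′ ∷ p ∷ w ∷ []) s t = E u s ∧ E t w

    ∑-tuples₆ : ∀ (f : Vec V 6 → ℕ) → ∑ (tuples 6) f ≡ ∑∑ λ a a′ → ∑∑ λ u u′ → ∑∑ λ p w → f (a ∷ a′ ∷ u ∷ u′ ∷ p ∷ w ∷ [])
    ∑-tuples₆ f = ∑-tuples 5 _ ∙ ∑-cong U λ a → ∑-tuples 4 _ ∙ ∑-cong U λ a′ → ∑-tuples 3 _ ∙ ∑-cong U λ u → ∑-tuples 2 _ ∙ ∑-cong U λ u′ →
      ∑-tuples 1 _ ∙ ∑-cong U λ p → ∑-tuples 0 _ ∙ ∑-cong U λ w → +-identityʳ _

    -- The order of the entries follows the nesting of `comp`: first the middle edge, then the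
    -- halves on the side of s and of t.
    walks-tuples : ∀ s t → walks₇ s t ≡ ∑[ g ∈ tuples 6 ] (𝟙 (core g) * 𝟙 (absorbs g s t))
    walks-tuples s t = ∑∑-cong (λ a a′ → sym (∑∑-*ʳ _ _) ∙ ∑∑-cong (λ u u′ → cong (k u u′ a *_) (sym (∑∑-*ˡ (𝟙 (E a a′)) _)) ∙ sym (∑∑-*ˡ (k u u′ a) _) ∙ ∑∑-cong λ p w →
        h (E u s) (E u u′) (E a u′) (E a a′) (E p a′) (E p w) (E t w))) ∙ sym (∑-tuples₆ _)
      where
      k : V → V → V → ℕ
      k u u′ a = 𝟙 (E u s) * (𝟙 (E u u′) * 𝟙 (E a u′))
      h : ∀ b₁ b₂ b₃ b₄ b₅ b₆ b₇ → 𝟙 b₁ * (𝟙 b₂ * 𝟙 b₃) * (𝟙 b₄ * (𝟙 b₅ * (𝟙 b₆ * 𝟙 b₇))) ≡ 𝟙 (b₂ ∧ (b₃ ∧ (b₄ ∧ (b₅ ∧ b₆)))) * 𝟙 (b₁ ∧ b₇)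
      h false b₂ b₃ b₄ b₅ b₆ b₇ = sym (*-zeroʳ (𝟙 (b₂ ∧ (b₃ ∧ (b₄ ∧ (b₅ ∧ b₆))))))
      h true false b₃ b₄ b₅ b₆ b₇ = refl
      h true true false b₄ b₅ b₆ b₇ = refl
      h true true true false b₅ b₆ b₇ = refl
      h true true true true false b₆ b₇ = refl
      h true true true true true false b₇ = refl
      h true true true true true true false = refl
      h true true true true true true true = refl

    used : List (Vec V 6) → V → ℕ
    used gs v = ∑[ g ∈ gs ] occ v (toList g)

    length-toList : ∀ {k} (xs : Vec V k) → length (toList xs) ≡ k
    length-toList [] = refl
    length-toList (x ∷ xs) = cong suc (length-toList xs)

    used-total : ∀ gs → ∑ U (used gs) ≡ length gs * 6
    used-total gs = ∑-swap U gs _ ∙ ∑-cong gs (λ g → sym (length-occ (toList g)) ∙ length-toList g) ∙ ∑-const gs 6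

    prs : List (V × V)
    prs = concatMap (λ s → map (s ,_) U) U

    Edge : V → V → Set
    Edge x y = E x y ≡ true

    -- A walk through the gadgets of a list in order. The three pieces around each gadget are stored
    -- separately, so that an absorption can reorder them.
    data Chain (y : V) : V → List (Vec V 6) → List V → Set where
      base : ∀ {x vs} → Walk Edge x y vs → Chain y x [] vs
      gad : ∀ {x a a′ u u′ p w l₁ l₂ l₃ vs gs} → core (a ∷ a′ ∷ u ∷ u′ ∷ p ∷ w ∷ []) ≡ true →
            Walk Edge x u l₁ → Walk Edge u′ p l₂ → Walk Edge w a l₃ → Chain y a′ gs vs →
            Chain y x ((a ∷ a′ ∷ u ∷ u′ ∷ p ∷ w ∷ []) ∷ gs) (l₁ ++ (l₂ ++ (l₃ ++ vs)))

    module Core {a a′ u u′ p w} (e : core (a ∷ a′ ∷ u ∷ u′ ∷ p ∷ w ∷ []) ≡ true) where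
      private
        e₂ = ∧-proj₂ {E u u′} e
        e₃ = ∧-proj₂ {E a u′} e₂
        e₄ = ∧-proj₂ {E a a′} e₃
      uu′ : Edge u u′
      uu′ = ∧-proj₁ e
      au′ : Edge a u′
      au′ = ∧-proj₁ e₂
      aa′ : Edge a a′
      aa′ = ∧-proj₁ e₃
      pa′ : Edge p a′
      pa′ = ∧-proj₁ e₄
      pw : Edge p w
      pw = ∧-proj₂ {E p a′} e₄

    forget : ∀ {y x gs vs} → Chain y x gs vs → Walk Edge x y vs
    forget (base w) = w
    forget (gad {l₁ = l₁} e w₁ w₂ w₃ c) = w₁ ⟨ uu′ ⟩++ (w₂ ⟨ pw ⟩++ (w₃ ⟨ aa′ ⟩++ forget c))
      where open Core e

    -- After an absorption the rerouted stretch is no longer a gadget; it becomes part of the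
    -- approach to the next one.
    prefix : ∀ {y x z x′ gs l vs} → Walk Edge x z l → Edge z x′ → Chain y x′ gs vs →
             ∃ λ vs′ → Chain y x gs vs′ × (∀ v → occ v vs′ ≡ occ v l + occ v vs)
    prefix {l = l} q r (base w) = _ , base (q ⟨ r ⟩++ w) , λ v → occ-++ v l _
    prefix {l = l} q r (gad {l₁ = l₁} {l₂} {l₃} {vs} e w₁ w₂ w₃ c) = _ , gad e (q ⟨ r ⟩++ w₁) w₂ w₃ c , λ v →
      occ-++ v (l ++ l₁) _ ∙ cong (_+ occ v (l₂ ++ (l₃ ++ vs))) (occ-++ v l l₁) ∙ +-assoc (occ v l) _ _ ∙ cong (occ v l +_) (sym (occ-++ v l₁ _))

    -- Absorption reroutes x…u→u′…p→w…a→a′… as x…u→s…t→w…a→u′…p→a′…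
    absorb : ∀ {y x gs vs g s t Q} → Chain y x gs vs → g ∈ gs → absorbs g s t ≡ true → Walk Edge s t Q →
             ∃ λ gs′ → (∀ f → ∑ gs f ≡ f g + ∑ gs′ f) × ∃ λ vs′ → Chain y x gs′ vs′ × (∀ v → occ v vs′ ≡ occ v vs + occ v Q)
    absorb {s = s} {t} {Q} (gad {u = u} {w = w} {l₁} {l₂} {l₃} {vs} {gs} e w₁ w₂ w₃ c) (here refl) ab q with
      prefix (w₁ ⟨ ∧-proj₁ ab ⟩++ (q ⟨ ∧-proj₂ {E u s} ab ⟩++ (w₃ ⟨ Core.au′ e ⟩++ w₂))) (Core.pa′ e) c
    ... | vs′ , c′ , o = gs , (λ f → refl) , vs′ , c′ , λ v → o v ∙ cong (_+ occ v vs) (occ-++ v l₁ _ ∙ cong (occ v l₁ +_) (occ-++ v Q _ ∙ cong (occ v Q +_) (occ-++ v l₃ l₂)))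
        ∙ shuffle (occ v l₁) (occ v l₂) (occ v l₃) (occ v Q) (occ v vs) ∙ cong (_+ occ v Q) (sym (occ-++ v l₁ _ ∙ cong (occ v l₁ +_) (occ-++ v l₂ _ ∙ cong (occ v l₂ +_) (occ-++ v l₃ vs))))
      where
      shuffle : ∀ a b c q v → a + (q + (c + b)) + v ≡ a + (b + (c + v)) + q
      shuffle a b c q v =
          ≤-antisym
          (lin ρ (# 0 ⊕ (# 3 ⊕ (# 2 ⊕ # 1)) ⊕ # 4) (# 0 ⊕ (# 1 ⊕ (# 2 ⊕ # 4)) ⊕ # 3) 0
          (triv) refl)
          (lin ρ (# 0 ⊕ (# 1 ⊕ (# 2 ⊕ # 4)) ⊕ # 3) (# 0 ⊕ (# 3 ⊕ (# 2 ⊕ # 1)) ⊕ # 4) 0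
          (triv) refl)
        where
        ρ = a ∷ b ∷ c ∷ q ∷ v ∷ []
    absorb {g = g} {Q = Q} (gad {a = a} {a′} {u} {u′} {p} {w} {l₁} {l₂} {l₃} {vs} e w₁ w₂ w₃ c) (there i) ab q with absorb c i ab q
    ... | gs′ , h , vs′ , c′ , o = _ ∷ gs′ , (λ f → cong (f (a ∷ a′ ∷ u ∷ u′ ∷ p ∷ w ∷ []) +_) (h f) ∙ swap+ [] (f (a ∷ a′ ∷ u ∷ u′ ∷ p ∷ w ∷ [])) (f g) (∑ gs′ f)) , _ , gad e w₁ w₂ w₃ c′ ,
        λ v → occ-++ v l₁ _ ∙ cong (occ v l₁ +_) (occ-++ v l₂ _ ∙ cong (occ v l₂ +_) (occ-++ v l₃ vs′))
          ∙ cong (λ k → occ v l₁ + (occ v l₂ + (occ v l₃ + k))) (o v) ∙ reassoc (occ v l₁) (occ v l₂) (occ v l₃) (occ v vs) (occ v Q)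
          ∙ cong (_+ occ v Q) (sym (occ-++ v l₁ _ ∙ cong (occ v l₁ +_) (occ-++ v l₂ _ ∙ cong (occ v l₂ +_) (occ-++ v l₃ vs))))
      where
      reassoc : ∀ a b c v q → a + (b + (c + (v + q))) ≡ a + (b + (c + v)) + q
      reassoc a b c v q =
          ≤-antisym
          (lin ρ (# 0 ⊕ (# 1 ⊕ (# 2 ⊕ (# 3 ⊕ # 4)))) (# 0 ⊕ (# 1 ⊕ (# 2 ⊕ # 3)) ⊕ # 4) 0
          (triv) refl)
          (lin ρ (# 0 ⊕ (# 1 ⊕ (# 2 ⊕ # 3)) ⊕ # 4) (# 0 ⊕ (# 1 ⊕ (# 2 ⊕ (# 3 ⊕ # 4)))) 0
          (triv) refl)
        where
        ρ = a ∷ b ∷ c ∷ v ∷ q ∷ []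

    -- Absorbing a path uses up one gadget and thus lowers the supply of every pair by at most one,
    -- just as the demand drops by one.
    absorb-all : ∀ {y x gs vs} (ps : List (Path Edge)) → Chain y x gs vs → (∀ s t → length ps ≤ ∑[ g ∈ gs ] 𝟙 (absorbs g s t)) →
                 ∃ λ vs′ → Walk Edge x y vs′ × (∀ v → occ v vs′ ≡ occ v vs + inside v ps)
    absorb-all [] c h = _ , forget c , λ v → sym (+-identityʳ _)
    absorb-all {gs = gs} {vs} (P ∷ ps) c h with ∑-pos gs (λ g → 𝟙 (absorbs g (hd P) (tl P))) (≤-trans (s≤s z≤n) (h (hd P) (tl P)))
    ... | g , g∈ , ab with absorb c g∈ (𝟙-true ab) (Path.walk P)
    ...   | gs′ , pk , vs′ , c′ , o with absorb-all ps c′ (λ s t → ≤-pred (≤-trans (h s t) (≤-trans (≤-reflexive (pk _)) (+-monoˡ-≤ _ (𝟙≤1 (absorbs g s t))))))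
    ...     | vs″ , w , o′ = vs″ , w , λ v → o′ v ∙ cong (_+ inside v ps) (o v) ∙ +-assoc (occ v vs) _ _

    -- Joining the gadgets to one closed walk

    module Building (L β : ℕ)
      (connect : ∀ (F : V → Bool) → size F ≤ β → ∀ a b → ∃ λ y → ∃ λ l → Walk Edge a y (a ∷ l) × Edge y b × (∀ v → occ v l ≤ 𝟙 (not (F v))) × length l ≤ L) where

      connect′ : ∀ fl → (∀ v → occ v fl ≤ 1) → length fl ≤ β → ∀ a b →
        ∃ λ y → ∃ λ l → Walk Edge a y (a ∷ l) × Edge y b × (∀ v → occ v (l ++ fl) ≤ 1) × length (l ++ fl) ≤ L + length fl
      connect′ fl h hβ a b with connect (λ v → 1 ≤ᵇ occ v fl) (≤-trans (∑-mono U (λ v → k (occ v fl))) (≤-trans (≤-reflexive (sym (length-occ fl))) hβ)) a b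
        where
        k : ∀ n → 𝟙 (1 ≤ᵇ n) ≤ n
        k zero = z≤n
        k (suc n) = s≤s z≤n
      ... | y , l , w , e , o , len = y , l , w , e , (λ v → ≤-trans (≤-reflexive (occ-++ v l fl)) (k (occ v l) (occ v fl) (o v) (h v))) ,
          ≤-trans (≤-reflexive (length-++ l)) (+-monoˡ-≤ (length fl) len)
        where
        k : ∀ m n → m ≤ 𝟙 (not (1 ≤ᵇ n)) → n ≤ 1 → m + n ≤ 1
        k m zero p q = ≤-trans (≤-reflexive (+-identityʳ m)) p
        k m (suc n) p q = ≤-trans (+-monoˡ-≤ (suc n) p) q

      len₁ : ∀ L f k b → f + (3 * suc k + 1) * L ≤ b → f ≤ b
      len₁ L f k b H1 =
          lin ρ (# 1) (# 3) 0
          ((# 1 ⊕ (con 3 ⊗ (con 1 ⊕ # 2) ⊕ con 1) ⊗ # 0 ≼ # 3 by H1)) refl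
        where
        ρ = L ∷ f ∷ k ∷ b ∷ []

      len₂ : ∀ L x f k b → f + (3 * suc k + 1) * L ≤ b → x ≤ L + f → x ≤ b
      len₂ L x f k b H1 H2 =
          lin ρ (# 1) (# 4) 0
          ((# 2 ⊕ (con 3 ⊗ (con 1 ⊕ # 3) ⊕ con 1) ⊗ # 0 ≼ # 4 by H1)
            ⊞ (# 1 ≼ # 0 ⊕ # 2 by H2)) refl
        where
        ρ = L ∷ x ∷ f ∷ k ∷ b ∷ []

      len₃ : ∀ L x y f k b → f + (3 * suc k + 1) * L ≤ b → x ≤ L + f → y ≤ L + x → y ≤ b
      len₃ L x y f k b H1 H2 H3 =
          lin ρ (# 2) (# 5) 0
          ((# 3 ⊕ (con 3 ⊗ (con 1 ⊕ # 4) ⊕ con 1) ⊗ # 0 ≼ # 5 by H1)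
            ⊞ (# 1 ≼ # 0 ⊕ # 3 by H2)
            ⊞ (# 2 ≼ # 0 ⊕ # 1 by H3)) refl
        where
        ρ = L ∷ x ∷ y ∷ f ∷ k ∷ b ∷ []

      len₄ : ∀ L x y z f k b → f + (3 * suc k + 1) * L ≤ b → x ≤ L + f → y ≤ L + x → z ≤ L + y → z + (3 * k + 1) * L ≤ b
      len₄ L x y z f k b H1 H2 H3 H4 =
          lin ρ (# 3 ⊕ (con 3 ⊗ # 5 ⊕ con 1) ⊗ # 0) (# 6) 0
          ((# 4 ⊕ (con 3 ⊗ (con 1 ⊕ # 5) ⊕ con 1) ⊗ # 0 ≼ # 6 by H1)
            ⊞ (# 1 ≼ # 0 ⊕ # 4 by H2)
            ⊞ (# 2 ≼ # 0 ⊕ # 1 by H3)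
            ⊞ (# 3 ≼ # 0 ⊕ # 2 by H4)) refl
        where
        ρ = L ∷ x ∷ y ∷ z ∷ f ∷ k ∷ b ∷ []

      len₅ : ∀ L x y z f k o → x ≤ L + f → y ≤ L + x → z ≤ L + y → o ≤ z + (3 * k + 1) * L → o ≤ f + (3 * suc k + 1) * L
      len₅ L x y z f k o H2 H3 H4 H5 =
          lin ρ (# 6) (# 4 ⊕ (con 3 ⊗ (con 1 ⊕ # 5) ⊕ con 1) ⊗ # 0) 0
          ((# 1 ≼ # 0 ⊕ # 4 by H2)
            ⊞ (# 2 ≼ # 0 ⊕ # 1 by H3)
            ⊞ (# 3 ≼ # 0 ⊕ # 2 by H4)
            ⊞ (# 6 ≼ # 3 ⊕ (con 3 ⊗ # 5 ⊕ con 1) ⊗ # 0 by H5)) refl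
        where
        ρ = L ∷ x ∷ y ∷ z ∷ f ∷ k ∷ o ∷ []

      -- Each gadget takes three connections and the closing takes one more, each forbidding at most
      -- `L` further vertices. The final equation is an exact ledger: if `fl` consists of the start
      -- and all gadget vertices, it says that the walk visits precisely the vertices of `fl′`.
      build : ∀ gs fl x z → (∀ {g} → g ∈ gs → core g ≡ true) → (∀ v → occ v fl ≤ 1) → length fl + (3 * length gs + 1) * L ≤ β →
              ∃ λ y → ∃ λ vs → Chain y x gs vs × Edge y z × ∃ λ fl′ → (∀ v → occ v fl′ ≤ 1) × (length fl′ ≤ length fl + (3 * length gs + 1) * L)
                × (∀ v → occ v vs + occ v fl ≡ 𝟙 (x == v) + used gs v + occ v fl′)
      build [] fl x z cs h hl with connect′ fl h (≤-trans (m≤m+n _ _) hl) x z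
      ... | y , l , w , e , o , len = y , _ , base w , e , l ++ fl , o , ≤-trans len (≤-reflexive (+-comm L _ ∙ cong (length fl +_) (sym (+-identityʳ L)))) ,
          λ v → +-assoc (𝟙 (x == v)) _ _ ∙ cong₂ _+_ (sym (+-identityʳ (𝟙 (x == v)))) (sym (occ-++ v l fl))
      build ((a ∷ a′ ∷ u ∷ u′ ∷ p ∷ w ∷ []) ∷ gs) fl x z cs h hl
        with connect′ fl h (len₁ L (length fl) (length gs) β hl) x u
      ... | y₁ , l₁ , w₁ , e₁ , o₁ , n₁ with connect′ (l₁ ++ fl) o₁ (len₂ L _ (length fl) (length gs) β hl n₁) u′ p
      ... | y₂ , l₂ , w₂ , e₂ , o₂ , n₂ with connect′ (l₂ ++ (l₁ ++ fl)) o₂ (len₃ L _ _ (length fl) (length gs) β hl n₁ n₂) w a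
      ... | y₃ , l₃ , w₃ , e₃ , o₃ , n₃ with build gs (l₃ ++ (l₂ ++ (l₁ ++ fl))) a′ z (cs ∘ there) o₃ (len₄ L _ _ _ (length fl) (length gs) β hl n₁ n₂ n₃)
      ... | y , vs , c , e , fl′ , o , n , q = y , _ , gad (cs (here refl)) (w₁ ⟨ e₁ ⟩++ [ u ]) (w₂ ⟨ e₂ ⟩++ [ p ]) (w₃ ⟨ e₃ ⟩++ [ a ]) c , e , fl′ , o ,
          len₅ L _ _ _ (length fl) (length gs) _ n₁ n₂ n₃ n , tally
        where
        three : ∀ v l l′ l″ r → occ v (l ++ (l′ ++ (l″ ++ r))) ≡ occ v l + (occ v l′ + (occ v l″ + occ v r))
        three v l l′ l″ r = occ-++ v l _ ∙ cong (occ v l +_) (occ-++ v l′ _ ∙ cong (occ v l′ +_) (occ-++ v l″ r))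
        total : ∀ x u l1 u2 p l2 w a l3 vs fl a2 us fl2 → vs + (l3 + (l2 + (l1 + fl))) ≡ a2 + us + fl2 → x + (l1 + (u + 0)) + (u2 + (l2 + (p + 0)) + (w + (l3 + (a + 0)) + vs)) + fl ≡ x + (a + (a2 + (u + (u2 + (p + (w + 0))))) + us) + fl2
        total x u l1 u2 p l2 w a l3 vs fl a2 us fl2 H =
            ≤-antisym
            (lin ρ (# 0 ⊕ (# 2 ⊕ (# 1 ⊕ con 0)) ⊕ (# 3 ⊕ (# 5 ⊕ (# 4 ⊕ con 0)) ⊕ (# 6 ⊕ (# 8 ⊕ (# 7 ⊕ con 0)) ⊕ # 9)) ⊕ # 10) (# 0 ⊕ (# 7 ⊕ (# 11 ⊕ (# 1 ⊕ (# 3 ⊕ (# 4 ⊕ (# 6 ⊕ con 0))))) ⊕ # 12) ⊕ # 13) 0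
            ((# 9 ⊕ (# 8 ⊕ (# 5 ⊕ (# 2 ⊕ # 10))) ≼ # 11 ⊕ # 12 ⊕ # 13 by ≤-reflexive H)) refl)
            (lin ρ (# 0 ⊕ (# 7 ⊕ (# 11 ⊕ (# 1 ⊕ (# 3 ⊕ (# 4 ⊕ (# 6 ⊕ con 0))))) ⊕ # 12) ⊕ # 13) (# 0 ⊕ (# 2 ⊕ (# 1 ⊕ con 0)) ⊕ (# 3 ⊕ (# 5 ⊕ (# 4 ⊕ con 0)) ⊕ (# 6 ⊕ (# 8 ⊕ (# 7 ⊕ con 0)) ⊕ # 9)) ⊕ # 10) 0
            ((# 11 ⊕ # 12 ⊕ # 13 ≼ # 9 ⊕ (# 8 ⊕ (# 5 ⊕ (# 2 ⊕ # 10))) by ≤-reflexive (sym H))) refl)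
          where
          ρ = x ∷ u ∷ l1 ∷ u2 ∷ p ∷ l2 ∷ w ∷ a ∷ l3 ∷ vs ∷ fl ∷ a2 ∷ us ∷ fl2 ∷ []
        tally : ∀ v → occ v ((x ∷ l₁ ++ u ∷ []) ++ ((u′ ∷ l₂ ++ p ∷ []) ++ ((w ∷ l₃ ++ a ∷ []) ++ vs))) + occ v fl
              ≡ 𝟙 (x == v) + used ((a ∷ a′ ∷ u ∷ u′ ∷ p ∷ w ∷ []) ∷ gs) v + occ v fl′
        tally v = cong (_+ occ v fl) (three v (x ∷ l₁ ++ u ∷ []) (u′ ∷ l₂ ++ p ∷ []) (w ∷ l₃ ++ a ∷ []) vs
              ∙ cong₂ _+_ (cong (𝟙 (x == v) +_) (occ-++ v l₁ (u ∷ []))) (cong₂ _+_ (cong (𝟙 (u′ == v) +_) (occ-++ v l₂ (p ∷ []))) (cong (_+ occ v vs) (cong (𝟙 (w == v) +_) (occ-++ v l₃ (a ∷ []))))))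
            ∙ total (𝟙 (x == v)) (𝟙 (u == v)) (occ v l₁) (𝟙 (u′ == v)) (𝟙 (p == v)) (occ v l₂) (𝟙 (w == v)) (𝟙 (a == v)) (occ v l₃) (occ v vs) (occ v fl)
                (𝟙 (a′ == v)) (used gs v) (occ v fl′) (cong (occ v vs +_) (sym (three v l₃ l₂ l₁ fl)) ∙ q v)

    module Assembly (m L β : ℕ) where

      module _ (gs : List (Vec V 6)) (cores : ∀ {g} → g ∈ gs → core g ≡ true) (disjoint : ∀ v → used gs v ≤ 1)
        (many : ∀ s t → m ≤ ∑[ g ∈ gs ] 𝟙 (absorbs g s t))
        (β-big : suc (length gs * 6) + (3 * length gs + 1) * L ≤ β) (β≤N : β ≤ N)
        (connect : ∀ (F : V → Bool) → size F ≤ β → ∀ a b → ∃ λ y → ∃ λ l → Walk Edge a y (a ∷ l) × Edge y b × (∀ v → occ v l ≤ 𝟙 (not (F v))) × length l ≤ L)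
        (cover : ∀ W → size (not ∘ W) ≤ β → ∃ λ (ps : List (Path Edge)) → length ps ≤ m × (∀ v → inside v ps ≡ 𝟙 (W v))) where

        open Building L β connect

        -- An anchor: the closed walk leaves this vertex, passes all gadgets and returns, so it must
        -- not lie in a gadget.
        free-vertex : ∃ λ z₀ → used gs z₀ < 1
        free-vertex with ∑-<⇒∃ U {used gs} {λ _ → 1} (≤-<-trans (≤-reflexive (used-total gs))
            (<-≤-trans (beta-lt β N (length gs) L β-big β≤N) (≤-reflexive (sym (∑U-const 1 ∙ *-identityʳ N)))))
        ... | z₀ , _ , h = z₀ , h

        z₀ = proj₁ free-vertex

        fl : List V
        fl = z₀ ∷ concatMap toList gs

        occ-fl : ∀ v → occ v fl ≡ 𝟙 (z₀ == v) + used gs v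
        occ-fl v = cong (𝟙 (z₀ == v) +_) (∑-concatMap toList gs _)

        occ-fl≤1 : ∀ v → occ v fl ≤ 1
        occ-fl≤1 v with z₀ ≟ v | occ-fl v
        ... | yes refl | e = ≤-trans (≤-reflexive e) (proj₂ free-vertex)
        ... | no _ | e = ≤-trans (≤-reflexive e) (disjoint v)

        length-fl : length fl ≡ suc (length gs * 6)
        length-fl = cong suc (length-∑ (concatMap toList gs) ∙ ∑-concatMap toList gs _ ∙ ∑-cong gs (λ g → sym (length-∑ (toList g)) ∙ length-toList g) ∙ ∑-const gs 6)

        fits : length fl + (3 * length gs + 1) * L ≤ β
        fits = ≤-trans (≤-reflexive (cong (_+ (3 * length gs + 1) * L) length-fl)) β-big

        private
          B = build gs fl z₀ z₀ cores occ-fl≤1 fits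
          trunk = proj₁ (proj₂ B)
          chain = proj₁ (proj₂ (proj₂ B))
          fl′ = proj₁ (proj₂ (proj₂ (proj₂ (proj₂ B))))

        occ-trunk : ∀ v → occ v trunk ≡ occ v fl′
        occ-trunk v = +-cancelʳ-≡ (occ v fl) (occ v trunk) (occ v fl′) (proj₂ (proj₂ (proj₂ (proj₂ (proj₂ (proj₂ (proj₂ B)))))) v ∙ cong (_+ occ v fl′) (sym (occ-fl v)) ∙ +-comm (occ v fl) (occ v fl′))

        occ-trunk≤1 : ∀ v → occ v trunk ≤ 1
        occ-trunk≤1 v = ≤-trans (≤-reflexive (occ-trunk v)) (proj₁ (proj₂ (proj₂ (proj₂ (proj₂ (proj₂ B))))) v)

        rest : V → Bool
        rest v = not (1 ≤ᵇ occ v trunk)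

        rest+occ : ∀ v → occ v trunk + 𝟙 (rest v) ≡ 1
        rest+occ v = h (occ v trunk) (occ-trunk≤1 v)
          where
          h : ∀ n → n ≤ 1 → n + 𝟙 (not (1 ≤ᵇ n)) ≡ 1
          h zero _ = refl
          h (suc zero) _ = refl
          h (suc (suc n)) (s≤s ())

        rest≤β : size (not ∘ rest) ≤ β
        rest≤β = ≤-trans (∑-mono U λ v → h (occ v trunk)) (≤-trans (≤-reflexive (∑-cong U occ-trunk ∙ sym (length-occ fl′)))
            (≤-trans (proj₁ (proj₂ (proj₂ (proj₂ (proj₂ (proj₂ (proj₂ B))))))) fits))
          where
          h : ∀ n → 𝟙 (not (not (1 ≤ᵇ n))) ≤ n
          h zero = z≤n
          h (suc n) = s≤s z≤n

        close : ∀ (ps : List (Path Edge)) → (∀ v → inside v ps ≡ 𝟙 (rest v)) →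
                (∃ λ vs′ → Walk Edge z₀ (proj₁ B) vs′ × (∀ v → occ v vs′ ≡ occ v trunk + inside v ps)) → Cyclic E
        close ps inside-ps (vs′ , w , o) = record { route = w ; closes = proj₁ (proj₂ (proj₂ (proj₂ B)))
          ; once = λ v → o v ∙ cong (occ v trunk +_) (inside-ps v) ∙ rest+occ v }

        cycle : Cyclic E
        cycle = swallow (cover rest rest≤β)
          where
          swallow : (∃ λ (ps : List (Path Edge)) → length ps ≤ m × (∀ v → inside v ps ≡ 𝟙 (rest v))) → Cyclic E
          swallow (ps , short , inside-ps) = close ps inside-ps (absorb-all ps chain (λ s t → ≤-trans short (many s t)))

    -- Robustly connected digraphs that are D-regular up to a total error Δ

    module Robust (c D Δ : ℕ) (1≤N : 1 ≤ N) (W₇ : ∀ s t → N * N * N * N * N * N ≤ c * walks₇ s t)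
      (reg⁺ : ∀ S → D * size S ≤ edges S (λ _ → true) + Δ) (reg⁻ : ∀ S → edges (λ _ → true) S ≤ D * size S + Δ) where

      all : V → Bool
      all _ = true

      outdeg′ indeg′ : V → ℕ
      outdeg′ x = ∑[ y ∈ U ] 𝟙 (E x y)
      indeg′ y = ∑[ x ∈ U ] 𝟙 (E x y)

      walks₃-out : ∀ y x → walks₃ y x ≤ N * outdeg′ x
      walks₃-out y x = ∑U-bound _ λ a → ∑-mono U λ b →
        ≤-trans (*-mono-≤ (𝟙≤1 (E a y)) (≤-trans (*-monoˡ-≤ (𝟙 (E x b)) (𝟙≤1 (E a b))) (≤-reflexive (*-identityˡ _)))) (≤-reflexive (*-identityˡ _))

      walks₃-in : ∀ y x → walks₃ y x ≤ N * indeg′ y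
      walks₃-in y x = ≤-trans (∑-mono U λ a → ∑U-bound (𝟙 (E a y)) λ b →
          ≤-trans (*-monoʳ-≤ (𝟙 (E a y)) (*-mono-≤ (𝟙≤1 (E a b)) (𝟙≤1 (E x b)))) (≤-reflexive (*-identityʳ _))) (≤-reflexive (∑-*ˡ U N _))

      walks₃-bound : ∀ y x → walks₃ y x ≤ N * N
      walks₃-bound y x = ≤-trans (comp-bound walks₁ 1 (λ y x → 𝟙≤1 (E x y)) y x) (≤-reflexive (cong (N *_) (*-identityʳ N)))

      deg-from-walks : ∀ N c d w → N * N * N * N * N * N ≤ c * w → w ≤ N * (N * (N * d * (N * N))) → N * N * N * N * N * N ≤ N * N * N * N * N * (c * d)
      deg-from-walks N c d w H1 H2 =
          lin ρ (# 0 ⊗ # 0 ⊗ # 0 ⊗ # 0 ⊗ # 0 ⊗ # 0) (# 0 ⊗ # 0 ⊗ # 0 ⊗ # 0 ⊗ # 0 ⊗ (# 1 ⊗ # 2)) 0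
          ((# 0 ⊗ # 0 ⊗ # 0 ⊗ # 0 ⊗ # 0 ⊗ # 0 ≼ # 1 ⊗ # 3 by H1)
            ⊞ (# 1 ⊗ # 3 ≼ # 1 ⊗ (# 0 ⊗ (# 0 ⊗ (# 0 ⊗ # 2 ⊗ (# 0 ⊗ # 0)))) by *-monoʳ-≤ (c) (H2))) refl
        where
        ρ = N ∷ c ∷ d ∷ w ∷ []

      N⁵>0 : 0 < N * N * N * N * N
      N⁵>0 = *-mono-≤ (*-mono-≤ (*-mono-≤ (*-mono-≤ 1≤N 1≤N) 1≤N) 1≤N) 1≤N

      -- All walks counted for `x` finish with an edge out of `x`, so a positive proportion of walks
      -- forces a linear degree.
      outdeg-bound : ∀ x → N ≤ c * outdeg′ x
      outdeg-bound x = *-cancelˡ-≤ (N * N * N * N * N) {{>-nonZero N⁵>0}} (deg-from-walks N c (outdeg′ x) (walks₇ x x) (W₇ x x)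
        (∑U-bound _ λ a → ∑U-bound _ λ b → ≤-trans (*-mono-≤ (walks₃-bound x a) (*-mono-≤ (𝟙≤1 (E a b)) (walks₃-out b x)))
           (≤-reflexive (cong (N * N *_) (*-identityˡ _) ∙ *-comm (N * N) _))))

      indeg-bound : ∀ x → N ≤ c * indeg′ x
      indeg-bound x = *-cancelˡ-≤ (N * N * N * N * N) {{>-nonZero N⁵>0}} (deg-from-walks N c (indeg′ x) (walks₇ x x) (W₇ x x)
        (∑U-bound _ λ a → ∑U-bound _ λ b → *-mono-≤ (walks₃-in x a) (≤-trans (*-mono-≤ (𝟙≤1 (E a b)) (walks₃-bound b x)) (≤-reflexive (*-identityˡ _)))))

      ∑-+³ : ∀ (f g h : V → ℕ) → ∑ U (λ x → f x + g x + h x) ≡ ∑ U f + ∑ U g + ∑ U h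
      ∑-+³ f g h = ∑-+ U (λ x → f x + g x) h ∙ cong (_+ ∑ U h) (∑-+ U f g)

      ∑∑-+³ : ∀ (f g h : V → V → ℕ) → ∑∑ (λ x y → f x y + g x y + h x y) ≡ ∑∑ f + ∑∑ g + ∑∑ h
      ∑∑-+³ f g h = ∑∑-+ (λ x y → f x y + g x y) h ∙ cong (_+ ∑∑ h) (∑∑-+ f g)

      size-not : ∀ A → size A + size (not ∘ A) ≡ N
      size-not = card-not

      edges-splitʳ : ∀ A B → edges A all ≡ edges A B + edges A (not ∘ B)
      edges-splitʳ A B = ∑∑-cong (λ x y → h (A x) (B y) (E x y)) ∙ ∑∑-+ _ _
        where
        h : ∀ a b e → 𝟙 a * (1 * 𝟙 e) ≡ 𝟙 a * (𝟙 b * 𝟙 e) + 𝟙 a * (𝟙 (not b) * 𝟙 e)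
        h false _ _ = refl
        h true true e = sym (+-identityʳ _)
        h true false e = refl

      edges-splitˡ : ∀ A B → edges all B ≡ edges A B + edges (not ∘ A) B
      edges-splitˡ A B = ∑∑-cong (λ x y → h (A x) (B y) (E x y)) ∙ ∑∑-+ _ _
        where
        h : ∀ a b e → 1 * (𝟙 b * 𝟙 e) ≡ 𝟙 a * (𝟙 b * 𝟙 e) + 𝟙 (not a) * (𝟙 b * 𝟙 e)
        h true b e = sym (+-identityʳ _)
        h false b e = refl

      expansion : ∀ A B → size B * size (not ∘ A) ≤ 7 * c * cut A B
      expansion A B = cut-expansion c A B 1≤N W₇

      -- Complementing both sets leaves the cut unchanged.
      expansion′ : ∀ A B → size (not ∘ B) * size A ≤ 7 * c * cut A B
      expansion′ A B = ≤-trans (≤-reflexive (cong (size (not ∘ B) *_) (∑-cong U λ x → cong 𝟙 (nn (A x)))))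
        (≤-trans (expansion (not ∘ A) (not ∘ B)) (≤-reflexive (cong (7 * c *_) (cong₂ _+_
          (∑∑-cong λ x y → cong (λ b → 𝟙 (not (A x)) * (𝟙 b * 𝟙 (E x y))) (sym (nn (B y))))
          (∑∑-cong λ x y → cong (λ b → 𝟙 b * (𝟙 (not (B y)) * 𝟙 (E x y))) (sym (nn (A x)))) ∙ +-comm _ (edges A (not ∘ B))))))
        where
        nn : ∀ a → a ≡ not (not a)
        nn true = refl
        nn false = refl

      cut-bound : ∀ S T κ → edges S (not ∘ T) ≤ κ → size T < size S → cut S T ≤ 2 * Δ + 2 * κ
      cut-bound S T κ h lt = cut-arith D (size S) (size T) Δ κ (edges S all) (edges S T) (edges S (not ∘ T)) (edges (not ∘ S) T) (edges all T)
        (reg⁺ S) (reg⁻ T) (edges-splitʳ S T) (edges-splitˡ S T) h lt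

      -- Hall's condition for a subrelation M of E on W: a violating pair (S , T) would be a sparse cut.
      module _ (M : V → V → Bool) (W : V → Bool) (κ μ : ℕ)
        (lost : edges W (λ _ → true) ≤ ∑∑ (λ x y → 𝟙 (M x y)) + κ)
        (M⊆ : ∀ x y → M x y ≡ true → W x ≡ true × W y ≡ true × E x y ≡ true)
        (out≥ : ∀ x → W x ≡ true → μ ≤ ∑[ y ∈ U ] 𝟙 (M x y))
        (in≥ : ∀ y → W y ≡ true → μ ≤ ∑[ x ∈ U ] 𝟙 (M x y))
        (slack : 14 * c * (2 * Δ + 2 * κ) < μ * N) where

        open Matching M

        lost-step : ∀ w s t m e → (m ≡ true → w ≡ true × e ≡ true) → (s ≡ true → w ≡ true) → (s ≡ true → m ≡ true → t ≡ true) →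
           𝟙 s * (𝟙 (not t) * 𝟙 e) + 𝟙 m ≤ 𝟙 w * (1 * 𝟙 e)
        lost-step w s t true e h1 h2 h3 with h1 refl
        lost-step w false t true e h1 h2 h3 | refl , refl = ≤-refl
        lost-step w true t true e h1 h2 h3 | refl , refl rewrite h3 refl refl = ≤-refl
        lost-step w false t false e h1 h2 h3 = z≤n
        lost-step w true t false e h1 h2 h3 rewrite h2 refl with t
        ... | true = z≤n
        ... | false = ≤-reflexive (+-identityʳ _)

        hall-condition : HallCondition W W
        hall-condition S S⊆W with card S ≤? card (λ y → W y ∧ nb S y)
        ... | yes p = p
        ... | no ¬p = ⊥-elim (<⇒≱ slack (bad (≰⇒> ¬p)))
          where
          T′ : V → Bool
          T′ y = W y ∧ nb S y
          sparse : edges S (not ∘ T′) ≤ κ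
          sparse = +-cancelʳ-≤ (∑∑ (λ x y → 𝟙 (M x y))) _ _ (≤-trans (≤-reflexive (sym (∑∑-+ _ _)))
            (≤-trans (∑∑-mono λ x y → lost-step (W x) (S x) (T′ y) (M x y) (E x y) (λ e → let (p , _ , q) = M⊆ x y e in p , q) (S⊆W x)
                 (λ p q → ∧-intro (proj₁ (proj₂ (M⊆ x y q))) (nb-intro {S} p q)))
              (≤-trans lost (≤-reflexive (+-comm _ κ)))))
          bad : size T′ < size S → μ * N ≤ 14 * c * (2 * Δ + 2 * κ)
          bad lt with card-pos S (≤-trans (s≤s z≤n) lt)
          ... | x , px with ∑-<⇒∃ U {𝟙 ∘ T′} {𝟙 ∘ W} (<-≤-trans lt (card-mono S⊆W))
          -- Expansion bounds the product of the sizes of `S` and of the complement of `T′`. If `S`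
          -- holds half of the vertices, the in-neighbours of `y` avoid it and make the other factor
          -- at least μ. Otherwise that factor is at least N/2, and the out-neighbours of `x` lie in
          -- `T′`, which is smaller than `S`.
          ... | y , _ , yT<yW with N ≤? 2 * size S
          ... | yes p = big-arith N μ (size S) (size (not ∘ T′)) c χ p (≤-trans μ≤nS nS≤nT) exp
            where
            χ = 2 * Δ + 2 * κ
            exp : size (not ∘ T′) * size S ≤ 7 * c * χ
            exp = ≤-trans (expansion′ S T′) (*-monoʳ-≤ (7 * c) (cut-bound S T′ κ sparse lt))
            nS≤nT = compl-lt N (size S) (size (not ∘ S)) (size T′) (size (not ∘ T′)) (size-not S) (size-not T′) lt
            yW : W y ≡ true × T′ y ≡ false
            yW = 𝟙<𝟙 (T′ y) (W y) yT<yW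
            μ≤nS : μ ≤ size (not ∘ S)
            μ≤nS = ≤-trans (in≥ y (proj₁ yW)) (∑-mono U λ z → ⊆ᵇ-𝟙 λ e → h z e)
              where
              h : ∀ z → M z y ≡ true → not (S z) ≡ true
              h z e with S z in eq
              ... | false = refl
              ... | true = ⊥-elim (true≢false (sym (∧-intro (proj₁ yW) (nb-intro {S} eq e)) ∙ proj₂ yW))
          ... | no ¬p = big-arith2 N μ (size S) (size (not ∘ S)) (size (not ∘ T′)) c χ (half N (size S) (size (not ∘ S)) (size-not S) (≰⇒> ¬p)) μ≤S exp nS≤nT
            where
            χ = 2 * Δ + 2 * κ
            exp : size (not ∘ T′) * size S ≤ 7 * c * χ
            exp = ≤-trans (expansion′ S T′) (*-monoʳ-≤ (7 * c) (cut-bound S T′ κ sparse lt))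
            nS≤nT = compl-lt N (size S) (size (not ∘ S)) (size T′) (size (not ∘ T′)) (size-not S) (size-not T′) lt
            μ≤S : μ ≤ size S
            μ≤S = ≤-trans (out≥ x (S⊆W x px)) (≤-trans (∑-mono U λ z → ⊆ᵇ-𝟙 λ e → ∧-intro (proj₁ (proj₂ (M⊆ x z e))) (nb-intro {S} px e)) (<⇒≤ lt))

        perfect : Saturating W W
        perfect = hall (card W) W W ≤-refl hall-condition

      record Factor (W : V → Bool) (k : ℕ) : Set where
        field
          rel : V → V → Bool
          rel⊆ : ∀ x y → rel x y ≡ true → W x ≡ true × W y ≡ true × E x y ≡ true
          out-k : ∀ x → ∑[ y ∈ U ] 𝟙 (rel x y) ≡ k * 𝟙 (W x)
          in-k : ∀ y → ∑[ x ∈ U ] 𝟙 (rel x y) ≤ k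
      open Factor

      lost-arith : ∀ N k b t m w r → t ≤ m + w + r → w ≤ N * b → r ≤ N * k → t ≤ m + (b + k) * N
      lost-arith N k b t m w r H1 H2 H3 =
          lin ρ (# 3) (# 4 ⊕ (# 2 ⊕ # 1) ⊗ # 0) 0
          ((# 3 ≼ # 4 ⊕ # 5 ⊕ # 6 by H1)
            ⊞ (# 5 ≼ # 0 ⊗ # 2 by H2)
            ⊞ (# 6 ≼ # 0 ⊗ # 1 by H3)) refl
        where
        ρ = N ∷ k ∷ b ∷ t ∷ m ∷ w ∷ r ∷ []

      -- The vertices left out and the k-factor found so far cost at most (b + k) N edges. What
      -- remains still has a matching that saturates `W`, and this is added to the factor.
      extend : ∀ W k b → size (not ∘ W) ≤ b → 28 * c * c * Δ + 28 * c * c * (b + k) * N + c * (b + k) * N < N * N → Factor W k → Factor W (suc k)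
      extend W k b hb hs F = record
        { rel = λ x y → rel F x y ∨ mem es x y
        ; rel⊆ = r⊆
        ; out-k = λ x → ∑-cong U (λ y → split x y) ∙ ∑-+ U _ _ ∙ cong₂ _+_ (out-k F x) (mem-out x) ∙ +-comm (k * 𝟙 (W x)) _
        ; in-k = λ y → ≤-trans (≤-reflexive (∑-cong U (λ x → split x y) ∙ ∑-+ U _ _)) (≤-trans (+-mono-≤ (in-k F y) (mem-in y)) (≤-reflexive (+-comm k 1))) }
        where
        M : V → V → Bool
        M x y = (W x ∧ (W y ∧ E x y)) ∧ not (rel F x y)
        M⊆ : ∀ x y → M x y ≡ true → W x ≡ true × W y ≡ true × E x y ≡ true
        M⊆ x y e = let f = ∧-proj₁ e ; g = ∧-proj₂ {W x} f in ∧-proj₁ f , ∧-proj₁ g , ∧-proj₂ {W y} g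
        lost-pt : ∀ wx wy e r → (wx ≡ true) → 𝟙 e ≤ 𝟙 ((wx ∧ (wy ∧ e)) ∧ not r) + 𝟙 (not wy) + 𝟙 r
        lost-pt true wy false r refl = z≤n
        lost-pt true false true r refl = s≤s z≤n
        lost-pt true true true true refl = ≤-refl
        lost-pt true true true false refl = ≤-refl
        lost-pt′ : ∀ wx wy e r → (wy ≡ true) → 𝟙 e ≤ 𝟙 ((wx ∧ (wy ∧ e)) ∧ not r) + 𝟙 (not wx) + 𝟙 r
        lost-pt′ wx true false r refl = z≤n
        lost-pt′ false true true r refl = s≤s z≤n
        lost-pt′ true true true true refl = ≤-refl
        lost-pt′ true true true false refl = ≤-refl
        out-F≤ : ∀ x → ∑[ y ∈ U ] 𝟙 (rel F x y) ≤ k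
        out-F≤ x = ≤-trans (≤-reflexive (out-k F x)) (≤-trans (*-monoʳ-≤ k (𝟙≤1 (W x))) (≤-reflexive (*-identityʳ k)))
        lost : edges W all ≤ ∑∑ (λ x y → 𝟙 (M x y)) + (b + k) * N
        lost = lost-arith N k b (edges W all) (∑∑ λ x y → 𝟙 (M x y)) (∑∑ λ x y → 𝟙 (not (W y))) (∑∑ λ x y → 𝟙 (rel F x y))
          (≤-trans (∑∑-mono λ x y → pt x y) (≤-reflexive (∑∑-+³ (λ x y → 𝟙 (M x y)) (λ x y → 𝟙 (not (W y))) (λ x y → 𝟙 (rel F x y)))))
          (∑U-bound b (λ _ → hb)) (∑U-bound k out-F≤)
          where
          pt : ∀ x y → 𝟙 (W x) * (1 * 𝟙 (E x y)) ≤ 𝟙 (M x y) + 𝟙 (not (W y)) + 𝟙 (rel F x y)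
          pt x y with W x in eq
          ... | false = z≤n
          ... | true = ≤-trans (≤-reflexive (+-identityʳ _ ∙ +-identityʳ _)) (lost-pt true (W y) (E x y) (rel F x y) refl)
        outM inM : V → ℕ
        outM x = ∑[ y ∈ U ] 𝟙 (M x y)
        inM y = ∑[ x ∈ U ] 𝟙 (M x y)
        Q = least-multiple (14 * c * (2 * Δ + 2 * ((b + k) * N))) N 1≤N
        μ₀ : ℕ
        μ₀ = proj₁ Q
        μ₀-min : ∀ {d} → ¬ (d * N ≤ 14 * c * (2 * Δ + 2 * ((b + k) * N))) → μ₀ ≤ d
        μ₀-min {d} ¬h = proj₂ (proj₂ Q) d (≰⇒> ¬h)
        out≥ : ∀ x → W x ≡ true → μ₀ ≤ outM x
        out≥ x wx = μ₀-min λ h → deg-arith N c b k (outdeg′ x) (outM x) (size (not ∘ W)) (∑[ y ∈ U ] 𝟙 (rel F x y)) Δ (outdeg-bound x)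
          (≤-trans (∑-mono U λ y → lost-pt (W x) (W y) (E x y) (rel F x y) wx) (≤-reflexive (∑-+³ (λ y → 𝟙 (M x y)) (λ y → 𝟙 (not (W y))) (λ y → 𝟙 (rel F x y))))) hb (out-F≤ x) hs h
        in≥ : ∀ y → W y ≡ true → μ₀ ≤ inM y
        in≥ y wy = μ₀-min λ h → deg-arith N c b k (indeg′ y) (inM y) (size (not ∘ W)) (∑[ x ∈ U ] 𝟙 (rel F x y)) Δ (indeg-bound y)
          (≤-trans (∑-mono U λ x → lost-pt′ (W x) (W y) (E x y) (rel F x y) wy) (≤-reflexive (∑-+³ (λ x → 𝟙 (M x y)) (λ x → 𝟙 (not (W x))) (λ x → 𝟙 (rel F x y))))) hb (in-k F y) hs h
        open Matching M using (module Saturating)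
        sat = perfect M W ((b + k) * N) μ₀ lost M⊆ out≥ in≥ (proj₁ (proj₂ Q))
        open Saturating sat
        mem-M : ∀ x y → mem es x y ≡ true → M x y ≡ true
        mem-M x y e = es⊆M (mem-∈ es e)
        r⊆ : ∀ x y → rel F x y ∨ mem es x y ≡ true → W x ≡ true × W y ≡ true × E x y ≡ true
        r⊆ x y e with rel F x y in eq
        ... | true = rel⊆ F x y eq
        ... | false = M⊆ x y (mem-M x y e)
        split : ∀ x y → 𝟙 (rel F x y ∨ mem es x y) ≡ 𝟙 (rel F x y) + 𝟙 (mem es x y)
        split x y with rel F x y in eq | mem es x y in eq′
        ... | false | _ = refl
        ... | true | false = refl
        ... | true | true = ⊥-elim (true≢false (sym (∧-proj₂ {W x ∧ (W y ∧ E x y)} (mem-M x y eq′)) ∙ cong not eq))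
        src≤1 : ∀ x → occ x (map proj₁ es) ≤ 1
        src≤1 x = ≤-trans (≤-reflexive (sources x)) (𝟙≤1 (W x))
        mem-out : ∀ x → ∑[ y ∈ U ] 𝟙 (mem es x y) ≡ 𝟙 (W x)
        mem-out x = ∑-cong U (λ y → 𝟙-mem es x y (src≤1 x)) ∙ ∑-swap U es _
          ∙ ∑-cong es (λ e → ∑-cong U (λ y → *-comm (𝟙 (proj₁ e == x)) _) ∙ ∑-δ (proj₂ e) (λ _ → 𝟙 (proj₁ e == x))) ∙ sym (∑-map proj₁ es _) ∙ sources x
        mem-in : ∀ y → ∑[ x ∈ U ] 𝟙 (mem es x y) ≤ 1
        mem-in y = ≤-trans (≤-reflexive (∑-cong U (λ x → 𝟙-mem es x y (src≤1 x)) ∙ ∑-swap U es _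
          ∙ ∑-cong es (λ e → ∑-δ (proj₁ e) (λ _ → 𝟙 (proj₂ e == y))) ∙ sym (∑-map proj₂ es _))) (≤-trans (targets y) (𝟙≤1 (W y)))

      factor : ∀ W k b → size (not ∘ W) ≤ b → 28 * c * c * Δ + 28 * c * c * (b + k) * N + c * (b + k) * N < N * N → Factor W k
      factor W zero b hb hs = record { rel = λ _ _ → false ; rel⊆ = λ _ _ () ; out-k = λ _ → ∑-zero U ; in-k = λ _ → ≤-reflexive (∑-zero U) }
      factor W (suc k) b hb hs = extend W k b hb (slack-mono c N Δ b k (suc k) hs (n≤1+n k)) (factor W k b hb (slack-mono c N Δ b k (suc k) hs (n≤1+n k)))

      module Connecting (F : V → Bool) (β : ℕ) (F≤β : size F ≤ β)
        (small : 56 * (c * c * c) * (N * β + Δ) ≤ N * N) (small′ : 2 * (c * β) ≤ N) where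

        module _ (a b : V) where

          -- `i` counts growth steps, each of which adds at least N/(56 c³) vertices. Since `route`
          -- stays inside `A`, a walk extended by a new vertex remains free of repetitions.
          record Reach (i : ℕ) : Set where
            field
              A : V → Bool
              avoid : ∀ v → A v ≡ true → F v ≡ false
              first : ∀ v → E a v ≡ true → F v ≡ false → A v ≡ true
              route : ∀ v → A v ≡ true → ∃ λ l → Walk Edge a v (a ∷ l) × (∀ u → occ u l ≤ 𝟙 (A u)) × length l ≤ suc i
              big : i * N ≤ 56 * (c * c * c) * size A

          Connection : Set
          Connection = ∃ λ y → ∃ λ l → Walk Edge a y (a ∷ l) × Edge y b × (∀ v → occ v l ≤ 𝟙 (not (F v))) × length l ≤ suc (56 * (c * c * c))

          grow : ∀ i → (R : Reach i) → i ≤ 56 * (c * c * c) → Connection ⊎ Reach (suc i)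
          grow i R i≤G with 1 ≤? ∑[ v ∈ U ] 𝟙 (A v ∧ E v b)
            where open Reach R
          ... | yes p with card-pos (λ v → Reach.A R v ∧ E v b) p
          ...   | v , e with Reach.route R v (∧-proj₁ e)
          ...     | l , w , o , h = inj₁ (v , l , w , ∧-proj₂ {Reach.A R v} e , (λ u → ≤-trans (o u) (⊆ᵇ-𝟙 λ p → cong not (Reach.avoid R u p))) , ≤-trans h (s≤s i≤G))
          grow i R i≤G | no ¬p = inj₂ record { A = A′ ; avoid = avoid′ ; first = λ v p q → A⊆A′ v (first v p q) ; route = route′ ; big = big′ }
            where
            open Reach R
            open Matching E using (nb; nb-intro; nb-elim)
            New A′ : V → Bool
            New v = not (A v) ∧ (not (F v) ∧ nb A v)
            A′ v = A v ∨ New v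
            A⊆A′ : A ⊆ᵇ A′
            A⊆A′ v p rewrite p = refl
            size-A′ : size A′ ≡ size A + size New
            size-A′ = ∑-cong U (λ v → h (A v) (not (F v) ∧ nb A v)) ∙ ∑-+ U _ _
              where
              h : ∀ a x → 𝟙 (a ∨ (not a ∧ x)) ≡ 𝟙 a + 𝟙 (not a ∧ x)
              h true x = refl
              h false x = refl
            avoid′ : ∀ v → A′ v ≡ true → F v ≡ false
            avoid′ v p with A v in eq
            ... | true = avoid v eq
            ... | false = not-true (∧-proj₁ p)
            route′ : ∀ v → A′ v ≡ true → ∃ λ l → Walk Edge a v (a ∷ l) × (∀ u → occ u l ≤ 𝟙 (A′ u)) × length l ≤ suc (suc i)
            route′ v p with A v in eq
            ... | true with route v eq
            ...   | l , w , o , h = l , w , (λ u → ≤-trans (o u) (⊆ᵇ-𝟙 (A⊆A′ u))) , ≤-trans h (n≤1+n _)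
            route′ v p | false with nb-elim {A} {v} (∧-proj₂ {not (F v)} p)
            ... | x , px , ex with route x px
            ...   | l , w , o , h = l ++ v ∷ [] , (w ⟨ ex ⟩++ [ v ]) , occ′ , ≤-trans (≤-reflexive (length-++ l ∙ +-comm (length l) 1)) (s≤s h)
              where
              occ′ : ∀ u → occ u (l ++ v ∷ []) ≤ 𝟙 (A′ u)
              occ′ u rewrite occ-++ u l (v ∷ []) with v ≟ u
              ... | yes refl rewrite eq | p = +-monoˡ-≤ 1 (≤-trans (o v) (≤-reflexive (cong 𝟙 eq)))
              ... | no _ = ≤-trans (≤-reflexive (+-identityʳ _)) (≤-trans (o u) (⊆ᵇ-𝟙 (A⊆A′ u)))
            leaving : edges A (not ∘ A) ≤ N * (size New + β)
            leaving = ≤-trans (∑∑-mono pt) (≤-trans (≤-reflexive (∑∑-right (λ y → 𝟙 (New y) + 𝟙 (F y)) ∙ cong (N *_) (∑-+ U _ _))) (*-monoʳ-≤ N (+-monoʳ-≤ (size New) F≤β)))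
              where
              pt : ∀ x y → 𝟙 (A x) * (𝟙 (not (A y)) * 𝟙 (E x y)) ≤ 𝟙 (New y) + 𝟙 (F y)
              pt x y with A x in px | A y | E x y in pe
              ... | false | _ | _ = z≤n
              ... | true | true | _ = z≤n
              ... | true | false | false = z≤n
              ... | true | false | true rewrite nb-intro {A} {x} {y} px pe with F y
              ...   | true = ≤-refl
              ...   | false = ≤-refl
            out-A : outdeg′ a ≤ size A + β
            out-A = ≤-trans (∑-mono U pt) (≤-trans (≤-reflexive (∑-+ U _ _)) (+-monoʳ-≤ (size A) F≤β))
              where
              pt : ∀ v → 𝟙 (E a v) ≤ 𝟙 (A v) + 𝟙 (F v)
              pt v with E a v in p | F v in q
              ... | false | _ = z≤n
              ... | true | true = m≤n+m 1 _
              ... | true | false rewrite first v p q = s≤s z≤n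
            in-b : indeg′ b ≤ size (not ∘ A)
            in-b = ∑-mono U pt
              where
              pt : ∀ v → 𝟙 (E v b) ≤ 𝟙 (not (A v))
              pt v with A v in p | E v b in q
              ... | false | e = 𝟙≤1 e
              ... | true | false = z≤n
              ... | true | true = ⊥-elim (¬p (card-∈ (λ v → A v ∧ E v b) v (∧-intro p q)))
            -- `A` contains the free out-neighbours of a, hence at least N/(2c) vertices; its
            -- complement contains the in-neighbours of b, hence at least N/c. Edges leaving `A` end
            -- in `New` or in `F`. Expansion yields N² ≤ 28 c³ (Δ + Nβ + N·size New), and `small`
            -- takes away half of N², whence 56.
            grows : N ≤ 56 * (c * c * c) * size New
            grows = *-cancelˡ-≤ N {{>-nonZero 1≤N}} (growth-arith N c β (size New) Δ (size A) (size (not ∘ A)) (edges A (not ∘ A))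
              (deg-split-arith N c (outdeg′ a) β (size A) (outdeg-bound a) out-A) small′
              (≤-trans (indeg-bound b) (*-monoʳ-≤ c in-b))
              (≤-trans (expansion A A) (*-monoʳ-≤ (7 * c) (self-cut-arith D (size A) Δ (edges A all) (edges A A) (edges A (not ∘ A)) (edges (not ∘ A) A) (edges all A)
                 (reg⁺ A) (reg⁻ A) (edges-splitʳ A A) (edges-splitˡ A A)))) leaving small)
            big′ : suc i * N ≤ 56 * (c * c * c) * size A′
            big′ = iterate-arith N (56 * (c * c * c)) i (size A) (size A′) (size New) big grows size-A′

          -- After 56 c³ + 1 growth steps the reached set would have more than N vertices.
          search : ∀ j i → j + i ≡ suc (56 * (c * c * c)) → Reach i → Connection
          search zero i refl R = ⊥-elim (overflow N (56 * (c * c * c)) (size (Reach.A R)) (Reach.big R)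
              (≤-trans (∑U-bound 1 (𝟙≤1 ∘ Reach.A R)) (≤-reflexive (*-identityʳ N))) 1≤N)
          search (suc j) i e R with grow i R (≤-pred (≤-trans (s≤s (m≤n+m i j)) (≤-reflexive e)))
          ... | inj₁ C = C
          ... | inj₂ R′ = search j (suc i) (+-suc j i ∙ e) R′

          connect : Connection
          connect = search (suc (56 * (c * c * c))) 0 (+-identityʳ _) record
            { A = λ v → E a v ∧ not (F v)
            ; avoid = λ v p → not-true (∧-proj₂ {E a v} p)
            ; first = λ v p q → ∧-intro p (cong not q)
            ; route = λ v p → v ∷ [] , a ∷⟨ ∧-proj₁ p ⟩ [ v ] , (λ u → single u v p) , ≤-refl
            ; big = z≤n }
            where
            single : ∀ u v → E a v ∧ not (F v) ≡ true → occ u (v ∷ []) ≤ 𝟙 (E a u ∧ not (F u))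
            single u v p with v ≟ u
            ... | yes refl rewrite p = ≤-refl
            ... | no _ = z≤n

      good : (V → Bool) → Vec V 6 → Bool
      good F g = core g ∧ fresh F g

      -- By the union bound, tuples that repeat a vertex or meet `F` make up at most half of the
      -- N⁶/c walks; the factor 2 is this loss.
      good-count : ∀ F b → size F ≤ b → 12 * c * (b + 6) ≤ N → ∀ s t →
                   N ^ 6 ≤ 2 * c * ∑[ g ∈ tuples 6 ] (𝟙 (good F g) * 𝟙 (absorbs g s t))
      good-count F b hb hs s t = *-cancelˡ-≤ N {{>-nonZero 1≤N}} (good-arith N (N ^ 6) c b (walks₇ s t) _ _
          (≤-trans (≤-reflexive (pow N)) (W₇ s t))
          (≤-trans (≤-reflexive (walks-tuples s t)) (≤-trans (∑-mono (tuples 6) λ g → h (core g) (fresh F g) (absorbs g s t)) (≤-reflexive (∑-+ (tuples 6) _ _))))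
          (stale 6 F b hb) hs)
        where
        h : ∀ x y z → 𝟙 x * 𝟙 z ≤ 𝟙 (x ∧ y) * 𝟙 z + 𝟙 (not y)
        h false y z = z≤n
        h true true z = m≤m+n _ _
        h true false true = ≤-refl
        h true false false = z≤n
        pow0 : ∀ N → N * (N * (N * (N * (N * (N * 1))))) ≡ N * N * N * N * N * N
        pow0 N =
            ≤-antisym
            (lin ρ (# 0 ⊗ (# 0 ⊗ (# 0 ⊗ (# 0 ⊗ (# 0 ⊗ (# 0 ⊗ con 1)))))) (# 0 ⊗ # 0 ⊗ # 0 ⊗ # 0 ⊗ # 0 ⊗ # 0) 0
            (triv) refl)
            (lin ρ (# 0 ⊗ # 0 ⊗ # 0 ⊗ # 0 ⊗ # 0 ⊗ # 0) (# 0 ⊗ (# 0 ⊗ (# 0 ⊗ (# 0 ⊗ (# 0 ⊗ (# 0 ⊗ con 1)))))) 0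
            (triv) refl)
          where
          ρ = N ∷ []
        pow : ∀ N → N ^ 6 ≡ N * N * N * N * N * N
        pow N = pow0 N

      -- Multiplicative weights: a pair doubles whenever the chosen gadget fails to absorb it.
      weight : List (Vec V 6) → V × V → ℕ
      weight [] _ = 1
      weight (g ∷ gs) (s , t) = if absorbs g s t then weight gs (s , t) else 2 * weight gs (s , t)

      absorbers : List (Vec V 6) → V → V → ℕ
      absorbers gs s t = ∑[ g ∈ gs ] 𝟙 (absorbs g s t)

      -- Each gadget either doubles the weight of the pair or counts as one of its absorbers.
      weight-absorbers : ∀ gs s t → weight gs (s , t) * 2 ^ absorbers gs s t ≡ 2 ^ length gs
      weight-absorbers [] s t = refl
      weight-absorbers (g ∷ gs) s t with absorbs g s t
      ... | true = swap* [] (weight gs (s , t)) 2 _ ∙ cong (2 *_) (weight-absorbers gs s t)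
      ... | false = *-assoc 2 (weight gs (s , t)) _ ∙ cong (2 *_) (weight-absorbers gs s t)

      weight-step : ∀ g gs → ∑ prs (weight (g ∷ gs)) + ∑[ x ∈ prs ] (𝟙 (absorbs g (proj₁ x) (proj₂ x)) * weight gs x) ≡ 2 * ∑ prs (weight gs)
      weight-step g gs = sym (∑-+ prs _ _) ∙ ∑-cong prs (λ x → h (absorbs g (proj₁ x) (proj₂ x)) (weight gs x)) ∙ ∑-*ˡ prs 2 _
        where
        h : ∀ b w → (if b then w else 2 * w) + 𝟙 b * w ≡ 2 * w
        h true w = refl
        h false w = +-identityʳ _

      weight-pos : ∀ gs x → 1 ≤ weight gs x
      weight-pos [] x = ≤-refl
      weight-pos (g ∷ gs) (s , t) with absorbs g s t
      ... | true = weight-pos gs (s , t)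
      ... | false = ≤-trans (weight-pos gs (s , t)) (m≤m+n _ _)

      -- `light` bounds the potential: it starts at N², and a step multiplies it by at most 2 -
      -- 1/(2c), that is (4c - 1)/(2c).
      record Family (T : ℕ) : Set where
        field
          gs : List (Vec V 6)
          len : length gs ≡ T
          cores : ∀ {g} → g ∈ gs → core g ≡ true
          disjoint : ∀ v → used gs v ≤ 1
          light : (2 * c) ^ T * ∑ prs (weight gs) ≤ (pred (4 * c)) ^ T * (N * N)

      -- Each pair is absorbed by a proportion 1/(2c) of all tuples that are moreover good;
      -- averaging the absorbed weight over all tuples finds one above the mean. It is good because
      -- the total weight is positive.
      best : ∀ F b gs → size F ≤ b → 12 * c * (b + 6) ≤ N → ∃ λ g → good F g ≡ true ×
             ∑ prs (weight gs) ≤ 2 * c * ∑[ x ∈ prs ] (𝟙 (absorbs g (proj₁ x) (proj₂ x)) * weight gs x)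
      best F b gs hb hs = conclude (∑-average (tuples 6) {λ _ → Φ} {λ g → 2 * c * (𝟙 (good F g) * share g)} ne avg)
        where
        Φ = ∑ prs (weight gs)
        share : Vec V 6 → ℕ
        share g = ∑[ x ∈ prs ] (𝟙 (absorbs g (proj₁ x) (proj₂ x)) * weight gs x)
        ne : 1 ≤ length (tuples 6)
        ne = ≤-trans (m^n>0 N {{>-nonZero 1≤N}} 6) (≤-reflexive (sym (length-tuples 6)))
        avg : ∑[ g ∈ tuples 6 ] Φ ≤ ∑[ g ∈ tuples 6 ] (2 * c * (𝟙 (good F g) * share g))
        avg = begin
          ∑[ g ∈ tuples 6 ] Φ ≡⟨ ∑-const (tuples 6) Φ ∙ cong (_* Φ) (length-tuples 6) ∙ sym (∑-*ˡ prs (N ^ 6) _) ⟩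
          ∑[ x ∈ prs ] (N ^ 6 * weight gs x) ≤⟨ ∑-mono prs (λ x → *-monoˡ-≤ (weight gs x) (good-count F b hb hs (proj₁ x) (proj₂ x))) ⟩
          ∑[ x ∈ prs ] (2 * c * ∑[ g ∈ tuples 6 ] (𝟙 (good F g) * 𝟙 (absorbs g (proj₁ x) (proj₂ x))) * weight gs x)
            ≡⟨ ∑-cong prs (λ x → *-assoc (2 * c) _ _ ∙ cong (2 * c *_) (sym (∑-*ʳ (tuples 6) (weight gs x) _))) ∙ ∑-*ˡ prs (2 * c) _ ⟩
          2 * c * ∑[ x ∈ prs ] ∑[ g ∈ tuples 6 ] (𝟙 (good F g) * 𝟙 (absorbs g (proj₁ x) (proj₂ x)) * weight gs x)
            ≡⟨ cong (2 * c *_) (∑-swap prs (tuples 6) _ ∙ ∑-cong (tuples 6) (λ g → ∑-cong prs (λ x → *-assoc (𝟙 (good F g)) _ _) ∙ ∑-*ˡ prs (𝟙 (good F g)) _)) ∙ sym (∑-*ˡ (tuples 6) (2 * c) _) ⟩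
          ∑[ g ∈ tuples 6 ] (2 * c * (𝟙 (good F g) * share g)) ∎
          where open ≤-Reasoning
        Φ>0 : 0 < ∑ prs (weight gs)
        Φ>0 = ≤-trans (≤-trans (*-mono-≤ 1≤N 1≤N) (≤-reflexive (sym (cong (N *_) (*-identityʳ N)) ∙ sym (∑U-const _) ∙ sym (∑-concatMap _ U _ ∙ ∑-cong U λ s → ∑-map (s ,_) U _ ∙ ∑U-const 1))))
              (∑-mono prs {λ _ → 1} (weight-pos gs))
        weigh : ∀ g b → good F g ≡ b → Φ ≤ 2 * c * (𝟙 b * share g) → good F g ≡ true × Φ ≤ 2 * c * share g
        weigh g true e h = e , ≤-trans h (≤-reflexive (cong (2 * c *_) (+-identityʳ (share g))))
        weigh g false e h = ⊥-elim (<⇒≱ Φ>0 (≤-trans h (≤-reflexive (*-zeroʳ (2 * c)))))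
        conclude : (∃ λ g → g ∈ tuples 6 × Φ ≤ 2 * c * (𝟙 (good F g) * share g)) → ∃ λ g → good F g ≡ true × Φ ≤ 2 * c * share g
        conclude (g , _ , h) = g , weigh g (good F g) refl h

      family : 1 ≤ c → ∀ T → 72 * c * (T + 1) ≤ N → Family T
      family 1≤c zero h = record { gs = [] ; len = refl ; cores = λ () ; disjoint = λ _ → z≤n
        ; light = ≤-reflexive (cong (_+ 0) (∑-concatMap _ U _ ∙ ∑-cong U (λ s → ∑-map (s ,_) U _ ∙ ∑U-const 1) ∙ ∑U-const _ ∙ cong (N *_) (*-identityʳ N))) }
      family 1≤c (suc T) h = record
        { gs = g ∷ gs ; len = cong suc len
        ; cores = λ { (here refl) → ∧-proj₁ (proj₁ (proj₂ B)) ; (there i) → cores i }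
        ; disjoint = dis
        ; light = decay-arith (2 * c) (pred (4 * c)) (∑ prs (weight gs)) (∑ prs (weight (g ∷ gs))) _ ((2 * c) ^ T) ((pred (4 * c)) ^ T) (N * N)
            (weight-step g gs) (proj₂ (proj₂ B)) (suc-pred (4 * c) {{>-nonZero (*-mono-≤ (s≤s (z≤n {3})) 1≤c)}} ∙ *-assoc 2 2 c) light }
        where
        h-weaken : ∀ c T N → 72 * c * (suc T + 1) ≤ N → 72 * c * (T + 1) ≤ N
        h-weaken c T N H =
            lin ρ (con 72 ⊗ # 0 ⊗ (# 1 ⊕ con 1)) (# 2) 0
            ((con 72 ⊗ # 0 ⊗ (con 1 ⊕ # 1 ⊕ con 1) ≼ # 2 by H)) refl
          where
          ρ = c ∷ T ∷ N ∷ []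

        h-use : ∀ c T N → 72 * c * (suc T + 1) ≤ N → 12 * c * (T * 6 + 6) ≤ N
        h-use c T N H =
            lin ρ (con 12 ⊗ # 0 ⊗ (# 1 ⊗ con 6 ⊕ con 6)) (# 2) 0
            ((con 72 ⊗ # 0 ⊗ (con 1 ⊕ # 1 ⊕ con 1) ≼ # 2 by H)) refl
          where
          ρ = c ∷ T ∷ N ∷ []
        open Family (family 1≤c T (h-weaken c T N h))
        F : V → Bool
        F v = 1 ≤ᵇ used gs v
        𝟙F : ∀ v → 𝟙 (F v) ≡ used gs v
        𝟙F v with used gs v | disjoint v
        ... | zero | _ = refl
        ... | suc zero | _ = refl
        ... | suc (suc _) | s≤s ()
        B = best F (T * 6) gs (≤-reflexive (∑-cong U 𝟙F ∙ used-total gs ∙ cong (_* 6) len)) (h-use c T N h)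
        g = proj₁ B
        dis : ∀ v → used (g ∷ gs) v ≤ 1
        dis v = ≤-trans (≤-reflexive (cong (occ v (toList g) +_) (sym (𝟙F v)))) (fresh-occ F g (∧-proj₂ {core g} (proj₁ (proj₂ B))) v)

      module Absorbing (m : ℕ) (1≤c : 1 ≤ c) (N²<2^m : N * N < 2 ^ m) (room : 72 * c * (pred (4 * c) * (2 * m) + 1) ≤ N) where

        private
          r = pred (4 * c)

        -- With r = 4c - 1, the power (4c/r) to the r·2m is at least 2 to the 2m. A pair with fewer
        -- than m absorbers would bound it by 2^m · N², which is smaller since N² < 2^m.
        steps : ℕ
        steps = r * (2 * m)

        1+r : suc r ≡ 4 * c
        1+r = suc-pred (4 * c) {{>-nonZero (*-mono-≤ (s≤s (z≤n {3})) 1≤c)}}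

        1≤r : 1 ≤ r
        1≤r = ≤-pred (≤-trans (s≤s (s≤s z≤n)) (≤-trans (*-monoʳ-≤ 4 1≤c) (≤-reflexive (sym 1+r))))

        fam : Family steps
        fam = family 1≤c steps room
        open Family fam public

        few-arith : ∀ A B q Wt S Z M n2 → Wt * S ≡ A → q * Z ≤ B * n2 → Wt ≤ Z → S ≤ M → M * M * B ≤ A * q → n2 < M → B * M ≤ 0
        few-arith A B q Wt S Z M n2 H1 H2 H3 H4 H5 H6 =
            lin ρ (# 1 ⊗ # 6) (con 0) 0
            ((# 6 ⊗ # 6 ⊗ # 1 ≼ # 0 ⊗ # 2 by H5)
              ⊞ (# 4 ⊗ # 2 ⊗ # 3 ≼ # 4 ⊗ # 2 ⊗ # 5 by *-monoʳ-≤ (S * q) (H3))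
              ⊞ (# 5 ⊗ # 2 ⊗ # 4 ≼ # 5 ⊗ # 2 ⊗ # 6 by *-monoʳ-≤ (Z * q) (H4))
              ⊞ (# 2 ⊗ # 0 ≼ # 2 ⊗ (# 3 ⊗ # 4) by *-monoʳ-≤ (q) (≤-reflexive (sym H1)))
              ⊞ (# 6 ⊗ (# 2 ⊗ # 5) ≼ # 6 ⊗ (# 1 ⊗ # 7) by *-monoʳ-≤ (M) (H2))
              ⊞ (# 1 ⊗ # 6 ⊗ (con 1 ⊕ # 7) ≼ # 1 ⊗ # 6 ⊗ # 6 by *-monoʳ-≤ (B * M) (H6))) refl
          where
          ρ = A ∷ B ∷ q ∷ Wt ∷ S ∷ Z ∷ M ∷ n2 ∷ []

        ∈-prs : ∀ s t → (s , t) ∈ prs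
        ∈-prs s t = go U (∈-allFin s)
          where
          go : ∀ xs → s ∈ xs → (s , t) ∈ concatMap (λ s → map (s ,_) U) xs
          go (x ∷ xs) (here refl) = ∈-++⁺ˡ (∈-map⁺ (s ,_) (∈-allFin t))
          go (x ∷ xs) (there i) = ∈-++⁺ʳ (map (x ,_) U) (go xs i)

        many : ∀ s t → m ≤ absorbers gs s t
        many s t with m ≤? absorbers gs s t
        ... | yes p = p
        ... | no ¬p = ⊥-elim (<⇒≱ (*-mono-≤ (m^n>0 r {{>-nonZero 1≤r}} steps) (m^n>0 2 m)) (few-arith (2 ^ steps) (r ^ steps) ((2 * c) ^ steps) (weight gs (s , t)) (2 ^ absorbers gs s t) (∑ prs (weight gs)) (2 ^ m) (N * N)
            (weight-absorbers gs s t ∙ cong (2 ^_) len) light (∑-∈ (weight gs) (∈-prs s t)) (^-monoʳ-≤ 2 (<⇒≤ (≰⇒> ¬p)))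
            (≤-trans (≤-reflexive (cong (_* r ^ steps) (sym (^-distribˡ-+-* 2 m m) ∙ cong (λ k → 2 ^ (m + k)) (sym (+-identityʳ m)))))
              (≤-trans (power-gap r (2 * m) 1≤r) (≤-reflexive (cong (_^ steps) (1+r ∙ *-assoc 2 2 c) ∙ ^-distribʳ-* 2 (2 * c) steps))))
            N²<2^m))

      -- `m` is both the number of absorbers of every pair and the number of leftover paths allowed;
      -- `β` bounds the vertices occupied by gadgets and connections; `k`, `z` and `K′` belong to
      -- the path cover of the rest.
      module RobustCycle (1≤c : 1 ≤ c)
        (m k z K′ β : ℕ)
        (N²<2^m : N * N < 2 ^ m) (room : 72 * c * (pred (4 * c) * (2 * m) + 1) ≤ N)
        (β-big : suc (pred (4 * c) * (2 * m) * 6) + (3 * (pred (4 * c) * (2 * m)) + 1) * suc (56 * (c * c * c)) ≤ β)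
        (β-small : 56 * (c * c * c) * (N * β + Δ) ≤ N * N) (β-small′ : 2 * (c * β) ≤ N)
        (factor-slack : 28 * c * c * Δ + 28 * c * c * (β + k) * N + c * (β + k) * N < N * N)
        (6N≤Km : 6 * N ≤ suc K′ * m) (4N²≤zkm : 4 * N * N ≤ z * (k * m)) (zK≤N : 3 * (z * z * (suc K′ * suc K′)) ≤ N) where

        open Absorbing m 1≤c N²<2^m room using (gs; cores; disjoint; many; len)

        cover : ∀ W → size (not ∘ W) ≤ β → ∃ λ (ps : List (Path (λ x y → E x y ≡ true))) → length ps ≤ m × (∀ v → inside v ps ≡ 𝟙 (W v))
        cover W h = map weaken (proj₁ PC) , ≤-trans (≤-reflexive (length-map weaken (proj₁ PC))) (proj₁ (proj₂ PC)) ,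
            λ v → ∑-map weaken (proj₁ PC) _ ∙ proj₂ (proj₂ PC) v
          where
          Fc : Factor W k
          Fc = factor W k β h factor-slack
          module Fc = Factor Fc
          PC = PathCover.path-cover W Fc.rel k m z K′ (λ x y e → proj₁ (Fc.rel⊆ x y e) , proj₁ (proj₂ (Fc.rel⊆ x y e))) Fc.out-k Fc.in-k 1≤N 6N≤Km 4N²≤zkm zK≤N
          weaken : Path (λ x y → Fc.rel x y ≡ true) → Path (λ x y → E x y ≡ true)
          weaken p = path (walk-map (λ {x} {y} e → proj₂ (proj₂ (Fc.rel⊆ x y e))) (Path.walk p))

        cycle : Cyclic E
        cycle = Assembly.cycle m (suc (56 * (c * c * c))) β gs cores disjoint many
          (subst (λ T → suc (T * 6) + (3 * T + 1) * suc (56 * (c * c * c)) ≤ β) (sym len) β-big)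
          (beta-le c β N β-small′ (m≤n*m β c {{>-nonZero 1≤c}}))
          (λ F h a b → Connecting.connect F β h β-small β-small′ a b)
          cover

  -- Choice of the constants for robustly connected digraphs

  module Constants where

    -- For m ≥ 10 the cube grows by a factor of at most 1.331 per step; the certificate counts in
    -- thousandths.
    cube-step : ∀ j m P → m ≡ 10 + j → m * m * m ≤ P → suc m * suc m * suc m ≤ 2 * P
    cube-step j m P H1 H2 =
        lin ρ ((con 1 ⊕ # 1) ⊗ (con 1 ⊕ # 1) ⊗ (con 1 ⊕ # 1)) (con 2 ⊗ # 2) 999
        (con 100 ⊠ (con 10 ⊕ # 0 ≼ # 1 by ≤-reflexive (sym H1))
          ⊞ con 1331 ⊠ (# 1 ⊗ # 1 ⊗ # 1 ≼ # 2 by H2)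
          ⊞ con 331 ⊠ (# 1 ⊗ # 1 ⊗ (con 10 ⊕ # 0) ≼ # 1 ⊗ # 1 ⊗ # 1 by *-monoʳ-≤ (m * m) (≤-reflexive (sym H1)))
          ⊞ con 310 ⊠ (# 1 ⊗ (con 10 ⊕ # 0) ≼ # 1 ⊗ # 1 by *-monoʳ-≤ (m) (≤-reflexive (sym H1)))) refl
      where
      ρ = j ∷ m ∷ P ∷ []

    cube-lt : ∀ C m P j → m * m * m ≤ P → m ≡ 10 + j → C < m → C * (m * m) < P
    cube-lt C m P j H1 H2 H3 =
        lin ρ (con 1 ⊕ # 0 ⊗ (# 1 ⊗ # 1)) (# 2) 99
        (con 100 ⊠ (# 1 ⊗ # 1 ⊗ # 1 ≼ # 2 by H1)
          ⊞ con 10 ⊠ (con 10 ⊕ # 3 ≼ # 1 by ≤-reflexive (sym H2))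
          ⊞ con 100 ⊠ (# 1 ⊗ # 1 ⊗ (con 1 ⊕ # 0) ≼ # 1 ⊗ # 1 ⊗ # 1 by *-monoʳ-≤ (m * m) (H3))
          ⊞ (# 1 ⊗ (con 10 ⊕ # 3) ≼ # 1 ⊗ # 1 by *-monoʳ-≤ (m) (≤-reflexive (sym H2)))) refl
      where
      ρ = C ∷ m ∷ P ∷ j ∷ []

    cube≤2^ : ∀ j → (10 + j) * (10 + j) * (10 + j) ≤ 2 ^ (10 + j)
    cube≤2^ zero = ≤ᵇ⇒≤ 1000 1024 _
    cube≤2^ (suc j) = cube-step j (10 + j) (2 ^ (10 + j)) refl (cube≤2^ j)

    square<2^ : ∀ C m → 10 + C < m → C * (m * m) < 2 ^ m
    square<2^ C m h = cube-lt C m (2 ^ m) (m ∸ 10) (subst (λ x → x * x * x ≤ 2 ^ x) e (cube≤2^ (m ∸ 10))) (sym e) (≤-trans (s≤s (m≤n+m C 10)) h)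
      where
      e : 10 + (m ∸ 10) ≡ m
      e = m+[n∸m]≡n (≤-trans (m≤m+n 10 C) (<⇒≤ h))

    quotient : ∀ N q → 1 ≤ q → ∃ λ m → q * m ≤ N × N < q * suc m
    quotient N q 1≤q = N / q , ≤-trans (≤-reflexive (*-comm q _)) (m/n*n≤m N q) ,
        ≤-trans (s≤s (≤-reflexive (m≡m%n+[m/n]*n N q))) (≤-trans (+-monoˡ-≤ (N / q * q) (m%n<n N q)) (≤-reflexive (*-comm (suc (N / q)) q)))
      where
      instance _ = >-nonZero 1≤q

    double : ∀ q m N → N < q * suc m → 1 ≤ m → N ≤ 2 * q * m
    double q m N H1 H2 =
        lin ρ (# 2) (con 2 ⊗ # 0 ⊗ # 1) 0
        ((con 1 ⊕ # 2 ≼ # 0 ⊗ (con 1 ⊕ # 1) by H1)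
          ⊞ (# 0 ⊗ con 1 ≼ # 0 ⊗ # 1 by *-monoʳ-≤ (q) (H2))) refl
      where
      ρ = q ∷ m ∷ N ∷ []

    q-pos : ∀ q m N M → N < q * suc m → q * suc M ≤ N → q * suc M < q * suc m
    q-pos q m N M H1 H2 =
        lin ρ (con 1 ⊕ # 0 ⊗ (con 1 ⊕ # 3)) (# 0 ⊗ (con 1 ⊕ # 1)) 0
        ((con 1 ⊕ # 2 ≼ # 0 ⊗ (con 1 ⊕ # 1) by H1)
          ⊞ (# 0 ⊗ (con 1 ⊕ # 3) ≼ # 2 by H2)) refl
      where
      ρ = q ∷ m ∷ N ∷ M ∷ []

    beta-bound : ∀ c p m T L B → p ≤ 4 * c → T ≡ p * (2 * m) → 1 ≤ m → B ≡ 1 + 48 * c + (24 * c + 1) * L → suc (T * 6) + (3 * T + 1) * L ≤ m * B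
    beta-bound c p m T L B H1 H2 H3 H4 =
        lin ρ (con 1 ⊕ # 3 ⊗ con 6 ⊕ (con 3 ⊗ # 3 ⊕ con 1) ⊗ # 4) (# 2 ⊗ # 5) 0
        (con 6 ⊠ (# 3 ≼ # 1 ⊗ (con 2 ⊗ # 2) by ≤-reflexive H2)
          ⊞ (con 1 ≼ # 2 by H3)
          ⊞ con 12 ⊠ (# 2 ⊗ # 1 ≼ # 2 ⊗ (con 4 ⊗ # 0) by *-monoʳ-≤ (m) (H1))
          ⊞ con 6 ⊠ (# 2 ⊗ # 4 ⊗ # 1 ≼ # 2 ⊗ # 4 ⊗ (con 4 ⊗ # 0) by *-monoʳ-≤ (m * L) (H1))
          ⊞ con 3 ⊠ (# 4 ⊗ # 3 ≼ # 4 ⊗ (# 1 ⊗ (con 2 ⊗ # 2)) by *-monoʳ-≤ (L) (≤-reflexive H2))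
          ⊞ (# 4 ⊗ con 1 ≼ # 4 ⊗ # 2 by *-monoʳ-≤ (L) (H3))
          ⊞ (# 2 ⊗ (con 1 ⊕ con 48 ⊗ # 0 ⊕ (con 24 ⊗ # 0 ⊕ con 1) ⊗ # 4) ≼ # 2 ⊗ # 5 by *-monoʳ-≤ (m) (≤-reflexive (sym H4)))) refl
      where
      ρ = c ∷ p ∷ m ∷ T ∷ L ∷ B ∷ []

    room-bound : ∀ c p m q N → p ≤ 4 * c → 1 ≤ m → 1 ≤ c → c * c * m ≤ q → 648 * q ≤ N → 72 * c * (p * (2 * m) + 1) ≤ N
    room-bound c p m q N H1 H3 H5 H6 H7 =
        lin ρ (con 72 ⊗ # 0 ⊗ (# 1 ⊗ (con 2 ⊗ # 2) ⊕ con 1)) (# 4) 0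
        (con 648 ⊠ (# 0 ⊗ # 0 ⊗ # 2 ≼ # 3 by H6)
          ⊞ (con 648 ⊗ # 3 ≼ # 4 by H7)
          ⊞ con 144 ⊠ (# 0 ⊗ # 2 ⊗ # 1 ≼ # 0 ⊗ # 2 ⊗ (con 4 ⊗ # 0) by *-monoʳ-≤ (c * m) (H1))
          ⊞ con 72 ⊠ (# 0 ⊗ con 1 ≼ # 0 ⊗ # 2 by *-monoʳ-≤ (c) (H3))
          ⊞ con 72 ⊠ (# 0 ⊗ # 2 ⊗ con 1 ≼ # 0 ⊗ # 2 ⊗ # 0 by *-monoʳ-≤ (c * m) (H5))) refl
      where
      ρ = c ∷ p ∷ m ∷ q ∷ N ∷ []

    small-bound : ∀ c b D q N → c * c * c * b ≤ q → 648 * q ≤ N → 336 * (c * c * c) * D ≤ N * N → 56 * (c * c * c) * (N * b + D) ≤ N * N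
    small-bound c b D q N H1 H2 H3 =
        lin ρ (con 56 ⊗ (# 0 ⊗ # 0 ⊗ # 0) ⊗ (# 4 ⊗ # 1 ⊕ # 2)) (# 4 ⊗ # 4) 161
        (con 27 ⊠ (con 336 ⊗ (# 0 ⊗ # 0 ⊗ # 0) ⊗ # 2 ≼ # 4 ⊗ # 4 by H3)
          ⊞ con 9072 ⊠ (# 4 ⊗ (# 0 ⊗ # 0 ⊗ # 0 ⊗ # 1) ≼ # 4 ⊗ # 3 by *-monoʳ-≤ (N) (H1))
          ⊞ con 14 ⊠ (# 4 ⊗ (con 648 ⊗ # 3) ≼ # 4 ⊗ # 4 by *-monoʳ-≤ (N) (H2))) refl
      where
      ρ = c ∷ b ∷ D ∷ q ∷ N ∷ []

    small-bound2 : ∀ c b q N → c * b ≤ q → 648 * q ≤ N → 2 * (c * b) ≤ N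
    small-bound2 c b q N H1 H2 =
        lin ρ (con 2 ⊗ (# 0 ⊗ # 1)) (# 3) 323
        (con 648 ⊠ (# 0 ⊗ # 1 ≼ # 2 by H1)
          ⊞ (con 648 ⊗ # 2 ≼ # 3 by H2)) refl
      where
      ρ = c ∷ b ∷ q ∷ N ∷ []

    slack-bound : ∀ c b k q N D → c * c * b ≤ q → c * b ≤ q → 648 * q ≤ N → 116 * c * c * k ≤ N → c * k ≤ c * c * k → c * c * D ≤ c * c * c * D → 336 * (c * c * c) * D ≤ N * N → 2 ≤ N → 28 * c * c * D + 28 * c * c * (b + k) * N + c * (b + k) * N < N * N
    slack-bound c b k q N D H1 H2 H3 H4 H5 H6 H7 H8 =
        lin ρ (con 1 ⊕ (con 28 ⊗ # 0 ⊗ # 0 ⊗ # 5 ⊕ con 28 ⊗ # 0 ⊗ # 0 ⊗ (# 1 ⊕ # 2) ⊗ # 4 ⊕ # 0 ⊗ (# 1 ⊕ # 2) ⊗ # 4)) (# 4 ⊗ # 4) 647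
        (con 18144 ⊠ (# 0 ⊗ # 0 ⊗ # 5 ≼ # 0 ⊗ # 0 ⊗ # 0 ⊗ # 5 by H6)
          ⊞ con 54 ⊠ (con 336 ⊗ (# 0 ⊗ # 0 ⊗ # 0) ⊗ # 5 ≼ # 4 ⊗ # 4 by H7)
          ⊞ con 324 ⊠ (con 2 ≼ # 4 by H8)
          ⊞ con 18144 ⊠ (# 4 ⊗ (# 0 ⊗ # 0 ⊗ # 1) ≼ # 4 ⊗ # 3 by *-monoʳ-≤ (N) (H1))
          ⊞ con 648 ⊠ (# 4 ⊗ (# 0 ⊗ # 1) ≼ # 4 ⊗ # 3 by *-monoʳ-≤ (N) (H2))
          ⊞ con 29 ⊠ (# 4 ⊗ (con 648 ⊗ # 3) ≼ # 4 ⊗ # 4 by *-monoʳ-≤ (N) (H3))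
          ⊞ con 162 ⊠ (# 4 ⊗ (con 116 ⊗ # 0 ⊗ # 0 ⊗ # 2) ≼ # 4 ⊗ # 4 by *-monoʳ-≤ (N) (H4))
          ⊞ con 648 ⊠ (# 4 ⊗ (# 0 ⊗ # 2) ≼ # 4 ⊗ (# 0 ⊗ # 0 ⊗ # 2) by *-monoʳ-≤ (N) (H5))
          ⊞ con 162 ⊠ (# 4 ⊗ con 2 ≼ # 4 ⊗ # 4 by *-monoʳ-≤ (N) (H8))) refl
      where
      ρ = c ∷ b ∷ k ∷ q ∷ N ∷ D ∷ []

    zkm : ∀ N k m g H → N ≤ 2 * g * k → N ≤ 2 * H * m → 4 * N * N ≤ 16 * g * H * (k * m)
    zkm N k m g H H1 H2 =
        lin ρ (con 4 ⊗ # 0 ⊗ # 0) (con 16 ⊗ # 3 ⊗ # 4 ⊗ (# 1 ⊗ # 2)) 0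
        (con 4 ⊠ (# 0 ⊗ # 0 ≼ # 0 ⊗ (con 2 ⊗ # 3 ⊗ # 1) by *-monoʳ-≤ (N) (H1))
          ⊞ con 8 ⊠ (# 3 ⊗ # 1 ⊗ # 0 ≼ # 3 ⊗ # 1 ⊗ (con 2 ⊗ # 4 ⊗ # 2) by *-monoʳ-≤ (g * k) (H2))) refl
      where
      ρ = N ∷ k ∷ m ∷ g ∷ H ∷ []

    km : ∀ N H m → N ≤ 2 * H * m → 6 * N ≤ 12 * H * m
    km N H m H2 =
        lin ρ (con 6 ⊗ # 0) (con 12 ⊗ # 1 ⊗ # 2) 0
        (con 6 ⊠ (# 0 ≼ con 2 ⊗ # 1 ⊗ # 2 by H2)) refl
      where
      ρ = N ∷ H ∷ m ∷ []

    sq : ∀ N H m → N ≤ 2 * H * m → N * N ≤ 4 * H * H * (m * m)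
    sq N H m H2 =
        lin ρ (# 0 ⊗ # 0) (con 4 ⊗ # 1 ⊗ # 1 ⊗ (# 2 ⊗ # 2)) 0
        ((# 0 ⊗ # 0 ≼ # 0 ⊗ (con 2 ⊗ # 1 ⊗ # 2) by *-monoʳ-≤ (N) (H2))
          ⊞ con 2 ⊠ (# 1 ⊗ # 2 ⊗ # 0 ≼ # 1 ⊗ # 2 ⊗ (con 2 ⊗ # 1 ⊗ # 2) by *-monoʳ-≤ (H * m) (H2))) refl
      where
      ρ = N ∷ H ∷ m ∷ []

    cc : ∀ c b q → c * c * c * b ≤ q → 1 ≤ c → c * c * b ≤ q
    cc c b q H1 H2 =
        lin ρ (# 0 ⊗ # 0 ⊗ # 1) (# 2) 0
        ((# 0 ⊗ # 0 ⊗ # 0 ⊗ # 1 ≼ # 2 by H1)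
          ⊞ (# 0 ⊗ # 0 ⊗ # 1 ⊗ con 1 ≼ # 0 ⊗ # 0 ⊗ # 1 ⊗ # 0 by *-monoʳ-≤ (c * c * b) (H2))) refl
      where
      ρ = c ∷ b ∷ q ∷ []

    c1 : ∀ c b q → c * c * b ≤ q → 1 ≤ c → c * b ≤ q
    c1 c b q H1 H2 =
        lin ρ (# 0 ⊗ # 1) (# 2) 0
        ((# 0 ⊗ # 0 ⊗ # 1 ≼ # 2 by H1)
          ⊞ (# 0 ⊗ # 1 ⊗ con 1 ≼ # 0 ⊗ # 1 ⊗ # 0 by *-monoʳ-≤ (c * b) (H2))) refl
      where
      ρ = c ∷ b ∷ q ∷ []

    abstract
      -- Here m is N/H and k is N/g, rounded down. `L` bounds a connection, and `B` the vertices
      -- occupied per unit of m. `H` gives 648 c³ m B ≤ N, where 648 = 72·8 + 72 is what disjoint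
      -- gadgets ask for; `g` with 116 = 4·29 keeps the factor's cost below a quarter of N²; 336 =
      -- 6·56 keeps the irregularity below a sixth in the growth argument. N ≤ 2Hm and N ≤ 2gk
      -- dictate `K` and `z`. The summands of `N₀` give 3z²K² ≤ N, an m with N² < 2^m, and k ≥ 1.
      L B H g z K N₀ tolerance : ℕ → ℕ
      L c = suc (56 * (c * c * c))
      B c = 1 + 48 * c + (24 * c + 1) * L c
      H c = 648 * (c * c * c * B c)
      g c = 116 * c * c
      z c = 16 * g c * H c
      K c = 12 * H c
      N₀ c = 3 * (z c * z c * (K c * K c)) + (H c * suc (11 + 4 * H c * H c) + g c)
      tolerance c = 336 * (c * c * c)

      -- The bound on walks₇ says that the bipartite double cover is robustly connected.
      robust-cycle : ∀ {N} (E : Fin N → Fin N → Bool) c D Δ → 1 ≤ c → N₀ c ≤ N →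
        (∀ s t → N * N * N * N * N * N ≤ c * Graph.walks₇ E s t) →
        (∀ S → D * Graph.size E S ≤ Graph.edges E S (λ _ → true) + Δ) →
        (∀ S → Graph.edges E (λ _ → true) S ≤ D * Graph.size E S + Δ) →
        tolerance c * Δ ≤ N * N → Cyclic E
      robust-cycle {N} E c D Δ 1≤c N₀≤N W₇ reg⁺ reg⁻ HΔ =
        RobustDigraph.Robust.RobustCycle.cycle E c D Δ 1≤N W₇ reg⁺ reg⁻ 1≤c m k (z c) (pred (K c)) β
          (≤-<-trans (sq N (H c) m N≤2Hm) (square<2^ (4 * H c * H c) m (≤-trans (s≤s (n≤1+n _)) m-big)))
          (room-bound c (pred (4 * c)) m q N pred≤ 1≤m 1≤c (≤-trans (*-monoʳ-≤ (c * c) (≤-trans (m≤m*n m (B c)) m≤)) (cc c (m * B c) q ≤-refl 1≤c)) 648q≤N)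
          ≤-refl
          (small-bound c β Δ q N cccβ 648q≤N HΔ)
          (small-bound2 c β q N (c1 c β q (cc c β q cccβ 1≤c) 1≤c) 648q≤N)
          (slack-bound c β k q N Δ (cc c β q cccβ 1≤c) (c1 c β q (cc c β q cccβ 1≤c) 1≤c) 648q≤N gk≤N
            (*-monoˡ-≤ k (m≤m*n c c {{>-nonZero 1≤c}})) (*-monoˡ-≤ Δ (m≤m*n (c * c) c {{>-nonZero 1≤c}})) HΔ 2≤N)
          (≤-trans (km N (H c) m N≤2Hm) (≤-reflexive (cong (_* m) (sym 1+K))))
          (zkm N k m (g c) (H c) N≤2gk N≤2Hm)
          (≤-trans (≤-reflexive (cong (λ K → 3 * (z c * z c * (K * K))) 1+K)) (≤-trans (m≤m+n _ _) N₀≤N))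
        where
        1≤ccc : 1 ≤ c * c * c
        1≤ccc = *-mono-≤ (*-mono-≤ 1≤c 1≤c) 1≤c
        1≤H : 1 ≤ H c
        1≤H = *-mono-≤ (s≤s (z≤n {647})) (*-mono-≤ 1≤ccc (s≤s (z≤n {48 * c + (24 * c + 1) * L c})))
        1≤g : 1 ≤ g c
        1≤g = *-mono-≤ (*-mono-≤ (s≤s (z≤n {115})) 1≤c) 1≤c
        1+K : suc (pred (K c)) ≡ K c
        1+K = suc-pred (K c) {{>-nonZero (*-mono-≤ (s≤s (z≤n {11})) 1≤H)}}
        tail≤N : H c * suc (11 + 4 * H c * H c) + g c ≤ N
        tail≤N = ≤-trans (m≤n+m _ (3 * (z c * z c * (K c * K c)))) N₀≤N
        1≤N : 1 ≤ N
        1≤N = ≤-trans 1≤g (≤-trans (m≤n+m _ _) tail≤N)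
        2≤N : 2 ≤ N
        2≤N = ≤-trans (s≤s (s≤s z≤n)) (≤-trans (*-mono-≤ 1≤H (≤-refl {suc (11 + 4 * H c * H c)})) (≤-trans (m≤m+n _ _) tail≤N))
        Qm : ∃ λ m → H c * m ≤ N × N < H c * suc m
        Qm = quotient N (H c) 1≤H
        Qk : ∃ λ k → g c * k ≤ N × N < g c * suc k
        Qk = quotient N (g c) 1≤g
        m k : ℕ
        m = proj₁ Qm
        k = proj₁ Qk
        m-big : suc (11 + 4 * H c * H c) ≤ m
        m-big = ≤-pred (*-cancelˡ-< (H c) _ _ (q-pos (H c) m N (11 + 4 * H c * H c) (proj₂ (proj₂ Qm)) (≤-trans (m≤m+n _ _) tail≤N)))
        1≤m : 1 ≤ m
        1≤m = ≤-trans (s≤s z≤n) m-big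
        1≤k : 1 ≤ k
        1≤k = ≤-pred (*-cancelˡ-< (g c) 1 (suc k) (≤-<-trans (≤-trans (≤-reflexive (*-identityʳ (g c))) (≤-trans (m≤n+m _ _) tail≤N)) (proj₂ (proj₂ Qk))))
        N≤2Hm : N ≤ 2 * H c * m
        N≤2Hm = double (H c) m N (proj₂ (proj₂ Qm)) 1≤m
        N≤2gk : N ≤ 2 * g c * k
        N≤2gk = double (g c) k N (proj₂ (proj₂ Qk)) 1≤k
        gk≤N : 116 * c * c * k ≤ N
        gk≤N = proj₁ (proj₂ Qk)
        β q : ℕ
        β = suc (pred (4 * c) * (2 * m) * 6) + (3 * (pred (4 * c) * (2 * m)) + 1) * L c
        q = c * c * c * (m * B c)
        pred≤ : pred (4 * c) ≤ 4 * c
        pred≤ = pred[n]≤n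
        m≤ : m * B c ≤ m * B c
        m≤ = ≤-refl
        β≤ : β ≤ m * B c
        β≤ = beta-bound c (pred (4 * c)) m (pred (4 * c) * (2 * m)) (L c) (B c) pred≤ refl 1≤m refl
        cccβ : c * c * c * β ≤ q
        cccβ = *-monoʳ-≤ (c * c * c) β≤
        648q≤N : 648 * q ≤ N
        648q≤N = ≤-trans (≤-reflexive (cong (648 *_) (cong (c * c * c *_) (*-comm m (B c)) ∙ sym (*-assoc (c * c * c) (B c) m)) ∙ sym (*-assoc 648 (c * c * c * B c) m))) (proj₁ (proj₂ Qm))

  -- Sparse cuts

  ∑-lookup : ∀ {A : Set} (L : List A) (f : A → ℕ) → ∑[ i ∈ allFin (length L) ] f (lookup L i) ≡ ∑ L f
  ∑-lookup [] f = refl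
  ∑-lookup (x ∷ L) f = ∑-allFin-suc (λ i → f (lookup (x ∷ L) i)) ∙ cong (f x +_) (∑-lookup L f)

  walk-image : ∀ {A B : Set} {R : A → A → Set} {S : B → B → Set} (f : A → B) → (∀ {x y} → R x y → S (f x) (f y)) →
               ∀ {x y l} → Walk R x y l → Walk S (f x) (f y) (map f l)
  walk-image f h [ x ] = [ f x ]
  walk-image f h (x ∷⟨ r ⟩ w) = f x ∷⟨ h r ⟩ walk-image f h w

  module DenseWalks {N : ℕ} (E : Fin N → Fin N → Bool) (typ : Fin N → Bool) (g α : ℕ)
    (atypical : ∑[ i ∈ allFin N ] 𝟙 (not (typ i)) ≤ α)
    (out≥ : ∀ x → g + α ≤ ∑[ y ∈ allFin N ] 𝟙 (E x y)) (in≥ : ∀ y → g + α ≤ ∑[ x ∈ allFin N ] 𝟙 (E x y))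
    (common : ∀ a p → typ a ≡ true → typ p ≡ true → g ≤ ∑[ b ∈ allFin N ] (𝟙 (E a b) * 𝟙 (E p b))) where

    open Graph E

    typical-in : ∀ v → g ≤ ∑[ a ∈ U ] (𝟙 (typ a) * 𝟙 (E a v))
    typical-in v = +-cancelʳ-≤ α _ _ (≤-trans (in≥ v) (≤-trans (∑-mono U λ a → pt (typ a) (E a v)) (≤-trans (≤-reflexive (∑-+ U _ _)) (+-monoʳ-≤ _ atypical))))
      where
      pt : ∀ t e → 𝟙 e ≤ 𝟙 t * 𝟙 e + 𝟙 (not t)
      pt true e = ≤-trans (m≤m+n _ _) (m≤m+n (𝟙 e + 0) 0)
      pt false e = 𝟙≤1 e

    some-out : ∀ x → g ≤ ∑[ y ∈ U ] 𝟙 (E x y)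
    some-out x = ≤-trans (m≤m+n g α) (out≥ x)

    some-in : ∀ x → g ≤ ∑[ y ∈ U ] 𝟙 (E y x)
    some-in x = ≤-trans (m≤m+n g α) (in≥ x)

    arrivals departures : V → ℕ
    arrivals s = ∑[ a ∈ U ] (𝟙 (typ a) * walks₃ s a)
    departures t = ∑[ p ∈ U ] ∑[ w ∈ U ] (𝟙 (typ p) * (𝟙 (E p w) * 𝟙 (E t w)))

    times≥ : ∀ (f : V → ℕ) b → (∀ x → b ≤ f x) → ∀ (e : V → ℕ) → ∑ U e * b ≤ ∑[ x ∈ U ] (e x * f x)
    times≥ f b h e = ≤-trans (≤-reflexive (sym (∑-*ʳ U b e))) (∑-mono U λ x → *-monoʳ-≤ (e x) (h x))

    departures≥ : ∀ t → g * g ≤ departures t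
    departures≥ t = ≤-trans (*-monoˡ-≤ g (some-out t)) (≤-trans (times≥ (λ w → ∑[ p ∈ U ] (𝟙 (typ p) * 𝟙 (E p w))) g typical-in (λ w → 𝟙 (E t w)))
      (≤-reflexive (∑-cong U (λ w → sym (∑-*ˡ U (𝟙 (E t w)) _) ∙ ∑-cong U λ p → *-comm (𝟙 (E t w)) _ ∙ *-assoc (𝟙 (typ p)) (𝟙 (E p w)) (𝟙 (E t w))) ∙ ∑-swap U U _)))

    arrivals≥ : ∀ s → g * (g * g) ≤ arrivals s
    arrivals≥ s = ≤-trans (*-monoˡ-≤ (g * g) (some-in s)) (≤-trans (times≥ (λ u → ∑[ v ∈ U ] (𝟙 (E u v) * ∑[ a ∈ U ] (𝟙 (typ a) * 𝟙 (E a v)))) (g * g)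
        (λ u → ≤-trans (*-monoˡ-≤ g (some-out u)) (times≥ _ g typical-in (λ v → 𝟙 (E u v)))) (λ u → 𝟙 (E u s)))
      (≤-reflexive (∑-cong U (λ u → sym (∑-*ˡ U (𝟙 (E u s)) _) ∙ ∑-cong U (λ v → cong (𝟙 (E u s) *_) (sym (∑-*ˡ U (𝟙 (E u v)) _)) ∙ sym (∑-*ˡ U (𝟙 (E u s)) _)
           ∙ ∑-cong U λ a → re (𝟙 (E u s)) (𝟙 (E u v)) (𝟙 (typ a)) (𝟙 (E a v))) ∙ ∑-swap U U _) ∙ ∑-swap U U _
         ∙ ∑-cong U λ a → ∑-cong U (λ u → ∑-*ˡ U (𝟙 (typ a)) _) ∙ ∑-*ˡ U (𝟙 (typ a)) _)))
      where
      re : ∀ a b c d → a * (b * (c * d)) ≡ c * (a * (b * d))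
      re a b c d =
          ≤-antisym
          (lin ρ (# 0 ⊗ (# 1 ⊗ (# 2 ⊗ # 3))) (# 2 ⊗ (# 0 ⊗ (# 1 ⊗ # 3))) 0
          (triv) refl)
          (lin ρ (# 2 ⊗ (# 0 ⊗ (# 1 ⊗ # 3))) (# 0 ⊗ (# 1 ⊗ (# 2 ⊗ # 3))) 0
          (triv) refl)
        where
        ρ = a ∷ b ∷ c ∷ d ∷ []

    -- Choose u, v, a and w, p and finally b in s ← u → v ← a → b ← p → w ← t, with a and p typical:
    -- each choice has at least g possibilities, the last one because typical vertices share
    -- out-neighbours.
    walks₇≥ : ∀ s t → g * g * g * g * g * g ≤ walks₇ s t
    walks₇≥ s t = begin
      g * g * g * g * g * g ≡⟨ six g ⟩
      g * (g * (g * g) * (g * g)) ≤⟨ *-monoʳ-≤ g (*-mono-≤ (arrivals≥ s) (departures≥ t)) ⟩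
      g * (arrivals s * departures t) ≡⟨ cong (g *_) (∑-*∑ U U _ _) ∙ sym (∑∑-*ˡ g _) ⟩
      ∑∑ (λ a p → g * (𝟙 (typ a) * walks₃ s a * D p)) ≤⟨ ∑∑-mono pt ⟩
      ∑∑ (λ a p → ∑[ b ∈ U ] (walks₃ s a * (𝟙 (E a b) * (𝟙 (E p b) * D′ p)))) ≡⟨ ∑-cong U (λ a → ∑-swap U U _) ⟩
      ∑∑ (λ a b → ∑[ p ∈ U ] (walks₃ s a * (𝟙 (E a b) * (𝟙 (E p b) * D′ p)))) ≡⟨ ∑∑-cong (λ a b → ∑-*ˡ U (walks₃ s a) _ ∙ cong (walks₃ s a *_) (∑-*ˡ U (𝟙 (E a b)) _
          ∙ cong (𝟙 (E a b) *_) (∑-cong U λ p → sym (∑-*ˡ U (𝟙 (E p b)) _)))) ⟩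
      walks₇ s t ∎
      where
      open ≤-Reasoning
      D D′ : V → ℕ
      D p = ∑[ w ∈ U ] (𝟙 (typ p) * (𝟙 (E p w) * 𝟙 (E t w)))
      D′ p = ∑[ w ∈ U ] (𝟙 (E p w) * 𝟙 (E t w))
      six : ∀ g → g * g * g * g * g * g ≡ g * (g * (g * g) * (g * g))
      six g =
          ≤-antisym
          (lin ρ (# 0 ⊗ # 0 ⊗ # 0 ⊗ # 0 ⊗ # 0 ⊗ # 0) (# 0 ⊗ (# 0 ⊗ (# 0 ⊗ # 0) ⊗ (# 0 ⊗ # 0))) 0
          (triv) refl)
          (lin ρ (# 0 ⊗ (# 0 ⊗ (# 0 ⊗ # 0) ⊗ (# 0 ⊗ # 0))) (# 0 ⊗ # 0 ⊗ # 0 ⊗ # 0 ⊗ # 0 ⊗ # 0) 0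
          (triv) refl)
        where
        ρ = g ∷ []

      mv : ∀ g C w d → g ≤ C → g * ((w + 0) * (d + 0)) ≤ C * (w * d)
      mv g C w d H =
          lin ρ (# 0 ⊗ ((# 2 ⊕ con 0) ⊗ (# 3 ⊕ con 0))) (# 1 ⊗ (# 2 ⊗ # 3)) 0
          ((# 2 ⊗ # 3 ⊗ # 0 ≼ # 2 ⊗ # 3 ⊗ # 1 by *-monoʳ-≤ (w * d) (H))) refl
        where
        ρ = g ∷ C ∷ w ∷ d ∷ []

      re′ : ∀ C w d → C * (w * d) ≡ w * (C * d)
      re′ C w d =
          ≤-antisym
          (lin ρ (# 0 ⊗ (# 1 ⊗ # 2)) (# 1 ⊗ (# 0 ⊗ # 2)) 0
          (triv) refl)
          (lin ρ (# 1 ⊗ (# 0 ⊗ # 2)) (# 0 ⊗ (# 1 ⊗ # 2)) 0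
          (triv) refl)
        where
        ρ = C ∷ w ∷ d ∷ []
      pt : ∀ a p → g * (𝟙 (typ a) * walks₃ s a * D p) ≤ ∑[ b ∈ U ] (walks₃ s a * (𝟙 (E a b) * (𝟙 (E p b) * D′ p)))
      pt a p with typ a in ea | typ p in ep
      ... | false | _ = ≤-trans (≤-reflexive (*-zeroʳ g)) z≤n
      ... | true | false = ≤-trans (≤-reflexive (cong (λ k → g * (1 * walks₃ s a * k)) (∑-zero U) ∙ cong (g *_) (*-zeroʳ (1 * walks₃ s a)) ∙ *-zeroʳ g)) z≤n
      ... | true | true = ≤-trans (*-monoʳ-≤ g (*-monoʳ-≤ (1 * walks₃ s a) (≤-reflexive (∑-*ˡ U 1 (λ w → 𝟙 (E p w) * 𝟙 (E t w))))))
        (≤-trans (mv g (∑[ b ∈ U ] (𝟙 (E a b) * 𝟙 (E p b))) (walks₃ s a) (D′ p) (common a p ea ep))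
        (≤-reflexive (re′ (∑[ b ∈ U ] (𝟙 (E a b) * 𝟙 (E p b))) (walks₃ s a) (D′ p) ∙ cong (walks₃ s a *_) (sym (∑-*ʳ U (D′ p) _)) ∙ sym (∑-*ˡ U (walks₃ s a) _)
          ∙ ∑-cong U λ b → cong (walks₃ s a *_) (*-assoc (𝟙 (E a b)) (𝟙 (E p b)) (D′ p)))))

  -- Degrees into a room survive the contraction up to ξ, because the list of entrances misses at
  -- most ξ elements of `Y`.
  sublist-sum : ∀ {n} (ys : List (Fin n)) (Y e : Fin n → Bool) ξ → (∀ y → occ y ys ≤ 𝟙 (Y y)) → card Y ≤ length ys + ξ →
    (∑[ y ∈ ys ] 𝟙 (e y) ≤ ∑[ y ∈ allFin n ] (𝟙 (Y y) * 𝟙 (e y))) × (∑[ y ∈ allFin n ] (𝟙 (Y y) * 𝟙 (e y)) ≤ ∑[ y ∈ ys ] 𝟙 (e y) + ξ)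
  sublist-sum {n} ys Y e ξ h hξ = ≤-trans (≤-reflexive (∑-occ ys _)) (∑-mono (allFin n) λ y → *-monoˡ-≤ (𝟙 (e y)) (h y)) ,
    arith (∑[ y ∈ allFin n ] (𝟙 (Y y) * 𝟙 (e y))) (∑[ y ∈ ys ] 𝟙 (e y)) (card Y) (length ys) ξ
      (≤-trans (+-monoʳ-≤ _ (≤-reflexive (length-occ ys))) (≤-trans (≤-reflexive (sym (∑-+ (allFin n) _ _))) (≤-trans (∑-mono (allFin n) λ y → pt (𝟙 (Y y)) (occ y ys) (e y) (h y))
        (≤-reflexive (∑-+ (allFin n) _ _ ∙ cong (_+ card Y) (sym (∑-occ ys _))))))) hξ
    where
    arith : ∀ A B C l x → A + l ≤ B + C → C ≤ l + x → A ≤ B + x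
    arith A B C l x H1 H2 =
        lin ρ (# 0) (# 1 ⊕ # 4) 0
        ((# 0 ⊕ # 3 ≼ # 1 ⊕ # 2 by H1)
          ⊞ (# 2 ≼ # 3 ⊕ # 4 by H2)) refl
      where
      ρ = A ∷ B ∷ C ∷ l ∷ x ∷ []
    pt : ∀ Y o e → o ≤ Y → Y * 𝟙 e + o ≤ o * 𝟙 e + Y
    pt Y o true h = ≤-reflexive (cong₂ _+_ (*-identityʳ Y) (sym (*-identityʳ o)) ∙ +-comm Y _)
    pt Y o false h = ≤-trans (≤-reflexive (cong (_+ o) (*-zeroʳ Y))) (≤-trans h (m≤n+m Y (o * 0)))

  -- Cutting a cycle of paths at its doors

  module DoorPaths {n : ℕ} (E : Fin n → Fin n → Bool) where

    V : Set
    V = Fin n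

    Edge : V → V → Set
    Edge x y = E x y ≡ true

    Pth : Set
    Pth = Path Edge

    flatten : ∀ {p q l} → Walk (λ a b → Edge (tl a) (hd b)) p q l →
              ∃ λ vs → Walk Edge (hd {R = Edge} p) (tl q) vs × (∀ v → occ v vs ≡ inside v l)
    flatten [ p ] = _ , Path.walk p , λ v → sym (+-identityʳ _)
    flatten (p ∷⟨ r ⟩ w) with flatten w
    ... | _ , w′ , o = _ , (Path.walk p ⟨ r ⟩++ w′) , λ v → occ-++ v (vs p) _ ∙ cong (occ v (vs p) +_) (o v)

    -- A door (p , q) enters the room along p and is left through q.
    Piece : Set
    Piece = Pth ⊎ (Pth × Pth)

    inn out : Piece → V
    inn (inj₁ p) = hd p
    inn (inj₂ (p , q)) = hd p
    out (inj₁ p) = tl p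
    out (inj₂ (p , q)) = tl q

    isDoor : Piece → ℕ
    isDoor (inj₁ _) = 0
    isDoor (inj₂ _) = 1

    content door-head door-tail : V → Piece → ℕ
    content v (inj₁ p) = occ v (vs p)
    content v (inj₂ (p , q)) = occ v (vs p) + occ v (vs q)
    door-head v (inj₁ p) = 0
    door-head v (inj₂ (p , q)) = 𝟙 (hd q == v)
    door-tail v (inj₁ p) = 0
    door-tail v (inj₂ (p , q)) = 𝟙 (tl p == v)

    record Closed (x y : V) (l : List Piece) : Set where
      constructor closed
      field
        {verts} : List V
        through : Walk Edge x y verts
        content≡ : ∀ v → occ v verts ≡ ∑ l (content v)
        no-door : ∑ l isDoor ≡ 0

    -- The cut falls between the two paths of every door. `middle` holds the complete segments from
    -- the second path of one door to the first path of the next; `start` and `end` are the outer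
    -- segments, still to be joined by the closing edge of the cycle.
    record Opened (x y : V) (l : List Piece) : Set where
      constructor opened
      field
        {x′ y′} : V
        {verts₁ verts₂} : List V
        start : Walk Edge x x′ verts₁
        middle : List Pth
        end : Walk Edge y′ y verts₂
        content≡ : ∀ v → occ v verts₁ + (inside v middle + occ v verts₂) ≡ ∑ l (content v)
        heads≡ : ∀ v → 𝟙 (y′ == v) + heads v middle ≡ ∑ l (door-head v)
        tails≡ : ∀ v → 𝟙 (x′ == v) + tails v middle ≡ ∑ l (door-tail v)

    cut-at-doors : ∀ {a b l} → Walk (λ a b → Edge (out a) (inn b)) a b l → Closed (inn a) (out b) l ⊎ Opened (inn a) (out b) l
    cut-at-doors [ inj₁ p ] = inj₁ (closed (Path.walk p) (λ v → sym (+-identityʳ _)) refl)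
    cut-at-doors [ inj₂ (p , q) ] = inj₂ (opened (Path.walk p) [] (Path.walk q) (λ v → sym (+-identityʳ _)) (λ v → refl) (λ v → refl))
    cut-at-doors (inj₁ p ∷⟨ r ⟩ w) with cut-at-doors w
    ... | inj₁ (closed t c nd) = inj₁ (closed (Path.walk p ⟨ r ⟩++ t) (λ v → occ-++ v (vs p) _ ∙ cong (occ v (vs p) +_) (c v)) nd)
    ... | inj₂ (opened s m e c hs ts) = inj₂ (opened (Path.walk p ⟨ r ⟩++ s) m e
          (λ v → cong (_+ _) (occ-++ v (vs p) _) ∙ +-assoc (occ v (vs p)) _ _ ∙ cong (occ v (vs p) +_) (c v)) hs ts)
    cut-at-doors {l = _ ∷ l} (inj₂ (p , q) ∷⟨ r ⟩ w) with cut-at-doors w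
    ... | inj₁ (closed t c nd) = inj₂ (opened (Path.walk p) [] (Path.walk q ⟨ r ⟩++ t)
          (λ v → cong (occ v (vs p) +_) (occ-++ v (vs q) _ ∙ cong (occ v (vs q) +_) (c v)) ∙ sym (+-assoc (occ v (vs p)) _ _))
          (λ v → cong (𝟙 (hd q == v) +_) (sym (none (door-head v) (λ { (inj₁ _) → z≤n ; (inj₂ (_ , q)) → 𝟙≤1 (hd q == v) }) l nd)))
          (λ v → cong (𝟙 (tl p == v) +_) (sym (none (door-tail v) (λ { (inj₁ _) → z≤n ; (inj₂ (p , _)) → 𝟙≤1 (tl p == v) }) l nd))))
      where
      none : ∀ (f : Piece → ℕ) → (∀ a → f a ≤ isDoor a) → ∀ l → ∑ l isDoor ≡ 0 → ∑ l f ≡ 0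
      none f h l e = n≤0⇒n≡0 (≤-trans (∑-mono l h) (≤-reflexive e))
    ... | inj₂ (opened {x′} {y′} {v₁} {v₂} s m e c hs ts) = inj₂ (opened (Path.walk p) (path (Path.walk q ⟨ r ⟩++ s) ∷ m) e
          (λ v → cong (λ k → occ v (vs p) + (k + inside v m + occ v v₂)) (occ-++ v (vs q) v₁) ∙ re (occ v (vs p)) (occ v (vs q)) (occ v v₁) (inside v m) (occ v v₂) _ (c v))
          (λ v → swap+ [] (𝟙 (y′ == v)) (𝟙 (hd q == v)) (heads v m) ∙ cong (𝟙 (hd q == v) +_) (hs v))
          (λ v → cong (𝟙 (tl p == v) +_) (ts v)))
      where
      re : ∀ p q a m b r → a + (m + b) ≡ r → p + (q + a + m + b) ≡ p + q + r
      re p q a m b r H =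
          ≤-antisym
          (lin ρ (# 0 ⊕ (# 1 ⊕ # 2 ⊕ # 3 ⊕ # 4)) (# 0 ⊕ # 1 ⊕ # 5) 0
          ((# 2 ⊕ (# 3 ⊕ # 4) ≼ # 5 by ≤-reflexive H)) refl)
          (lin ρ (# 0 ⊕ # 1 ⊕ # 5) (# 0 ⊕ (# 1 ⊕ # 2 ⊕ # 3 ⊕ # 4)) 0
          ((# 5 ≼ # 2 ⊕ (# 3 ⊕ # 4) by ≤-reflexive (sym H))) refl)
        where
        ρ = p ∷ q ∷ a ∷ m ∷ b ∷ r ∷ []

  ∑-zip₁ : ∀ {A B : Set} (xs : List A) (ys : List B) → length xs ≡ length ys → ∀ f → ∑ (zip xs ys) (f ∘ proj₁) ≡ ∑ xs f
  ∑-zip₁ [] [] e f = refl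
  ∑-zip₁ (x ∷ xs) (y ∷ ys) e f = cong (f x +_) (∑-zip₁ xs ys (suc-injective e) f)

  ∑-zip₂ : ∀ {A B : Set} (xs : List A) (ys : List B) → length xs ≡ length ys → ∀ f → ∑ (zip xs ys) (f ∘ proj₂) ≡ ∑ ys f
  ∑-zip₂ [] [] e f = refl
  ∑-zip₂ (x ∷ xs) (y ∷ ys) e f = cong (f y +_) (∑-zip₂ xs ys (suc-injective e) f)

  -- Linear forests and their selection from a dense relation

  module Forests {n : ℕ} where

    V : Set
    V = Fin n

    srcs tgts : List (V × V) → V → ℕ
    srcs es v = occ v (map proj₁ es)
    tgts es v = occ v (map proj₂ es)

    record Forest (es : List (V × V)) : Set where
      field
        src≤1 : ∀ v → srcs es v ≤ 1
        tgt≤1 : ∀ v → tgts es v ≤ 1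
        rank : V → ℕ
        ranked : ∀ {x y} → (x , y) ∈ es → rank x < rank y
    open Forest

    ∈-srcs : ∀ {es x y} → (x , y) ∈ es → 1 ≤ srcs es x
    ∈-srcs i = ∈⇒occ (∈-map⁺ proj₁ i)

    ∈-tgts : ∀ {es x y} → (x , y) ∈ es → 1 ≤ tgts es y
    ∈-tgts i = ∈⇒occ (∈-map⁺ proj₂ i)

    absent : ∀ {a b : ℕ} → 1 ≤ a → a ≡ 0 → ⊥
    absent (s≤s _) ()

    empty : Forest []
    empty = record { src≤1 = λ _ → z≤n ; tgt≤1 = λ _ → z≤n ; rank = λ _ → 0 ; ranked = λ () }

    insert-occ : ∀ z (xs : List V) → (∀ v → occ v xs ≤ 1) → occ z xs ≡ 0 → ∀ v → occ v (z ∷ xs) ≤ 1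
    insert-occ z xs h h0 v with z ≟ v
    ... | yes refl = ≤-reflexive (cong suc h0)
    ... | no _ = h v

    add-out : ∀ {es} v z → Forest es → srcs es v ≡ 0 → srcs es z ≡ 0 → tgts es z ≡ 0 → ¬ (v ≡ z) → Forest ((v , z) ∷ es)
    add-out {es} v z F v∉ z∉ z∉′ v≢z = record
      { src≤1 = insert-occ v (map proj₁ es) (src≤1 F) v∉ ; tgt≤1 = insert-occ z (map proj₂ es) (tgt≤1 F) z∉′ ; rank = ρ ; ranked = ranked′ }
      where
      ρ : V → ℕ
      ρ w = if w == z then suc (rank F v) else rank F w
      ρ-z : ρ z ≡ suc (rank F v)
      ρ-z rewrite ==-refl z = refl
      ρ-≢ : ∀ {w} → ¬ (w ≡ z) → ρ w ≡ rank F w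
      ρ-≢ {w} h rewrite ≢⇒== h = refl
      ranked′ : ∀ {x y} → (x , y) ∈ (v , z) ∷ es → ρ x < ρ y
      ranked′ (here refl) = ≤-reflexive (cong suc (ρ-≢ v≢z) ∙ sym ρ-z)
      ranked′ (there i) = ≤-trans (s≤s (≤-reflexive (ρ-≢ λ { refl → absent {b = 0} (∈-srcs i) z∉ }))) (≤-trans (ranked F i) (≤-reflexive (sym (ρ-≢ λ { refl → absent {b = 0} (∈-tgts i) z∉′ }))))

    -- Room below `v` is made by giving the untouched vertex `u` rank 0 and raising all other ranks
    -- by one.
    add-in : ∀ {es} u v → Forest es → tgts es v ≡ 0 → srcs es u ≡ 0 → tgts es u ≡ 0 → ¬ (u ≡ v) → Forest ((u , v) ∷ es)
    add-in {es} u v F v∉ u∉ u∉′ u≢v = record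
      { src≤1 = insert-occ u (map proj₁ es) (src≤1 F) u∉ ; tgt≤1 = insert-occ v (map proj₂ es) (tgt≤1 F) v∉ ; rank = ρ ; ranked = ranked′ }
      where
      ρ : V → ℕ
      ρ w = if w == u then 0 else suc (rank F w)
      ρ-u : ρ u ≡ 0
      ρ-u rewrite ==-refl u = refl
      ρ-≢ : ∀ {w} → ¬ (w ≡ u) → ρ w ≡ suc (rank F w)
      ρ-≢ {w} h rewrite ≢⇒== h = refl
      ranked′ : ∀ {x y} → (x , y) ∈ (u , v) ∷ es → ρ x < ρ y
      ranked′ (here refl) = ≤-trans (s≤s (≤-reflexive ρ-u)) (≤-trans (s≤s z≤n) (≤-reflexive (sym (ρ-≢ λ { refl → u≢v refl }))))
      ranked′ (there i) = ≤-trans (s≤s (≤-reflexive (ρ-≢ λ { refl → absent {b = 0} (∈-srcs i) u∉ }))) (≤-trans (s≤s (ranked F i)) (≤-reflexive (sym (ρ-≢ λ { refl → absent {b = 0} (∈-tgts i) u∉′ }))))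

    -- Tells where the path from a vertex will end before the edges have been linked to paths; this
    -- certifies a door.
    data Ends (es : List (V × V)) : V → V → Set where
      stop : ∀ {v} → srcs es v ≡ 0 → Ends es v v
      step : ∀ {u v w} → (u , v) ∈ es → Ends es v w → Ends es u w

    unique-target : ∀ {es u v v′} → srcs es u ≤ 1 → (u , v) ∈ es → (u , v′) ∈ es → v ≡ v′
    unique-target h (here refl) (here refl) = refl
    unique-target {_ ∷ es} {u} h (here refl) (there j) = ⊥-elim (absent {b = 0} (∈-srcs j) (n≤0⇒n≡0 (≤-pred (≤-trans (≤-reflexive (sym (occ-here u (map proj₁ es)))) h))))
    unique-target {_ ∷ es} {u} h (there i) (here refl) = ⊥-elim (absent {b = 0} (∈-srcs i) (n≤0⇒n≡0 (≤-pred (≤-trans (≤-reflexive (sym (occ-here u (map proj₁ es)))) h))))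
    unique-target h (there i) (there j) = unique-target (≤-trans (m≤n+m _ _) h) i j

    follow : ∀ {es u v w l} → Forest es → Walk (λ x y → (x , y) ∈ es) u w l → srcs es w ≡ 0 → Ends es u v → v ≡ w
    follow F [ x ] e (stop _) = refl
    follow F [ x ] e (step i _) = ⊥-elim (absent {b = 0} (∈-srcs i) e)
    follow F (x ∷⟨ i ⟩ w) e (stop e′) = ⊥-elim (absent {b = 0} (∈-srcs i) e′)
    follow F (x ∷⟨ i ⟩ w) e (step j E) with unique-target (src≤1 F x) i j
    ... | refl = follow F w e E

    total : (V → V → Bool) → ℕ
    total F = ∑[ x ∈ allFin n ] ∑[ y ∈ allFin n ] 𝟙 (F x y)

    out-count in-count : (V → V → Bool) → V → ℕ
    out-count F x = ∑[ y ∈ allFin n ] 𝟙 (F x y)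
    in-count F y = ∑[ x ∈ allFin n ] 𝟙 (F x y)

    record Selected (F : V → V → Bool) (k : ℕ) : Set where
      field
        es : List (V × V)
        len : length es ≡ k
        es⊆F : ∀ {x y} → (x , y) ∈ es → F x y ≡ true
        forest : Forest es

    srcs-none : ∀ {es} (F : V → V → Bool) v → (∀ {x y} → (x , y) ∈ es → F x y ≡ true) → (∀ y → F v y ≡ false) → srcs es v ≡ 0
    srcs-none {es} F v h none with srcs es v in eq
    ... | zero = refl
    ... | suc _ with ∈-map⁻ proj₁ (occ⇒∈ {x = v} (map proj₁ es) (≤-trans (s≤s z≤n) (≤-reflexive (sym eq))))
    ...   | (_ , y) , i , refl = ⊥-elim (true≢false (sym (h i) ∙ none y))

    tgts-none : ∀ {es} (F : V → V → Bool) v → (∀ {x y} → (x , y) ∈ es → F x y ≡ true) → (∀ x → F x v ≡ false) → tgts es v ≡ 0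
    tgts-none {es} F v h none with tgts es v in eq
    ... | zero = refl
    ... | suc _ with ∈-map⁻ proj₂ (occ⇒∈ {x = v} (map proj₂ es) (≤-trans (s≤s z≤n) (≤-reflexive (sym eq))))
    ...   | (x , _) , i , refl = ⊥-elim (true≢false (sym (h i) ∙ none x))

    touched : List (V × V) → V → ℕ
    touched es v = srcs es v + tgts es v

    total-touched : ∀ es → ∑ (allFin n) (touched es) ≡ length es + length es
    total-touched es = ∑-+ (allFin n) _ _ ∙ cong₂ _+_ (sym (length-occ (map proj₁ es)) ∙ length-map proj₁ es) (sym (length-occ (map proj₂ es)) ∙ length-map proj₂ es)

    fresh-in : ∀ es (A : V → Bool) → length es + length es < card A → ∃ λ z → A z ≡ true × srcs es z ≡ 0 × tgts es z ≡ 0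
    fresh-in es A h with ∑-<⇒∃ (allFin n) {touched es} {𝟙 ∘ A} (≤-<-trans (≤-reflexive (total-touched es)) h)
    ... | z , _ , lt = z , 𝟙-true (≤-trans (s≤s z≤n) lt) , m+n≡0⇒m≡0 (srcs es z) e , m+n≡0⇒n≡0 (srcs es z) e
      where
      e : touched es z ≡ 0
      e = n≤0⇒n≡0 (≤-pred (≤-trans lt (𝟙≤1 (A z))))

    drop-arith : ∀ D k e e2 o → D * suc k ≤ e → e ≤ e2 + o → o ≤ D → D * k ≤ e2
    drop-arith D k e e2 o H1 H2 H3 =
        lin ρ (# 0 ⊗ # 1) (# 3) 0
        ((# 0 ⊗ (con 1 ⊕ # 1) ≼ # 2 by H1)
          ⊞ (# 2 ≼ # 3 ⊕ # 4 by H2)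
          ⊞ (# 4 ≼ # 0 by H3)) refl
      where
      ρ = D ∷ k ∷ e ∷ e2 ∷ o ∷ []

    four-arith : ∀ D k e e2 a b c d L → D * suc k ≤ e → e ≤ e2 + (a + b + (c + d)) → a < L → b < L → c < L → d < L → 4 * L ≤ D → D * k ≤ e2
    four-arith D k e e2 a b c d L H1 H2 H3 H4 H5 H6 H7 =
        lin ρ (# 0 ⊗ # 1) (# 3) 0
        ((# 0 ⊗ (con 1 ⊕ # 1) ≼ # 2 by H1)
          ⊞ (# 2 ≼ # 3 ⊕ (# 4 ⊕ # 5 ⊕ (# 6 ⊕ # 7)) by H2)
          ⊞ (con 1 ⊕ # 4 ≼ # 8 by H3)
          ⊞ (con 1 ⊕ # 5 ≼ # 8 by H4)
          ⊞ (con 1 ⊕ # 6 ≼ # 8 by H5)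
          ⊞ (con 1 ⊕ # 7 ≼ # 8 by H6)
          ⊞ (con 4 ⊗ # 8 ≼ # 0 by H7)) refl
      where
      ρ = D ∷ k ∷ e ∷ e2 ∷ a ∷ b ∷ c ∷ d ∷ L ∷ []

    L-weaken : ∀ k L → 2 * suc k < L → 2 * k < L
    L-weaken k L H =
        lin ρ (con 1 ⊕ con 2 ⊗ # 0) (# 1) 0
        ((con 1 ⊕ con 2 ⊗ (con 1 ⊕ # 0) ≼ # 1 by H)) refl
      where
      ρ = k ∷ L ∷ []

    L-fresh : ∀ k L o → 2 * suc k < L → L ≤ o → k + k < o
    L-fresh k L o H H2 =
        lin ρ (con 1 ⊕ (# 0 ⊕ # 0)) (# 2) 0
        ((con 1 ⊕ con 2 ⊗ (con 1 ⊕ # 0) ≼ # 1 by H)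
          ⊞ (# 1 ≼ # 2 by H2)) refl
      where
      ρ = k ∷ L ∷ o ∷ []

    some-edge : ∀ D k e L → D * suc k ≤ e → 4 * L ≤ D → 2 * suc k < L → 1 ≤ e
    some-edge D k e L H H2 H3 =
        lin ρ (con 1) (# 2) 11
        ((# 0 ⊗ (con 1 ⊕ # 1) ≼ # 2 by H)
          ⊞ (con 4 ⊗ # 3 ≼ # 0 by H2)
          ⊞ con 4 ⊠ (con 1 ⊕ con 2 ⊗ (con 1 ⊕ # 1) ≼ # 3 by H3)) refl
      where
      ρ = D ∷ k ∷ e ∷ L ∷ []

    -- A vertex of large degree gets a pendant edge at the end; otherwise edges can be chosen disjoint.
    select : ∀ D Λ k → 4 * Λ ≤ D → 2 * k < Λ → (F : V → V → Bool) → (∀ x → F x x ≡ false) →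
             (∀ x → out-count F x ≤ D) → (∀ y → in-count F y ≤ D) → D * k ≤ total F → Selected F k
    select D Λ zero hΛ hk F irr o i e = record { es = [] ; len = refl ; es⊆F = λ () ; forest = empty }
    select D Λ (suc k) hΛ hk F irr o i e with any? (λ v → Λ ≤? out-count F v) | any? (λ v → Λ ≤? in-count F v)
    ... | yes (v , big) | _ = go (select D Λ k hΛ (L-weaken k Λ hk) F′ (λ x → cong (_∧ not (x == v)) (irr x))
           (λ x → ≤-trans (∑-mono (allFin n) λ y → sub (F x y) _) (o x)) (λ y → ≤-trans (∑-mono (allFin n) λ x → sub (F x y) _) (i y))
           (drop-arith D k (total F) (total F′) (out-count F v) e
             (≤-trans (∑-mono (allFin n) λ x → ∑-mono (allFin n) λ y → pt (x == v) (F x y))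
               (≤-reflexive (∑-cong (allFin n) (λ x → ∑-+ (allFin n) _ _) ∙ ∑-+ (allFin n) _ _ ∙ cong (total F′ +_) (∑-cong (allFin n) (λ x → ∑-*ˡ (allFin n) (𝟙 (x == v)) _) ∙ ∑-δ′ v (out-count F))))) (o v)))
      where
      F′ : V → V → Bool
      F′ x y = F x y ∧ not (x == v)
      sub : ∀ a b → 𝟙 (a ∧ b) ≤ 𝟙 a
      sub true b = 𝟙≤1 b
      sub false b = z≤n
      pt : ∀ b f → 𝟙 f ≤ 𝟙 (f ∧ not b) + 𝟙 b * 𝟙 f
      pt b false = z≤n
      pt true true = ≤-refl
      pt false true = ≤-refl
      go : Selected F′ k → Selected F (suc k)
      -- Only the out-edges of `v` were removed, so `v` may be a target of the forest but is no
      -- source. It has more than 2k out-neighbours, and k edges touch at most 2k vertices.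
      go s with fresh-in (Selected.es s) (F v) (≤-<-trans (≤-reflexive (cong₂ _+_ (Selected.len s) (Selected.len s))) (L-fresh k Λ (out-count F v) hk big))
      ... | z , fz , z∉ , z∉′ = record
        { es = (v , z) ∷ Selected.es s ; len = cong suc (Selected.len s)
        ; es⊆F = λ { (here refl) → fz ; (there j) → ∧-proj₁ (Selected.es⊆F s j) }
        ; forest = add-out v z (Selected.forest s) (srcs-none F′ v (Selected.es⊆F s) λ y → gone y) z∉ z∉′ λ { refl → true≢false (sym fz ∙ irr v) } }
        where
        gone : ∀ y → F′ v y ≡ false
        gone y rewrite ==-refl v with F v y
        ... | true = refl
        ... | false = refl
    ... | no _ | yes (v , big) = go (select D Λ k hΛ (L-weaken k Λ hk) F′ (λ x → cong (_∧ not (x == v)) (irr x))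
           (λ x → ≤-trans (∑-mono (allFin n) λ y → sub (F x y) _) (o x)) (λ y → ≤-trans (∑-mono (allFin n) λ x → sub (F x y) _) (i y))
           (drop-arith D k (total F) (total F′) (in-count F v) e
             (≤-trans (∑-mono (allFin n) λ x → ∑-mono (allFin n) λ y → pt (y == v) (F x y))
               (≤-reflexive (∑-cong (allFin n) (λ x → ∑-+ (allFin n) _ _) ∙ ∑-+ (allFin n) _ _ ∙ cong (total F′ +_) (∑-cong (allFin n) (λ x → ∑-δ′ v (F′′ x)))))) (i v)))
      where
      F′ : V → V → Bool
      F′ x y = F x y ∧ not (y == v)
      F′′ : V → V → ℕ
      F′′ x y = 𝟙 (F x y)
      sub : ∀ a b → 𝟙 (a ∧ b) ≤ 𝟙 a
      sub true b = 𝟙≤1 b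
      sub false b = z≤n
      pt : ∀ b f → 𝟙 f ≤ 𝟙 (f ∧ not b) + 𝟙 b * 𝟙 f
      pt b false = z≤n
      pt true true = ≤-refl
      pt false true = ≤-refl
      go : Selected F′ k → Selected F (suc k)
      go s with fresh-in (Selected.es s) (λ u → F u v) (≤-<-trans (≤-reflexive (cong₂ _+_ (Selected.len s) (Selected.len s))) (L-fresh k Λ (in-count F v) hk big))
      ... | u , fu , u∉ , u∉′ = record
        { es = (u , v) ∷ Selected.es s ; len = cong suc (Selected.len s)
        ; es⊆F = λ { (here refl) → fu ; (there j) → ∧-proj₁ (Selected.es⊆F s j) }
        ; forest = add-in u v (Selected.forest s) (tgts-none F′ v (Selected.es⊆F s) λ x → gone x) u∉ u∉′ λ { refl → true≢false (sym fu ∙ irr v) } }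
        where
        gone : ∀ x → F′ x v ≡ false
        gone x rewrite ==-refl v with F x v
        ... | true = refl
        ... | false = refl
    ... | no ¬o | no ¬i with ∑-pos (allFin n) (out-count F) (some-edge D k (total F) Λ e hΛ hk)
    ...   | u , _ , pu with card-pos (F u) pu
    -- All degrees are below Λ here, so removing every edge at `u` or `v` costs less than 4Λ ≤ D
    -- edges.
    ...     | v , fuv = go (select D Λ k hΛ (L-weaken k Λ hk) F′ (λ x → cong (_∧ away x x) (irr x))
           (λ x → ≤-trans (∑-mono (allFin n) λ y → sub (F x y) _) (o x)) (λ y → ≤-trans (∑-mono (allFin n) λ x → sub (F x y) _) (i y))
           (four-arith D k (total F) (total F′) (out-count F u) (out-count F v) (in-count F u) (in-count F v) Λ e
             (≤-trans (∑-mono (allFin n) λ x → ∑-mono (allFin n) λ y → pt (x == u) (x == v) (y == u) (y == v) (F x y))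
               (≤-reflexive (∑-cong (allFin n) (λ x → ∑-+ (allFin n) _ _) ∙ ∑-+ (allFin n) _ _ ∙ cong (total F′ +_)
                 (∑-cong (allFin n) (λ x → ∑-+ (allFin n) _ _ ∙ cong₂ _+_ (∑-+ (allFin n) _ _ ∙ cong₂ _+_ (∑-*ˡ (allFin n) (𝟙 (x == u)) _) (∑-*ˡ (allFin n) (𝟙 (x == v)) _))
                     (∑-+ (allFin n) _ _ ∙ cong₂ _+_ (∑-δ′ u (F′′ x)) (∑-δ′ v (F′′ x))))
                  ∙ ∑-+ (allFin n) _ _ ∙ cong₂ _+_ (∑-+ (allFin n) _ _ ∙ cong₂ _+_ (∑-δ′ u (out-count F)) (∑-δ′ v (out-count F))) (∑-+ (allFin n) _ _)))))
             (lo u) (lo v) (li u) (li v) hΛ))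
      where
      away : V → V → Bool
      away x y = not (x == u) ∧ (not (x == v) ∧ (not (y == u) ∧ not (y == v)))
      F′ : V → V → Bool
      F′ x y = F x y ∧ away x y
      F′′ : V → V → ℕ
      F′′ x y = 𝟙 (F x y)
      sub : ∀ a b → 𝟙 (a ∧ b) ≤ 𝟙 a
      sub true b = 𝟙≤1 b
      sub false b = z≤n
      pt : ∀ a b c d f → 𝟙 f ≤ 𝟙 (f ∧ (not a ∧ (not b ∧ (not c ∧ not d)))) + (𝟙 a * 𝟙 f + 𝟙 b * 𝟙 f + (𝟙 c * 𝟙 f + 𝟙 d * 𝟙 f))
      pt a b c d false = z≤n
      pt true b c d true = s≤s z≤n
      pt false true c d true = s≤s z≤n
      pt false false true d true = s≤s z≤n
      pt false false false true true = s≤s z≤n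
      pt false false false false true = s≤s z≤n
      lo : ∀ x → out-count F x < Λ
      lo x = ≰⇒> λ h → ¬o (x , h)
      li : ∀ x → in-count F x < Λ
      li x = ≰⇒> λ h → ¬i (x , h)
      ∧f : ∀ a → a ∧ false ≡ false
      ∧f true = refl
      ∧f false = refl
      go : Selected F′ k → Selected F (suc k)
      go s = record
        { es = (u , v) ∷ Selected.es s ; len = cong suc (Selected.len s)
        ; es⊆F = λ { (here refl) → fuv ; (there j) → ∧-proj₁ (Selected.es⊆F s j) }
        ; forest = add-out u v (Selected.forest s) (srcs-none F′ u (Selected.es⊆F s) nu) (srcs-none F′ v (Selected.es⊆F s) nv) (tgts-none F′ v (Selected.es⊆F s) nt)
            λ { refl → true≢false (sym fuv ∙ irr u) } }
        where
        nu : ∀ y → F′ u y ≡ false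
        nu y rewrite ==-refl u = ∧f (F u y)
        nv : ∀ y → F′ v y ≡ false
        nv y rewrite ==-refl v = cong (F v y ∧_) (∧f (not (v == u))) ∙ ∧f (F v y)
        nt : ∀ x → F′ x v ≡ false
        nt x rewrite ==-refl v = cong (F x v ∧_) (cong (not (x == u) ∧_) (cong (not (x == v) ∧_) (∧f (not (v == u))) ∙ ∧f (not (x == v))) ∙ ∧f (not (x == u))) ∙ ∧f (F x v)

  𝟙≢ : ∀ {n} (x y : Fin n) → ¬ (x ≡ y) → 𝟙 (x == y) ≡ 0
  𝟙≢ x y h = cong 𝟙 (≢⇒== {x = x} {y} h)

  -- Few walks produce a sparse cut

  module RegularDigraph {n : ℕ} (E : Fin n → Fin n → Bool) (d : ℕ)
    (out-d : ∀ x → ∑[ y ∈ allFin n ] 𝟙 (E x y) ≡ d) (in-d : ∀ y → ∑[ x ∈ allFin n ] 𝟙 (E x y) ≡ d) where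

    open Graph E public

    all′ : V → Bool
    all′ _ = true

    outTo inFrom : V → (V → Bool) → ℕ
    outTo x P = ∑[ y ∈ U ] (𝟙 (P y) * 𝟙 (E x y))
    inFrom y P = ∑[ x ∈ U ] (𝟙 (P x) * 𝟙 (E x y))

    edges-out : ∀ A B → edges A B ≡ ∑[ x ∈ U ] (𝟙 (A x) * outTo x B)
    edges-out A B = ∑-cong U λ x → ∑-*ˡ U (𝟙 (A x)) _

    edges-in : ∀ A B → edges A B ≡ ∑[ y ∈ U ] (𝟙 (B y) * inFrom y A)
    edges-in A B = ∑-swap U U _ ∙ ∑-cong U λ y → ∑-cong U (λ x → swap* [] (𝟙 (A x)) (𝟙 (B y)) (𝟙 (E x y))) ∙ ∑-*ˡ U (𝟙 (B y)) _

    outTo-split : ∀ x P → outTo x P + outTo x (not ∘ P) ≡ d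
    outTo-split x P = sym (∑-+ U _ _) ∙ ∑-cong U (λ y → h (P y) (𝟙 (E x y))) ∙ out-d x
      where
      h : ∀ p e → 𝟙 p * e + 𝟙 (not p) * e ≡ e
      h true e = +-identityʳ _ ∙ +-identityʳ e
      h false e = +-identityʳ e

    inFrom-split : ∀ y P → inFrom y P + inFrom y (not ∘ P) ≡ d
    inFrom-split y P = sym (∑-+ U _ _) ∙ ∑-cong U (λ x → h (P x) (𝟙 (E x y))) ∙ in-d y
      where
      h : ∀ p e → 𝟙 p * e + 𝟙 (not p) * e ≡ e
      h true e = +-identityʳ _ ∙ +-identityʳ e
      h false e = +-identityʳ e

    outTo≤d : ∀ x P → outTo x P ≤ d
    outTo≤d x P = ≤-trans (m≤m+n _ _) (≤-reflexive (outTo-split x P))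

    inFrom≤d : ∀ x P → inFrom x P ≤ d
    inFrom≤d x P = ≤-trans (m≤m+n _ _) (≤-reflexive (inFrom-split x P))

    weigh : ∀ (A : V → Bool) b (f : V → ℕ) → (∀ x → A x ≡ true → f x ≤ b) → ∑[ x ∈ U ] (𝟙 (A x) * f x) ≤ size A * b
    weigh A b f h = ≤-trans (∑-mono U λ x → k (A x) (f x) (h x)) (≤-reflexive (∑-*ʳ U b _))
      where
      k : ∀ a y → (a ≡ true → y ≤ b) → 𝟙 a * y ≤ 𝟙 a * b
      k false y h = z≤n
      k true y h = *-monoʳ-≤ 1 (h refl)

    size≤n : ∀ A → size A ≤ n
    size≤n A = ≤-trans (∑U-bound 1 (𝟙≤1 ∘ A)) (≤-reflexive (*-identityʳ n))

    edges-right≤ : ∀ A B → edges A B ≤ size B * d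
    edges-right≤ A B = ≤-trans (≤-reflexive (edges-in A B)) (weigh B d _ λ y _ → inFrom≤d y A)

    edges-left≤ : ∀ A B → edges A B ≤ size A * d
    edges-left≤ A B = ≤-trans (≤-reflexive (edges-out A B)) (weigh A d _ λ x _ → outTo≤d x B)

    splitʳ : ∀ A B → edges A B + edges A (not ∘ B) ≡ size A * d
    splitʳ A B = cong₂ _+_ (edges-out A B) (edges-out A (not ∘ B)) ∙ sym (∑-+ U _ _)
      ∙ ∑-cong U (λ x → sym (*-distribˡ-+ (𝟙 (A x)) _ _) ∙ cong (𝟙 (A x) *_) (outTo-split x B)) ∙ ∑-*ʳ U d _

    splitˡ : ∀ A B → edges A B + edges (not ∘ A) B ≡ size B * d
    splitˡ A B = cong₂ _+_ (edges-in A B) (edges-in (not ∘ A) B) ∙ sym (∑-+ U _ _)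
      ∙ ∑-cong U (λ y → sym (*-distribˡ-+ (𝟙 (B y)) _ _) ∙ cong (𝟙 (B y) *_) (inFrom-split y A)) ∙ ∑-*ʳ U d _

    edges-mono : ∀ {A A′ B B′} → A ⊆ᵇ A′ → B ⊆ᵇ B′ → edges A B ≤ edges A′ B′
    edges-mono h k = ∑∑-mono λ x y → *-mono-≤ (⊆ᵇ-𝟙 (h x)) (*-monoˡ-≤ (𝟙 (E x y)) (⊆ᵇ-𝟙 (k y)))

    ≤ᵇ-true : ∀ {a b} → (a ≤ᵇ b) ≡ true → a ≤ b
    ≤ᵇ-true {a} {b} e = ≤ᵇ⇒≤ a b (subst T (sym e) _)

    true-≤ᵇ : ∀ {a b} → a ≤ b → (a ≤ᵇ b) ≡ true
    true-≤ᵇ {a} {b} h with a ≤ᵇ b | ≤⇒≤ᵇ h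
    ... | true | _ = refl

    ≤ᵇ-false : ∀ {a b} → (a ≤ᵇ b) ≡ false → b < a
    ≤ᵇ-false {a} {b} e with b <? a
    ... | yes p = p
    ... | no ¬p = ⊥-elim (true≢false (sym (true-≤ᵇ (≮⇒≥ ¬p)) ∙ e))

    -- A room (X, Y) together with its complement, in a form invariant under complementing both.
    -- Each copy of a vertex keeps about half of its edges in its own room, being assigned by
    -- majority; 24ζ and 27ζ are the losses of that assignment.
    record Split (ζ : ℕ) (X Y : V → Bool) : Set where
      field
        sparse : cut X Y ≤ 2 * ζ * n
        out-X : ∀ x → X x ≡ true → d ≤ 2 * outTo x Y + 24 * ζ
        out-¬X : ∀ x → X x ≡ false → d ≤ 2 * outTo x (not ∘ Y) + 24 * ζ
        in-Y : ∀ y → Y y ≡ true → d ≤ 2 * inFrom y X + 24 * ζ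
        in-¬Y : ∀ y → Y y ≡ false → d ≤ 2 * inFrom y (not ∘ X) + 24 * ζ
        big-X : d ≤ size X + 27 * ζ
        big-¬X : d ≤ size (not ∘ X) + 27 * ζ
        big-Y : d ≤ size Y + 27 * ζ
        big-¬Y : d ≤ size (not ∘ Y) + 27 * ζ

    not-not : ∀ a → not (not a) ≡ a
    not-not true = refl
    not-not false = refl

    edges-cong : ∀ {A A′ B B′} → (∀ x → A x ≡ A′ x) → (∀ x → B x ≡ B′ x) → edges A B ≡ edges A′ B′
    edges-cong h k = ∑∑-cong λ x y → cong₂ (λ a b → 𝟙 a * (𝟙 b * 𝟙 (E x y))) (h x) (k y)

    outTo-cong : ∀ x {B B′} → (∀ y → B y ≡ B′ y) → outTo x B ≡ outTo x B′
    outTo-cong x k = ∑-cong U λ y → cong (λ b → 𝟙 b * 𝟙 (E x y)) (k y)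

    inFrom-cong : ∀ x {B B′} → (∀ y → B y ≡ B′ y) → inFrom x B ≡ inFrom x B′
    inFrom-cong x k = ∑-cong U λ y → cong (λ b → 𝟙 b * 𝟙 (E y x)) (k y)

    size-cong : ∀ {B B′ : V → Bool} → (∀ y → B y ≡ B′ y) → size B ≡ size B′
    size-cong k = ∑-cong U λ y → cong 𝟙 (k y)

    not-false : ∀ {a} → not a ≡ false → a ≡ true
    not-false {true} _ = refl

    swap-split : ∀ {ζ X Y} → Split ζ X Y → Split ζ (not ∘ X) (not ∘ Y)
    swap-split {ζ} {X} {Y} S = record
      { sparse = ≤-trans (≤-reflexive (cong₂ _+_ (edges-cong {not ∘ X} {not ∘ X} {not ∘ not ∘ Y} {Y} (λ x → refl) (λ y → not-not (Y y))) (edges-cong {not ∘ not ∘ X} {X} {not ∘ Y} {not ∘ Y} (λ x → not-not (X x)) λ y → refl) ∙ +-comm (edges (not ∘ X) Y) (edges X (not ∘ Y)))) sparse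
      ; out-X = λ x e → out-¬X x (not-true e)
      ; out-¬X = λ x e → ≤-trans (out-X x (not-false e)) (≤-reflexive (cong (λ k → 2 * k + 24 * ζ) (outTo-cong x {Y} {not ∘ not ∘ Y} λ y → sym (not-not (Y y)))))
      ; in-Y = λ x e → in-¬Y x (not-true e)
      ; in-¬Y = λ x e → ≤-trans (in-Y x (not-false e)) (≤-reflexive (cong (λ k → 2 * k + 24 * ζ) (inFrom-cong x {X} {not ∘ not ∘ X} λ y → sym (not-not (X y)))))
      ; big-X = big-¬X
      ; big-¬X = ≤-trans big-X (≤-reflexive (cong (_+ 27 * ζ) (size-cong {X} {not ∘ not ∘ X} λ x → sym (not-not (X x)))))
      ; big-Y = big-¬Y
      ; big-¬Y = ≤-trans big-Y (≤-reflexive (cong (_+ 27 * ζ) (size-cong {Y} {not ∘ not ∘ Y} λ x → sym (not-not (Y x))))) }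
      where open Split S

    module Threshold (ζ : ℕ) where

      -- Robust neighbourhoods: asking for ζ edges instead of one makes walks come in bulk, and at
      -- most nζ edges are missed.
      many-in many-out : (V → Bool) → V → Bool
      many-in P y = ζ ≤ᵇ inFrom y P
      many-out P x = ζ ≤ᵇ outTo x P

      few-in : ∀ P → edges P (not ∘ many-in P) ≤ n * ζ
      few-in P = ≤-trans (≤-reflexive (edges-in P (not ∘ many-in P))) (≤-trans (weigh (not ∘ many-in P) ζ (λ y → inFrom y P) λ y e → <⇒≤ (≤ᵇ-false (not-true e))) (*-monoˡ-≤ ζ (size≤n (not ∘ many-in P))))

      few-out : ∀ P → edges (not ∘ many-out P) P ≤ n * ζ
      few-out P = ≤-trans (≤-reflexive (edges-out (not ∘ many-out P) P)) (≤-trans (weigh (not ∘ many-out P) ζ (λ x → outTo x P) λ x e → <⇒≤ (≤ᵇ-false (not-true e))) (*-monoˡ-≤ ζ (size≤n (not ∘ many-out P))))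

    cancel3 : ∀ n d z a b h → a * d ≤ b * d + n * z → n + 3 * h ≤ 3 * d → d * a ≤ d * (b + 3 * z)
    cancel3 n d z a b h H1 H2 =
        lin ρ (# 1 ⊗ # 3) (# 1 ⊗ (# 4 ⊕ con 3 ⊗ # 2)) 0
        ((# 3 ⊗ # 1 ≼ # 4 ⊗ # 1 ⊕ # 0 ⊗ # 2 by H1)
          ⊞ (# 2 ⊗ (# 0 ⊕ con 3 ⊗ # 5) ≼ # 2 ⊗ (con 3 ⊗ # 1) by *-monoʳ-≤ (z) (H2))) refl
      where
      ρ = n ∷ d ∷ z ∷ a ∷ b ∷ h ∷ []

    cancel6 : ∀ n d z a h → a * d ≤ n * z + n * z → n + 3 * h ≤ 3 * d → d * a ≤ d * (6 * z)
    cancel6 n d z a h H1 H2 =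
        lin ρ (# 1 ⊗ # 3) (# 1 ⊗ (con 6 ⊗ # 2)) 0
        ((# 3 ⊗ # 1 ≼ # 0 ⊗ # 2 ⊕ # 0 ⊗ # 2 by H1)
          ⊞ con 2 ⊠ (# 2 ⊗ (# 0 ⊕ con 3 ⊗ # 4) ≼ # 2 ⊗ (con 3 ⊗ # 1) by *-monoʳ-≤ (z) (H2))) refl
      where
      ρ = n ∷ d ∷ z ∷ a ∷ h ∷ []

    J-bound : ∀ n d z I k h → I * d ≤ k * I + (n * z + n * z) → k ≤ 6 * z → n + 3 * h ≤ 3 * d → 24 * z ≤ d → d * (3 * I) ≤ d * (24 * z)
    J-bound n d z I k h H1 H2 H3 H4 =
        lin ρ (# 1 ⊗ (con 3 ⊗ # 3)) (# 1 ⊗ (con 24 ⊗ # 2)) 0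
        (con 4 ⊠ (# 3 ⊗ # 1 ≼ # 4 ⊗ # 3 ⊕ (# 0 ⊗ # 2 ⊕ # 0 ⊗ # 2) by H1)
          ⊞ con 4 ⊠ (# 3 ⊗ # 4 ≼ # 3 ⊗ (con 6 ⊗ # 2) by *-monoʳ-≤ (I) (H2))
          ⊞ con 8 ⊠ (# 2 ⊗ (# 0 ⊕ con 3 ⊗ # 5) ≼ # 2 ⊗ (con 3 ⊗ # 1) by *-monoʳ-≤ (z) (H3))
          ⊞ (# 3 ⊗ (con 24 ⊗ # 2) ≼ # 3 ⊗ # 1 by *-monoʳ-≤ (I) (H4))) refl
      where
      ρ = n ∷ d ∷ z ∷ I ∷ k ∷ h ∷ []

    -- If some pair has few walks, the robust neighbourhoods around it form a sparse cut.
    module FewWalks (h ζ : ℕ) (gap : n + 3 * h ≤ 3 * d) (small : 24 * ζ ≤ h) (1≤d : 1 ≤ d) (s t : V)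
      (few : edges (Threshold.many-out ζ (Threshold.many-in ζ (λ u → E u s))) (Threshold.many-in ζ (Threshold.many-out ζ (λ w → E t w))) ≤ n * ζ) where

      open Threshold ζ

      A₁ A₂ A₃ B₁ B₂ B₃ : V → Bool
      A₁ u = E u s
      A₂ = many-in A₁
      A₃ = many-out A₂
      B₁ w = E t w
      B₂ = many-out B₁
      B₃ = many-in B₂

      private instance
        d≢0 : NonZero d
        d≢0 = >-nonZero 1≤d

      h≤d : ∀ n d h z → n + 3 * h ≤ 3 * d → 24 * z ≤ h → 24 * z ≤ d
      h≤d n d h z H1 H2 =
          lin ρ (con 24 ⊗ # 3) (# 1) 2
          ((# 0 ⊕ con 3 ⊗ # 2 ≼ con 3 ⊗ # 1 by H1)
            ⊞ con 3 ⊠ (con 24 ⊗ # 3 ≼ # 2 by H2)) refl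
        where
        ρ = n ∷ d ∷ h ∷ z ∷ []

      -- The d² edges out of `A₁` enter `A₂` except for nζ of them, and `A₂` takes at most d at each
      -- vertex. Since n ≤ 3d, the quotient nζ/d is at most 3ζ.
      A₂-big : d ≤ size A₂ + 3 * ζ
      A₂-big = *-cancelˡ-≤ d (cancel3 n d ζ d (size A₂) h (≤-trans (≤-reflexive (sym (splitʳ A₁ A₂ ∙ cong (_* d) (in-d s))))
        (+-mono-≤ (edges-right≤ A₁ A₂) (few-in A₁))) gap)

      A₃-big : size A₂ ≤ size A₃ + 3 * ζ
      A₃-big = *-cancelˡ-≤ d (cancel3 n d ζ (size A₂) (size A₃) h (≤-trans (≤-reflexive (sym (splitˡ A₃ A₂)))
        (+-mono-≤ (edges-left≤ A₃ A₂) (few-out A₂))) gap)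

      B₂-big : d ≤ size B₂ + 3 * ζ
      B₂-big = *-cancelˡ-≤ d (cancel3 n d ζ d (size B₂) h (≤-trans (≤-reflexive (sym (splitˡ B₂ B₁ ∙ cong (_* d) (out-d t))))
        (+-mono-≤ (edges-left≤ B₂ B₁) (few-out B₁))) gap)

      K I : V → Bool
      K x = A₃ x ∧ B₂ x
      I y = A₂ y ∧ B₁ y

      -- Each vertex of `K` has d out-edges; those into `B₃` are few by hypothesis, those missing
      -- `B₃` by the threshold.
      K-small : size K ≤ 6 * ζ
      K-small = *-cancelˡ-≤ d (cancel6 n d ζ (size K) h (≤-trans (≤-reflexive (sym (splitʳ K B₃)))
        (+-mono-≤ (≤-trans (edges-mono {K} {A₃} {B₃} {B₃} (λ x e → ∧-proj₁ e) (λ y e → e)) few)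
          (≤-trans (edges-mono {K} {B₂} {not ∘ B₃} {not ∘ B₃} (λ x e → ∧-proj₂ {A₃ x} e) (λ y e → e)) (few-in B₂)))) gap)

      -- Edges into `I` start in `K`, outside `A₃` or outside `B₂`; the last two kinds are few by
      -- the thresholds. Since d - 6ζ is at least 3d/4, the size is at most 2nζ·4/(3d) ≤ 8ζ.
      J-small : 3 * size I ≤ 24 * ζ
      J-small = *-cancelˡ-≤ d (J-bound n d ζ (size I) (size K) h (≤-trans (≤-reflexive (sym (splitˡ K I)))
        (+-mono-≤ into-I (≤-trans not-K (+-mono-≤ (≤-trans (edges-mono {not ∘ A₃} {not ∘ A₃} {I} {A₂} (λ x e → e) (λ y e → ∧-proj₁ e)) (few-out A₂))
          (≤-trans (edges-mono {not ∘ B₂} {not ∘ B₂} {I} {B₁} (λ x e → e) (λ y e → ∧-proj₂ {A₂ y} e)) (few-out B₁)))))) K-small gap (h≤d n d h ζ gap small))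
        where
        into-I : edges K I ≤ size K * size I
        into-I = ≤-trans (≤-reflexive (edges-out K I)) (weigh K (size I) _ λ x _ → ∑-mono U λ y → ≤-trans (*-monoʳ-≤ (𝟙 (I y)) (𝟙≤1 (E x y))) (≤-reflexive (*-identityʳ _)))
        not-K : edges (not ∘ K) I ≤ edges (not ∘ A₃) I + edges (not ∘ B₂) I
        not-K = ≤-trans (∑∑-mono λ x y → pt (A₃ x) (B₂ x) (𝟙 (I y) * 𝟙 (E x y))) (≤-reflexive (∑∑-+ _ _))
          where
          pt : ∀ a b k → 𝟙 (not (a ∧ b)) * k ≤ 𝟙 (not a) * k + 𝟙 (not b) * k
          pt true b k = ≤-refl
          pt false b k = m≤m+n (k + 0) _

      -- three sets of size about d > n/3 cannot be pairwise nearly disjoint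
      A₃∪B₂ : ∀ x → A₃ x ≡ false → B₂ x ≡ true
      A₃∪B₂ x e = true-≤ᵇ (three n d h ζ (size A₂) (size I) (outTo x A₂) (outTo x B₁) gap small A₂-big J-small (≤ᵇ-false e)
        (≤-trans (≤-reflexive (cong₂ _+_ (cong₂ _+_ (sym (out-d x)) refl) (sym (out-d t)) ∙ sym (∑-+ U _ (λ y → 𝟙 (B₁ y)) ∙ cong (_+ size B₁) (∑-+ U _ _))))
          (≤-trans (∑-mono U λ y → pt (E x y) (A₂ y) (B₁ y)) (≤-reflexive (∑-+ U _ _ ∙ cong₂ _+_ (∑-+ U _ _ ∙ cong₂ _+_ (∑-+ U (λ _ → 1) _ ∙ cong (_+ outTo x A₂) (∑U-const 1 ∙ *-identityʳ n)) refl) refl)))))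
        where
        three : ∀ n d h z a I p q → n + 3 * h ≤ 3 * d → 24 * z ≤ h → d ≤ a + 3 * z → 3 * I ≤ 24 * z → p < z → d + a + d ≤ n + p + q + I → z ≤ q
        three n d h z a I p q H1 H2 H3 H4 H5 H6 =
            lin ρ (# 3) (# 7) 179
            (con 3 ⊠ (# 0 ⊕ con 3 ⊗ # 2 ≼ con 3 ⊗ # 1 by H1)
              ⊞ con 9 ⊠ (con 24 ⊗ # 3 ≼ # 2 by H2)
              ⊞ con 3 ⊠ (# 1 ≼ # 4 ⊕ con 3 ⊗ # 3 by H3)
              ⊞ (con 3 ⊗ # 5 ≼ con 24 ⊗ # 3 by H4)
              ⊞ con 3 ⊠ (con 1 ⊕ # 6 ≼ # 3 by H5)
              ⊞ con 3 ⊠ (# 1 ⊕ # 4 ⊕ # 1 ≼ # 0 ⊕ # 6 ⊕ # 7 ⊕ # 5 by H6)) refl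
          where
          ρ = n ∷ d ∷ h ∷ z ∷ a ∷ I ∷ p ∷ q ∷ []
        pt : ∀ e a b → 𝟙 e + 𝟙 a + 𝟙 b ≤ 1 + 𝟙 a * 𝟙 e + 𝟙 b * 𝟙 e + 𝟙 (a ∧ b)
        pt false false b = ≤-trans (𝟙≤1 b) (m≤m+n 1 _)
        pt false true b = s≤s (m≤n+m (𝟙 b) _)
        pt true false false = ≤-refl
        pt true false true = ≤-refl
        pt true true false = ≤-refl
        pt true true true = m≤m+n 3 1

      -- Vertices outside `A₃` lie in `B₂`, and nearly all edges out of `B₂` end in `B₃`.
      A₃∪B₂-sparse : cut A₃ (not ∘ B₃) ≤ 2 * ζ * n
      A₃∪B₂-sparse = ≤-trans (+-mono-≤ (≤-trans (≤-reflexive (edges-cong {A₃} {A₃} {not ∘ not ∘ B₃} {B₃} (λ x → refl) λ y → not-not (B₃ y))) few)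
          (≤-trans (edges-mono {not ∘ A₃} {B₂} {not ∘ B₃} {not ∘ B₃} (λ x e → A₃∪B₂ x (not-true e)) (λ y e → e)) (few-in B₂))) (≤-reflexive (twice n ζ))
        where
        twice : ∀ n z → n * z + n * z ≡ 2 * z * n
        twice n z =
            ≤-antisym
            (lin ρ (# 0 ⊗ # 1 ⊕ # 0 ⊗ # 1) (con 2 ⊗ # 1 ⊗ # 0) 0
            (triv) refl)
            (lin ρ (con 2 ⊗ # 1 ⊗ # 0) (# 0 ⊗ # 1 ⊕ # 0 ⊗ # 1) 0
            (triv) refl)
          where
          ρ = n ∷ z ∷ []

      A₃-large : d ≤ size A₃ + 6 * ζ
      A₃-large = sz d ζ (size A₂) (size A₃) A₂-big A₃-big
        where
        sz : ∀ d z a b → d ≤ a + 3 * z → a ≤ b + 3 * z → d ≤ b + 6 * z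
        sz d z a b H1 H2 =
            lin ρ (# 0) (# 3 ⊕ con 6 ⊗ # 1) 0
            ((# 0 ≼ # 2 ⊕ con 3 ⊗ # 1 by H1)
              ⊞ (# 2 ≼ # 3 ⊕ con 3 ⊗ # 1 by H2)) refl
          where
          ρ = d ∷ z ∷ a ∷ b ∷ []

      ¬A₃-large : d ≤ size (not ∘ A₃) + 9 * ζ
      ¬A₃-large = sz d ζ (size B₂) (size K) (size (not ∘ A₃)) B₂-big K-small (≤-trans (∑-mono U λ x → pt (A₃ x) (B₂ x)) (≤-reflexive (∑-+ U _ _)))
        where
        sz : ∀ d z a k b → d ≤ a + 3 * z → k ≤ 6 * z → a ≤ k + b → d ≤ b + 9 * z
        sz d z a k b H1 H2 H3 =
            lin ρ (# 0) (# 4 ⊕ con 9 ⊗ # 1) 0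
            ((# 0 ≼ # 2 ⊕ con 3 ⊗ # 1 by H1)
              ⊞ (# 3 ≼ con 6 ⊗ # 1 by H2)
              ⊞ (# 2 ≼ # 3 ⊕ # 4 by H3)) refl
          where
          ρ = d ∷ z ∷ a ∷ k ∷ b ∷ []
        pt : ∀ a b → 𝟙 b ≤ 𝟙 (a ∧ b) + 𝟙 (not a)
        pt true b = m≤m+n _ 0
        pt false b = 𝟙≤1 b

    -- Every copy of a vertex moves to the side holding most of its edges, out-copies first. The cut
    -- can only shrink, and a moved copy accounted for at least d/2 edges of the old cut, so at most
    -- 12ζ move on either side.
    module Majority (h ζ : ℕ) (gap : n + 3 * h ≤ 3 * d) (1≤d : 1 ≤ d) (X₀ Y₀ : V → Bool) (sparse₀ : cut X₀ Y₀ ≤ 2 * ζ * n)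
      (X₀-large : d ≤ size X₀ + 6 * ζ) (¬X₀-large : d ≤ size (not ∘ X₀) + 9 * ζ) where

      private instance
        d≢0 : NonZero d
        d≢0 = >-nonZero 1≤d

      X Y : V → Bool
      X x = d ≤ᵇ 2 * outTo x Y₀
      Y y = d ≤ᵇ 2 * inFrom y X

      cut-out : ∀ A B → cut A B ≡ ∑[ x ∈ U ] (𝟙 (A x) * outTo x (not ∘ B) + 𝟙 (not (A x)) * outTo x B)
      cut-out A B = cong₂ _+_ (edges-out A (not ∘ B)) (edges-out (not ∘ A) B) ∙ sym (∑-+ U _ _)

      cut-in : ∀ A B → cut A B ≡ ∑[ y ∈ U ] (𝟙 (not (B y)) * inFrom y A + 𝟙 (B y) * inFrom y (not ∘ A))
      cut-in A B = cong₂ _+_ (edges-in A (not ∘ B)) (edges-in (not ∘ A) B) ∙ sym (∑-+ U _ _)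

      maj₁ : ∀ d p q → p + q ≡ d → d ≤ 2 * p → q ≤ p
      maj₁ d p q H1 H2 =
          lin ρ (# 2) (# 1) 0
          ((# 1 ⊕ # 2 ≼ # 0 by ≤-reflexive H1)
            ⊞ (# 0 ≼ con 2 ⊗ # 1 by H2)) refl
        where
        ρ = d ∷ p ∷ q ∷ []

      maj₂ : ∀ d p q → p + q ≡ d → 2 * p < d → p ≤ q
      maj₂ d p q H1 H2 =
          lin ρ (# 1) (# 2) 0
          ((# 0 ≼ # 1 ⊕ # 2 by ≤-reflexive (sym H1))
            ⊞ (con 1 ⊕ con 2 ⊗ # 1 ≼ # 0 by H2)) refl
        where
        ρ = d ∷ p ∷ q ∷ []

      maj₃ : ∀ d p q → p + q ≡ d → 2 * p < d → d ≤ 2 * q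
      maj₃ d p q H1 H2 =
          lin ρ (# 0) (con 2 ⊗ # 2) 0
          (con 2 ⊠ (# 0 ≼ # 1 ⊕ # 2 by ≤-reflexive (sym H1))
            ⊞ (con 1 ⊕ con 2 ⊗ # 1 ≼ # 0 by H2)) refl
        where
        ρ = d ∷ p ∷ q ∷ []

      diff-cancel : ∀ d n z c a h → a * d ≤ 2 * c → c ≤ 2 * z * n → n + 3 * h ≤ 3 * d → d * a ≤ d * (12 * z)
      diff-cancel d n z c a h H1 H2 H3 =
          lin ρ (# 0 ⊗ # 4) (# 0 ⊗ (con 12 ⊗ # 2)) 0
          ((# 4 ⊗ # 0 ≼ con 2 ⊗ # 3 by H1)
            ⊞ con 2 ⊠ (# 3 ≼ con 2 ⊗ # 2 ⊗ # 1 by H2)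
            ⊞ con 4 ⊠ (# 2 ⊗ (# 1 ⊕ con 3 ⊗ # 5) ≼ # 2 ⊗ (con 3 ⊗ # 0) by *-monoʳ-≤ (z) (H3))) refl
        where
        ρ = d ∷ n ∷ z ∷ c ∷ a ∷ h ∷ []

      shift-deg : ∀ d z p q D → d ≤ 2 * p → p ≤ q + D → D ≤ 12 * z → d ≤ 2 * q + 24 * z
      shift-deg d z p q D H1 H2 H3 =
          lin ρ (# 0) (con 2 ⊗ # 3 ⊕ con 24 ⊗ # 1) 0
          ((# 0 ≼ con 2 ⊗ # 2 by H1)
            ⊞ con 2 ⊠ (# 2 ≼ # 3 ⊕ # 4 by H2)
            ⊞ con 2 ⊠ (# 4 ≼ con 12 ⊗ # 1 by H3)) refl
        where
        ρ = d ∷ z ∷ p ∷ q ∷ D ∷ []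

      minority : ∀ b₀ p q → p + q ≡ d → 𝟙 (d ≤ᵇ 2 * p) * q + 𝟙 (not (d ≤ᵇ 2 * p)) * p ≤ 𝟙 b₀ * q + 𝟙 (not b₀) * p
      minority b₀ p q e with d ≤ᵇ 2 * p in eq
      minority true p q e | true = ≤-refl
      minority false p q e | true = ≤-trans (≤-reflexive (+-identityʳ _)) (*-monoʳ-≤ 1 (maj₁ d p q e (≤ᵇ-true eq)))
      minority true p q e | false = ≤-trans (*-monoʳ-≤ 1 (maj₂ d p q e (≤ᵇ-false eq))) (≤-reflexive (sym (+-identityʳ _)))
      minority false p q e | false = ≤-refl

      differs : Bool → Bool → Bool
      differs true b = not b
      differs false b = b

      changed : ∀ b₀ p q → p + q ≡ d → 𝟙 (differs (d ≤ᵇ 2 * p) b₀) * d ≤ 2 * (𝟙 b₀ * q + 𝟙 (not b₀) * p)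
      changed b₀ p q e with d ≤ᵇ 2 * p in eq
      changed true p q e | true = z≤n
      changed false p q e | true = ≤-trans (≤-reflexive (+-identityʳ d)) (≤-trans (≤ᵇ-true eq) (*-monoʳ-≤ 2 (≤-reflexive (sym (+-identityʳ p)))))
      changed true p q e | false = ≤-trans (≤-reflexive (+-identityʳ d)) (≤-trans (maj₃ d p q e (≤ᵇ-false eq)) (*-monoʳ-≤ 2 (≤-reflexive (sym (+-identityʳ (q + 0) ∙ +-identityʳ q)))))
      changed false p q e | false = z≤n

      sparse₁ : cut X Y₀ ≤ cut X₀ Y₀
      sparse₁ = ≤-trans (≤-reflexive (cut-out X Y₀)) (≤-trans (∑-mono U λ x → minority (X₀ x) (outTo x Y₀) (outTo x (not ∘ Y₀)) (outTo-split x Y₀)) (≤-reflexive (sym (cut-out X₀ Y₀))))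

      sparse₂ : cut X Y ≤ cut X Y₀
      sparse₂ = ≤-trans (≤-reflexive (cut-in X Y ∙ ∑-cong U λ y → +-comm (𝟙 (not (Y y)) * inFrom y X) _)) (≤-trans (∑-mono U λ y → minority (Y₀ y) (inFrom y X) (inFrom y (not ∘ X)) (inFrom-split y X))
          (≤-reflexive (sym (cut-in X Y₀ ∙ ∑-cong U λ y → +-comm (𝟙 (not (Y₀ y)) * inFrom y X) _))))

      sparse : cut X Y ≤ 2 * ζ * n
      sparse = ≤-trans sparse₂ (≤-trans sparse₁ sparse₀)

      DX DY : V → Bool
      DX x = differs (X x) (X₀ x)
      DY y = differs (Y y) (Y₀ y)

      DX-small : size DX ≤ 12 * ζ
      DX-small = *-cancelˡ-≤ d (diff-cancel d n ζ (cut X₀ Y₀) (size DX) h (≤-trans (≤-reflexive (sym (∑-*ʳ U d _)))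
        (≤-trans (∑-mono U λ x → changed (X₀ x) (outTo x Y₀) (outTo x (not ∘ Y₀)) (outTo-split x Y₀)) (≤-reflexive (∑-*ˡ U 2 _ ∙ cong (2 *_) (sym (cut-out X₀ Y₀)))))) sparse₀ gap)

      DY-small : size DY ≤ 12 * ζ
      DY-small = *-cancelˡ-≤ d (diff-cancel d n ζ (cut X Y₀) (size DY) h (≤-trans (≤-reflexive (sym (∑-*ʳ U d _)))
        (≤-trans (∑-mono U λ y → changed (Y₀ y) (inFrom y X) (inFrom y (not ∘ X)) (inFrom-split y X)) (≤-reflexive (∑-*ˡ U 2 _ ∙ cong (2 *_) (∑-cong U (λ y → +-comm (𝟙 (Y₀ y) * inFrom y (not ∘ X)) _) ∙ sym (cut-in X Y₀)))))) (≤-trans sparse₁ sparse₀) gap)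

      size-change : ∀ (A A₀ : V → Bool) → size A₀ ≤ size A + size (λ x → differs (A x) (A₀ x))
      size-change A A₀ = ≤-trans (∑-mono U λ x → pt (A x) (A₀ x)) (≤-reflexive (∑-+ U _ _))
        where
        pt : ∀ a b → 𝟙 b ≤ 𝟙 a + 𝟙 (differs a b)
        pt true b = ≤-trans (𝟙≤1 b) (s≤s z≤n)
        pt false b = ≤-refl

      differs-not : ∀ a b → differs (not a) (not b) ≡ differs a b
      differs-not true true = refl
      differs-not true false = refl
      differs-not false true = refl
      differs-not false false = refl

      out-change : ∀ x (B B₀ : V → Bool) → outTo x B₀ ≤ outTo x B + size (λ x → differs (B x) (B₀ x))
      out-change x B B₀ = ≤-trans (∑-mono U λ y → pt (B y) (B₀ y) (𝟙 (E x y)) (𝟙≤1 (E x y))) (≤-reflexive (∑-+ U _ _))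
        where
        pt : ∀ a b e → e ≤ 1 → 𝟙 b * e ≤ 𝟙 a * e + 𝟙 (differs a b)
        pt true true e h = m≤m+n _ _
        pt true false e h = z≤n
        pt false true e h = ≤-trans (≤-reflexive (+-identityʳ e)) h
        pt false false e h = z≤n

      sz₁ : ∀ d z a b D → d ≤ a + 6 * z → a ≤ b + D → D ≤ 12 * z → d ≤ b + 18 * z
      sz₁ d z a b D H1 H2 H3 =
          lin ρ (# 0) (# 3 ⊕ con 18 ⊗ # 1) 0
          ((# 0 ≼ # 2 ⊕ con 6 ⊗ # 1 by H1)
            ⊞ (# 2 ≼ # 3 ⊕ # 4 by H2)
            ⊞ (# 4 ≼ con 12 ⊗ # 1 by H3)) refl
        where
        ρ = d ∷ z ∷ a ∷ b ∷ D ∷ []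

      sz₂ : ∀ d z a b D → d ≤ a + 9 * z → a ≤ b + D → D ≤ 12 * z → d ≤ b + 21 * z
      sz₂ d z a b D H1 H2 H3 =
          lin ρ (# 0) (# 3 ⊕ con 21 ⊗ # 1) 0
          ((# 0 ≼ # 2 ⊕ con 9 ⊗ # 1 by H1)
            ⊞ (# 2 ≼ # 3 ⊕ # 4 by H2)
            ⊞ (# 4 ≼ con 12 ⊗ # 1 by H3)) refl
        where
        ρ = d ∷ z ∷ a ∷ b ∷ D ∷ []

      up₁ : ∀ z a → a + 18 * z ≤ a + 27 * z
      up₁ z a =
          lin ρ (# 1 ⊕ con 18 ⊗ # 0) (# 1 ⊕ con 27 ⊗ # 0) 0
          (triv) refl
        where
        ρ = z ∷ a ∷ []

      up₂ : ∀ z a → a + 21 * z ≤ a + 27 * z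
      up₂ z a =
          lin ρ (# 1 ⊕ con 21 ⊗ # 0) (# 1 ⊕ con 27 ⊗ # 0) 0
          (triv) refl
        where
        ρ = z ∷ a ∷ []

      balance : ∀ d n z x y c h → x * d ≤ y * d + c → c ≤ 2 * z * n → n + 3 * h ≤ 3 * d → d * x ≤ d * (y + 6 * z)
      balance d n z x y c h H1 H2 H3 =
          lin ρ (# 0 ⊗ # 3) (# 0 ⊗ (# 4 ⊕ con 6 ⊗ # 2)) 0
          ((# 3 ⊗ # 0 ≼ # 4 ⊗ # 0 ⊕ # 5 by H1)
            ⊞ (# 5 ≼ con 2 ⊗ # 2 ⊗ # 1 by H2)
            ⊞ con 2 ⊠ (# 2 ⊗ (# 1 ⊕ con 3 ⊗ # 6) ≼ # 2 ⊗ (con 3 ⊗ # 0) by *-monoʳ-≤ (z) (H3))) refl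
        where
        ρ = d ∷ n ∷ z ∷ x ∷ y ∷ c ∷ h ∷ []

      by₁ : ∀ d z x y → d ≤ x + 18 * z → x ≤ y + 6 * z → d ≤ y + 27 * z
      by₁ d z x y H1 H2 =
          lin ρ (# 0) (# 3 ⊕ con 27 ⊗ # 1) 0
          ((# 0 ≼ # 2 ⊕ con 18 ⊗ # 1 by H1)
            ⊞ (# 2 ≼ # 3 ⊕ con 6 ⊗ # 1 by H2)) refl
        where
        ρ = d ∷ z ∷ x ∷ y ∷ []

      by₂ : ∀ d z x y → d ≤ x + 21 * z → x ≤ y + 6 * z → d ≤ y + 27 * z
      by₂ d z x y H1 H2 =
          lin ρ (# 0) (# 3 ⊕ con 27 ⊗ # 1) 0
          ((# 0 ≼ # 2 ⊕ con 21 ⊗ # 1 by H1)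
            ⊞ (# 2 ≼ # 3 ⊕ con 6 ⊗ # 1 by H2)) refl
        where
        ρ = d ∷ z ∷ x ∷ y ∷ []

      X-large : d ≤ size X + 18 * ζ
      X-large = sz₁ d ζ (size X₀) (size X) (size DX) X₀-large (size-change X X₀) DX-small

      ¬X-large : d ≤ size (not ∘ X) + 21 * ζ
      ¬X-large = sz₂ d ζ (size (not ∘ X₀)) (size (not ∘ X)) (size DX) ¬X₀-large
        (≤-trans (size-change (not ∘ X) (not ∘ X₀)) (≤-reflexive (cong (size (not ∘ X) +_) (size-cong {λ x → differs (not (X x)) (not (X₀ x))} {DX} λ x → differs-not (X x) (X₀ x))))) DX-small

      X≤Y : size X ≤ size Y + 6 * ζ
      X≤Y = *-cancelˡ-≤ d (balance d n ζ (size X) (size Y) (cut X Y) h (≤-trans (≤-reflexive (sym (splitʳ X Y))) (+-mono-≤ (edges-right≤ X Y) (m≤m+n _ _))) sparse gap)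

      ¬X≤¬Y : size (not ∘ X) ≤ size (not ∘ Y) + 6 * ζ
      ¬X≤¬Y = *-cancelˡ-≤ d (balance d n ζ (size (not ∘ X)) (size (not ∘ Y)) (cut X Y) h (≤-trans (≤-reflexive (sym (splitʳ (not ∘ X) Y) ∙ +-comm _ (edges (not ∘ X) (not ∘ Y))))
        (+-mono-≤ (edges-right≤ (not ∘ X) (not ∘ Y)) (m≤n+m _ _))) sparse gap)

      split : Split ζ X Y
      split = record
        { sparse = sparse
        -- `X` was chosen with respect to `Y₀`, so passing to `Y` costs 2·12ζ; the in-degrees need
        -- no correction because `Y` was chosen after `X`.
        ; out-X = λ x e → shift-deg d ζ (outTo x Y₀) (outTo x Y) (size DY) (≤ᵇ-true e) (out-change x Y Y₀) DY-small
        ; out-¬X = λ x e → shift-deg d ζ (outTo x (not ∘ Y₀)) (outTo x (not ∘ Y)) (size DY) (maj₃ d (outTo x Y₀) _ (outTo-split x Y₀) (≤ᵇ-false e))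
            (≤-trans (out-change x (not ∘ Y) (not ∘ Y₀)) (≤-reflexive (cong (outTo x (not ∘ Y) +_) (size-cong {λ y → differs (not (Y y)) (not (Y₀ y))} {DY} λ y → differs-not (Y y) (Y₀ y))))) DY-small
        ; in-Y = λ y e → ≤-trans (≤ᵇ-true e) (m≤m+n _ _)
        ; in-¬Y = λ y e → ≤-trans (maj₃ d (inFrom y X) _ (inFrom-split y X) (≤ᵇ-false e)) (m≤m+n _ _)
        ; big-X = ≤-trans X-large (up₁ ζ (size X))
        ; big-¬X = ≤-trans ¬X-large (up₂ ζ (size (not ∘ X)))
        ; big-Y = by₁ d ζ (size X) (size Y) X-large X≤Y
        ; big-¬Y = by₂ d ζ (size (not ∘ X)) (size (not ∘ Y)) ¬X-large ¬X≤¬Y }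

    module _ (ζ M : ℕ) (n≤Mζ : n ≤ M * ζ) where
      open Threshold ζ

      walks₃-start : ∀ s a → many-out (many-in (λ u → E u s)) a ≡ true → ζ * ζ ≤ walks₃ s a
      walks₃-start s a e = ≤-trans (*-monoˡ-≤ ζ (≤ᵇ-true {ζ} {outTo a S} e)) (≤-trans (≤-reflexive (sym (∑-*ʳ U ζ (λ v → 𝟙 (S v) * 𝟙 (E a v)))))
        (≤-trans (∑-mono U pt) (≤-reflexive (∑-swap U U (λ v u → 𝟙 (E u s) * (𝟙 (E u v) * 𝟙 (E a v)))))))
        where
        S : V → Bool
        S = many-in (λ u → E u s)
        pt : ∀ v → 𝟙 (S v) * 𝟙 (E a v) * ζ ≤ ∑[ u ∈ U ] (𝟙 (E u s) * (𝟙 (E u v) * 𝟙 (E a v)))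
        pt v with S v in eq
        ... | false = z≤n
        ... | true = ≤-trans (≤-reflexive (cong (_* ζ) (+-identityʳ (𝟙 (E a v))) ∙ *-comm (𝟙 (E a v)) ζ)) (≤-trans (*-monoˡ-≤ (𝟙 (E a v)) (≤ᵇ-true {ζ} {inFrom v (λ u → E u s)} eq))
            (≤-reflexive (sym (∑-*ʳ U (𝟙 (E a v)) (λ u → 𝟙 (E u s) * 𝟙 (E u v))) ∙ ∑-cong U λ u → *-assoc (𝟙 (E u s)) (𝟙 (E u v)) (𝟙 (E a v)))))

      walks₃-end : ∀ b t → many-in (many-out (λ w → E t w)) b ≡ true → ζ * ζ ≤ walks₃ b t
      walks₃-end b t e = ≤-trans (*-monoˡ-≤ ζ (≤ᵇ-true {ζ} {inFrom b S} e)) (≤-trans (≤-reflexive (sym (∑-*ʳ U ζ (λ u → 𝟙 (S u) * 𝟙 (E u b))))) (∑-mono U pt))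
        where
        S : V → Bool
        S = many-out (λ w → E t w)
        pt : ∀ u → 𝟙 (S u) * 𝟙 (E u b) * ζ ≤ ∑[ v ∈ U ] (𝟙 (E u b) * (𝟙 (E u v) * 𝟙 (E t v)))
        pt u with S u in eq
        ... | false = z≤n
        ... | true = ≤-trans (≤-reflexive (cong (_* ζ) (+-identityʳ (𝟙 (E u b))))) (≤-trans (*-monoʳ-≤ (𝟙 (E u b)) (≤ᵇ-true {ζ} {outTo u (λ w → E t w)} eq))
            (≤-reflexive (sym (∑-*ˡ U (𝟙 (E u b)) (λ v → 𝟙 (E t v) * 𝟙 (E u v))) ∙ ∑-cong U λ v → cong (𝟙 (E u b) *_) (*-comm (𝟙 (E t v)) (𝟙 (E u v))))))

      -- Crossing two thresholds on either side, every edge between the outer neighbourhoods extends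
      -- to ζ² walks at each end.
      walks₇-through : ∀ s t → edges (many-out (many-in (λ u → E u s))) (many-in (many-out (λ w → E t w))) * (ζ * ζ * (ζ * ζ)) ≤ walks₇ s t
      walks₇-through s t = ≤-trans (≤-reflexive (sym (∑∑-*ʳ _ _))) (∑∑-mono pt)
        where
        A B : V → Bool
        A = many-out (many-in (λ u → E u s))
        B = many-in (many-out (λ w → E t w))
        pt : ∀ a b → 𝟙 (A a) * (𝟙 (B b) * 𝟙 (E a b)) * (ζ * ζ * (ζ * ζ)) ≤ walks₃ s a * (𝟙 (E a b) * walks₃ b t)
        pt a b with A a in p | B b in q
        ... | false | _ = z≤n
        ... | true | false = z≤n
        ... | true | true = ≤-trans (≤-reflexive (cong (_* (ζ * ζ * (ζ * ζ))) (+-identityʳ (𝟙 (E a b) + 0) ∙ +-identityʳ (𝟙 (E a b))) ∙ swap* [] (𝟙 (E a b)) (ζ * ζ) (ζ * ζ)))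
            (*-mono-≤ (walks₃-start s a p) (*-monoʳ-≤ (𝟙 (E a b)) (walks₃-end b t q)))

      fifth : n * n * n * n * n ≤ M * M * M * M * M * (ζ * ζ * ζ * ζ * ζ)
      fifth = ≤-trans (*-mono-≤ (*-mono-≤ (*-mono-≤ (*-mono-≤ n≤Mζ n≤Mζ) n≤Mζ) n≤Mζ) n≤Mζ) (r5 M ζ)
        where
        r5 : ∀ M z → M * z * (M * z) * (M * z) * (M * z) * (M * z) ≤ M * M * M * M * M * (z * z * z * z * z)
        r5 M z =
            lin ρ (# 0 ⊗ # 1 ⊗ (# 0 ⊗ # 1) ⊗ (# 0 ⊗ # 1) ⊗ (# 0 ⊗ # 1) ⊗ (# 0 ⊗ # 1)) (# 0 ⊗ # 0 ⊗ # 0 ⊗ # 0 ⊗ # 0 ⊗ (# 1 ⊗ # 1 ⊗ # 1 ⊗ # 1 ⊗ # 1)) 0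
            (triv) refl
          where
          ρ = M ∷ z ∷ []

      -- More than nζ edges with ζ⁴ walks each would give nζ⁵ ≥ n⁶/M⁵ walks.
      few-edges : ∀ s t → ¬ (n * n * n * n * n * n ≤ M * M * M * M * M * walks₇ s t) →
        edges (many-out (many-in (λ u → E u s))) (many-in (many-out (λ w → E t w))) ≤ n * ζ
      few-edges s t ¬w = ≮⇒≥ λ lt → ¬w (walks n ζ (M * M * M * M * M) _ (walks₇ s t) lt (walks₇-through s t) fifth)
        where
        walks : ∀ n z c e w → n * z < e → e * (z * z * (z * z)) ≤ w → n * n * n * n * n ≤ c * (z * z * z * z * z) → n * n * n * n * n * n ≤ c * w
        walks n z c e w H1 H2 H3 =
            lin ρ (# 0 ⊗ # 0 ⊗ # 0 ⊗ # 0 ⊗ # 0 ⊗ # 0) (# 2 ⊗ # 4) 0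
            ((# 2 ⊗ # 1 ⊗ # 1 ⊗ # 1 ⊗ # 1 ⊗ (con 1 ⊕ # 0 ⊗ # 1) ≼ # 2 ⊗ # 1 ⊗ # 1 ⊗ # 1 ⊗ # 1 ⊗ # 3 by *-monoʳ-≤ (c * z * z * z * z) (H1))
              ⊞ (# 2 ⊗ (# 3 ⊗ (# 1 ⊗ # 1 ⊗ (# 1 ⊗ # 1))) ≼ # 2 ⊗ # 4 by *-monoʳ-≤ (c) (H2))
              ⊞ (# 0 ⊗ (# 0 ⊗ # 0 ⊗ # 0 ⊗ # 0 ⊗ # 0) ≼ # 0 ⊗ (# 2 ⊗ (# 1 ⊗ # 1 ⊗ # 1 ⊗ # 1 ⊗ # 1)) by *-monoʳ-≤ (n) (H3))) refl
          where
          ρ = n ∷ z ∷ c ∷ e ∷ w ∷ []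

    dichotomy : ∀ h ζ M → n + 3 * h ≤ 3 * d → 24 * ζ ≤ h → 1 ≤ d → n ≤ M * ζ →
      (∀ s t → n * n * n * n * n * n ≤ M * M * M * M * M * walks₇ s t) ⊎ (∃ λ X → ∃ λ Y → Split ζ X Y)
    dichotomy h ζ M gap small 1≤d n≤Mζ with any? (λ s → any? (λ t → ¬? (n * n * n * n * n * n ≤? M * M * M * M * M * walks₇ s t)))
    ... | no ¬few = inj₁ λ s t → decidable-stable (_ ≤? _) λ ¬w → ¬few (s , t , ¬w)
    ... | yes (s , t , ¬w) = inj₂ (Maj.X , Maj.Y , Maj.split)
      where
      module F = FewWalks h ζ gap small 1≤d s t (few-edges ζ M n≤Mζ s t ¬w)
      module Maj = Majority h ζ gap 1≤d F.A₃ (not ∘ F.B₃) F.A₃∪B₂-sparse F.A₃-large F.¬A₃-large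

    -- The elements are contracted paths, entered at `inn` and left at `out`. That `order` permutes
    -- the list is expressed by the equality of all sums.
    record RoomCycle {A : Set} (L : List A) (inn out : A → V) : Set where
      field
        {first final} : A
        {order} : List A
        route : Walk (λ a b → E (out a) (inn b) ≡ true) first final order
        closes : E (out final) (inn first) ≡ true
        permutes : ∀ f → ∑ order f ≡ ∑ L f

    -- A single room is robustly connected

    module Rooms
      (h ζ ξ τ P : ℕ) (gap : n + 3 * h ≤ 3 * d) (h≤n : h ≤ n) (5τ≤h : 5 * τ ≤ h) (n≤Pτ : n ≤ P * τ) (1≤τ : 1 ≤ τ) (2ξ≤τ : 2 * ξ ≤ τ) (27ζ≤τ : 27 * ζ ≤ τ) (2ζP≤τ : 2 * ζ * P ≤ τ)
      (c : ℕ) (1≤c : 1 ≤ c) (P⁶≤c : P * P * P * P * P * P ≤ c) (N₀≤τ : Constants.N₀ c ≤ τ)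
      (tiny : Constants.tolerance c * P * (ξ + 2 * ζ) ≤ τ) where

      module _ {X Y : V → Bool} (S : Split ζ X Y) {A : Set} (L : List A) (inn out : A → V)
        (ins : ∀ y → ∑[ a ∈ L ] 𝟙 (inn a == y) ≤ 𝟙 (Y y)) (outs : ∀ x → ∑[ a ∈ L ] 𝟙 (out a == x) ≤ 𝟙 (X x))
        (Y≤ : size Y ≤ length L + ξ) (X≤ : size X ≤ length L + ξ) where

        open Split S

        private
          N = length L

        E′ : Fin N → Fin N → Bool
        E′ i j = E (out (lookup L i)) (inn (lookup L j))

        module G = Graph E′

        Is Os : List V
        Is = map inn L
        Os = map out L

        occ-Is : ∀ y → occ y Is ≤ 𝟙 (Y y)
        occ-Is y = ≤-trans (≤-reflexive (∑-map inn L _)) (ins y)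

        occ-Os : ∀ x → occ x Os ≤ 𝟙 (X x)
        occ-Os x = ≤-trans (≤-reflexive (∑-map out L _)) (outs x)

        out∈X : ∀ i → X (out (lookup L i)) ≡ true
        out∈X i = 𝟙-true (≤-trans (∈⇒occ (∈-map⁺ out (∈-lookup {xs = L} i))) (occ-Os (out (lookup L i))))

        inn∈Y : ∀ i → Y (inn (lookup L i)) ≡ true
        inn∈Y i = 𝟙-true (≤-trans (∈⇒occ (∈-map⁺ inn (∈-lookup {xs = L} i))) (occ-Is (inn (lookup L i))))

        outdeg′ indeg′ : Fin N → ℕ
        outdeg′ i = ∑[ j ∈ G.U ] 𝟙 (E′ i j)
        indeg′ j = ∑[ i ∈ G.U ] 𝟙 (E′ i j)

        outdeg′-≡ : ∀ i → outdeg′ i ≡ ∑[ y ∈ Is ] 𝟙 (E (out (lookup L i)) y)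
        outdeg′-≡ i = ∑-lookup L _ ∙ sym (∑-map inn L _)

        indeg′-≡ : ∀ j → indeg′ j ≡ ∑[ x ∈ Os ] 𝟙 (E x (inn (lookup L j)))
        indeg′-≡ j = ∑-lookup L _ ∙ sym (∑-map out L _)

        |Is| : length Is ≡ N
        |Is| = length-map inn L

        |Os| : length Os ≡ N
        |Os| = length-map out L

        out-≥ : ∀ i → outTo (out (lookup L i)) Y ≤ outdeg′ i + ξ
        out-≥ i = ≤-trans (proj₂ (sublist-sum Is Y (E (out (lookup L i))) ξ occ-Is (≤-trans Y≤ (≤-reflexive (cong (_+ ξ) (sym |Is|)))))) (≤-reflexive (cong (_+ ξ) (sym (outdeg′-≡ i))))

        in-≥ : ∀ j → inFrom (inn (lookup L j)) X ≤ indeg′ j + ξ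
        in-≥ j = ≤-trans (proj₂ (sublist-sum Os X (λ x → E x (inn (lookup L j))) ξ occ-Os (≤-trans X≤ (≤-reflexive (cong (_+ ξ) (sym |Os|)))))) (≤-reflexive (cong (_+ ξ) (sym (indeg′-≡ j))))

        in-≤ : ∀ j → indeg′ j ≤ d
        in-≤ j = ≤-trans (≤-reflexive (indeg′-≡ j)) (≤-trans (proj₁ (sublist-sum Os X (λ x → E x (inn (lookup L j))) ξ occ-Os (≤-trans X≤ (≤-reflexive (cong (_+ ξ) (sym |Os|)))))) (inFrom≤d _ X))

        stray : Fin N → ℕ
        stray i = outTo (out (lookup L i)) (not ∘ Y)

        total-stray : ∑ G.U stray ≤ 2 * ζ * n
        total-stray = ≤-trans (≤-reflexive (∑-lookup L _ ∙ sym (∑-map out L (λ x → outTo x (not ∘ Y))) ∙ ∑-occ Os _)) (≤-trans (∑-mono U λ x → *-monoˡ-≤ _ (occ-Os x))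
          (≤-trans (≤-reflexive (sym (edges-out X (not ∘ Y)))) (≤-trans (m≤m+n _ _) sparse)))

        typ : Fin N → Bool
        typ i = stray i ≤ᵇ τ

        atyp : ∀ a t z n P → a * t ≤ 2 * z * n → n ≤ P * t → t * a ≤ t * (2 * z * P)
        atyp a t z n P H1 H2 =
            lin ρ (# 1 ⊗ # 0) (# 1 ⊗ (con 2 ⊗ # 2 ⊗ # 4)) 0
            ((# 0 ⊗ # 1 ≼ con 2 ⊗ # 2 ⊗ # 3 by H1)
              ⊞ con 2 ⊠ (# 2 ⊗ # 3 ≼ # 2 ⊗ (# 4 ⊗ # 1) by *-monoʳ-≤ (z) (H2))) refl
          where
          ρ = a ∷ t ∷ z ∷ n ∷ P ∷ []

        min-deg : ∀ n d h z x t a O N → d ≤ 2 * N + 24 * z → N ≤ O + x → 2 * x ≤ t → 27 * z ≤ t → a ≤ t → 5 * t ≤ h → n + 3 * h ≤ 3 * d → h ≤ n → t + a ≤ O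
        min-deg n d h z x t a O N H1 H2 H3 H4 H5 H6 H7 H8 =
            lin ρ (# 5 ⊕ # 6) (# 7) 42
            (con 18 ⊠ (# 1 ≼ con 2 ⊗ # 8 ⊕ con 24 ⊗ # 3 by H1)
              ⊞ con 36 ⊠ (# 8 ≼ # 7 ⊕ # 4 by H2)
              ⊞ con 18 ⊠ (con 2 ⊗ # 4 ≼ # 5 by H3)
              ⊞ con 16 ⊠ (con 27 ⊗ # 3 ≼ # 5 by H4)
              ⊞ con 43 ⊠ (# 6 ≼ # 5 by H5)
              ⊞ con 24 ⊠ (con 5 ⊗ # 5 ≼ # 2 by H6)
              ⊞ con 6 ⊠ (# 0 ⊕ con 3 ⊗ # 2 ≼ con 3 ⊗ # 1 by H7)
              ⊞ con 6 ⊠ (# 2 ≼ # 0 by H8)) refl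
          where
          ρ = n ∷ d ∷ h ∷ z ∷ x ∷ t ∷ a ∷ O ∷ N ∷ []

        room-size : ∀ n d z y ny N → N ≤ y → y + ny ≡ n → d ≤ ny + 27 * z → N + d ≤ n + 27 * z
        room-size n d z y ny N H1 H2 H3 =
            lin ρ (# 5 ⊕ # 1) (# 0 ⊕ con 27 ⊗ # 2) 0
            ((# 5 ≼ # 3 by H1)
              ⊞ (# 3 ⊕ # 4 ≼ # 0 by ≤-reflexive H2)
              ⊞ (# 1 ≼ # 4 ⊕ con 27 ⊗ # 2 by H3)) refl
          where
          ρ = n ∷ d ∷ z ∷ y ∷ ny ∷ N ∷ []

        room-lower : ∀ n d z y N x t h → y ≤ N + x → d ≤ y + 27 * z → 2 * x ≤ t → 27 * z ≤ t → 5 * t ≤ h → h ≤ n → n + 3 * h ≤ 3 * d → t ≤ N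
        room-lower n d z y N x t h H1 H2 H3 H4 H5 H6 H7 =
            lin ρ (# 6) (# 4) 30
            (con 6 ⊠ (# 3 ≼ # 4 ⊕ # 5 by H1)
              ⊞ con 6 ⊠ (# 1 ≼ # 3 ⊕ con 27 ⊗ # 2 by H2)
              ⊞ con 3 ⊠ (con 2 ⊗ # 5 ≼ # 6 by H3)
              ⊞ con 6 ⊠ (con 27 ⊗ # 2 ≼ # 6 by H4)
              ⊞ con 8 ⊠ (con 5 ⊗ # 6 ≼ # 7 by H5)
              ⊞ con 2 ⊠ (# 7 ≼ # 0 by H6)
              ⊞ con 2 ⊠ (# 0 ⊕ con 3 ⊗ # 7 ≼ con 3 ⊗ # 1 by H7)) refl
          where
          ρ = n ∷ d ∷ z ∷ y ∷ N ∷ x ∷ t ∷ h ∷ []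

        common-arith : ∀ n d h z x t N Oa Op ta tp sa sp C → ta + sa ≡ d → tp + sp ≡ d → sa ≤ t → sp ≤ t → ta ≤ Oa + x → tp ≤ Op + x → Oa + Op ≤ N + C → N + d ≤ n + 27 * z → n + 3 * h ≤ 3 * d → 2 * x ≤ t → 27 * z ≤ t → 5 * t ≤ h → t ≤ C
        common-arith n d h z x t N Oa Op ta tp sa sp C H1 H2 H3 H4 H5 H6 H7 H8 H9 H10 H11 H12 =
            lin ρ (# 5) (# 13) 10
            ((# 1 ≼ # 9 ⊕ # 11 by ≤-reflexive (sym H1))
              ⊞ (# 1 ≼ # 10 ⊕ # 12 by ≤-reflexive (sym H2))
              ⊞ (# 11 ≼ # 5 by H3)
              ⊞ (# 12 ≼ # 5 by H4)
              ⊞ (# 9 ≼ # 7 ⊕ # 4 by H5)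
              ⊞ (# 10 ≼ # 8 ⊕ # 4 by H6)
              ⊞ (# 7 ⊕ # 8 ≼ # 6 ⊕ # 13 by H7)
              ⊞ (# 6 ⊕ # 1 ≼ # 0 ⊕ con 27 ⊗ # 3 by H8)
              ⊞ (# 0 ⊕ con 3 ⊗ # 2 ≼ con 3 ⊗ # 1 by H9)
              ⊞ (con 2 ⊗ # 4 ≼ # 5 by H10)
              ⊞ (con 27 ⊗ # 3 ≼ # 5 by H11)
              ⊞ con 3 ⊠ (con 5 ⊗ # 5 ≼ # 2 by H12)) refl
          where
          ρ = n ∷ d ∷ h ∷ z ∷ x ∷ t ∷ N ∷ Oa ∷ Op ∷ ta ∷ tp ∷ sa ∷ sp ∷ C ∷ []

        delta-arith : ∀ k P x z n t N → k * P * (x + 2 * z) ≤ t → n ≤ P * t → t ≤ N → k * (n * x + 2 * z * n) ≤ N * N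
        delta-arith k P x z n t N H1 H2 H3 =
            lin ρ (# 0 ⊗ (# 4 ⊗ # 2 ⊕ con 2 ⊗ # 3 ⊗ # 4)) (# 6 ⊗ # 6) 0
            ((# 0 ⊗ (# 2 ⊕ con 2 ⊗ # 3) ⊗ # 4 ≼ # 0 ⊗ (# 2 ⊕ con 2 ⊗ # 3) ⊗ (# 1 ⊗ # 5) by *-monoʳ-≤ (k * (x + 2 * z)) (H2))
              ⊞ (# 5 ⊗ (# 0 ⊗ # 1 ⊗ (# 2 ⊕ con 2 ⊗ # 3)) ≼ # 5 ⊗ # 5 by *-monoʳ-≤ (t) (H1))
              ⊞ (# 5 ⊗ # 5 ≼ # 5 ⊗ # 6 by *-monoʳ-≤ (t) (H3))
              ⊞ (# 6 ⊗ # 5 ≼ # 6 ⊗ # 6 by *-monoʳ-≤ (N) (H3))) refl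
          where
          ρ = k ∷ P ∷ x ∷ z ∷ n ∷ t ∷ N ∷ []

        private instance
          τ≢0 : NonZero τ
          τ≢0 = >-nonZero 1≤τ

        α : ℕ
        α = ∑[ i ∈ G.U ] 𝟙 (not (typ i))

        α≤τ : α ≤ τ
        α≤τ = ≤-trans (*-cancelˡ-≤ τ (atyp α τ ζ n P (≤-trans (≤-trans (≤-reflexive (sym (∑-*ʳ G.U τ _))) (∑-mono G.U λ i → pt i)) total-stray) n≤Pτ)) 2ζP≤τ
          where
          pt : ∀ i → 𝟙 (not (typ i)) * τ ≤ stray i
          pt i with typ i in eq
          ... | true = z≤n
          ... | false = ≤-trans (≤-reflexive (+-identityʳ τ)) (<⇒≤ (≤ᵇ-false eq))

        N≤Y : N ≤ size Y
        N≤Y = ≤-trans (≤-reflexive (sym |Is| ∙ length-occ Is)) (∑-mono U occ-Is)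

        N+d : N + d ≤ n + 27 * ζ
        N+d = room-size n d ζ (size Y) (size (not ∘ Y)) N N≤Y (card-not Y) big-¬Y

        τ≤N : τ ≤ N
        τ≤N = room-lower n d ζ (size Y) N ξ τ h Y≤ big-Y 2ξ≤τ 27ζ≤τ 5τ≤h h≤n gap

        -- Even an atypical element keeps about d/2 out-neighbours in its room, by the majority
        -- rule.
        out≥ : ∀ i → τ + α ≤ outdeg′ i
        out≥ i = min-deg n d h ζ ξ τ α (outdeg′ i) (outTo (out (lookup L i)) Y) (out-X _ (out∈X i)) (out-≥ i) 2ξ≤τ 27ζ≤τ α≤τ 5τ≤h gap h≤n

        in≥ : ∀ j → τ + α ≤ indeg′ j
        in≥ j = min-deg n d h ζ ξ τ α (indeg′ j) (inFrom (inn (lookup L j)) X) (in-Y _ (inn∈Y j)) (in-≥ j) 2ξ≤τ 27ζ≤τ α≤τ 5τ≤h gap h≤n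

        -- A room has at most n - d + 27ζ elements, because the other one holds about d in-copies,
        -- while typical elements have nearly d out-neighbours in it. As 3d - n ≥ 3h, two such
        -- neighbourhoods overlap in τ elements.
        common : ∀ a p → typ a ≡ true → typ p ≡ true → τ ≤ ∑[ b ∈ G.U ] (𝟙 (E′ a b) * 𝟙 (E′ p b))
        common a p ta tp = common-arith n d h ζ ξ τ N (outdeg′ a) (outdeg′ p) (outTo (out (lookup L a)) Y) (outTo (out (lookup L p)) Y) (stray a) (stray p) _
          (outTo-split _ Y) (outTo-split _ Y) (≤ᵇ-true ta) (≤ᵇ-true tp) (out-≥ a) (out-≥ p)
          (≤-trans (≤-reflexive (sym (∑-+ G.U _ _))) (≤-trans (∑-mono G.U λ b → pt (E′ a b) (E′ p b)) (≤-reflexive (∑-+ G.U _ _ ∙ cong (_+ ∑[ b ∈ G.U ] (𝟙 (E′ a b) * 𝟙 (E′ p b))) (G.∑U-const 1 ∙ *-identityʳ N)))))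
          N+d gap 2ξ≤τ 27ζ≤τ 5τ≤h
          where
          pt : ∀ a b → 𝟙 a + 𝟙 b ≤ 1 + 𝟙 a * 𝟙 b
          pt true true = ≤-refl
          pt true false = ≤-refl
          pt false b = 𝟙≤1 b

        W₇ : ∀ s t → N * N * N * N * N * N ≤ c * G.walks₇ s t
        W₇ s t = ≤-trans (*-mono-≤ (*-mono-≤ (*-mono-≤ (*-mono-≤ (*-mono-≤ N≤ N≤) N≤) N≤) N≤) N≤)
          (≤-trans (≤-reflexive (r6 P τ)) (*-mono-≤ P⁶≤c (DenseWalks.walks₇≥ E′ typ τ α ≤-refl out≥ in≥ common s t)))
          where
          N≤ : N ≤ P * τ
          N≤ = ≤-trans (≤-trans N≤Y (size≤n Y)) n≤Pτ
          r6 : ∀ M z → M * z * (M * z) * (M * z) * (M * z) * (M * z) * (M * z) ≡ M * M * M * M * M * M * (z * z * z * z * z * z)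
          r6 M z =
              ≤-antisym
              (lin ρ (# 0 ⊗ # 1 ⊗ (# 0 ⊗ # 1) ⊗ (# 0 ⊗ # 1) ⊗ (# 0 ⊗ # 1) ⊗ (# 0 ⊗ # 1) ⊗ (# 0 ⊗ # 1)) (# 0 ⊗ # 0 ⊗ # 0 ⊗ # 0 ⊗ # 0 ⊗ # 0 ⊗ (# 1 ⊗ # 1 ⊗ # 1 ⊗ # 1 ⊗ # 1 ⊗ # 1)) 0
              (triv) refl)
              (lin ρ (# 0 ⊗ # 0 ⊗ # 0 ⊗ # 0 ⊗ # 0 ⊗ # 0 ⊗ (# 1 ⊗ # 1 ⊗ # 1 ⊗ # 1 ⊗ # 1 ⊗ # 1)) (# 0 ⊗ # 1 ⊗ (# 0 ⊗ # 1) ⊗ (# 0 ⊗ # 1) ⊗ (# 0 ⊗ # 1) ⊗ (# 0 ⊗ # 1) ⊗ (# 0 ⊗ # 1)) 0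
              (triv) refl)
            where
            ρ = M ∷ z ∷ []

        -- An out-degree falls short of d by at most ξ through missing entrances and by the stray
        -- edges, whose total the sparse cut bounds.
        reg⁺ : ∀ T → d * G.size T ≤ G.edges T (λ _ → true) + (n * ξ + 2 * ζ * n)
        reg⁺ T = begin
          d * G.size T ≡⟨ sym (∑-*ˡ G.U d _) ⟩
          ∑[ i ∈ G.U ] (d * 𝟙 (T i)) ≤⟨ ∑-mono G.U pt ⟩
          ∑[ i ∈ G.U ] (𝟙 (T i) * outdeg′ i + (ξ + stray i)) ≡⟨ ∑-+ G.U _ _ ∙ cong (∑[ i ∈ G.U ] (𝟙 (T i) * outdeg′ i) +_) (∑-+ G.U _ _ ∙ cong (_+ ∑ G.U stray) (G.∑U-const ξ)) ⟩
          ∑[ i ∈ G.U ] (𝟙 (T i) * outdeg′ i) + (N * ξ + ∑ G.U stray) ≤⟨ +-mono-≤ (≤-reflexive (∑-cong G.U λ i → sym (∑-*ˡ G.U (𝟙 (T i)) _) ∙ ∑-cong G.U λ j → cong (𝟙 (T i) *_) (sym (+-identityʳ _))))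
               (+-mono-≤ (*-monoˡ-≤ ξ (≤-trans N≤Y (size≤n Y))) total-stray) ⟩
          G.edges T (λ _ → true) + (n * ξ + 2 * ζ * n) ∎
          where
          open ≤-Reasoning
          deg : ∀ d t s O x → t + s ≡ d → t ≤ O + x → d * 1 ≤ O + 0 + (x + s)
          deg d t s O x H1 H2 =
              lin ρ (# 0 ⊗ con 1) (# 3 ⊕ con 0 ⊕ (# 4 ⊕ # 2)) 0
              ((# 0 ≼ # 1 ⊕ # 2 by ≤-reflexive (sym H1))
                ⊞ (# 1 ≼ # 3 ⊕ # 4 by H2)) refl
            where
            ρ = d ∷ t ∷ s ∷ O ∷ x ∷ []
          pt : ∀ i → d * 𝟙 (T i) ≤ 𝟙 (T i) * outdeg′ i + (ξ + stray i)
          pt i with T i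
          ... | false = ≤-trans (≤-reflexive (*-zeroʳ d)) z≤n
          ... | true = deg d _ (stray i) (outdeg′ i) ξ (outTo-split _ Y) (out-≥ i)

        reg⁻ : ∀ T → G.edges (λ _ → true) T ≤ d * G.size T + (n * ξ + 2 * ζ * n)
        reg⁻ T = ≤-trans (≤-trans (≤-reflexive (∑-swap G.U G.U _ ∙ ∑-cong G.U λ j → ∑-cong G.U (λ i → +-identityʳ _) ∙ ∑-*ˡ G.U (𝟙 (T j)) _))
          (≤-trans (∑-mono G.U λ j → ≤-trans (*-monoʳ-≤ (𝟙 (T j)) (in-≤ j)) (≤-reflexive (*-comm (𝟙 (T j)) d))) (≤-reflexive (∑-*ˡ G.U d _)))) (m≤m+n _ _)

        room : RoomCycle L inn out
        room = record
          { route = walk-image (lookup L) id (Cyclic.route C)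
          ; closes = Cyclic.closes C
          ; permutes = λ f → ∑-map (lookup L) (Cyclic.vertices C) f ∙ ∑-occ (Cyclic.vertices C) _ ∙ ∑-cong G.U (λ i → cong (_* f (lookup L i)) (Cyclic.once C i) ∙ +-identityʳ _) ∙ ∑-lookup L f }
          where
          C : Cyclic E′
          C = Constants.robust-cycle E′ c d (n * ξ + 2 * ζ * n) 1≤c (≤-trans N₀≤τ τ≤N) W₇ reg⁺ reg⁻
            (delta-arith (Constants.tolerance c) P ξ ζ n τ N tiny n≤Pτ τ≤N)

    -- Two rooms joined by doors

    module TwoRooms (ζ ξ : ℕ) where

      open DoorPaths E hiding (V)

      Room : Set₁
      Room = ∀ {X Y} → Split ζ X Y → ∀ {A : Set} (L : List A) (inn out : A → V) →
             (∀ y → ∑[ a ∈ L ] 𝟙 (inn a == y) ≤ 𝟙 (Y y)) → (∀ x → ∑[ a ∈ L ] 𝟙 (out a == x) ≤ 𝟙 (X x)) →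
             size Y ≤ length L + ξ → size X ≤ length L + ξ → RoomCycle L inn out

      module _ (room : Room)
        {X Y : V → Bool} (S : Split ζ X Y) (ps : List Pth)
        (covers : ∀ v → inside v ps ≡ 1) (heads≤1 : ∀ v → heads v ps ≤ 1) (tails≤1 : ∀ v → tails v ps ≤ 1)
        (balanced : ∑[ p ∈ ps ] 𝟙 (Y (hd p)) ≡ ∑[ p ∈ ps ] 𝟙 (X (tl p)))
        (Y≤ : size Y ≤ ∑[ p ∈ ps ] 𝟙 (Y (hd p)) + ξ) (¬Y≤ : size (not ∘ Y) ≤ ∑[ p ∈ ps ] 𝟙 (not (Y (hd p))) + ξ)
        (X≤ : size X ≤ ∑[ p ∈ ps ] 𝟙 (X (tl p)) + ξ) (¬X≤ : size (not ∘ X) ≤ ∑[ p ∈ ps ] 𝟙 (not (X (tl p))) + ξ)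
        (door : 1 ≤ ∑[ p ∈ ps ] (𝟙 (Y (hd p)) * 𝟙 (not (X (tl p))))) where

        class : (Bool → Bool) → (Bool → Bool) → List Pth
        class i o = filter (λ p → T? (i (Y (hd p)) ∧ o (X (tl p)))) ps

        ∑-class : ∀ i o f → ∑ (class i o) f ≡ ∑[ p ∈ ps ] (𝟙 (i (Y (hd p))) * 𝟙 (o (X (tl p))) * f p)
        ∑-class i o f = ∑-filter _ ps f ∙ ∑-cong ps λ p → cong (_* f p) (𝟙-∧ (i (Y (hd p))) _)

        -- The first index tells whether the tail lies in `X` (1) or not (2), the second whether the
        -- head lies in `Y`, in agreement with the indices of V₁₁ and V₂₂.
        P₁₁ P₁₂ P₂₁ P₂₂ : List Pth
        P₁₁ = class id id
        P₂₁ = class id not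
        P₁₂ = class not id
        P₂₂ = class not not

        by-head : ∀ i f → ∑ (class i id) f + ∑ (class i not) f ≡ ∑[ p ∈ ps ] (𝟙 (i (Y (hd p))) * f p)
        by-head i f = cong₂ _+_ (∑-class i id f) (∑-class i not f) ∙ sym (∑-+ ps _ _) ∙ ∑-cong ps λ p → h (𝟙 (i (Y (hd p)))) (X (tl p)) (f p)
          where
          h : ∀ a x y → a * 𝟙 x * y + a * 𝟙 (not x) * y ≡ a * y
          h a true y = cong₂ _+_ (cong (_* y) (*-identityʳ a)) (cong (_* y) (*-zeroʳ a)) ∙ +-identityʳ _
          h a false y = cong₂ _+_ (cong (_* y) (*-zeroʳ a)) (cong (_* y) (*-identityʳ a))

        by-tail : ∀ o f → ∑ (class id o) f + ∑ (class not o) f ≡ ∑[ p ∈ ps ] (𝟙 (o (X (tl p))) * f p)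
        by-tail o f = cong₂ _+_ (∑-class id o f) (∑-class not o f) ∙ sym (∑-+ ps _ _) ∙ ∑-cong ps λ p → h (Y (hd p)) (𝟙 (o (X (tl p)))) (f p)
          where
          h : ∀ y a z → 𝟙 y * a * z + 𝟙 (not y) * a * z ≡ a * z
          h true a z = cong (_+ 0) (cong (_* z) (+-identityʳ a)) ∙ +-identityʳ _
          h false a z = cong (_* z) (+-identityʳ a)

        len-head : ∀ i → length (class i id) + length (class i not) ≡ ∑[ p ∈ ps ] 𝟙 (i (Y (hd p)))
        len-head i = cong₂ _+_ (length-∑ (class i id)) (length-∑ (class i not)) ∙ by-head i (λ _ → 1) ∙ ∑-cong ps λ p → *-identityʳ _

        len-tail : ∀ o → length (class id o) + length (class not o) ≡ ∑[ p ∈ ps ] 𝟙 (o (X (tl p)))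
        len-tail o = cong₂ _+_ (length-∑ (class id o)) (length-∑ (class not o)) ∙ by-tail o (λ _ → 1) ∙ ∑-cong ps λ p → *-identityʳ _

        -- As many heads lie in `Y` as tails in `X`, so the two kinds of doors can be paired off.
        same : length P₁₂ ≡ length P₂₁
        same = sym (+-cancelˡ-≡ (length P₁₁) _ _ (len-head id ∙ balanced ∙ sym (len-tail id)))

        heads-in : ∀ i v → ∑ (class i id) (λ p → 𝟙 (hd p == v)) + ∑ (class i not) (λ p → 𝟙 (hd p == v)) ≤ 𝟙 (i (Y v))
        heads-in i v = ≤-trans (≤-reflexive (by-head i _)) (≤-trans (∑-mono ps λ p → h (hd p)) (≤-trans (≤-reflexive (∑-*ˡ ps (𝟙 (i (Y v))) _)) (≤-trans (*-monoʳ-≤ (𝟙 (i (Y v))) (heads≤1 v)) (≤-reflexive (*-identityʳ _)))))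
          where
          h : ∀ w → 𝟙 (i (Y w)) * 𝟙 (w == v) ≤ 𝟙 (i (Y v)) * 𝟙 (w == v)
          h w with w ≟ v
          ... | yes refl = ≤-refl
          ... | no _ = ≤-reflexive (*-zeroʳ (𝟙 (i (Y w))) ∙ sym (*-zeroʳ (𝟙 (i (Y v)))))

        tails-in : ∀ o v → ∑ (class id o) (λ p → 𝟙 (tl p == v)) + ∑ (class not o) (λ p → 𝟙 (tl p == v)) ≤ 𝟙 (o (X v))
        tails-in o v = ≤-trans (≤-reflexive (by-tail o _)) (≤-trans (∑-mono ps λ p → h (tl p)) (≤-trans (≤-reflexive (∑-*ˡ ps (𝟙 (o (X v))) _)) (≤-trans (*-monoʳ-≤ (𝟙 (o (X v))) (tails≤1 v)) (≤-reflexive (*-identityʳ _)))))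
          where
          h : ∀ w → 𝟙 (o (X w)) * 𝟙 (w == v) ≤ 𝟙 (o (X v)) * 𝟙 (w == v)
          h w with w ≟ v
          ... | yes refl = ≤-refl
          ... | no _ = ≤-reflexive (*-zeroʳ (𝟙 (o (X w))) ∙ sym (*-zeroʳ (𝟙 (o (X v)))))

        -- The second room treats a pair as one vertex, entered at the head of its first path and
        -- left at the tail of its second; the inner two ends belong to the first room.
        L₂ : List Piece
        L₂ = map inj₁ P₂₂ ++ map inj₂ (zip P₁₂ P₂₁)

        ∑-L₂ : ∀ (f : Piece → ℕ) → ∑ L₂ f ≡ ∑ P₂₂ (f ∘ inj₁) + ∑ (zip P₁₂ P₂₁) (f ∘ inj₂)
        ∑-L₂ f = ∑-++ (map inj₁ P₂₂) _ f ∙ cong₂ _+_ (∑-map inj₁ P₂₂ f) (∑-map inj₂ (zip P₁₂ P₂₁) f)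

        second : RoomCycle L₂ inn out
        second = room (swap-split S) L₂ inn out
          (λ y → ≤-trans (≤-reflexive (∑-L₂ _ ∙ cong (∑ P₂₂ (λ p → 𝟙 (hd p == y)) +_) (∑-zip₁ P₁₂ P₂₁ same (λ p → 𝟙 (hd p == y))) ∙ +-comm (∑ P₂₂ _) _)) (heads-in not y))
          (λ x → ≤-trans (≤-reflexive (∑-L₂ _ ∙ cong (∑ P₂₂ (λ p → 𝟙 (tl p == x)) +_) (∑-zip₂ P₁₂ P₂₁ same (λ p → 𝟙 (tl p == x))) ∙ +-comm (∑ P₂₂ _) _)) (tails-in not x))
          (≤-trans ¬Y≤ (+-monoˡ-≤ ξ (≤-reflexive (sym (len-head not) ∙ +-comm (length P₁₂) _ ∙ sym len₁))))
          (≤-trans ¬X≤ (+-monoˡ-≤ ξ (≤-reflexive (sym (len-tail not) ∙ cong (_+ length P₂₂) (sym same) ∙ +-comm (length P₁₂) _ ∙ sym len₁))))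
          where
          len₁ : length L₂ ≡ length P₂₂ + length P₁₂
          len₁ = length-∑ L₂ ∙ ∑-L₂ _ ∙ cong₂ _+_ (sym (length-∑ P₂₂)) (∑-zip₁ P₁₂ P₂₁ same (λ _ → 1) ∙ sym (length-∑ P₁₂))

        doors : 1 ≤ ∑ L₂ isDoor
        doors = ≤-trans door (≤-reflexive (sym (∑-L₂ isDoor ∙ cong₂ _+_ (∑-zero P₂₂) (∑-zip₂ P₁₂ P₂₁ same (λ _ → 1) ∙ ∑-class id not _ ∙ ∑-cong ps λ p → *-identityʳ _))))

        -- The segments of the second room's cycle between doors run from the head of a path in
        -- `P₂₁` to the tail of one in `P₁₂`, so the first room sees them as its own paths.
        record Returns : Set where
          field
            qs : List Pth
            content≡ : ∀ v → inside v qs ≡ ∑ L₂ (content v)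
            heads≡ : ∀ v → heads v qs ≡ ∑ P₂₁ (λ p → 𝟙 (hd p == v))
            tails≡ : ∀ v → tails v qs ≡ ∑ P₁₂ (λ p → 𝟙 (tl p == v))

        returns : RoomCycle L₂ inn out → Returns
        returns second with cut-at-doors (RoomCycle.route second)
        ... | inj₁ c = ⊥-elim (1+n≰n (≤-trans doors (≤-reflexive (sym (RoomCycle.permutes second isDoor) ∙ Closed.no-door c))))
        ... | inj₂ (opened {verts₁ = v₁} {v₂} s m e c hs ts) = record
              { qs = path (e ⟨ RoomCycle.closes second ⟩++ s) ∷ m
              ; content≡ = λ v → cong (_+ inside v m) (occ-++ v v₂ v₁) ∙ re (occ v v₂) (occ v v₁) (inside v m) ∙ c v ∙ RoomCycle.permutes second (content v)
              ; heads≡ = λ v → hs v ∙ RoomCycle.permutes second (door-head v) ∙ ∑-L₂ _ ∙ cong₂ _+_ (∑-zero P₂₂) (∑-zip₂ P₁₂ P₂₁ same (λ p → 𝟙 (hd p == v)))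
              ; tails≡ = λ v → ts v ∙ RoomCycle.permutes second (door-tail v) ∙ ∑-L₂ _ ∙ cong₂ _+_ (∑-zero P₂₂) (∑-zip₁ P₁₂ P₂₁ same (λ p → 𝟙 (tl p == v))) }
          where
          re : ∀ b a m → b + a + m ≡ a + (m + b)
          re b a m =
              ≤-antisym
              (lin ρ (# 0 ⊕ # 1 ⊕ # 2) (# 1 ⊕ (# 2 ⊕ # 0)) 0
              (triv) refl)
              (lin ρ (# 1 ⊕ (# 2 ⊕ # 0)) (# 0 ⊕ # 1 ⊕ # 2) 0
              (triv) refl)
            where
            ρ = b ∷ a ∷ m ∷ []

        module Finish (R : Returns) where

          open Returns R

          L₁ : List Pth
          L₁ = P₁₁ ++ qs

          qs-length : length qs ≡ length P₂₁
          qs-length = sym (length-heads qs) ∙ ∑-cong (allFin n) heads≡ ∙ ∑-swap (allFin n) P₂₁ _ ∙ ∑-cong P₂₁ (λ p → ∑-𝟙== (hd p)) ∙ sym (length-∑ P₂₁)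

          first : RoomCycle L₁ hd tl
          first = room S L₁ hd tl
            (λ y → ≤-trans (≤-reflexive (∑-++ P₁₁ qs _ ∙ cong (∑ P₁₁ (λ p → 𝟙 (hd p == y)) +_) (heads≡ y))) (heads-in id y))
            (λ x → ≤-trans (≤-reflexive (∑-++ P₁₁ qs _ ∙ cong (∑ P₁₁ (λ p → 𝟙 (tl p == x)) +_) (tails≡ x))) (tails-in id x))
            (≤-trans Y≤ (+-monoˡ-≤ ξ (≤-reflexive (sym (len-head id) ∙ cong (length P₁₁ +_) (sym qs-length) ∙ sym (length-++ P₁₁)))))
            (≤-trans X≤ (+-monoˡ-≤ ξ (≤-reflexive (sym (len-tail id) ∙ cong (length P₁₁ +_) (same ∙ sym qs-length) ∙ sym (length-++ P₁₁)))))

          flatten-cycle : RoomCycle L₁ hd tl → Cyclic E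
          flatten-cycle first with flatten (RoomCycle.route first)
          ... | vs , w , o = record { route = w ; closes = RoomCycle.closes first ; once = λ v → o v ∙ RoomCycle.permutes first _ ∙ ∑-++ P₁₁ qs _
                ∙ cong (inside v P₁₁ +_) (content≡ v ∙ ∑-L₂ _ ∙ cong (inside v P₂₂ +_) (∑-+ (zip P₁₂ P₂₁) _ _ ∙ cong₂ _+_ (∑-zip₁ P₁₂ P₂₁ same (λ p → occ v (Path.vs p))) (∑-zip₂ P₁₂ P₂₁ same (λ p → occ v (Path.vs p)))))
                ∙ re (inside v P₁₁) (inside v P₂₂) (inside v P₁₂) (inside v P₂₁)
                ∙ cong₂ _+_ (by-head id (λ p → occ v (Path.vs p))) (by-head not (λ p → occ v (Path.vs p))) ∙ sym (∑-+ ps _ _) ∙ ∑-cong ps (λ p → h (Y (hd p)) (occ v (Path.vs p))) ∙ covers v }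
            where
            re : ∀ a d b c → a + (d + (b + c)) ≡ a + c + (b + d)
            re a d b c =
                ≤-antisym
                (lin ρ (# 0 ⊕ (# 1 ⊕ (# 2 ⊕ # 3))) (# 0 ⊕ # 3 ⊕ (# 2 ⊕ # 1)) 0
                (triv) refl)
                (lin ρ (# 0 ⊕ # 3 ⊕ (# 2 ⊕ # 1)) (# 0 ⊕ (# 1 ⊕ (# 2 ⊕ # 3))) 0
                (triv) refl)
              where
              ρ = a ∷ d ∷ b ∷ c ∷ []
            h : ∀ y k → 𝟙 y * k + 𝟙 (not y) * k ≡ k
            h true k = +-identityʳ _ ∙ +-identityʳ k
            h false k = +-identityʳ k

        two-rooms : Cyclic E
        two-rooms = Finish.flatten-cycle R (Finish.first R)
          where
          R : Returns
          R = returns second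

      -- Crossing edges that balance the rooms and provide a door

      module SparseCut (loopless : ∀ v → E v v ≡ false) where

        open Forests {n} hiding (V)
        open Forest

        from into : (V → Bool) → List (V × V) → ℕ
        from X es = ∑[ e ∈ es ] 𝟙 (X (proj₁ e))
        into Y es = ∑[ e ∈ es ] 𝟙 (Y (proj₂ e))

        module _ (room : Room) {X Y : V → Bool} (S : Split ζ X Y) where

          -- After contraction the tails are all vertices except sources, the heads all vertices
          -- except targets. `balance` therefore equates the tails in `X` with the heads in `Y`.
          module Contract (es : List (V × V)) (F : Forest es) (es⊆E : ∀ {x y} → (x , y) ∈ es → E x y ≡ true) (few : length es ≤ ξ)
            (balance : size X + into Y es ≡ size Y + from X es) where

            Link : V → V → Set
            Link x y = (x , y) ∈ es

            module Li = Linked (link Link U es (rank F) (ranked F) id (λ v → ≤-trans (src≤1 F v) (≤-reflexive (sym (occ-allFin v)))) (λ v → ≤-trans (tgt≤1 F v) (≤-reflexive (sym (occ-allFin v)))))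

            weaken : Path Link → Path Edge
            weaken p = path (walk-map es⊆E (Path.walk p))

            ps : List (Path Edge)
            ps = map weaken Li.paths

            heads+tgts : ∀ v → heads v ps + tgts es v ≡ 1
            heads+tgts v = cong (_+ tgts es v) (∑-map weaken Li.paths _) ∙ Li.heads+targets v ∙ occ-allFin v

            tails+srcs : ∀ v → tails v ps + srcs es v ≡ 1
            tails+srcs v = cong (_+ srcs es v) (∑-map weaken Li.paths _) ∙ Li.tails+sources v ∙ occ-allFin v

            account : ∀ (B : V → Bool) (end : Path Edge → V) (xs : List V) → (∀ v → ∑[ p ∈ ps ] 𝟙 (end p == v) + occ v xs ≡ 1) →
                      size B ≡ ∑[ p ∈ ps ] 𝟙 (B (end p)) + ∑[ x ∈ xs ] 𝟙 (B x)
            account B end xs h = ∑-cong U (λ v → sym (*-identityˡ _) ∙ cong (_* 𝟙 (B v)) (sym (h v)) ∙ *-distribʳ-+ (𝟙 (B v)) (∑[ p ∈ ps ] 𝟙 (end p == v)) (occ v xs)) ∙ ∑-+ U _ _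
              ∙ cong₂ _+_ (∑-cong U (λ v → sym (∑-*ʳ ps (𝟙 (B v)) _)) ∙ ∑-swap U ps _ ∙ ∑-cong ps λ p → ∑-δ (end p) (𝟙 ∘ B)) (sym (∑-occ xs (𝟙 ∘ B)))

            account-heads : ∀ B → size B ≡ ∑[ p ∈ ps ] 𝟙 (B (hd p)) + into B es
            account-heads B = account B hd (map proj₂ es) heads+tgts ∙ cong (∑[ p ∈ ps ] 𝟙 (B (hd p)) +_) (∑-map proj₂ es _)

            account-tails : ∀ B → size B ≡ ∑[ p ∈ ps ] 𝟙 (B (tl p)) + from B es
            account-tails B = account B tl (map proj₁ es) tails+srcs ∙ cong (∑[ p ∈ ps ] 𝟙 (B (tl p)) +_) (∑-map proj₁ es _)

            small-loss : ∀ (f : V × V → Bool) → ∑[ e ∈ es ] 𝟙 (f e) ≤ ξ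
            small-loss f = ≤-trans (∑-bound es 1 (𝟙≤1 ∘ f)) (≤-trans (≤-reflexive (*-identityʳ _)) few)

            balanced-arith : ∀ X Y hX hY i f → Y ≡ hY + i → X ≡ hX + f → X + i ≡ Y + f → hY ≡ hX
            balanced-arith X Y hX hY i f H1 H2 H3 =
                ≤-antisym
                (lin ρ (# 3) (# 2) 0
                ((# 3 ⊕ # 4 ≼ # 1 by ≤-reflexive (sym H1))
                  ⊞ (# 0 ≼ # 2 ⊕ # 5 by ≤-reflexive H2)
                  ⊞ (# 1 ⊕ # 5 ≼ # 0 ⊕ # 4 by ≤-reflexive (sym H3))) refl)
                (lin ρ (# 2) (# 3) 0
                ((# 1 ≼ # 3 ⊕ # 4 by ≤-reflexive H1)
                  ⊞ (# 2 ⊕ # 5 ≼ # 0 by ≤-reflexive (sym H2))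
                  ⊞ (# 0 ⊕ # 4 ≼ # 1 ⊕ # 5 by ≤-reflexive H3)) refl)
              where
              ρ = X ∷ Y ∷ hX ∷ hY ∷ i ∷ f ∷ []

            -- No chosen edge enters `v`, so a path starts there; it ends at `w` and is thus the
            -- door that makes the second room reachable.
            cycle : ∀ v w → Y v ≡ true → X w ≡ false → tgts es v ≡ 0 → Ends es v w → Cyclic E
            cycle v w Yv Xw v∉ ends = two-rooms room S ps (λ v → ∑-map weaken Li.paths _ ∙ Li.covers v ∙ occ-allFin v)
              (λ v → ≤-trans (m≤m+n _ _) (≤-reflexive (heads+tgts v))) (λ v → ≤-trans (m≤m+n _ _) (≤-reflexive (tails+srcs v)))
              (balanced-arith (size X) (size Y) _ _ (into Y es) (from X es) (account-heads Y) (account-tails X) balance)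
              (≤-trans (≤-reflexive (account-heads Y)) (+-monoʳ-≤ _ (small-loss (λ e → Y (proj₂ e)))))
              (≤-trans (≤-reflexive (account-heads (not ∘ Y))) (+-monoʳ-≤ _ (small-loss (λ e → not (Y (proj₂ e))))))
              (≤-trans (≤-reflexive (account-tails X)) (+-monoʳ-≤ _ (small-loss (λ e → X (proj₁ e)))))
              (≤-trans (≤-reflexive (account-tails (not ∘ X))) (+-monoʳ-≤ _ (small-loss (λ e → not (X (proj₁ e))))))
              (≤-trans door (≤-reflexive (sym (∑-map weaken Li.paths _))))
              where
              door : 1 ≤ ∑[ p ∈ Li.paths ] (𝟙 (Y (hd p)) * 𝟙 (not (X (tl p))))
              door with ∑-pos Li.paths (λ p → 𝟙 (hd p == v)) (≤-reflexive (sym (Li.heads+targets v ∙ occ-allFin v) ∙ cong (heads v Li.paths +_) v∉ ∙ +-identityʳ _))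
              ... | p , p∈ , e with ==⇒≡ {x = hd p} {v} (𝟙-true e)
              ...   | refl with follow F (Path.walk p) no-out ends
                where
                no-out : srcs es (tl p) ≡ 0
                no-out = n≤0⇒n≡0 (≤-pred (≤-trans (+-monoˡ-≤ (srcs es (tl p)) (≤-trans (≤-reflexive (cong 𝟙 (sym (==-refl (tl p))))) (∑-∈ (λ q → 𝟙 (tl q == tl p)) p∈)))
                           (≤-reflexive (Li.tails+sources (tl p) ∙ occ-allFin (tl p)))))
              ...     | refl = ≤-trans (≤-reflexive (sym (cong₂ (λ a b → 𝟙 a * 𝟙 (not b)) Yv Xw))) (∑-∈ (λ q → 𝟙 (Y (hd q)) * 𝟙 (not (X (tl q)))) p∈)

        -- `D` is half of d + 24ζ, rounded down: most edges stay inside a room, so no copy of a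
        -- vertex has more than `D` crossing edges.
        module CrossingEdges (room : Room)
          (1≤ζ : 1 ≤ ζ) (9ζ≤ξ : 9 * ζ ≤ ξ) (400ζ≤d : 400 * ζ ≤ d) (n≤3d : n ≤ 3 * d) (D : ℕ) (2D≤ : 2 * D ≤ d + 24 * ζ) (<2D : d + 24 * ζ < 2 * suc D)
          (well-connected : ∀ (A : Fin n → Bool) → 2 ≤ card A → 2 ≤ card (not ∘ A) → ∃ λ a → ∃ λ b → ∃ λ c → ∃ λ e →
             A a ≡ true × A e ≡ true × A b ≡ false × A c ≡ false × ¬ (a ≡ e) × ¬ (b ≡ c) × E a b ≡ true × E c e ≡ true) where

          module _ {X Y : V → Bool} (S : Split ζ X Y) (r : ℕ) (X≡Y+r : size X ≡ size Y + r) where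

            open Split S

            -- Contracting an edge of this kind lowers the count of `X` by one and leaves that of
            -- `Y` unchanged, so `r` of them remove the surplus.
            F : V → V → Bool
            F x y = X x ∧ (not (Y y) ∧ E x y)

            F-X : ∀ {x y} → F x y ≡ true → X x ≡ true
            F-X = ∧-proj₁

            F-Y : ∀ {x y} → F x y ≡ true → Y y ≡ false
            F-Y {x} {y} e = not-true (∧-proj₁ (∧-proj₂ {X x} e))

            F-E : ∀ {x y} → F x y ≡ true → E x y ≡ true
            F-E {x} {y} e = ∧-proj₂ {not (Y y)} (∧-proj₂ {X x} e)

            𝟙-F : ∀ x y → 𝟙 (F x y) ≡ 𝟙 (X x) * (𝟙 (not (Y y)) * 𝟙 (E x y))
            𝟙-F x y = 𝟙-∧ (X x) _ ∙ cong (𝟙 (X x) *_) (𝟙-∧ (not (Y y)) (E x y))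

            r-arith : ∀ r d n z x y c e → x ≡ y + r → e + c ≡ x * d → e ≤ y * d → c ≤ 2 * z * n → n ≤ 3 * d → d * r ≤ d * (6 * z)
            r-arith r d n z x y c e H1 H2 H3 H4 H5 =
                lin ρ (# 1 ⊗ # 0) (# 1 ⊗ (con 6 ⊗ # 3)) 0
                ((# 4 ⊗ # 1 ≼ # 7 ⊕ # 6 by ≤-reflexive (sym H2))
                  ⊞ (# 7 ≼ # 5 ⊗ # 1 by H3)
                  ⊞ (# 6 ≼ con 2 ⊗ # 3 ⊗ # 2 by H4)
                  ⊞ (# 1 ⊗ (# 5 ⊕ # 0) ≼ # 1 ⊗ # 4 by *-monoʳ-≤ (d) (≤-reflexive (sym H1)))
                  ⊞ con 2 ⊠ (# 3 ⊗ # 2 ≼ # 3 ⊗ (con 3 ⊗ # 1) by *-monoʳ-≤ (z) (H5))) refl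
              where
              ρ = r ∷ d ∷ n ∷ z ∷ x ∷ y ∷ c ∷ e ∷ []

            total-arith : ∀ r d x y c e → x ≡ y + r → e + c ≡ x * d → e ≤ y * d → d * r ≤ c
            total-arith r d x y c e H1 H2 H3 =
                lin ρ (# 1 ⊗ # 0) (# 4) 0
                ((# 2 ⊗ # 1 ≼ # 5 ⊕ # 4 by ≤-reflexive (sym H2))
                  ⊞ (# 5 ≼ # 3 ⊗ # 1 by H3)
                  ⊞ (# 1 ⊗ (# 3 ⊕ # 0) ≼ # 1 ⊗ # 2 by *-monoʳ-≤ (d) (≤-reflexive (sym H1)))) refl
              where
              ρ = r ∷ d ∷ x ∷ y ∷ c ∷ e ∷ []

            D-max : ∀ d z D p q → d ≤ 2 * p + 24 * z → p + q ≡ d → d + 24 * z < 2 * suc D → 2 * q < 2 * suc D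
            D-max d z D p q H1 H2 H3 =
                lin ρ (con 1 ⊕ con 2 ⊗ # 4) (con 2 ⊗ (con 1 ⊕ # 2)) 0
                ((# 0 ≼ con 2 ⊗ # 3 ⊕ con 24 ⊗ # 1 by H1)
                  ⊞ con 2 ⊠ (# 3 ⊕ # 4 ≼ # 0 by ≤-reflexive H2)
                  ⊞ (con 1 ⊕ (# 0 ⊕ con 24 ⊗ # 1) ≼ con 2 ⊗ (con 1 ⊕ # 2) by H3)) refl
              where
              ρ = d ∷ z ∷ D ∷ p ∷ q ∷ []

            L-arith : ∀ d z D r → r ≤ 6 * z → 400 * z ≤ d → d + 24 * z < 2 * suc D → 1 ≤ z → 4 * suc (2 * r) ≤ D
            L-arith d z D r H1 H2 H3 H4 =
                lin ρ (con 4 ⊗ (con 1 ⊕ con 2 ⊗ # 3)) (# 2) 422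
                (con 3384 ⊠ (# 3 ≼ con 6 ⊗ # 1 by H1)
                  ⊞ con 52 ⊠ (con 400 ⊗ # 1 ≼ # 0 by H2)
                  ⊞ con 52 ⊠ (con 1 ⊕ (# 0 ⊕ con 24 ⊗ # 1) ≼ con 2 ⊗ (con 1 ⊕ # 2) by H3)
                  ⊞ con 1744 ⊠ (con 1 ≼ # 1 by H4)) refl
              where
              ρ = d ∷ z ∷ D ∷ r ∷ []

            L-lt : ∀ k r → k ≤ r → 2 * k < suc (2 * r)
            L-lt k r H =
                lin ρ (con 1 ⊕ con 2 ⊗ # 0) (con 1 ⊕ con 2 ⊗ # 1) 0
                (con 2 ⊠ (# 0 ≼ # 1 by H)) refl
              where
              ρ = k ∷ r ∷ []

            D≤d-arith : ∀ d z D → 2 * D ≤ d + 24 * z → 400 * z ≤ d → 2 * D ≤ 2 * d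
            D≤d-arith d z D H1 H2 =
                lin ρ (con 2 ⊗ # 2) (con 2 ⊗ # 0) 49
                (con 50 ⊠ (con 2 ⊗ # 2 ≼ # 0 ⊕ con 24 ⊗ # 1 by H1)
                  ⊞ con 3 ⊠ (con 400 ⊗ # 1 ≼ # 0 by H2)) refl
              where
              ρ = d ∷ z ∷ D ∷ []

            private instance
              d≢0 : NonZero d
              d≢0 = >-nonZero (≤-trans (*-mono-≤ (s≤s (z≤n {399})) 1≤ζ) 400ζ≤d)

            r≤6ζ : r ≤ 6 * ζ
            r≤6ζ = *-cancelˡ-≤ d (r-arith r d n ζ (size X) (size Y) (edges X (not ∘ Y)) (edges X Y) X≡Y+r (splitʳ X Y) (edges-right≤ X Y) (≤-trans (m≤m+n _ _) sparse) n≤3d)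

            D≤d : D ≤ d
            D≤d = *-cancelˡ-≤ 2 (D≤d-arith d ζ D 2D≤ 400ζ≤d)

            -- `X` sends out d edges per vertex and `Y` takes in at most d per vertex; the excess
            -- has to cross.
            total-F : d * r ≤ total F
            total-F = ≤-trans (total-arith r d (size X) (size Y) (edges X (not ∘ Y)) (edges X Y) X≡Y+r (splitʳ X Y) (edges-right≤ X Y))
              (≤-reflexive (∑∑-cong λ x y → sym (𝟙-F x y)))

            out-F : ∀ x → out-count F x ≤ D
            out-F x with X x in eq
            ... | false = ≤-trans (≤-reflexive (∑-zero U)) z≤n
            ... | true = ≤-pred (*-cancelˡ-< 2 _ _ (D-max d ζ D (outTo x Y) (out′ x) (out-X x eq)
                (cong (outTo x Y +_) (∑-cong U λ y → 𝟙-∧ (not (Y y)) (E x y)) ∙ outTo-split x Y) <2D))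
              where
              out′ : V → ℕ
              out′ x = ∑[ y ∈ U ] 𝟙 (not (Y y) ∧ E x y)

            in-F : ∀ y → in-count F y ≤ D
            in-F y with Y y in eq
            ... | true = ≤-trans (≤-reflexive (∑-cong U (λ x → cong 𝟙 (f (X x))) ∙ ∑-zero U)) z≤n
              where
              f : ∀ a → a ∧ false ≡ false
              f true = refl
              f false = refl
            ... | false = ≤-pred (*-cancelˡ-< 2 _ _ (D-max d ζ D (inFrom y (not ∘ X)) (∑[ x ∈ U ] 𝟙 (X x ∧ E x y)) (in-¬Y y eq)
                (cong (inFrom y (not ∘ X) +_) (∑-cong U λ x → 𝟙-∧ (X x) (E x y)) ∙ +-comm (inFrom y (not ∘ X)) _ ∙ inFrom-split y X) <2D))

            F-loopless : ∀ x → F x x ≡ false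
            F-loopless x rewrite loopless x with X x | Y x
            ... | false | _ = refl
            ... | true | true = refl
            ... | true | false = refl

            pick-edges : ∀ k → k ≤ r → (F′ : V → V → Bool) → (∀ x y → F′ x y ≡ true → F x y ≡ true) → D * k ≤ total F′ → Selected F′ k
            pick-edges k k≤r F′ F′⊆F h = select D (suc (2 * r)) k (L-arith d ζ D r r≤6ζ 400ζ≤d <2D 1≤ζ) (L-lt k r k≤r) F′ irr
                (λ x → ≤-trans (∑-mono U λ y → ⊆ᵇ-𝟙 (F′⊆F x y)) (out-F x)) (λ y → ≤-trans (∑-mono U λ x → ⊆ᵇ-𝟙 (F′⊆F x y)) (in-F y)) h
              where
              irr : ∀ x → F′ x x ≡ false
              irr x with F′ x x in eq
              ... | false = refl
              ... | true = ⊥-elim (true≢false (sym (F′⊆F x x eq) ∙ F-loopless x))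

            from-F : ∀ es → (∀ {x y} → (x , y) ∈ es → F x y ≡ true) → from X es ≡ length es
            from-F [] h = refl
            from-F ((x , y) ∷ es) h = cong₂ _+_ (cong 𝟙 (F-X (h (here refl)))) (from-F es (h ∘ there))

            into-F : ∀ es → (∀ {x y} → (x , y) ∈ es → F x y ≡ true) → into Y es ≡ 0
            into-F [] h = refl
            into-F ((x , y) ∷ es) h = cong₂ _+_ (cong 𝟙 (F-Y {x} {y} (h (here refl)))) (into-F es (h ∘ there))

            -- Origin of ξ = 9ζ: the surplus is at most 6ζ, and 3ζ leaves space for the few
            -- additional edges.
            r≤ξ-arith : ∀ r z x → r ≤ 6 * z → 9 * z ≤ x → 1 ≤ z → r + 3 ≤ x
            r≤ξ-arith r z x H1 H2 H3 =
                lin ρ (# 0 ⊕ con 3) (# 2) 0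
                ((# 0 ≼ con 6 ⊗ # 1 by H1)
                  ⊞ (con 9 ⊗ # 1 ≼ # 2 by H2)
                  ⊞ con 3 ⊠ (con 1 ≼ # 1 by H3)) refl
              where
              ρ = r ∷ z ∷ x ∷ []

            r+3≤ξ : r + 3 ≤ ξ
            r+3≤ξ = r≤ξ-arith r ζ ξ r≤6ζ 9ζ≤ξ 1≤ζ

            -- A vertex of `Y` outside `X` meets no edge of `F`, so it remains a path of its own,
            -- with its head in one room and its tail in the other.
            with-door-vertex : ∀ v → X v ≡ false → Y v ≡ true → Cyclic E
            with-door-vertex v Xv Yv = Contract.cycle room S es forest (λ i → F-E (es⊆F i)) (≤-trans (≤-reflexive len) (≤-trans (m≤m+n r 3) r+3≤ξ))
                (cong (size X +_) (into-F es es⊆F) ∙ +-identityʳ _ ∙ X≡Y+r ∙ cong (size Y +_) (sym len ∙ sym (from-F es es⊆F)))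
                v v Yv Xv (tgts-none F v es⊆F λ x → no-in x) (stop (srcs-none F v es⊆F λ y → cong (_∧ _) Xv))
              where
              s : Selected F r
              s = pick-edges r ≤-refl F (λ x y e → e) (≤-trans (*-monoˡ-≤ r D≤d) total-F)
              open Selected s
              no-in : ∀ x → F x v ≡ false
              no-in x rewrite Yv with X x
              ... | true = refl
              ... | false = refl

            module _ (Y⊆X : ∀ v → Y v ≡ true → X v ≡ true) where

              Z : V → Bool
              Z v = X v ∧ not (Y v)

              size-Z : size Z ≡ r
              size-Z = +-cancelˡ-≡ (size Y) _ _ (sym (∑-+ U _ _) ∙ ∑-cong U (λ v → h (X v) (Y v) (Y⊆X v)) ∙ X≡Y+r)
                where
                h : ∀ x y → (y ≡ true → x ≡ true) → 𝟙 y + 𝟙 (x ∧ not y) ≡ 𝟙 x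
                h x true i rewrite i refl = refl
                h true false i = refl
                h false false i = refl

              two-arith : ∀ d z y → d ≤ y + 27 * z → 400 * z ≤ d → 1 ≤ z → 2 ≤ y
              two-arith d z y H1 H2 H3 =
                  lin ρ (con 2) (# 2) 372
                  (con 2 ⊠ (# 0 ≼ # 2 ⊕ con 27 ⊗ # 1 by H1)
                    ⊞ con 2 ⊠ (con 400 ⊗ # 1 ≼ # 0 by H2)
                    ⊞ con 746 ⊠ (con 1 ≼ # 1 by H3)) refl
                where
                ρ = d ∷ z ∷ y ∷ []

              -- X = Y: the two rooms are disjoint, and the connecting edges come from well-connectedness.
              disjoint-rooms : r ≡ 0 → Cyclic E
              disjoint-rooms r≡0 = conclude (well-connected X (two-arith d ζ (size X) big-X 400ζ≤d 1≤ζ) (two-arith d ζ (size (not ∘ X)) big-¬X 400ζ≤d 1≤ζ))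
                where
                X≡Y : ∀ v → X v ≡ Y v
                X≡Y v with Y v in p | X v in q
                ... | true | true = refl
                ... | false | false = refl
                ... | true | false = ⊥-elim (true≢false (sym (Y⊆X v p) ∙ q))
                ... | false | true = ⊥-elim (1+n≰n (≤-trans (card-∈ Z v (∧-intro q (cong not p))) (≤-reflexive (size-Z ∙ r≡0))))
                conclude : (∃ λ a → ∃ λ b → ∃ λ c → ∃ λ e → X a ≡ true × X e ≡ true × X b ≡ false × X c ≡ false × ¬ (a ≡ e) × ¬ (b ≡ c) × E a b ≡ true × E c e ≡ true) → Cyclic E
                conclude (a , b , c , e , Xa , Xe , Xb , Xc , a≢e , b≢c , ab , ce) = Contract.cycle room S es forest es⊆E (≤-trans (s≤s (s≤s z≤n)) (≤-trans (m≤n+m 3 r) r+3≤ξ))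
                    (cong₂ _+_ (X≡Y+r ∙ cong (size Y +_) r≡0 ∙ +-identityʳ _) (cong₂ (λ p q → 𝟙 p + (𝟙 q + 0)) (sym (X≡Y b) ∙ Xb) (sym (X≡Y e) ∙ Xe) ∙ cong₂ (λ p q → 𝟙 p + (𝟙 q + 0)) (sym Xa) (sym Xc)))
                    a b (sym (X≡Y a) ∙ Xa) Xb (cong₂ _+_ (𝟙≢ b a (a≢b ∘ sym)) (cong (_+ 0) (𝟙≢ e a (a≢e ∘ sym))))
                    (step (here refl) (stop (cong₂ _+_ (𝟙≢ a b a≢b) (cong (_+ 0) (𝟙≢ c b (b≢c ∘ sym))))))
                  where
                  apart : ∀ {u v} → X u ≡ true → X v ≡ false → ¬ (u ≡ v)
                  apart Xu Xv q = true≢false (sym Xu ∙ cong X q ∙ Xv)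
                  a≢b : ¬ (a ≡ b)
                  a≢b = apart Xa Xb
                  es : List (V × V)
                  es = (a , b) ∷ (c , e) ∷ []
                  forest : Forest es
                  forest = add-out a b (add-out c e empty refl refl refl (apart Xe Xc ∘ sym))
                    (cong (_+ 0) (𝟙≢ c a (apart Xa Xc ∘ sym))) (cong (_+ 0) (𝟙≢ c b (b≢c ∘ sym))) (cong (_+ 0) (𝟙≢ e b (apart Xe Xb))) a≢b
                  es⊆E : ∀ {x y} → (x , y) ∈ es → E x y ≡ true
                  es⊆E (here refl) = ab
                  es⊆E (there (here refl)) = ce

              remove-vertex : (V → Bool) → (V → Bool) → V → V → Bool
              remove-vertex A B x y = F x y ∧ (not (A x) ∧ not (B y))

              remove-⊆ : ∀ A B x y → remove-vertex A B x y ≡ true → F x y ≡ true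
              remove-⊆ A B x y e = ∧-proj₁ e

              total-remove : ∀ a b → total F ≤ total (remove-vertex (_== a) (_== b)) + (D + D)
              total-remove a b = ≤-trans (∑∑-mono λ x y → pt (F x y) (x == a) (y == b)) (≤-trans (≤-reflexive (∑∑-+ _ _ ∙ cong (total (remove-vertex (_== a) (_== b)) +_)
                  (∑∑-+ _ _ ∙ cong₂ _+_ (∑-cong U (λ x → ∑-*ˡ U (𝟙 (x == a)) _) ∙ ∑-δ′ a (out-count F)) (∑-cong U (λ x → ∑-δ′ b (λ y → 𝟙 (F x y)))))))
                  (+-monoʳ-≤ (total (remove-vertex (_== a) (_== b))) (+-mono-≤ (out-F a) (in-F b))))
                where
                pt : ∀ f a b → 𝟙 f ≤ 𝟙 (f ∧ (not a ∧ not b)) + (𝟙 a * 𝟙 f + 𝟙 b * 𝟙 f)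
                pt false a b = z≤n
                pt true true b = s≤s z≤n
                pt true false true = ≤-refl
                pt true false false = ≤-refl

              -- Each selected edge costs only `D`, about d/2, while each unit of surplus supplies d
              -- edges. From r = 2 on, this pays for the 2D edges set aside at the ends of the door.
              i-arith : ∀ d z D r j t t2 → r ≡ 2 + j → d * r ≤ t → t ≤ t2 + (D + D) → 2 * D ≤ d + 24 * z → 400 * z ≤ d → D * suc j ≤ t2
              i-arith d z D r j t t2 H0 H1 H2 H3 H4 =
                  lin ρ (# 2 ⊗ (con 1 ⊕ # 4)) (# 6) 4699
                  (con 2650 ⊠ (# 0 ⊗ # 3 ≼ # 5 by H1)
                    ⊞ con 2650 ⊠ (# 5 ≼ # 6 ⊕ (# 2 ⊕ # 2) by H2)
                    ⊞ con 5000 ⊠ (con 2 ⊗ # 2 ≼ # 0 ⊕ con 24 ⊗ # 1 by H3)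
                    ⊞ con 300 ⊠ (con 400 ⊗ # 1 ≼ # 0 by H4)
                    ⊞ con 2350 ⊠ (# 4 ⊗ (con 2 ⊗ # 2) ≼ # 4 ⊗ (# 0 ⊕ con 24 ⊗ # 1) by *-monoʳ-≤ (j) (H3))
                    ⊞ con 141 ⊠ (# 4 ⊗ (con 400 ⊗ # 1) ≼ # 4 ⊗ # 0 by *-monoʳ-≤ (j) (H4))
                    ⊞ con 2650 ⊠ (# 0 ⊗ (con 2 ⊕ # 4) ≼ # 0 ⊗ # 3 by *-monoʳ-≤ (d) (≤-reflexive (sym H0)))) refl
                where
                ρ = d ∷ z ∷ D ∷ r ∷ j ∷ t ∷ t2 ∷ []

              ii-arith : ∀ d D r j t t2 → r ≡ 2 + j → d * r ≤ t → t ≤ t2 + (D + D) → D ≤ d → D * j ≤ t2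
              ii-arith d D r j t t2 H0 H1 H2 H3 =
                  lin ρ (# 1 ⊗ # 3) (# 5) 0
                  ((# 0 ⊗ # 2 ≼ # 4 by H1)
                    ⊞ (# 4 ≼ # 5 ⊕ (# 1 ⊕ # 1) by H2)
                    ⊞ (# 2 ⊗ # 1 ≼ # 2 ⊗ # 0 by *-monoʳ-≤ (r) (H3))
                    ⊞ (# 1 ⊗ (con 2 ⊕ # 3) ≼ # 1 ⊗ # 2 by *-monoʳ-≤ (D) (≤-reflexive (sym H0)))) refl
                where
                ρ = d ∷ D ∷ r ∷ j ∷ t ∷ t2 ∷ []

              -- an edge from V₁₁ to V₂₂ is itself a door
              direct-door : ∀ r′ → r ≡ suc r′ → ∀ a b → Y a ≡ true → X b ≡ false → E a b ≡ true → Cyclic E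
              direct-door r′ r≡ a b Ya Xb ab = Contract.cycle room S es′ forest′ es′⊆E
                  (≤-trans (≤-reflexive (cong suc len ∙ sym r≡)) (≤-trans (m≤m+n r 3) r+3≤ξ))
                  (cong (size X +_) (cong₂ _+_ (cong 𝟙 Yb) (into-F es ⊆F)) ∙ +-identityʳ _ ∙ X≡Y+r
                    ∙ cong (size Y +_) (r≡ ∙ sym (cong₂ _+_ (cong 𝟙 Xa) (from-F es ⊆F ∙ len))))
                  a b Ya Xb (cong₂ _+_ (𝟙≢ b a b≢a) (tgts-none F a ⊆F no-in))
                  (step (here refl) (stop (cong₂ _+_ (𝟙≢ a b (b≢a ∘ sym)) b∉)))
                where
                Xa = Y⊆X a Ya
                Yb : Y b ≡ false
                Yb with Y b in eq
                ... | false = refl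
                ... | true = ⊥-elim (true≢false (sym (Y⊆X b eq) ∙ Xb))
                b≢a : ¬ (b ≡ a)
                b≢a q = true≢false (sym Ya ∙ cong Y (sym q) ∙ Yb)
                F′ : V → V → Bool
                F′ = remove-vertex (_== a) (_== b)
                enough : ∀ r′ → r ≡ suc r′ → D * r′ ≤ total F′
                enough zero _ = ≤-trans (≤-reflexive (*-zeroʳ D)) z≤n
                enough (suc j) e = i-arith d ζ D r j (total F) (total F′) e total-F (total-remove a b) 2D≤ 400ζ≤d
                s : Selected F′ r′
                s = pick-edges r′ (≤-trans (n≤1+n r′) (≤-reflexive (sym r≡))) F′ (remove-⊆ (_== a) (_== b)) (enough r′ r≡)
                open Selected s
                ⊆F : ∀ {x y} → (x , y) ∈ es → F x y ≡ true
                ⊆F {x} {y} i = remove-⊆ (_== a) (_== b) x y (es⊆F i)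
                es′ : List (V × V)
                es′ = (a , b) ∷ es
                no-in : ∀ x → F x a ≡ false
                no-in x rewrite Ya with X x
                ... | true = refl
                ... | false = refl
                ∧f : ∀ p → p ∧ false ≡ false
                ∧f true = refl
                ∧f false = refl
                a∉ : srcs es a ≡ 0
                a∉ = srcs-none F′ a es⊆F λ y → cong (F a y ∧_) (cong (λ p → not p ∧ not (y == b)) (==-refl a)) ∙ ∧f (F a y)
                b∉ : srcs es b ≡ 0
                b∉ = srcs-none F b ⊆F λ y → cong (_∧ (not (Y y) ∧ E b y)) Xb
                b∉′ : tgts es b ≡ 0
                b∉′ = tgts-none F′ b es⊆F λ x → cong (F x b ∧_) (cong (λ p → not (x == a) ∧ not p) (==-refl b) ∙ ∧f (not (x == a))) ∙ ∧f (F x b)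
                forest′ : Forest es′
                forest′ = add-out a b forest a∉ b∉ b∉′ (b≢a ∘ sym)
                es′⊆E : ∀ {x y} → (x , y) ∈ es′ → E x y ≡ true
                es′⊆E (here refl) = ab
                es′⊆E {x} {y} (there i) = F-E {x} {y} (⊆F i)

              -- At least d crossing edges, at most `D` of them in either direction, leave about d/2
              -- in each; at most `r` of these neighbours lie in `Z`, and at most 2k are already
              -- touched.
              room-left : ∀ d z D o i q r k → d ≤ o + i → i ≤ D → 2 * D ≤ d + 24 * z → 400 * z ≤ d → r ≤ 6 * z → o ≤ q + r → k ≤ r + 2 → 1 ≤ z → k + k < q
              room-left d z D o i q r k H1 H2 H3 H4 H5 H6 H7 H8 =
                  lin ρ (con 1 ⊕ (# 7 ⊕ # 7)) (# 5) 363
                  (con 34 ⊠ (# 0 ≼ # 3 ⊕ # 4 by H1)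
                    ⊞ con 34 ⊠ (# 4 ≼ # 2 by H2)
                    ⊞ con 17 ⊠ (con 2 ⊗ # 2 ≼ # 0 ⊕ con 24 ⊗ # 1 by H3)
                    ⊞ con 17 ⊠ (con 400 ⊗ # 1 ≼ # 0 by H4)
                    ⊞ con 762 ⊠ (# 6 ≼ con 6 ⊗ # 1 by H5)
                    ⊞ con 34 ⊠ (# 3 ≼ # 5 ⊕ # 6 by H6)
                    ⊞ con 728 ⊠ (# 7 ≼ # 6 ⊕ con 2 by H7)
                    ⊞ con 1820 ⊠ (con 1 ≼ # 1 by H8)) refl
                where
                ρ = d ∷ z ∷ D ∷ o ∷ i ∷ q ∷ r ∷ k ∷ []

              -- Without a direct door, a path V₁₁ → x → V₂₂ through a vertex x of X ∖ Y serves instead.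
              module Through (x : V) (Xx : X x ≡ true) (Yx : Y x ≡ false) (busy : d ≤ out-count F x + in-count F x)
                (es : List (V × V)) (forest : Forest es) (es⊆E : ∀ {u v} → (u , v) ∈ es → E u v ≡ true)
                (x∉ : srcs es x ≡ 0) (x∉′ : tgts es x ≡ 0) (few : length es ≤ r) (balance : size X + into Y es ≡ size Y + (2 + from X es)) where

                route : ∀ a b → Y a ≡ true → F a x ≡ true → srcs es a ≡ 0 → tgts es a ≡ 0 →
                        X b ≡ false → F x b ≡ true → srcs ((a , x) ∷ es) b ≡ 0 → tgts ((a , x) ∷ es) b ≡ 0 → Cyclic E
                route a b Ya ax a∉ a∉′ Xb xb b∉ b∉′ = Contract.cycle room S es₂ forest₂ es₂⊆E
                    (≤-trans (s≤s (s≤s few)) (≤-trans (≤-reflexive (+-comm 2 r)) (≤-trans (+-monoʳ-≤ r (s≤s (s≤s z≤n))) r+3≤ξ)))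
                    balance₂ a b Ya Xb (cong₂ _+_ (𝟙≢ b a b≢a) (cong₂ _+_ (𝟙≢ x a (a≢x ∘ sym)) a∉′))
                    (step (there (here refl)) (step (here refl) (stop (cong₂ _+_ (𝟙≢ x b x≢b) b∉))))
                  where
                  a≢x : ¬ (a ≡ x)
                  a≢x e = true≢false (sym Ya ∙ cong Y e ∙ Yx)
                  x≢b : ¬ (x ≡ b)
                  x≢b e = true≢false (sym Xx ∙ cong X e ∙ Xb)
                  b≢a : ¬ (b ≡ a)
                  b≢a e = true≢false (sym (F-X ax) ∙ cong X (sym e) ∙ Xb)
                  es₂ : List (V × V)
                  es₂ = (x , b) ∷ (a , x) ∷ es
                  forest₂ : Forest es₂
                  forest₂ = add-out x b (add-in a x forest x∉′ a∉ a∉′ a≢x) (cong₂ _+_ (𝟙≢ a x a≢x) x∉) b∉ b∉′ x≢b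
                  es₂⊆E : ∀ {u v} → (u , v) ∈ es₂ → E u v ≡ true
                  es₂⊆E (here refl) = F-E {x} {b} xb
                  es₂⊆E (there (here refl)) = F-E {a} {x} ax
                  es₂⊆E (there (there i)) = es⊆E i
                  balance₂ : size X + into Y es₂ ≡ size Y + from X es₂
                  balance₂ = cong (size X +_) (cong₂ _+_ (cong 𝟙 (F-Y {x} {b} xb)) (cong (_+ into Y es) (cong 𝟙 Yx))) ∙ balance
                    ∙ cong (size Y +_) (sym (cong₂ _+_ (cong 𝟙 Xx) (cong (_+ from X es) (cong 𝟙 (F-X {a} {x} ax)))))

                pt₁ : ∀ y f x → (f ≡ true → x ≡ true) → 𝟙 f ≤ 𝟙 (y ∧ f) + 𝟙 (x ∧ not y)
                pt₁ y false x h = z≤n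
                pt₁ true true x h = s≤s z≤n
                pt₁ false true x h rewrite h refl = ≤-refl

                pt₂ : ∀ x f y → (f ≡ true → y ≡ false) → 𝟙 f ≤ 𝟙 (not x ∧ f) + 𝟙 (x ∧ not y)
                pt₂ x false y h = z≤n
                pt₂ false true y h = s≤s z≤n
                pt₂ true true y h rewrite h refl = ≤-refl

                from-left : in-count F x ≤ card (λ a → Y a ∧ F a x) + r
                from-left = ≤-trans (∑-mono U λ a → pt₁ (Y a) (F a x) (X a) F-X) (≤-reflexive (∑-+ U (λ a → 𝟙 (Y a ∧ F a x)) (λ a → 𝟙 (Z a)) ∙ cong (card (λ a → Y a ∧ F a x) +_) size-Z))

                to-right : out-count F x ≤ card (λ b → not (X b) ∧ F x b) + r
                to-right = ≤-trans (∑-mono U λ b → pt₂ (X b) (F x b) (Y b) (F-Y {x} {b})) (≤-reflexive (∑-+ U (λ b → 𝟙 (not (X b) ∧ F x b)) (λ b → 𝟙 (Z b)) ∙ cong (card (λ b → not (X b) ∧ F x b) +_) size-Z))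

                choose-b : ∀ a → Y a ∧ F a x ≡ true → srcs es a ≡ 0 → tgts es a ≡ 0 →
                           (∃ λ b → not (X b) ∧ F x b ≡ true × srcs ((a , x) ∷ es) b ≡ 0 × tgts ((a , x) ∷ es) b ≡ 0) → Cyclic E
                choose-b a a-ok a∉ a∉′ (b , b-ok , b∉ , b∉′) = route a b (∧-proj₁ a-ok) (∧-proj₂ {Y a} a-ok) a∉ a∉′ (not-true (∧-proj₁ b-ok)) (∧-proj₂ {not (X b)} b-ok) b∉ b∉′

                choose-a : (∃ λ a → Y a ∧ F a x ≡ true × srcs es a ≡ 0 × tgts es a ≡ 0) → Cyclic E
                choose-a (a , a-ok , a∉ , a∉′) = choose-b a a-ok a∉ a∉′ (fresh-in ((a , x) ∷ es) (λ b → not (X b) ∧ F x b)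
                  (room-left d ζ D (out-count F x) (in-count F x) _ r (suc (length es)) busy (in-F x) 2D≤ 400ζ≤d r≤6ζ to-right
                    (≤-trans (s≤s few) (≤-trans (≤-reflexive (+-comm 1 r)) (+-monoʳ-≤ r (s≤s z≤n)))) 1≤ζ))

                cycle : Cyclic E
                cycle = choose-a (fresh-in es (λ a → Y a ∧ F a x) (room-left d ζ D (in-count F x) (out-count F x) _ r (length es)
                  (≤-trans busy (≤-reflexive (+-comm (out-count F x) _))) (out-F x) 2D≤ 400ζ≤d r≤6ζ from-left (≤-trans few (m≤m+n r 2)) 1≤ζ))

              module NoDirectDoor (no-direct : ∀ a b → Y a ≡ true → X b ≡ false → E a b ≡ true → ⊥) (1≤r : 1 ≤ r) where

                -- An edge of `F` starts in `X` and ends outside `Y`. As it cannot run from `Y` to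
                -- the complement of `X`, one of its ends lies in `Z`.
                incident : total F ≤ ∑[ x ∈ filter (λ x → T? (Z x)) U ] (out-count F x + in-count F x)
                incident = ≤-trans (∑∑-mono λ x y → pt x y) (≤-reflexive (∑∑-+ (λ x y → 𝟙 (Z x) * 𝟙 (F x y)) (λ x y → 𝟙 (Z y) * 𝟙 (F x y))
                    ∙ cong₂ _+_ (∑-cong U (λ x → ∑-*ˡ U (𝟙 (Z x)) _)) (∑-swap U U (λ x y → 𝟙 (Z y) * 𝟙 (F x y)) ∙ ∑-cong U (λ y → ∑-*ˡ U (𝟙 (Z y)) _))
                    ∙ sym (∑-+ U (λ x → 𝟙 (Z x) * out-count F x) (λ x → 𝟙 (Z x) * in-count F x)) ∙ ∑-cong U (λ x → sym (*-distribˡ-+ (𝟙 (Z x)) (out-count F x) (in-count F x))) ∙ sym (∑-filter Z U (λ x → out-count F x + in-count F x))))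
                  where
                  pt : ∀ x y → 𝟙 (F x y) ≤ 𝟙 (Z x) * 𝟙 (F x y) + 𝟙 (Z y) * 𝟙 (F x y)
                  pt x y with F x y in f
                  ... | false = z≤n
                  ... | true with Y x in p | X y in q
                  ...   | true | false = ⊥-elim (no-direct x y p q (F-E {x} {y} f))
                  ...   | false | _ rewrite F-X {x} {y} f = s≤s z≤n
                  ...   | true | true rewrite F-Y {x} {y} f = m≤n+m 1 (𝟙 (X x ∧ false) * 1)

                length-Z : length (filter (λ x → T? (Z x)) U) ≡ r
                length-Z = length-∑ (filter (λ x → T? (Z x)) U) ∙ ∑-filter Z U _ ∙ ∑-cong U (λ x → *-identityʳ _) ∙ size-Z

                -- At least d r edges are shared among the r vertices of `Z`.
                busy-vertex : ∃ λ x → Z x ≡ true × d ≤ out-count F x + in-count F x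
                busy-vertex = conclude (∑-average (filter (λ x → T? (Z x)) U) {λ _ → d} {λ x → out-count F x + in-count F x} (≤-trans 1≤r (≤-reflexive (sym length-Z)))
                    (≤-trans (≤-reflexive (∑-const (filter (λ x → T? (Z x)) U) d ∙ cong (_* d) length-Z ∙ *-comm r d)) (≤-trans total-F incident)))
                  where
                  conclude : (∃ λ x → x ∈ filter (λ x → T? (Z x)) U × d ≤ out-count F x + in-count F x) → ∃ λ x → Z x ≡ true × d ≤ out-count F x + in-count F x
                  conclude (x , i , h) = x , Equivalence.to T-≡ (proj₂ (∈-filter⁻ (λ x → T? (Z x)) {xs = U} i)) , h

                Z-only : r ≡ 1 → ∀ {x v} → Z x ≡ true → Z v ≡ true → v ≡ x
                Z-only r≡1 {x} {v} Zx Zv with v ≟ x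
                ... | yes e = e
                ... | no v≢x = ⊥-elim (1+n≰n (≤-trans (≤-trans (≤-reflexive (cong₂ _+_ (sym (card-single v)) (sym (card-single x)) ∙ sym (∑-+ U _ _))) (∑-mono U pt)) (≤-reflexive (size-Z ∙ r≡1))))
                  where
                  pt : ∀ w → 𝟙 (w == v) + 𝟙 (w == x) ≤ 𝟙 (Z w)
                  pt w with w ≟ v | w ≟ x
                  ... | no _ | no _ = z≤n
                  ... | yes refl | yes refl = ⊥-elim (v≢x refl)
                  ... | yes refl | no _ = ≤-reflexive (cong 𝟙 (sym Zv))
                  ... | no _ | yes refl = ≤-reflexive (cong 𝟙 (sym Zx))

                -- The path through `x` uses two crossing edges for a surplus of one, so an edge
                -- back from V₂₂ to V₁₁ must compensate. Well-connectedness is applied to `Y`: its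
                -- edge out of `Y` has to end in `x`, for want of a direct door, and so the edge
                -- disjoint from it starts outside both `X` and `Y`.
                one : r ≡ 1 → ∀ x → Z x ≡ true → d ≤ out-count F x + in-count F x → Cyclic E
                one r≡1 x Zx busy = conclude (well-connected Y (two-arith d ζ (size Y) big-Y 400ζ≤d 1≤ζ) (two-arith d ζ (size (not ∘ Y)) big-¬Y 400ζ≤d 1≤ζ))
                  where
                  conclude : (∃ λ a → ∃ λ b → ∃ λ c → ∃ λ e → Y a ≡ true × Y e ≡ true × Y b ≡ false × Y c ≡ false × ¬ (a ≡ e) × ¬ (b ≡ c) × E a b ≡ true × E c e ≡ true) → Cyclic E
                  conclude (a , b , c , e , Ya , Ye , Yb , Yc , a≢e , b≢c , ab , ce) = Through.cycle x (∧-proj₁ Zx) (not-true (∧-proj₂ {X x} Zx)) busy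
                      ((c , e) ∷ []) (add-out c e empty refl refl refl λ q → true≢false (sym Ye ∙ cong Y (sym q) ∙ Yc)) (λ { (here refl) → ce })
                      (cong (_+ 0) (𝟙≢ c x c≢x)) (cong (_+ 0) (𝟙≢ e x λ q → true≢false (sym Ye ∙ cong Y q ∙ not-true (∧-proj₂ {X x} Zx)))) 1≤r
                      (cong₂ _+_ X≡Y+r (cong (λ p → 𝟙 p + 0) Ye) ∙ +-assoc (size Y) r 1 ∙ cong (size Y +_) (cong (_+ 1) r≡1 ∙ sym (cong (λ p → 2 + (𝟙 p + 0)) Xc)))
                    where
                    Zb : Z b ≡ true
                    Zb with X b in q
                    ... | true = cong not Yb
                    ... | false = ⊥-elim (no-direct a b Ya q ab)
                    c≢x : ¬ (c ≡ x)
                    c≢x q = b≢c (Z-only r≡1 Zx Zb ∙ sym q)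
                    Xc : X c ≡ false
                    Xc with X c in q
                    ... | false = refl
                    ... | true = ⊥-elim (c≢x (Z-only r≡1 Zx (∧-intro q (cong not Yc))))

                -- The path through `x` settles two units of the surplus; the other r - 2 edges are
                -- selected among those that avoid `x`.
                more : ∀ j → r ≡ 2 + j → ∀ x → Z x ≡ true → d ≤ out-count F x + in-count F x → Cyclic E
                more j r≡ x Zx busy = Through.cycle x (∧-proj₁ Zx) (not-true (∧-proj₂ {X x} Zx)) busy es forest (λ {u} {v} i → F-E {u} {v} (⊆F i)) x∉ x∉′
                    (≤-trans (≤-reflexive len) j≤r)
                    (cong (size X +_) (into-F es ⊆F) ∙ +-identityʳ _ ∙ X≡Y+r ∙ cong (size Y +_) (r≡ ∙ cong (2 +_) (sym len ∙ sym (from-F es ⊆F))))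
                  where
                  F′ : V → V → Bool
                  F′ = remove-vertex (_== x) (_== x)
                  j≤r : j ≤ r
                  j≤r = ≤-trans (m≤n+m j 2) (≤-reflexive (sym r≡))
                  s : Selected F′ j
                  s = pick-edges j j≤r F′ (remove-⊆ (_== x) (_== x)) (ii-arith d D r j (total F) (total F′) r≡ total-F (total-remove x x) D≤d)
                  open Selected s
                  ⊆F : ∀ {u v} → (u , v) ∈ es → F u v ≡ true
                  ⊆F {u} {v} i = remove-⊆ (_== x) (_== x) u v (es⊆F i)
                  ∧f : ∀ p → p ∧ false ≡ false
                  ∧f true = refl
                  ∧f false = refl
                  x∉ : srcs es x ≡ 0
                  x∉ = srcs-none F′ x es⊆F λ y → cong (F x y ∧_) (cong (λ p → not p ∧ not (y == x)) (==-refl x)) ∙ ∧f (F x y)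
                  x∉′ : tgts es x ≡ 0
                  x∉′ = tgts-none F′ x es⊆F λ u → cong (F u x ∧_) (cong (λ p → not (u == x) ∧ not p) (==-refl x) ∙ ∧f (not (u == x))) ∙ ∧f (F u x)

                by-size : ∀ r′ → r ≡ suc r′ → (∃ λ x → Z x ≡ true × d ≤ out-count F x + in-count F x) → Cyclic E
                by-size zero e (x , Zx , busy) = one e x Zx busy
                by-size (suc j) e (x , Zx , busy) = more j e x Zx busy

              nested : ∀ r′ → r ≡ r′ → Dec (∃ λ a → ∃ λ b → Y a ∧ (not (X b) ∧ E a b) ≡ true) → Cyclic E
              nested zero e _ = disjoint-rooms e
              nested (suc r′) e (yes (a , b , h)) = direct-door r′ e a b (∧-proj₁ h) (not-true (∧-proj₁ (∧-proj₂ {Y a} h))) (∧-proj₂ {not (X b)} (∧-proj₂ {Y a} h))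
              nested (suc r′) e (no ¬h) = by-size r′ e busy-vertex
                where open NoDirectDoor (λ a b Ya Xb ab → ¬h (a , b , ∧-intro Ya (∧-intro (cong not Xb) ab))) (≤-trans (s≤s z≤n) (≤-reflexive (sym e)))

            surplus-cycle : Dec (∃ λ v → not (X v) ∧ Y v ≡ true) → Cyclic E
            surplus-cycle (yes (v , e)) = with-door-vertex v (not-true (∧-proj₁ e)) (∧-proj₂ {not (X v)} e)
            surplus-cycle (no ¬v) = nested Y⊆X r refl (any? λ a → any? λ b → (Y a ∧ (not (X b) ∧ E a b)) ≟ᵇ true)
              where
              Y⊆X : ∀ v → Y v ≡ true → X v ≡ true
              Y⊆X v Yv with X v in eq
              ... | true = refl
              ... | false = ⊥-elim (¬v (v , ∧-intro (cong not eq) Yv))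

          -- Complementing both sets exchanges the rooms and reverses the sign of the surplus, so
          -- `X` may be taken to be the larger set.
          sparse-cut-cycle : ∀ {X Y : V → Bool} → Split ζ X Y → Cyclic E
          sparse-cut-cycle {X} {Y} S = by-total (≤-total (size Y) (size X))
            where
            decide : ∀ (X Y : V → Bool) → Dec (∃ λ v → not (X v) ∧ Y v ≡ true)
            decide X Y = any? λ v → (not (X v) ∧ Y v) ≟ᵇ true
            flip-arith : ∀ x y nx ny n k → x + nx ≡ n → y + ny ≡ n → x + k ≡ y → nx ≡ ny + k
            flip-arith x y nx ny n k H1 H2 H3 =
                ≤-antisym
                (lin ρ (# 2) (# 3 ⊕ # 5) 0
                ((# 0 ⊕ # 2 ≼ # 4 by ≤-reflexive H1)
                  ⊞ (# 4 ≼ # 1 ⊕ # 3 by ≤-reflexive (sym H2))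
                  ⊞ (# 1 ≼ # 0 ⊕ # 5 by ≤-reflexive (sym H3))) refl)
                (lin ρ (# 3 ⊕ # 5) (# 2) 0
                ((# 4 ≼ # 0 ⊕ # 2 by ≤-reflexive (sym H1))
                  ⊞ (# 1 ⊕ # 3 ≼ # 4 by ≤-reflexive H2)
                  ⊞ (# 0 ⊕ # 5 ≼ # 1 by ≤-reflexive H3)) refl)
              where
              ρ = x ∷ y ∷ nx ∷ ny ∷ n ∷ k ∷ []
            by-total : size Y ≤ size X ⊎ size X ≤ size Y → Cyclic E
            by-total (inj₁ h) = surplus-cycle S (size X ∸ size Y) (sym (m+[n∸m]≡n h)) (decide X Y)
            by-total (inj₂ h) = surplus-cycle (swap-split S) (size Y ∸ size X)
              (flip-arith (size X) (size Y) (size (not ∘ X)) (size (not ∘ Y)) n (size Y ∸ size X) (card-not X) (card-not Y) (m+[n∸m]≡n h)) (decide (not ∘ X) (not ∘ Y))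

    module Assemble (loopless : ∀ v → E v v ≡ false)
      (well-connected : ∀ (A : Fin n → Bool) → 2 ≤ card A → 2 ≤ card (not ∘ A) → ∃ λ a → ∃ λ b → ∃ λ c → ∃ λ e →
         A a ≡ true × A e ≡ true × A b ≡ false × A c ≡ false × ¬ (a ≡ e) × ¬ (b ≡ c) × E a b ≡ true × E c e ≡ true)
      (h ζ τ P c M : ℕ) (gap : n + 3 * h ≤ 3 * d) (h≤n : h ≤ n) (5τ≤h : 5 * τ ≤ h) (n≤Pτ : n ≤ P * τ) (1≤ζ : 1 ≤ ζ) (80ζ≤τ : 80 * ζ ≤ τ) (2ζP≤τ : 2 * ζ * P ≤ τ)
      (1≤c : 1 ≤ c) (P⁶≤c : P * P * P * P * P * P ≤ c) (N₀≤τ : Constants.N₀ c ≤ τ) (tiny : Constants.tolerance c * P * (9 * ζ + 2 * ζ) ≤ τ)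
      (n≤Mζ : n ≤ M * ζ) (1≤M : 1 ≤ M) (N₀≤n : Constants.N₀ (M * M * M * M * M) ≤ n) where

      a₁ : ∀ z t → 80 * z ≤ t → 2 * (9 * z) ≤ t
      a₁ z t H =
          lin ρ (con 2 ⊗ (con 9 ⊗ # 0)) (# 1) 39
          (con 9 ⊠ (con 80 ⊗ # 0 ≼ # 1 by H)) refl
        where
        ρ = z ∷ t ∷ []

      a₂ : ∀ z t → 80 * z ≤ t → 27 * z ≤ t
      a₂ z t H =
          lin ρ (con 27 ⊗ # 0) (# 1) 79
          (con 27 ⊠ (con 80 ⊗ # 0 ≼ # 1 by H)) refl
        where
        ρ = z ∷ t ∷ []

      a₃ : ∀ z t h → 80 * z ≤ t → 5 * t ≤ h → 24 * z ≤ h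
      a₃ z t h H H2 =
          lin ρ (con 24 ⊗ # 0) (# 2) 49
          (con 15 ⊠ (con 80 ⊗ # 0 ≼ # 1 by H)
            ⊞ con 3 ⊠ (con 5 ⊗ # 1 ≼ # 2 by H2)) refl
        where
        ρ = z ∷ t ∷ h ∷ []

      a₄ : ∀ z t h n d → 80 * z ≤ t → 5 * t ≤ h → n + 3 * h ≤ 3 * d → 400 * z ≤ d
      a₄ z t h n d H H2 H3 =
          lin ρ (con 400 ⊗ # 0) (# 4) 2
          (con 15 ⊠ (con 80 ⊗ # 0 ≼ # 1 by H)
            ⊞ con 3 ⊠ (con 5 ⊗ # 1 ≼ # 2 by H2)
            ⊞ (# 3 ⊕ con 3 ⊗ # 2 ≼ con 3 ⊗ # 4 by H3)) refl
        where
        ρ = z ∷ t ∷ h ∷ n ∷ d ∷ []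

      a₅ : ∀ n h d → n + 3 * h ≤ 3 * d → n ≤ 3 * d
      a₅ n h d H3 =
          lin ρ (# 0) (con 3 ⊗ # 2) 0
          ((# 0 ⊕ con 3 ⊗ # 1 ≼ con 3 ⊗ # 2 by H3)) refl
        where
        ρ = n ∷ h ∷ d ∷ []

      a₆ : ∀ z t → 80 * z ≤ t → 1 ≤ z → 1 ≤ t
      a₆ z t H H2 =
          lin ρ (con 1) (# 1) 79
          ((con 80 ⊗ # 0 ≼ # 1 by H)
            ⊞ con 80 ⊠ (con 1 ≼ # 0 by H2)) refl
        where
        ρ = z ∷ t ∷ []

      a₇ : ∀ z d → 400 * z ≤ d → 1 ≤ z → 1 ≤ d
      a₇ z d H H2 =
          lin ρ (con 1) (# 1) 399
          ((con 400 ⊗ # 0 ≼ # 1 by H)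
            ⊞ con 400 ⊠ (con 1 ≼ # 0 by H2)) refl
        where
        ρ = z ∷ d ∷ []

      1≤τ : 1 ≤ τ
      1≤τ = a₆ ζ τ 80ζ≤τ 1≤ζ

      400ζ≤d : 400 * ζ ≤ d
      400ζ≤d = a₄ ζ τ h n d 80ζ≤τ 5τ≤h gap

      room : TwoRooms.Room ζ (9 * ζ)
      room = Rooms.room h ζ (9 * ζ) τ P gap h≤n 5τ≤h n≤Pτ 1≤τ (a₁ ζ τ 80ζ≤τ) (a₂ ζ τ 80ζ≤τ) 2ζP≤τ c 1≤c P⁶≤c N₀≤τ tiny

      from-dichotomy : ((∀ s t → n * n * n * n * n * n ≤ M * M * M * M * M * walks₇ s t) ⊎ (∃ λ X → ∃ λ Y → Split ζ X Y)) → Cyclic E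
      -- The digraph itself is exactly regular, so the irregularity is 0.
      from-dichotomy (inj₁ W₇) = Constants.robust-cycle E (M * M * M * M * M) d 0 (*-mono-≤ (*-mono-≤ (*-mono-≤ (*-mono-≤ 1≤M 1≤M) 1≤M) 1≤M) 1≤M) N₀≤n W₇
          (λ S → ≤-reflexive (*-comm d (size S) ∙ sym (splitʳ S all′) ∙ cong (edges S all′ +_) (none S)))
          (λ S → ≤-trans (edges-right≤ all′ S) (≤-trans (≤-reflexive (*-comm (size S) d)) (m≤m+n _ 0)))
          (≤-trans (≤-reflexive (*-zeroʳ (Constants.tolerance (M * M * M * M * M)))) z≤n)
        where
        none : ∀ S → edges S (not ∘ all′) ≡ 0
        none S = ∑-cong U (λ x → ∑-cong U (λ y → *-zeroʳ (𝟙 (S x))) ∙ ∑-zero U) ∙ ∑-zero U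
      from-dichotomy (inj₂ (X , Y , S)) = TwoRooms.SparseCut.CrossingEdges.sparse-cut-cycle ζ (9 * ζ) loopless room 1≤ζ ≤-refl 400ζ≤d (a₅ n h d gap)
          (proj₁ Q) (proj₁ (proj₂ Q)) (proj₂ (proj₂ Q)) well-connected S
        where
        Q : ∃ λ D → 2 * D ≤ d + 24 * ζ × d + 24 * ζ < 2 * suc D
        Q = Constants.quotient (d + 24 * ζ) 2 (s≤s z≤n)

      cyclic : Cyclic E
      cyclic = from-dichotomy (dichotomy h ζ M gap (a₃ ζ τ h 80ζ≤τ 5τ≤h) (a₇ ζ d 400ζ≤d 1≤ζ) n≤Mζ)

  -- Thresholds, and the passage from cyclic walks to Hamilton cycles

  module Thresholds (e : ℕ) (1≤e : 1 ≤ e) where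

    open Constants using (quotient; N₀; tolerance; double)

    -- With h = n/e, τ = h/5 and ζ = τ/Q rounded down, n ≤ 2eh ≤ 20eτ explains `P`, and rooms have
    -- robustness P⁶. `Q` makes ζ small against their tolerance (11ζ = ξ + 2ζ), against the number
    -- of atypical elements (2P) and against the numerical losses (80). Then n ≤ Mζ is the form in
    -- which the dichotomy uses ζ.
    P c Q M n₀ : ℕ
    P = 20 * e
    c = P * P * P * P * P * P
    Q = tolerance c * P * 11 + (2 * P + 80)
    M = P * (2 * Q)
    n₀ = e * (5 * (N₀ c + Q + 1)) + N₀ (M * M * M * M * M)

    gap-arith : ∀ e n d h → n * (e + 3) ≤ 3 * e * d → e * h ≤ n → e * (n + 3 * h) ≤ e * (3 * d)
    gap-arith e n d h H1 H2 =
        lin ρ (# 0 ⊗ (# 1 ⊕ con 3 ⊗ # 3)) (# 0 ⊗ (con 3 ⊗ # 2)) 0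
        ((# 1 ⊗ (# 0 ⊕ con 3) ≼ con 3 ⊗ # 0 ⊗ # 2 by H1)
          ⊞ con 3 ⊠ (# 0 ⊗ # 3 ≼ # 1 by H2)) refl
      where
      ρ = e ∷ n ∷ d ∷ h ∷ []

    n≤Pτ-arith : ∀ e n h t → n ≤ 2 * e * h → h ≤ 2 * 5 * t → n ≤ 20 * e * t
    n≤Pτ-arith e n h t H1 H2 =
        lin ρ (# 1) (con 20 ⊗ # 0 ⊗ # 3) 0
        ((# 1 ≼ con 2 ⊗ # 0 ⊗ # 2 by H1)
          ⊞ con 2 ⊠ (# 0 ⊗ # 2 ≼ # 0 ⊗ (con 2 ⊗ con 5 ⊗ # 3) by *-monoʳ-≤ (e) (H2))) refl
      where
      ρ = e ∷ n ∷ h ∷ t ∷ []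

    n≤Mζ-arith : ∀ P Q n t z → n ≤ P * t → t ≤ 2 * Q * z → n ≤ P * (2 * Q) * z
    n≤Mζ-arith P Q n t z H1 H2 =
        lin ρ (# 2) (# 0 ⊗ (con 2 ⊗ # 1) ⊗ # 4) 0
        ((# 2 ≼ # 0 ⊗ # 3 by H1)
          ⊞ (# 0 ⊗ # 3 ≼ # 0 ⊗ (con 2 ⊗ # 1 ⊗ # 4) by *-monoʳ-≤ (P) (H2))) refl
      where
      ρ = P ∷ Q ∷ n ∷ t ∷ z ∷ []

    use₁ : ∀ T P z t Q → Q * z ≤ t → Q ≡ T * P * 11 + (2 * P + 80) → 80 * z ≤ t
    use₁ T P z t Q H1 H2 =
        lin ρ (con 80 ⊗ # 2) (# 3) 0
        ((# 4 ⊗ # 2 ≼ # 3 by H1)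
          ⊞ (# 2 ⊗ (# 0 ⊗ # 1 ⊗ con 11 ⊕ (con 2 ⊗ # 1 ⊕ con 80)) ≼ # 2 ⊗ # 4 by *-monoʳ-≤ (z) (≤-reflexive (sym H2)))) refl
      where
      ρ = T ∷ P ∷ z ∷ t ∷ Q ∷ []

    use₂ : ∀ T P z t Q → Q * z ≤ t → Q ≡ T * P * 11 + (2 * P + 80) → 2 * z * P ≤ t
    use₂ T P z t Q H1 H2 =
        lin ρ (con 2 ⊗ # 2 ⊗ # 1) (# 3) 0
        ((# 4 ⊗ # 2 ≼ # 3 by H1)
          ⊞ (# 2 ⊗ (# 0 ⊗ # 1 ⊗ con 11 ⊕ (con 2 ⊗ # 1 ⊕ con 80)) ≼ # 2 ⊗ # 4 by *-monoʳ-≤ (z) (≤-reflexive (sym H2)))) refl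
      where
      ρ = T ∷ P ∷ z ∷ t ∷ Q ∷ []

    use₃ : ∀ T P z t Q → Q * z ≤ t → Q ≡ T * P * 11 + (2 * P + 80) → T * P * (9 * z + 2 * z) ≤ t
    use₃ T P z t Q H1 H2 =
        lin ρ (# 0 ⊗ # 1 ⊗ (con 9 ⊗ # 2 ⊕ con 2 ⊗ # 2)) (# 3) 0
        ((# 4 ⊗ # 2 ≼ # 3 by H1)
          ⊞ (# 2 ⊗ (# 0 ⊗ # 1 ⊗ con 11 ⊕ (con 2 ⊗ # 1 ⊕ con 80)) ≼ # 2 ⊗ # 4 by *-monoʳ-≤ (z) (≤-reflexive (sym H2)))) refl
      where
      ρ = T ∷ P ∷ z ∷ t ∷ Q ∷ []

    at-least : ∀ q a n m → 1 ≤ q → q * a ≤ n → n < q * suc m → a ≤ m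
    at-least q a n m 1≤q h k = ≤-pred (*-cancelˡ-< q a (suc m) (≤-<-trans h k))

    h≤n-arith : ∀ h n → e * h ≤ n → h ≤ n
    h≤n-arith h n k = ≤-trans (m≤n*m h e {{>-nonZero 1≤e}}) k

    cyclic-of-dense : ∀ {n} (E : Fin n → Fin n → Bool) (loopless : ∀ v → E v v ≡ false) (d : ℕ)
      (out-d : ∀ x → ∑[ y ∈ allFin n ] 𝟙 (E x y) ≡ d) (in-d : ∀ y → ∑[ x ∈ allFin n ] 𝟙 (E x y) ≡ d)
      (well-connected : ∀ (A : Fin n → Bool) → 2 ≤ card A → 2 ≤ card (not ∘ A) → ∃ λ a → ∃ λ b → ∃ λ c → ∃ λ e →
         A a ≡ true × A e ≡ true × A b ≡ false × A c ≡ false × ¬ (a ≡ e) × ¬ (b ≡ c) × E a b ≡ true × E c e ≡ true) →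
      n₀ ≤ n → n * (e + 3) ≤ 3 * e * d → Cyclic E
    cyclic-of-dense {n} E loopless d out-d in-d wc n₀≤n dense = from-quotients (quotient n e 1≤e)
      where
      big : e * (5 * (N₀ c + Q + 1)) ≤ n
      big = ≤-trans (m≤m+n _ _) n₀≤n
      1≤Q : 1 ≤ Q
      1≤Q = ≤-trans (≤-trans (s≤s z≤n) (m≤n+m 80 (2 * P))) (m≤n+m (2 * P + 80) (tolerance c * P * 11))
      1≤P : 1 ≤ P
      1≤P = *-mono-≤ (s≤s (z≤n {19})) 1≤e
      finish : ∀ h τ ζ → e * h ≤ n → n ≤ 2 * e * h → 5 * τ ≤ h → h ≤ 2 * 5 * τ → N₀ c ≤ τ → 1 ≤ ζ → Q * ζ ≤ τ → τ ≤ 2 * Q * ζ → Cyclic E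
      finish h τ ζ eh≤n n≤2eh 5τ≤h h≤10τ N₀≤τ 1≤ζ Qζ≤τ τ≤2Qζ = RegularDigraph.Assemble.cyclic E d out-d in-d loopless wc h ζ τ P c M
        (*-cancelˡ-≤ e {{>-nonZero 1≤e}} (gap-arith e n d h dense eh≤n)) (h≤n-arith h n eh≤n) 5τ≤h n≤Pτ 1≤ζ
        (use₁ (tolerance c) P ζ τ Q Qζ≤τ refl) (use₂ (tolerance c) P ζ τ Q Qζ≤τ refl)
        (*-mono-≤ (*-mono-≤ (*-mono-≤ (*-mono-≤ (*-mono-≤ 1≤P 1≤P) 1≤P) 1≤P) 1≤P) 1≤P) ≤-refl N₀≤τ
        (use₃ (tolerance c) P ζ τ Q Qζ≤τ refl)
        (n≤Mζ-arith P Q n τ ζ n≤Pτ τ≤2Qζ) (*-mono-≤ 1≤P (*-mono-≤ (s≤s (z≤n {1})) 1≤Q)) (≤-trans (m≤n+m _ _) n₀≤n)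
        where
        n≤Pτ : n ≤ P * τ
        n≤Pτ = n≤Pτ-arith e n h τ n≤2eh h≤10τ
      from-quotients : (∃ λ h → e * h ≤ n × n < e * suc h) → Cyclic E
      from-quotients (h , eh≤n , n<) = next-quotient (quotient h 5 (s≤s z≤n))
        where
        h-big : 5 * (N₀ c + Q + 1) ≤ h
        h-big = at-least e _ n h 1≤e big n<
        next-quotient : (∃ λ τ → 5 * τ ≤ h × h < 5 * suc τ) → Cyclic E
        next-quotient (τ , 5τ≤h , h<) = last-quotient (quotient τ Q 1≤Q)
          where
          τ-big : N₀ c + Q + 1 ≤ τ
          τ-big = at-least 5 _ h τ (s≤s z≤n) h-big h<
          last-quotient : (∃ λ ζ → Q * ζ ≤ τ × τ < Q * suc ζ) → Cyclic E
          last-quotient (ζ , Qζ≤τ , τ<) = finish h τ ζ eh≤n (double e h n n< (≤-trans (≤-trans (m≤n+m 1 (N₀ c + Q)) τ-big) (≤-trans (m≤n*m τ 5) 5τ≤h))) 5τ≤h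
              (double 5 τ h h< (≤-trans (m≤n+m 1 (N₀ c + Q)) τ-big)) (≤-trans (≤-trans (m≤m+n (N₀ c) Q) (m≤m+n _ 1)) τ-big) 1≤ζ Qζ≤τ (double Q ζ τ τ< 1≤ζ)
            where
            1≤ζ : 1 ≤ ζ
            1≤ζ = at-least Q 1 τ ζ 1≤Q (≤-trans (≤-reflexive (*-identityʳ Q)) (≤-trans (≤-trans (m≤n+m Q (N₀ c)) (m≤m+n _ 1)) τ-big)) τ<

  -- From closed walks to cyclic permutations

  module Conversion {m : ℕ} where

    private
      V = Fin (suc m)

    -- The first argument is a default that makes indexing total.
    at : V → List V → ℕ → V
    at z [] k = z
    at z (x ∷ l) zero = x
    at z (x ∷ l) (suc k) = at z l k

    at-∈ : ∀ z l k → k < length l → at z l k ∈ l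
    at-∈ z (x ∷ l) zero h = here refl
    at-∈ z (x ∷ l) (suc k) (s≤s h) = there (at-∈ z l k h)

    at-injective : ∀ z l → (∀ v → occ v l ≤ 1) → ∀ i j → i < length l → j < length l → at z l i ≡ at z l j → i ≡ j
    at-injective z (x ∷ l) o zero zero hi hj e = refl
    at-injective z (x ∷ l) o zero (suc j) hi (s≤s hj) refl = ⊥-elim (1+n≰n (≤-trans (s≤s (∈⇒occ (at-∈ z l j hj))) (≤-trans (≤-reflexive (sym (occ-here x l))) (o x))))
    at-injective z (x ∷ l) o (suc i) zero (s≤s hi) hj refl = ⊥-elim (1+n≰n (≤-trans (s≤s (∈⇒occ (at-∈ z l i hi))) (≤-trans (≤-reflexive (sym (occ-here x l))) (o x))))
    at-injective z (x ∷ l) o (suc i) (suc j) (s≤s hi) (s≤s hj) e = cong suc (at-injective z l (λ v → ≤-trans (m≤n+m _ _) (o v)) i j hi hj e)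

    position : ∀ z {l v} → v ∈ l → ∃ λ k → k < length l × at z l k ≡ v
    position z (here refl) = zero , s≤s z≤n , refl
    position z (there i) with position z i
    ... | k , h , e = suc k , s≤s h , e

    walk-step : ∀ {R : V → V → Set} z {x y l} → Walk R x y l → ∀ k → suc k < length l → R (at z l k) (at z l (suc k))
    walk-step z [ x ] k (s≤s ())
    walk-step z (x ∷⟨ r ⟩ [ y ]) zero h = r
    walk-step z (x ∷⟨ r ⟩ (y ∷⟨ _ ⟩ w)) zero h = r
    walk-step z (x ∷⟨ r ⟩ w) (suc k) (s≤s h) = walk-step z w k h

    walk-first : ∀ {R : V → V → Set} z {x y l} → Walk R x y l → at z l 0 ≡ x
    walk-first z [ x ] = refl
    walk-first z (x ∷⟨ r ⟩ w) = refl

    walk-last : ∀ {R : V → V → Set} z {x y l} → Walk R x y l → ∀ k → suc k ≡ length l → at z l k ≡ y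
    walk-last z [ x ] zero e = refl
    walk-last z (x ∷⟨ r ⟩ [ y ]) (suc zero) e = refl
    walk-last z (x ∷⟨ r ⟩ (y ∷⟨ s ⟩ w)) (suc k) e = walk-last z (y ∷⟨ s ⟩ w) k (suc-injective e)
    walk-last z (x ∷⟨ r ⟩ [ y ]) (suc (suc k)) ()

    module _ (G : Digraph (suc m)) (C : Cyclic (E G)) where

      open Cyclic C

      length-vertices : length vertices ≡ suc m
      length-vertices = length-occ vertices ∙ ∑-cong (allFin (suc m)) once ∙ ∑-const (allFin (suc m)) 1 ∙ *-identityʳ _ ∙ length-tabulate {n = suc m} id

      to : V → V
      to i = at zero vertices (toℕ i)

      bounded : ∀ (i : V) → toℕ i < length vertices
      bounded i = ≤-trans (toℕ<n i) (≤-reflexive (sym length-vertices))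

      find : ∀ v → ∃ λ k → k < length vertices × at zero vertices k ≡ v
      find v = position zero (occ⇒∈ {x = v} vertices (≤-reflexive (sym (once v))))

      from : V → V
      from v = fromℕ< (≤-trans (proj₁ (proj₂ (find v))) (≤-reflexive length-vertices))

      to-from : ∀ v → to (from v) ≡ v
      to-from v = cong (at zero vertices) (toℕ-fromℕ< _) ∙ proj₂ (proj₂ (find v))

      from-to : ∀ i → from (to i) ≡ i
      from-to i = toℕ-injective (at-injective zero vertices (λ v → ≤-reflexive (once v)) _ _ (bounded (from (to i))) (bounded i) (to-from (to i)))

      edge : ∀ i → E G (to i) (to (next i)) ≡ true
      edge i with suc (toℕ i) <? suc m
      ... | yes p = subst (λ k → E G (to i) (at zero vertices k) ≡ true) (sym (toℕ-fromℕ< _ ∙ m<n⇒m%n≡m p))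
            (walk-step zero route (toℕ i) (≤-trans p (≤-reflexive (sym length-vertices))))
      -- At the last index `next` wraps around to 0, where the closing edge is used.
      ... | no ¬p = subst (λ k → E G (to i) (at zero vertices k) ≡ true) (sym (toℕ-fromℕ< _ ∙ cong (_% suc m) last ∙ n%n≡0 (suc m)))
            (subst (λ a → E G a (at zero vertices 0) ≡ true) (sym (walk-last zero route (toℕ i) (last ∙ sym length-vertices)))
              (subst (λ b → E G end b ≡ true) (sym (walk-first zero route)) closes))
        where
        last : suc (toℕ i) ≡ suc m
        last = ≤-antisym (toℕ<n i) (≮⇒≥ ¬p)

      hamilton : HamiltonCycle G
      hamilton = mk↔ₛ′ to from to-from from-to , edge

  count≡∑ : ∀ {n} (P : Fin n → Bool) → count P ≡ ∑[ v ∈ allFin n ] 𝟙 (P v)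
  count≡∑ {n} P = length-∑ (filter (λ v → T? (P v)) (allFin n)) ∙ ∑-filter P (allFin n) _ ∙ ∑-cong (allFin n) λ v → *-identityʳ _

  hamilton-of-dense : ∀ e (1≤e : 1 ≤ e) n d (G : Digraph n) → Thresholds.n₀ e 1≤e ≤ n → StronglyWellConnected G → Regular d G → n * (e + 3) ≤ 3 * e * d → HamiltonCycle G
  hamilton-of-dense e 1≤e zero d G n₀≤n (() , _) reg dense
  hamilton-of-dense e 1≤e (suc m) d G n₀≤n (_ , swc) reg dense = Conversion.hamilton G
    (Thresholds.cyclic-of-dense e 1≤e (E G) (noLoop G) d (λ x → sym (count≡∑ (E G x)) ∙ proj₁ (reg x)) (λ y → sym (count≡∑ (λ x → E G x y)) ∙ proj₂ (reg y))
      (λ A h k → swc A (≤-trans h (≤-reflexive (sym (count≡∑ A)))) (≤-trans k (≤-reflexive (sym (count≡∑ (not ∘ A)))))) n₀≤n dense)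

-- From a rational density to natural numbers

module Density where

  open import Data.Nat using (ℕ; suc; s≤s; z≤n; _+_; _*_; _≤_)
  open import Data.Integer using (+_; +≤+; drop‿+≤+)
  import Data.Integer as ℤ
  import Data.Integer.Properties as ℤ
  open import Data.Rational using (ℚ; mkℚ; _/_; Positive; toℚᵘ; ↧ₙ_)
  import Data.Rational as ℚ
  import Data.Rational.Properties as ℚ
  open import Data.Rational.Unnormalised using (mkℚᵘ; *≤*; _≃_)
  import Data.Rational.Unnormalised as ℚᵘ
  import Data.Rational.Unnormalised.Properties as ℚᵘ
  open import Relation.Binary.PropositionalEquality
  open Hamiltonicity
  open import Data.List using ([]; _∷_)

  -- The numerator of ε is at least 1, so ε may be lowered to the reciprocal of its denominator; the
  -- threshold depends on the denominator alone.
  clear : ∀ p q n d → (1 * suc q + suc p * 3) * n * 1 ≤ d * (3 * suc q * 1) → n * (suc q + 3) ≤ 3 * suc q * d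
  clear p q n d H =
      lin ρ (# 2 ⊗ (con 1 ⊕ # 1 ⊕ con 3)) (con 3 ⊗ (con 1 ⊕ # 1) ⊗ # 3) 0
      (((con 1 ⊗ (con 1 ⊕ # 1) ⊕ (con 1 ⊕ # 0) ⊗ con 3) ⊗ # 2 ⊗ con 1 ≼ # 3 ⊗ (con 3 ⊗ (con 1 ⊕ # 1) ⊗ con 1) by H)) refl
    where
    ρ = p ∷ q ∷ n ∷ d ∷ []

  toℚᵘ-/ : ∀ i k → toℚᵘ (i / suc k) ≃ mkℚᵘ i k
  toℚᵘ-/ i k = ℚ.toℚᵘ-fromℚᵘ (mkℚᵘ i k)

  -- Normalised fractions with variable entries do not reduce, so the inequality is moved to
  -- unnormalised ones, where it is a comparison of integer products.
  toℚᵘ-bound : ∀ {t ε N D t′ N′ D′} → toℚᵘ t ≃ t′ → toℚᵘ N ≃ N′ → toℚᵘ D ≃ D′ →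
    (t ℚ.+ ε) ℚ.* N ℚ.≤ D → (t′ ℚᵘ.+ toℚᵘ ε) ℚᵘ.* N′ ℚᵘ.≤ D′
  toℚᵘ-bound {t} {ε} {N} t≃ N≃ D≃ h = ℚᵘ.≤-respʳ-≃ D≃ (ℚᵘ.≤-respˡ-≃ lhs (ℚ.toℚᵘ-mono-≤ h))
    where
    lhs = ℚᵘ.≃-trans (ℚ.toℚᵘ-homo-* (t ℚ.+ ε) N)
      (ℚᵘ.*-cong (ℚᵘ.≃-trans (ℚ.toℚᵘ-homo-+ t ε) (ℚᵘ.+-congˡ (toℚᵘ ε) t≃)) N≃)

  clear-ℤ : ∀ p q n d → (mkℚᵘ (+ 1) 2 ℚᵘ.+ mkℚᵘ (+ suc p) q) ℚᵘ.* mkℚᵘ (+ n) 0 ℚᵘ.≤ mkℚᵘ (+ d) 0 →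
    n * (suc q + 3) ≤ 3 * suc q * d
  clear-ℤ p q n d (*≤* le) = clear p q n d (drop‿+≤+ (subst₂ ℤ._≤_ left (sym (ℤ.pos-* d (3 * suc q * 1))) le))
    where
    left : ((+ 1 ℤ.* + suc q ℤ.+ + suc p ℤ.* + 3) ℤ.* + n) ℤ.* + 1 ≡ + ((1 * suc q + suc p * 3) * n * 1)
    left = trans (cong (ℤ._* + 1) (trans (cong (ℤ._* + n) (cong₂ ℤ._+_ (sym (ℤ.pos-* 1 (suc q))) (sym (ℤ.pos-* (suc p) 3)))) (sym (ℤ.pos-* (1 * suc q + suc p * 3) n))))
      (sym (ℤ.pos-* ((1 * suc q + suc p * 3) * n) 1))

  density : ∀ ε → Positive ε → ∀ n d → (+ 1 / 3 ℚ.+ ε) ℚ.* (+ n / 1) ℚ.≤ (+ d / 1) → n * (↧ₙ ε + 3) ≤ 3 * ↧ₙ ε * d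
  density ε@(mkℚ (+ suc p) q _) _ n d h =
    clear-ℤ p q n d (toℚᵘ-bound {t = + 1 / 3} {ε} (toℚᵘ-/ (+ 1) 2) (toℚᵘ-/ (+ n) 0) (toℚᵘ-/ (+ d) 0) h)

open import Data.Nat using (ℕ; _≥_; s≤s; z≤n)
open import Data.Product using (Σ; ∃-syntax; _,_)
open import Data.Rational using (ℚ; _+_; _*_; _≤_; Positive; 1ℚ; _/_; ↧ₙ_)
open import Data.Integer using (+_)

theorem1p5 : (ε : ℚ) → Positive ε →
    ∃[ n₀ ] ∀ (n d : ℕ) (G : Digraph n) → n ≥ n₀ →
    StronglyWellConnected G → Regular d G →
    ((+ 1 / 3 + ε) * (+ n / 1)) ≤ (+ d / 1) →
    HamiltonCycle G
theorem1p5 ε ε>0 = Hamiltonicity.Thresholds.n₀ (↧ₙ ε) (s≤s z≤n) ,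
  λ n d G n≥n₀ connected regular dense →
    Hamiltonicity.hamilton-of-dense (↧ₙ ε) (s≤s z≤n) n d G n≥n₀ connected regular (Density.density ε ε>0 n d dense)
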